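{- Let $G$ be a finite non-cyclic group and let $p$ be the smallest prime divisor of $|G|$. Then $$\mathsf D(G)\leq \frac{2}{p}|G|.$$
   Context: A sequence over a finite group $G$ is a finite unordered list of elements of $G$ with repetition allowed; its length is its number of terms with multiplicity. It is product-one if its terms can be ordered so that their product is the identity. A minimal product-one sequence is a nonempty product-one sequence that cannot be partitioned into two nonempty product-one subsequences. $\mathsf D(G)$ (the large Davenport constant) is the maximal length of a minimal product-one sequence over $G$. -}

module Defs where

open import Data.Nat using (ℕ; zero; suc)
open import Data.Fin using (Fin)
open import Data.List using (List; []; _∷_; _++_; foldr; length)
open import Data.List.Relation.Binary.Permutation.Propositional using (_↭_)
open import Data.Product using (Σ; ∃; ∃-syntax; _×_; _,_)
open import Relation.Binary.PropositionalEquality using (_≡_)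
open import Relation.Nullary using (¬_)
open import Algebra.Structures using (IsGroup)

-- A finite group, presented (up to isomorphism) on the carrier Fin order,
-- with propositional equality.  Every finite group is isomorphic to one of these.
record FiniteGroup : Set where
  field
    order   : ℕ
    _∙_     : Fin order → Fin order → Fin order
    ε       : Fin order
    _⁻¹     : Fin order → Fin order
    isGroup : IsGroup _≡_ _∙_ ε _⁻¹

module _ (G : FiniteGroup) where
  open FiniteGroup G

  ∣_∣ᴳ : ℕ
  ∣_∣ᴳ = order

  pow : Fin order → ℕ → Fin order
  pow g zero    = ε
  pow g (suc k) = g ∙ pow g k

  IsCyclic : Set
  IsCyclic = ∃[ g ] ∀ (x : Fin order) → ∃[ k ] x ≡ pow g k

  -- A sequence over G: a finite unordered list, represented by a list
  -- considered up to permutation (all predicates below are permutation-invariant).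
  Sequence : Set
  Sequence = List (Fin order)

  prod : List (Fin order) → Fin order
  prod = foldr _∙_ ε

  ProductOne : Sequence → Set
  ProductOne S = ∃[ T ] (S ↭ T) × (prod T ≡ ε)

  NonEmpty : Sequence → Set
  NonEmpty S = ¬ (S ≡ [])

  MinimalProductOne : Sequence → Set
  MinimalProductOne S =
    NonEmpty S × ProductOne S ×
    ¬ (∃[ A ] ∃[ B ] (S ↭ A ++ B) × NonEmpty A × NonEmpty B
                     × ProductOne A × ProductOne B)

-- If a subgroup H has the property that product-one lists over H longer than d split, then |S| |H| ≤ d |G|
-- for every minimal S: more than d prefixes of S lie in one coset of H, which cuts S (cyclically) into more
-- than d blocks with products in H.  The trivial subgroup settles p = 2.
--
-- A noncyclic group of odd order contains either C_q × C_q or an element c of prime order r together with an x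
-- normalising ⟨c⟩ whose action on ⟨c⟩ has prime order q.  To see this take a minimal noncyclic subgroup; if it is
-- not abelian, its centralisers of noncentral elements are cyclic and partition the noncentral elements, and by
-- counting conjugates one of them is not self-normalising.
--
-- Over C_q × C_q lists longer than 2q split, by finite differences of a polynomial of degree 2(q - 1) over ℤ/q
-- supported at the origin.  In the second case ⟨c , x⟩ modulo the centralising powers of x is the affine group
-- ℤ/r ⋊ ℤ/q, over which product-one lists longer than 2r split: one finds a short product-one part T such that
-- the products of the orderings of the remaining elements fill a whole coset of ℤ/r.  Filling is shown by adding
-- elements one at a time, each of which enlarges the set of values unless this set is invariant under a rotation.
module Submission where

-- Both kinds of subgroup H yield the same ratio: |H| = q² with lists longer than 2q splitting, and
-- |H| = rζq with lists longer than 2rζ splitting, where ζ is the order of x^q. Either way |S| is at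
-- most 2|G|/q, and q ≥ p.
--
-- In the affine group, 2r comes from dividing a list into a product-one part T of length at most r
-- and a remainder R of more than r elements. R has level zero together with the whole list and T,
-- so only its value in ℤ/r has to be hit.
--
-- The obstacle is commutativity: reordering elements of one centraliser produces nothing new, so T
-- must not leave R inside, or nearly inside, a single centraliser. Centralisers of nonidentity
-- elements are the translations (inner elements) and the point stabilisers of order q; they meet
-- only in the identity. If every stabiliser holds fewer than q terms, R is inserted element by
-- element. Otherwise T is usually taken from a crowded stabiliser and R is cut into 2J - 1 groups
-- of q elements, where r = 1 + Jq; an R almost inside one class is treated separately. Odd order
-- gives q ≥ 3 and J ≥ 2, on which all these counts depend.

-- Subsets of a finite type, their sizes, and orbits of maps of prime order.

module Counting where

  open import Data.Bool using (Bool; true; false; _∧_; _∨_; not)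
  open import Data.Bool.Properties using (∨-zeroʳ; ¬-not)
  import Data.Bool as Bool
  open import Data.Nat hiding (less; equal; greater)
  open import Data.Nat.Properties
  open import Data.Nat.Divisibility using (_∣_; ∣-refl; ∣m∣n⇒∣m+n; _∣0)
  open import Data.Nat.Primality using (Prime; prime⇒nonZero)
  open import Data.Nat.Coprimality using (Coprime; prime⇒coprime; coprime-Bézout)
  open import Data.Nat.GCD using (module Bézout)
  open import Data.Nat.Induction using (<-wellFounded)
  open import Data.Nat.DivMod using (_%_; _/_; m≡m%n+[m/n]*n; m%n<n)
  open import Induction.WellFounded using (Acc; acc)
  open import Data.Fin using (Fin; zero; suc; toℕ; fromℕ<)
  import Data.Fin as Fin
  open import Data.Fin.Properties using (any?; all?; toℕ-fromℕ<; toℕ<n; ¬∀⟶∃¬; toℕ-injective)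
  open import Data.Fin.Permutation using (permutation)
  open import Data.List using (List; []; _∷_; length; tabulate)
  open import Data.List.Properties using (length-tabulate)
  open import Data.List.Relation.Unary.All using (All; []; _∷_)
  import Data.List.Relation.Unary.All as All
  import Data.List.Relation.Unary.All.Properties as Allₚ
  open import Data.List.Relation.Unary.AllPairs using ([]; _∷_)
  open import Data.List.Relation.Unary.Any using (here; there)
  open import Data.List.Relation.Unary.Unique.Propositional using (Unique)
  open import Data.List.Relation.Unary.Unique.Propositional.Properties using (tabulate⁺)
  open import Data.List.Membership.Propositional using (_∈_; _∉_)
  open import Data.List.Membership.Propositional.Properties using (∈-tabulate⁺; ∈-tabulate⁻)
  open import Data.Product using (∃-syntax; _×_; _,_; proj₁; proj₂)
  open import Data.Sum using (_⊎_; inj₁; inj₂)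
  open import Data.Empty using (⊥; ⊥-elim)
  open import Function using (_∘_; _$_)
  open import Relation.Nullary using (¬_; Dec; yes; no; does; contradiction)
  open import Relation.Nullary.Decidable using (dec-true; map′; _→-dec_)
  open import Relation.Unary using (Pred; Decidable)
  open import Relation.Binary.PropositionalEquality hiding ([_])
  open import Relation.Binary.Definitions using (tri<; tri≈; tri>)
  open import Algebra.Properties.CommutativeMonoid.Sum +-0-commutativeMonoid using (sum; sum-cong-≗; ∑-distrib-+; sum-permute; sum-replicate-zero)

  Sub : ℕ → Set
  Sub n = Fin n → Bool

  infix 4 _∊_ _∌_ _∊?_
  -- A record rather than a bare equation, so that unification can recover the set and the element
  -- from the type of a membership proof.
  record _∊_ {n} (x : Fin n) (X : Sub n) : Set where
    constructor mem
    field holds : X x ≡ true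
  open _∊_ public

  _∌_ : ∀ {n} → Sub n → Fin n → Set
  X ∌ x = ¬ (x ∊ X)

  _∊?_ : ∀ {n} (x : Fin n) (X : Sub n) → Dec (x ∊ X)
  x ∊? X = map′ mem holds (X x Bool.≟ true)

  module _ {n : ℕ} {ℓ} {P : Pred (Fin n) ℓ} (P? : Decidable P) where
    sep : Sub n
    sep x = does (P? x)

    sep⁺ : ∀ {x} → P x → x ∊ sep
    sep⁺ {x} px = mem (dec-true (P? x) px)

    sep⁻ : ∀ {x} → x ∊ sep → P x
    sep⁻ {x} (mem e) with P? x
    ... | yes p = p
    ... | no _ with () ← e

  infixr 6 _∪_
  infixr 7 _∩_
  _∪_ _∩_ : ∀ {n} → Sub n → Sub n → Sub n
  (X ∪ Y) x = X x ∨ Y x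
  (X ∩ Y) x = X x ∧ Y x

  ∁ : ∀ {n} → Sub n → Sub n
  ∁ X x = not (X x)

  module _ {n : ℕ} {X Y : Sub n} {x : Fin n} where
    ∪⁺ˡ : x ∊ X → x ∊ X ∪ Y
    ∪⁺ˡ (mem e) = mem (cong (_∨ Y x) e)

    ∪⁺ʳ : x ∊ Y → x ∊ X ∪ Y
    ∪⁺ʳ (mem e) = mem (trans (cong (X x ∨_) e) (∨-zeroʳ (X x)))

    ∪⁻ : x ∊ X ∪ Y → x ∊ X ⊎ x ∊ Y
    ∪⁻ (mem e) with X x in eq
    ... | true = inj₁ (mem eq)
    ... | false = inj₂ (mem e)

    ∩⁺ : x ∊ X → x ∊ Y → x ∊ X ∩ Y
    ∩⁺ (mem e) (mem f) = mem (cong₂ _∧_ e f)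

    ∩⁻ : x ∊ X ∩ Y → x ∊ X × x ∊ Y
    ∩⁻ (mem e) with X x in eq
    ... | true = mem eq , mem e
    ... | false with () ← e

  module _ {n : ℕ} {X : Sub n} {x : Fin n} where
    ∁⁺ : X ∌ x → x ∊ ∁ X
    ∁⁺ h with X x in eq
    ... | true = ⊥-elim (h (mem eq))
    ... | false = mem (cong not eq)

    ∁⁻ : x ∊ ∁ X → X ∌ x
    ∁⁻ (mem e) (mem f) rewrite f with () ← e

  b2n : Bool → ℕ
  b2n true = 1
  b2n false = 0

  abstract
    count : ∀ {n} → Sub n → ℕ
    count X = sum (b2n ∘ X)

    count-sum : ∀ {n} (X : Sub n) → count X ≡ sum (b2n ∘ X)
    count-sum X = refl

  sum-mono : ∀ {n} {f g : Fin n → ℕ} → (∀ i → f i ≤ g i) → sum f ≤ sum g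
  sum-mono {zero} h = z≤n
  sum-mono {suc n} h = +-mono-≤ (h zero) (sum-mono (h ∘ suc))

  sum-const : ∀ n c → sum {n} (λ _ → c) ≡ n * c
  sum-const zero c = refl
  sum-const (suc n) c = cong (c +_) (sum-const n c)

  sum-*ʳ : ∀ {n} (f : Fin n → ℕ) c → sum (λ i → f i * c) ≡ sum f * c
  sum-*ʳ {zero} f c = refl
  sum-*ʳ {suc n} f c = trans (cong (f zero * c +_) (sum-*ʳ (f ∘ suc) c)) (sym (*-distribʳ-+ c (f zero) _))

  sum-bij : ∀ {m n} (f : Fin m → Fin n) (g : Fin n → Fin m) → (∀ x → f (g x) ≡ x) → (∀ x → g (f x) ≡ x) →
    (h : Fin n → ℕ) → sum (h ∘ f) ≡ sum h
  sum-bij f g fg gf h = sym (sum-permute h (permutation f g fg gf))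

  module _ {n : ℕ} where
    abstract
      count-cong : {X Y : Sub n} → (∀ x → X x ≡ Y x) → count X ≡ count Y
      count-cong h = sum-cong-≗ (λ x → cong b2n (h x))

      count-mono : {X Y : Sub n} → (∀ x → x ∊ X → x ∊ Y) → count X ≤ count Y
      count-mono {X} {Y} h = sum-mono λ i → aux (X i) (Y i) (λ e → holds (h i (mem e)))
        where
        aux : ∀ a b → (a ≡ true → b ≡ true) → b2n a ≤ b2n b
        aux false b _ = z≤n
        aux true b k rewrite k refl = ≤-refl

      count-∁ : (X : Sub n) → count X + count (∁ X) ≡ n
      count-∁ X = trans (sym (∑-distrib-+ (b2n ∘ X) (b2n ∘ ∁ X)))
        (trans (sum-cong-≗ (λ x → aux (X x))) (trans (sum-const n 1) (*-identityʳ n)))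
        where
        aux : ∀ a → b2n a + b2n (not a) ≡ 1
        aux true = refl
        aux false = refl

    count-≤ : (X : Sub n) → count X ≤ n
    count-≤ X = ≤-trans (m≤m+n _ _) (≤-reflexive (count-∁ X))

    abstract
      count-∪∩ : (X Y : Sub n) → count (X ∪ Y) + count (X ∩ Y) ≡ count X + count Y
      count-∪∩ X Y = trans (sym (∑-distrib-+ (b2n ∘ (X ∪ Y)) (b2n ∘ (X ∩ Y))))
        (trans (sum-cong-≗ (λ x → aux (X x) (Y x))) (∑-distrib-+ (b2n ∘ X) (b2n ∘ Y)))
        where
        aux : ∀ a b → b2n (a ∨ b) + b2n (a ∧ b) ≡ b2n a + b2n b
        aux true true = refl
        aux true false = refl
        aux false true = refl
        aux false false = refl

    abstract
      count-bij : (f g : Fin n → Fin n) → (∀ x → f (g x) ≡ x) → (∀ x → g (f x) ≡ x) →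
        (X : Sub n) → count (X ∘ f) ≡ count X
      count-bij f g fg gf X = sum-bij f g fg gf (b2n ∘ X)

    ⁅_⁆ : Fin n → Sub n
    ⁅ x ⁆ y = does (y Fin.≟ x)

    ∊-⁅⁆ : ∀ {x} → x ∊ ⁅ x ⁆
    ∊-⁅⁆ {x} = mem (dec-true (x Fin.≟ x) refl)

    ⁅⁆⁻ : ∀ {x y} → y ∊ ⁅ x ⁆ → y ≡ x
    ⁅⁆⁻ {x} {y} = sep⁻ (Fin._≟ x) {y}

    remove : Fin n → Sub n → Sub n
    remove x X = X ∩ ∁ ⁅ x ⁆

    remove⁻ : ∀ {x y X} → y ∊ remove x X → y ∊ X × y ≢ x
    remove⁻ {x} {y} {X} h with p , q ← ∩⁻ {X = X} {∁ ⁅ x ⁆} h = p , λ { refl → ∁⁻ {X = ⁅ x ⁆} {y} q ∊-⁅⁆ }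

    remove⁺ : ∀ {x y X} → y ∊ X → y ≢ x → y ∊ remove x X
    remove⁺ {x} {y} {X} p h = ∩⁺ {X = X} {∁ ⁅ x ⁆} p (∁⁺ {X = ⁅ x ⁆} (λ e → h (⁅⁆⁻ e)))

  abstract
    count-none : ∀ {n} {X : Sub n} → (∀ x → X ∌ x) → count X ≡ 0
    count-none {n} {X} h = trans (sum-cong-≗ (λ x → cong b2n (¬-not (λ e → h x (mem e))))) (sum-replicate-zero n)

    count-⁅⁆ : ∀ {n} (x : Fin n) → count ⁅ x ⁆ ≡ 1
    count-⁅⁆ {suc n} zero = cong suc (count-none {X = λ y → ⁅_⁆ {suc n} zero (suc y)} λ x e → case (⁅⁆⁻ {x = zero} {suc x} (mem (holds e))))
      where
      case : ∀ {k} {x : Fin k} → Fin.suc x ≡ zero → ⊥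
      case ()
    count-⁅⁆ {suc n} (suc x) = trans (count-cong {X = λ y → ⁅ Fin.suc x ⁆ (suc y)} {⁅ x ⁆} aux) (count-⁅⁆ x)
      where
      aux : ∀ y → does (suc y Fin.≟ suc x) ≡ does (y Fin.≟ x)
      aux y with y Fin.≟ x
      ... | yes p = refl
      ... | no _ = refl

    count-all : ∀ n → count {n} (λ _ → true) ≡ n
    count-all n = trans (sum-const n 1) (*-identityʳ n)

  module _ {n : ℕ} where
    count-remove : ∀ {x : Fin n} {X} → x ∊ X → count X ≡ suc (count (remove x X))
    count-remove {x} {X} h = begin
      count X                                              ≡⟨ sym (count-cong aux∪) ⟩
      count (remove x X ∪ ⁅ x ⁆)                            ≡⟨ sym (+-identityʳ _) ⟩
      count (remove x X ∪ ⁅ x ⁆) + 0                        ≡⟨ cong (count (remove x X ∪ ⁅ x ⁆) +_) (sym (count-none none)) ⟩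
      count (remove x X ∪ ⁅ x ⁆) + count (remove x X ∩ ⁅ x ⁆) ≡⟨ count-∪∩ (remove x X) ⁅ x ⁆ ⟩
      count (remove x X) + count ⁅ x ⁆                      ≡⟨ cong (count (remove x X) +_) (count-⁅⁆ x) ⟩
      count (remove x X) + 1                                ≡⟨ +-comm _ 1 ⟩
      suc (count (remove x X))                              ∎
      where
      open ≡-Reasoning
      none : ∀ y → (remove x X ∩ ⁅ x ⁆) ∌ y
      none y e with p , q ← ∩⁻ {X = remove x X} {⁅ x ⁆} {y} e = proj₂ (remove⁻ {x = x} {y} {X} p) (⁅⁆⁻ q)
      aux∪ : ∀ y → (remove x X ∪ ⁅ x ⁆) y ≡ X y
      aux∪ y with y Fin.≟ x
      ... | yes refl rewrite holds h = refl
      ... | no _ with X y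
      ... | true = refl
      ... | false = refl

    count-pos : ∀ {x : Fin n} {X} → x ∊ X → 1 ≤ count X
    count-pos h = subst (1 ≤_) (sym (count-remove h)) (s≤s z≤n)

    count-witness : (X : Sub n) → 1 ≤ count X → ∃[ x ] x ∊ X
    count-witness X h with any? (_∊? X)
    ... | yes w = w
    ... | no ¬w = contradiction (count-none {X = X} (λ x e → ¬w (x , e))) λ e → case≤ (subst (1 ≤_) e h)
      where
      case≤ : ¬ (1 ≤ 0)
      case≤ ()

    count-mono-< : {X Y : Sub n} {y : Fin n} → (∀ x → x ∊ X → x ∊ Y) → y ∊ Y → X ∌ y → count X < count Y
    count-mono-< {X} {Y} {y} h yY yX = subst (count X <_) (sym (count-remove yY)) $
      s≤s (count-mono {X = X} λ x e → remove⁺ {x = y} {x} {Y} (h x e) λ { refl → yX e })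

    count-full : {X : Sub n} → n ≤ count X → ∀ x → x ∊ X
    count-full {X} h x with x ∊? X
    ... | yes e = e
    ... | no ¬e = contradiction (≤-trans (+-monoˡ-≤ 1 h) (≤-trans (+-monoʳ-≤ (count X) (count-pos {x} {∁ X} (∁⁺ {X = X} ¬e))) (≤-reflexive (count-∁ X)))) (m+1+n≰m n)

    count-nonfull : {X : Sub n} → count X < n → ∃[ x ] X ∌ x
    count-nonfull {X} h with all? (_∊? X)
    ... | no ¬a = ¬∀⟶∃¬ n _ (_∊? X) ¬a
    ... | yes a = contradiction (≤-trans (≤-reflexive (sym (count-all n)))
                    (count-mono {X = λ _ → true} {X} (λ x _ → a x))) (<⇒≱ h)

    _∖_ : Sub n → List (Fin n) → Sub n
    X ∖ [] = X
    X ∖ (x ∷ xs) = remove x (X ∖ xs)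

    ∖⁺ : ∀ {X y} xs → y ∊ X → y ∉ xs → y ∊ X ∖ xs
    ∖⁺ [] h _ = h
    ∖⁺ {X} {y} (x ∷ xs) h k = remove⁺ {x = x} {y} {X ∖ xs} (∖⁺ xs h (k ∘ there)) (λ { refl → k (here refl) })

    ∖⁻ : ∀ {X y} xs → y ∊ X ∖ xs → y ∊ X × y ∉ xs
    ∖⁻ [] h = h , λ ()
    ∖⁻ {X} {y} (x ∷ xs) h with p , q ← remove⁻ {x = x} {y} {X ∖ xs} h with a , b ← ∖⁻ {X} xs p =
      a , λ { (here e) → q e ; (there m) → b m }

    count-∖ : ∀ {X} {xs : List (Fin n)} → Unique xs → All (_∊ X) xs → count X ≡ length xs + count (X ∖ xs)
    count-∖ [] [] = refl
    count-∖ {X} {x ∷ xs} (u ∷ us) (h ∷ hs) = begin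
      count X                                       ≡⟨ count-∖ us hs ⟩
      length xs + count (X ∖ xs)                    ≡⟨ cong (length xs +_) (count-remove (∖⁺ xs h (λ m → All.lookup u m refl))) ⟩
      length xs + suc (count (remove x (X ∖ xs)))   ≡⟨ +-suc _ _ ⟩
      suc (length xs) + count (remove x (X ∖ xs))   ∎
      where open ≡-Reasoning

    count-unique : ∀ {X} {xs : List (Fin n)} → Unique xs → All (_∊ X) xs → length xs ≤ count X
    count-unique u a = ≤-trans (m≤m+n _ _) (≤-reflexive (sym (count-∖ u a)))

    count-inj : ∀ {k X} (f : Fin k → Fin n) → (∀ {i j} → f i ≡ f j → i ≡ j) → (∀ i → f i ∊ X) → k ≤ count X
    count-inj {k} f inj h = subst (_≤ _) (length-tabulate f) (count-unique (tabulate⁺ inj) (Allₚ.tabulate⁺ h))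

    count≤1 : {X : Sub n} → count X ≤ 1 → ∀ {x y} → x ∊ X → y ∊ X → x ≡ y
    count≤1 {X} h {x} {y} a b with x Fin.≟ y
    ... | yes e = e
    ... | no ne = contradiction (≤-trans (count-unique {X = X} {x ∷ y ∷ []} ((ne ∷ []) ∷ [] ∷ []) (a ∷ b ∷ [])) h) λ { (s≤s ()) }

  iter : ∀ {A : Set} → ℕ → (A → A) → A → A
  iter zero f x = x
  iter (suc k) f x = f (iter k f x)

  module _ {A : Set} (f : A → A) where
    iter-+ : ∀ m k x → iter (m + k) f x ≡ iter m f (iter k f x)
    iter-+ zero k x = refl
    iter-+ (suc m) k x = cong f (iter-+ m k x)

    iter-* : ∀ {d x} → iter d f x ≡ x → ∀ k → iter (k * d) f x ≡ x
    iter-* e zero = refl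
    iter-* {d} {x} e (suc k) = trans (iter-+ d (k * d) x) (trans (cong (iter d f) (iter-* e k)) e)

    -- By Bézout, 1 is a difference of a multiple of `c` and a multiple of `d`, and iterates of
    -- either kind fix `x`.
    iter-coprime : ∀ {c d x} → Coprime c d → iter c f x ≡ x → iter d f x ≡ x → f x ≡ x
    iter-coprime {c} {d} {x} co ec ed with coprime-Bézout co
    ... | Bézout.+- a b e = trans (cong f (sym (iter-* ed b))) (trans (cong (λ k → iter k f x) e) (iter-* ec a))
    ... | Bézout.-+ a b e = trans (cong f (sym (iter-* ec a))) (trans (cong (λ k → iter k f x) e) (iter-* ed b))

  module _ {A : Set} {q : ℕ} (q-prime : Prime q) (f : A → A) (per : ∀ x → iter q f x ≡ x) where
    private instance q≢0 = prime⇒nonZero q-prime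

    iter-mod : ∀ m x → iter m f x ≡ iter (m % q) f x
    iter-mod m x = trans (cong (λ k → iter k f x) (m≡m%n+[m/n]*n m q))
      (trans (iter-+ f (m % q) (m / q * q) x) (cong (iter (m % q) f) (iter-* f (per x) (m / q))))

    iter-inverse : ∀ x → iter (pred q) f (f x) ≡ x
    iter-inverse x = trans (sym (iter-+ f (pred q) 1 x)) (trans (cong (λ k → iter k f x) (trans (+-comm (pred q) 1) (suc-pred q))) (per x))

    f-injective : ∀ {x y} → f x ≡ f y → x ≡ y
    f-injective {x} {y} e = trans (sym (iter-inverse x)) (trans (cong (iter (pred q) f) e) (iter-inverse y))

    private
      -- Cancelling `i` applications leaves `x` fixed by the iterate of order j - i, which is
      -- coprime to `q`.
      dist : ∀ {i j x} → f x ≢ x → i < j → j < q → iter i f x ≢ iter j f x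
      dist {i} {j} {x} nf i<j j<q e = nf (iter-coprime f (prime⇒coprime q-prime d<q) (per x) ed)
        where
        d = j ∸ i
        instance
          d≢0 : NonZero d
          d≢0 = >-nonZero (m<n⇒0<n∸m i<j)
        d<q : d < q
        d<q = ≤-<-trans (m∸n≤m j i) j<q
        cancel : ∀ k {a b} → iter k f a ≡ iter k f b → a ≡ b
        cancel zero e = e
        cancel (suc k) e = cancel k (f-injective e)
        ed : iter d f x ≡ x
        ed = cancel i (trans (sym (iter-+ f i d x)) (trans (cong (λ k → iter k f x) (m+[n∸m]≡n (<⇒≤ i<j))) (sym e)))

    orbit-injective : ∀ {x} → f x ≢ x → ∀ {i j : Fin q} → iter (toℕ i) f x ≡ iter (toℕ j) f x → i ≡ j
    orbit-injective {x} nf {i} {j} e with <-cmp (toℕ i) (toℕ j)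
    ... | tri< a _ _ = contradiction e (dist nf a (toℕ<n j))
    ... | tri≈ _ b _ = toℕ-injective b
    ... | tri> _ _ c = contradiction (sym e) (dist nf c (toℕ<n i))

  module _ {n q : ℕ} (q-prime : Prime q) (f : Fin n → Fin n) (per : ∀ x → iter q f x ≡ x) where
    private instance q≢0 = prime⇒nonZero q-prime

    -- Peel off one free orbit at a time.
    free-orbits : (X : Sub n) → (∀ x → x ∊ X → f x ∊ X) → (∀ x → x ∊ X → f x ≢ x) → q ∣ count X
    free-orbits X cl nf = go X cl nf (<-wellFounded (count X))
      where
      go : (X : Sub n) → (∀ x → x ∊ X → f x ∊ X) → (∀ x → x ∊ X → f x ≢ x) → Acc _<_ (count X) → q ∣ count X
      go X cl nf (acc rs) with count X in eq
      ... | zero = q ∣0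
      ... | suc c with x , xX ← count-witness X (subst (1 ≤_) (sym eq) (s≤s z≤n)) =
        subst (q ∣_) (trans (sym cX) eq) (∣m∣n⇒∣m+n ∣-refl (go Y clY (λ y h → nf y (proj₁ (∖⁻ {X = X} orb h))) (rs less)))
        where
        orb : List (Fin n)
        orb = tabulate {n = q} (λ i → iter (toℕ i) f x)
        allX : ∀ k → iter k f x ∊ X
        allX zero = xX
        allX (suc k) = cl _ (allX k)
        Y = X ∖ orb
        cX : count X ≡ q + count Y
        cX = trans (count-∖ (tabulate⁺ (orbit-injective q-prime f per (nf x xX))) (Allₚ.tabulate⁺ (λ i → allX (toℕ i))))
               (cong (_+ count Y) (length-tabulate {n = q} _))
        in-orb : ∀ k → iter k f x ∈ orb
        in-orb k = subst (_∈ orb) (trans (cong (λ k → iter k f x) (toℕ-fromℕ< (m%n<n k q))) (sym (iter-mod q-prime f per k x)))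
                    (∈-tabulate⁺ (fromℕ< (m%n<n k q)))
        -- If `f y` lay in the removed orbit, so would `y`, since the inverse of `f` is its iterate
        -- of order q - 1.
        clY : ∀ y → y ∊ Y → f y ∊ Y
        clY y h with yX , yo ← ∖⁻ {X = X} orb h = ∖⁺ orb (cl y yX) λ m → case (∈-tabulate⁻ m)
          where
          case : ∃[ i ] f y ≡ iter (toℕ i) f x → ⊥
          case (i , e) = yo (subst (_∈ orb) (trans (iter-+ f (pred q) (toℕ i) x)
            (trans (cong (iter (pred q) f) (sym e)) (iter-inverse q-prime f per y))) (in-orb (pred q + toℕ i)))
        less : count Y < suc c
        less = subst (count Y <_) (trans (sym cX) eq) (m<n+m (count Y) (>-nonZero⁻¹ q))

  module Bijection {n : ℕ} (f g : Fin n → Fin n) (fg : ∀ x → f (g x) ≡ x) (gf : ∀ x → g (f x) ≡ x) where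
    image : Sub n → Sub n
    image X = X ∘ g

    image⁺ : ∀ {X x} → x ∊ X → f x ∊ image X
    image⁺ {X} {x} (mem e) = mem (trans (cong X (gf x)) e)

    image⁻ : ∀ {X y} → y ∊ image X → g y ∊ X
    image⁻ (mem e) = mem e

    count-image : ∀ X → count (image X) ≡ count X
    count-image = count-bij g f gf fg

    -- The preimage of `X` contains `X` and has the same size, so the two agree.
    closed-inverse : ∀ {X} → (∀ x → x ∊ X → f x ∊ X) → ∀ x → f x ∊ X → x ∊ X
    closed-inverse {X} cl x fx with x ∊? X
    ... | yes h = h
    ... | no h = contradiction (count-bij f g fg gf X)
      (<⇒≢ (count-mono-< {X = X} {X ∘ f} {x} (λ y k → mem (holds (cl y k))) (mem (holds fx)) h) ∘ sym)

    -- The dichotomy behind most lower bounds on numbers of values: a step that adds nothing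
    -- exhibits a symmetry of `X`.
    grows-or-closed : ∀ X → (∀ x → x ∊ X → f x ∊ X) ⊎ count X < count (X ∪ image X)
    grows-or-closed X with all? (λ x → (x ∊? X) →-dec (f x ∊? X))
    ... | yes c = inj₁ (λ x h → c x h)
    ... | no ¬c with x , h ← ¬∀⟶∃¬ n _ (λ x → (x ∊? X) →-dec (f x ∊? X)) ¬c with x ∊? X
    ... | no k = contradiction (λ e → contradiction e k) h
    ... | yes k = inj₂ (count-mono-< {y = f x} (λ _ → ∪⁺ˡ) (∪⁺ʳ (image⁺ k)) (λ e → h (λ _ → e)))

-- The field ℤ/r and a ring solver over it.

module ZMod where

  open import Data.Nat using (ℕ; suc; pred; NonZero)
  import Data.Nat as ℕ
  open import Data.Nat.Properties using (suc-pred; *-comm; +-comm; *-assoc; +-assoc; *-identityˡ; *-distribʳ-+; +-identityˡ)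
  open import Data.Nat.Divisibility using (_∣_; m%n≡0⇒n∣m; n∣m⇒m%n≡0; ∣1⇒≡1)
  open import Data.Nat.Primality using (Prime; prime⇒nonZero; ¬prime[1])
  open import Data.Nat.Coprimality using (prime⇒coprime; coprime-Bézout)
  open import Data.Nat.GCD using (module Bézout)
  open import Data.Nat.DivMod using (_%_; m%n<n; %-distribˡ-+; %-distribˡ-*; m%n%n≡m%n; m<n⇒m%n≡m; [m+kn]%n≡m%n; m*n%n≡0)
  open import Data.Fin using (Fin; toℕ; fromℕ<)
  import Data.Fin as Fin
  open import Data.Fin.Properties using (toℕ-fromℕ<; toℕ<n; toℕ-injective)
  open import Data.Maybe using (Maybe; just; nothing)
  open import Data.Product using (∃-syntax; _×_; _,_)
  open import Relation.Nullary using (yes; no)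
  open import Relation.Binary.PropositionalEquality hiding ([_])
  open import Algebra.Structures using (IsCommutativeRing)
  open import Algebra.Bundles using (CommutativeRing; RawRing)
  open import Level using (0ℓ)

  -- An interface, so that later arguments never unfold remainders. `nat` is reduction modulo `r`;
  -- through it exponents in ℕ meet field elements.
  record PrimeField (r : ℕ) : Set where
    infixl 7 _⊗_
    infixl 6 _⊕_ _⊝_
    infix 8 ⊖_
    field
      r-prime : Prime r
      _⊕_ _⊗_ : Fin r → Fin r → Fin r
      ⊖_ : Fin r → Fin r
      𝟘 𝟙 : Fin r
      isCommutativeRing : IsCommutativeRing _≡_ _⊕_ _⊗_ ⊖_ 𝟘 𝟙
      inverse : ∀ x → x ≢ 𝟘 → ∃[ y ] y ⊗ x ≡ 𝟙
      nat : ℕ → Fin r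
      nat-0 : nat 0 ≡ 𝟘
      nat-1 : nat 1 ≡ 𝟙
      nat-+ : ∀ m n → nat (m ℕ.+ n) ≡ nat m ⊕ nat n
      nat-* : ∀ m n → nat (m ℕ.* n) ≡ nat m ⊗ nat n
      nat-toℕ : ∀ x → nat (toℕ x) ≡ x
      nat≡𝟘⁻ : ∀ m → nat m ≡ 𝟘 → r ∣ m
      nat≡𝟘⁺ : ∀ m → r ∣ m → nat m ≡ 𝟘

    _⊝_ : Fin r → Fin r → Fin r
    x ⊝ y = x ⊕ ⊖ y

    commutativeRing : CommutativeRing 0ℓ 0ℓ
    commutativeRing = record { isCommutativeRing = isCommutativeRing }

  module FieldTheory {r : ℕ} (Fd : PrimeField r) where
    open PrimeField Fd
    open CommutativeRing commutativeRing public using ()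
      renaming (+-assoc to ⊕-assoc; +-comm to ⊕-comm; +-identityˡ to ⊕-identityˡ; +-identityʳ to ⊕-identityʳ;
                *-assoc to ⊗-assoc; *-comm to ⊗-comm; *-identityˡ to ⊗-identityˡ; *-identityʳ to ⊗-identityʳ;
                -‿inverseʳ to ⊖-inverseʳ; -‿inverseˡ to ⊖-inverseˡ; zeroˡ to ⊗-zeroˡ; zeroʳ to ⊗-zeroʳ;
                distribˡ to ⊗-distribˡ; distribʳ to ⊗-distribʳ)
    private module R = CommutativeRing commutativeRing
    open import Algebra.Solver.Ring.AlmostCommutativeRing using (fromCommutativeRing; _-Raw-AlmostCommutative⟶_)
    open import Algebra.Properties.Ring R.ring using (-‿distribˡ-*; -‿distribʳ-*; -‿involutive)
    open import Algebra.Properties.AbelianGroup R.+-abelianGroup using (⁻¹-∙-comm)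
    open import Algebra.Properties.CommutativeSemigroup R.+-commutativeSemigroup using (interchange)

    private
      -- The pair (a , b) stands for the integer a - b.
      Diff : RawRing 0ℓ 0ℓ
      Diff = record
        { Carrier = ℕ × ℕ ; _≈_ = _≡_
        ; _+_ = λ { (a , b) (c , d) → a ℕ.+ c , b ℕ.+ d }
        ; _*_ = λ { (a , b) (c , d) → a ℕ.* c ℕ.+ b ℕ.* d , a ℕ.* d ℕ.+ b ℕ.* c }
        ; -_ = λ { (a , b) → b , a }
        ; 0# = 0 , 0 ; 1# = 1 , 0 }

      ⟦_⟧′ : ℕ × ℕ → Fin r
      ⟦ a , b ⟧′ = nat a ⊝ nat b

      -- The first two clauses make the solver's constants denote 𝟘 and 𝟙 judgementally.
      ⟦_⟧ : ℕ × ℕ → Fin r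
      ⟦ 0 , 0 ⟧ = 𝟘
      ⟦ 1 , 0 ⟧ = 𝟙
      ⟦ a , b ⟧ = nat a ⊝ nat b

      ⊖𝟘 : ⊖ 𝟘 ≡ 𝟘
      ⊖𝟘 = trans (sym (⊕-identityˡ _)) (⊖-inverseʳ 𝟘)

      eval : ∀ x → ⟦ x ⟧ ≡ ⟦ x ⟧′
      eval (0 , 0) = sym (⊖-inverseʳ (nat 0))
      eval (1 , 0) = sym (trans (cong₂ _⊝_ nat-1 nat-0) (trans (cong (𝟙 ⊕_) ⊖𝟘) (⊕-identityʳ 𝟙)))
      eval (suc (suc a) , 0) = refl
      eval (0 , suc b) = refl
      eval (1 , suc b) = refl
      eval (suc (suc a) , suc b) = refl

      +-homo : ∀ x y → ⟦ RawRing._+_ Diff x y ⟧′ ≡ ⟦ x ⟧′ ⊕ ⟦ y ⟧′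
      +-homo (a , b) (c , d) = trans (cong₂ _⊝_ (nat-+ a c) (nat-+ b d))
        (trans (cong (nat a ⊕ nat c ⊕_) (sym (⁻¹-∙-comm (nat b) (nat d)))) (interchange _ _ _ _))

      -homo : ∀ x → ⟦ RawRing.-_ Diff x ⟧′ ≡ ⊖ ⟦ x ⟧′
      -homo (a , b) = trans (⊕-comm _ _) (trans (cong (⊖ nat a ⊕_) (sym (-‿involutive (nat b)))) (⁻¹-∙-comm _ _))

      *-homo : ∀ x y → ⟦ RawRing._*_ Diff x y ⟧′ ≡ ⟦ x ⟧′ ⊗ ⟦ y ⟧′
      *-homo (a , b) (c , d) = begin
        nat (a ℕ.* c ℕ.+ b ℕ.* d) ⊝ nat (a ℕ.* d ℕ.+ b ℕ.* c)
          ≡⟨ cong₂ _⊝_ (trans (nat-+ (a ℕ.* c) _) (cong₂ _⊕_ (nat-* a c) (nat-* b d))) (trans (nat-+ (a ℕ.* d) _) (cong₂ _⊕_ (nat-* a d) (nat-* b c))) ⟩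
        (A ⊗ C ⊕ B ⊗ D) ⊝ (A ⊗ D ⊕ B ⊗ C)
          ≡⟨ cong (A ⊗ C ⊕ B ⊗ D ⊕_) (sym (⁻¹-∙-comm (A ⊗ D) (B ⊗ C))) ⟩
        A ⊗ C ⊕ B ⊗ D ⊕ (⊖ (A ⊗ D) ⊕ ⊖ (B ⊗ C)) ≡⟨ interchange _ _ _ _ ⟩
        (A ⊗ C ⊝ A ⊗ D) ⊕ (B ⊗ D ⊝ B ⊗ C)
          ≡⟨ cong₂ _⊕_ (cong (A ⊗ C ⊕_) (-‿distribʳ-* A D)) (trans (⊕-comm _ _) (cong₂ _⊕_ (-‿distribˡ-* B C) BD)) ⟩
        (A ⊗ C ⊕ A ⊗ (⊖ D)) ⊕ ((⊖ B) ⊗ C ⊕ (⊖ B) ⊗ (⊖ D)) ≡⟨ cong₂ _⊕_ (sym (⊗-distribˡ A C (⊖ D))) (sym (⊗-distribˡ (⊖ B) C (⊖ D))) ⟩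
        A ⊗ (C ⊝ D) ⊕ (⊖ B) ⊗ (C ⊝ D) ≡⟨ sym (⊗-distribʳ (C ⊝ D) A (⊖ B)) ⟩
        (A ⊝ B) ⊗ (C ⊝ D) ∎
        where
        open ≡-Reasoning
        A = nat a
        B = nat b
        C = nat c
        D = nat d
        BD : B ⊗ D ≡ (⊖ B) ⊗ (⊖ D)
        BD = trans (sym (-‿involutive (B ⊗ D))) (trans (cong ⊖_ (-‿distribˡ-* B D)) (-‿distribʳ-* (⊖ B) D))

      morphism : Diff -Raw-AlmostCommutative⟶ fromCommutativeRing commutativeRing
      morphism = record
        { ⟦_⟧ = ⟦_⟧
        ; +-homo = λ x y → trans (eval _) (trans (+-homo x y) (sym (cong₂ _⊕_ (eval x) (eval y))))
        ; *-homo = λ x y → trans (eval _) (trans (*-homo x y) (sym (cong₂ _⊗_ (eval x) (eval y))))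
        ; -‿homo = λ x → trans (eval _) (trans (-homo x) (sym (cong ⊖_ (eval x))))
        ; 0-homo = refl
        ; 1-homo = refl }

      move : ∀ {a b c d : Fin r} → a ⊕ d ≡ c ⊕ b → a ⊝ b ≡ c ⊝ d
      move {a} {b} {c} {d} e = begin
        a ⊝ b                 ≡⟨ sym (⊕-identityʳ _) ⟩
        a ⊝ b ⊕ 𝟘             ≡⟨ cong (a ⊝ b ⊕_) (sym (⊖-inverseʳ d)) ⟩
        a ⊝ b ⊕ (d ⊝ d)       ≡⟨ interchange _ _ _ _ ⟩
        a ⊕ d ⊕ (⊖ b ⊕ ⊖ d)   ≡⟨ cong (_⊕ (⊖ b ⊕ ⊖ d)) e ⟩
        c ⊕ b ⊕ (⊖ b ⊕ ⊖ d)   ≡⟨ cong (c ⊕ b ⊕_) (⊕-comm _ _) ⟩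
        c ⊕ b ⊕ (⊖ d ⊕ ⊖ b)   ≡⟨ interchange _ _ _ _ ⟩
        c ⊝ d ⊕ (b ⊝ b)       ≡⟨ cong (c ⊝ d ⊕_) (⊖-inverseʳ b) ⟩
        c ⊝ d ⊕ 𝟘             ≡⟨ ⊕-identityʳ _ ⟩
        c ⊝ d ∎
        where open ≡-Reasoning

      coeff≟ : ∀ (x y : ℕ × ℕ) → Maybe (⟦ x ⟧ ≡ ⟦ y ⟧)
      coeff≟ (a , b) (c , d) with a ℕ.+ d ℕ.≟ c ℕ.+ b
      ... | yes e = just (trans (eval (a , b)) (trans (move (trans (sym (nat-+ a d)) (trans (cong nat e) (nat-+ c b)))) (sym (eval (c , d)))))
      ... | no _ = nothing

    open import Algebra.Solver.Ring Diff (fromCommutativeRing commutativeRing) morphism coeff≟ public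
      using (Polynomial; solve; _:+_; _:*_; _:-_; :-_; _:=_; con)

    :1 :0 : ∀ {n} → Polynomial n
    :1 = con (1 , 0)
    :0 = con (0 , 0)

    𝟙≢𝟘 : 𝟙 ≢ 𝟘
    𝟙≢𝟘 e = ¬prime[1] (subst Prime (∣1⇒≡1 (nat≡𝟘⁻ 1 (trans nat-1 e))) r-prime)

    ⊝≡𝟘 : ∀ {x y} → x ⊝ y ≡ 𝟘 → x ≡ y
    ⊝≡𝟘 {x} {y} e = begin
      x ≡⟨ solve 2 (λ x y → x := (x :- y) :+ y) refl x y ⟩
      x ⊝ y ⊕ y ≡⟨ cong (_⊕ y) e ⟩
      𝟘 ⊕ y ≡⟨ ⊕-identityˡ y ⟩
      y ∎
      where open ≡-Reasoning

    ⊝-self : ∀ x → x ⊝ x ≡ 𝟘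
    ⊝-self = ⊖-inverseʳ

    ⊕-cancelˡ : ∀ x {y z} → x ⊕ y ≡ x ⊕ z → y ≡ z
    ⊕-cancelˡ x {y} {z} e = begin
      y ≡⟨ solve 2 (λ x y → y := (x :+ y) :- x) refl x y ⟩
      (x ⊕ y) ⊝ x ≡⟨ cong (_⊝ x) e ⟩
      (x ⊕ z) ⊝ x ≡⟨ solve 2 (λ x y → (x :+ y) :- x := y) refl x z ⟩
      z ∎
      where open ≡-Reasoning

    ⊕-cancelʳ : ∀ x {y z} → y ⊕ x ≡ z ⊕ x → y ≡ z
    ⊕-cancelʳ x {y} {z} e = ⊕-cancelˡ x (trans (⊕-comm x y) (trans e (⊕-comm z x)))

    ⊗≡𝟘 : ∀ {x y} → x ⊗ y ≡ 𝟘 → x ≢ 𝟘 → y ≡ 𝟘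
    ⊗≡𝟘 {x} {y} e nx with i , ix ← inverse x nx = begin
      y ≡⟨ sym (⊗-identityˡ y) ⟩
      𝟙 ⊗ y ≡⟨ cong (_⊗ y) (sym ix) ⟩
      i ⊗ x ⊗ y ≡⟨ ⊗-assoc i x y ⟩
      i ⊗ (x ⊗ y) ≡⟨ cong (i ⊗_) e ⟩
      i ⊗ 𝟘 ≡⟨ ⊗-zeroʳ i ⟩
      𝟘 ∎
      where open ≡-Reasoning

    ⊗-cancelˡ : ∀ x {y z} → x ≢ 𝟘 → x ⊗ y ≡ x ⊗ z → y ≡ z
    ⊗-cancelˡ x {y} {z} nx e = ⊝≡𝟘 (⊗≡𝟘 {x} (trans (solve 3 (λ x y z → x :* (y :- z) := x :* y :- x :* z) refl x y z)
      (trans (cong (_⊝ x ⊗ z) e) (⊝-self _))) nx)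

  module _ (r : ℕ) (r-prime : Prime r) where
    private
      instance
        r≢0 : NonZero r
        r≢0 = prime⇒nonZero r-prime

      [_] : ℕ → Fin r
      [ k ] = fromℕ< (m%n<n k r)

      toℕ[_] : ∀ k → toℕ [ k ] ≡ k % r
      toℕ[ k ] = toℕ-fromℕ< (m%n<n k r)

      []-cong : ∀ {a b} → a % r ≡ b % r → [ a ] ≡ [ b ]
      []-cong {a} {b} e = toℕ-injective (trans toℕ[ a ] (trans e (sym toℕ[ b ])))

      []-toℕ : ∀ x → [ toℕ x ] ≡ x
      []-toℕ x = toℕ-injective (trans toℕ[ toℕ x ] (m<n⇒m%n≡m (toℕ<n x)))

      add mul : Fin r → Fin r → Fin r
      add x y = [ toℕ x ℕ.+ toℕ y ]
      mul x y = [ toℕ x ℕ.* toℕ y ]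

      -- Multiplication by r - 1, which avoids truncated subtraction.
      neg : Fin r → Fin r
      neg x = [ pred r ℕ.* toℕ x ]

      add-[] : ∀ a b → add [ a ] [ b ] ≡ [ a ℕ.+ b ]
      add-[] a b = []-cong (trans (cong₂ (λ x y → (x ℕ.+ y) % r) toℕ[ a ] toℕ[ b ]) (sym (%-distribˡ-+ a b r)))

      mul-[] : ∀ a b → mul [ a ] [ b ] ≡ [ a ℕ.* b ]
      mul-[] a b = []-cong (trans (cong₂ (λ x y → (x ℕ.* y) % r) toℕ[ a ] toℕ[ b ]) (sym (%-distribˡ-* a b r)))

      neg-[] : ∀ a → neg [ a ] ≡ [ pred r ℕ.* a ]
      neg-[] a = trans ([]-cong (trans (cong (λ x → (pred r ℕ.* x) % r) toℕ[ a ]) (sym e))) refl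
        where
        e : (pred r ℕ.* a) % r ≡ (pred r ℕ.* (a % r)) % r
        e = trans (%-distribˡ-* (pred r) a r) (sym (trans (%-distribˡ-* (pred r) (a % r) r) (cong (λ x → (pred r % r ℕ.* x) % r) (m%n%n≡m%n a r))))

      -- Every residue is [ a ] for some a, which turns laws of ℕ into laws of residues.
      ind₁ : (P : Fin r → Set) → (∀ a → P [ a ]) → ∀ x → P x
      ind₁ P h x = subst P ([]-toℕ x) (h (toℕ x))

      ind₂ : (P : Fin r → Fin r → Set) → (∀ a b → P [ a ] [ b ]) → ∀ x y → P x y
      ind₂ P h = ind₁ _ (λ a → ind₁ _ (h a))

      ind₃ : (P : Fin r → Fin r → Fin r → Set) → (∀ a b c → P [ a ] [ b ] [ c ]) → ∀ x y z → P x y z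
      ind₃ P h = ind₁ _ (λ a → ind₂ _ (h a))

      neg-inv : ∀ x → add x (neg x) ≡ [ 0 ]
      neg-inv = ind₁ _ λ a → trans (cong (add [ a ]) (neg-[] a)) (trans (add-[] a _)
        ([]-cong {b = 0} (trans (cong (_% r) (trans (cong (ℕ._* a) (suc-pred r)) (*-comm r a))) (trans (m*n%n≡0 a r) (sym (m*n%n≡0 0 r))))))

      add-comm : ∀ x y → add x y ≡ add y x
      add-comm x y = cong [_] (+-comm (toℕ x) (toℕ y))

      mul-comm : ∀ x y → mul x y ≡ mul y x
      mul-comm x y = cong [_] (*-comm (toℕ x) (toℕ y))

      add-assoc : ∀ x y z → add (add x y) z ≡ add x (add y z)
      add-assoc = ind₃ _ λ a b c → trans (cong (λ t → add t [ c ]) (add-[] a b)) (trans (add-[] (a ℕ.+ b) c)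
        (trans (cong [_] (+-assoc a b c)) (sym (trans (cong (add [ a ]) (add-[] b c)) (add-[] a (b ℕ.+ c))))))

      mul-assoc : ∀ x y z → mul (mul x y) z ≡ mul x (mul y z)
      mul-assoc = ind₃ _ λ a b c → trans (cong (λ t → mul t [ c ]) (mul-[] a b)) (trans (mul-[] (a ℕ.* b) c)
        (trans (cong [_] (*-assoc a b c)) (sym (trans (cong (mul [ a ]) (mul-[] b c)) (mul-[] a (b ℕ.* c))))))

      add-idˡ : ∀ x → add [ 0 ] x ≡ x
      add-idˡ = ind₁ _ λ a → add-[] 0 a

      mul-idˡ : ∀ x → mul [ 1 ] x ≡ x
      mul-idˡ = ind₁ _ λ a → trans (mul-[] 1 a) (cong [_] (*-identityˡ a))

      distr : ∀ x y z → mul (add y z) x ≡ add (mul y x) (mul z x)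
      distr = ind₃ _ λ a b c → trans (cong (λ t → mul t [ a ]) (add-[] b c)) (trans (mul-[] (b ℕ.+ c) a)
        (trans (cong [_] (*-distribʳ-+ a b c)) (sym (trans (cong₂ add (mul-[] b a) (mul-[] c a)) (add-[] _ _)))))

      isCR : IsCommutativeRing _≡_ add mul neg [ 0 ] [ 1 ]
      isCR = record
        { isRing = record
          { +-isAbelianGroup = record
            { isGroup = record
              { isMonoid = record
                { isSemigroup = record { isMagma = record { isEquivalence = isEquivalence ; ∙-cong = cong₂ add } ; assoc = add-assoc }
                ; identity = add-idˡ , λ x → trans (add-comm x _) (add-idˡ x) }
              ; inverse = (λ x → trans (add-comm (neg x) x) (neg-inv x)) , neg-inv
              ; ⁻¹-cong = cong neg }
            ; comm = add-comm }
          ; *-cong = cong₂ mul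
          ; *-assoc = mul-assoc
          ; *-identity = mul-idˡ , λ x → trans (mul-comm x _) (mul-idˡ x)
          ; distrib = (λ x y z → trans (mul-comm x _) (trans (distr x y z) (cong₂ add (mul-comm y x) (mul-comm z x)))) , distr }
        ; *-comm = mul-comm }

      nat≡0⁻ : ∀ m → [ m ] ≡ [ 0 ] → r ∣ m
      nat≡0⁻ m e = m%n≡0⇒n∣m m r (trans (sym toℕ[ m ]) (trans (cong toℕ e) (trans toℕ[ 0 ] (m*n%n≡0 0 r))))

      nat≡0⁺ : ∀ m → r ∣ m → [ m ] ≡ [ 0 ]
      nat≡0⁺ m d = []-cong {b = 0} (trans (n∣m⇒m%n≡0 m r d) (sym (m*n%n≡0 0 r)))

      inv : ∀ x → x ≢ [ 0 ] → ∃[ y ] mul y x ≡ [ 1 ]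
      inv x nz = go (coprime-Bézout (prime⇒coprime r-prime (toℕ<n x)))
        where
        m = toℕ x
        instance
          m≢0 : NonZero m
          m≢0 = ℕ.≢-nonZero λ e → nz (trans (sym ([]-toℕ x)) (cong [_] e))
        mulx : ∀ b → mul [ b ] x ≡ [ b ℕ.* m ]
        mulx b = trans (cong (mul [ b ]) (sym ([]-toℕ x))) (mul-[] b m)
        go : Bézout.Identity 1 r m → ∃[ y ] mul y x ≡ [ 1 ]
        go (Bézout.-+ a b e) = [ b ] , trans (mulx b) (trans (cong [_] (sym e)) ([]-cong ([m+kn]%n≡m%n 1 a r)))
        -- Here 1 + bm = ar, so the inverse is -b, written as (r - 1)b.
        go (Bézout.+- a b e) = [ pred r ℕ.* b ] , trans (mulx _) ([]-cong eq)
          where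
          eq : (pred r ℕ.* b ℕ.* m) % r ≡ 1 % r
          eq = begin
            (pred r ℕ.* b ℕ.* m) % r                         ≡⟨ sym ([m+kn]%n≡m%n _ a r) ⟩
            (pred r ℕ.* b ℕ.* m ℕ.+ a ℕ.* r) % r             ≡⟨ cong (λ t → (pred r ℕ.* b ℕ.* m ℕ.+ t) % r) (sym e) ⟩
            (pred r ℕ.* b ℕ.* m ℕ.+ (1 ℕ.+ b ℕ.* m)) % r     ≡⟨ cong (_% r) rearr ⟩
            (1 ℕ.+ b ℕ.* m ℕ.* r) % r                        ≡⟨ [m+kn]%n≡m%n 1 (b ℕ.* m) r ⟩
            1 % r ∎
            where
            open ≡-Reasoning
            rearr : pred r ℕ.* b ℕ.* m ℕ.+ (1 ℕ.+ b ℕ.* m) ≡ 1 ℕ.+ b ℕ.* m ℕ.* r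
            rearr = trans (cong (ℕ._+ (1 ℕ.+ b ℕ.* m)) (*-assoc (pred r) b m)) (trans (+-comm (pred r ℕ.* (b ℕ.* m)) (1 ℕ.+ b ℕ.* m))
              (cong suc (trans (cong (ℕ._* (b ℕ.* m)) (suc-pred r)) (*-comm r (b ℕ.* m)))))

    abstract
      ℤmod : PrimeField r
      ℤmod = record
        { r-prime = r-prime ; _⊕_ = add ; _⊗_ = mul ; ⊖_ = neg ; 𝟘 = [ 0 ] ; 𝟙 = [ 1 ]
        ; isCommutativeRing = isCR ; inverse = inv ; nat = [_] ; nat-0 = refl ; nat-1 = refl
        ; nat-+ = λ m n → sym (add-[] m n) ; nat-* = λ m n → sym (mul-[] m n) ; nat-toℕ = []-toℕ
        ; nat≡𝟘⁻ = nat≡0⁻ ; nat≡𝟘⁺ = nat≡0⁺ }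

-- Subsets of ℤ/r: translations, Cauchy-Davenport, and sets invariant under affine maps.

module FieldSets where

  open Counting
  open ZMod
  open import Data.Nat using (ℕ; zero; suc; NonZero; _+_; _*_; _≤_; _<_; z≤n; s≤s; _≤?_)
  open import Data.Nat.Properties hiding (_≟_)
  open import Data.Nat.Divisibility using (_∣_; quotient)
  open import Data.Nat.Primality using (Prime; prime⇒nonZero)
  open import Data.Nat.Induction using (<-wellFounded)
  open import Induction.WellFounded using (Acc; acc)
  open import Data.Bool using (true)
  open import Data.Fin using (Fin; toℕ; _≟_)
  open import Data.Fin.Properties using (any?; all?; ¬∀⟶∃¬)
  open import Data.Product using (∃-syntax; _×_; _,_; proj₁; proj₂)
  open import Data.Sum using (_⊎_; inj₁; inj₂)
  open import Data.Empty using (⊥; ⊥-elim)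
  open import Function using (_∘_)
  open import Relation.Nullary using (Dec; yes; no; contradiction)
  open import Relation.Nullary.Decidable using (_×-dec_; _→-dec_)
  open import Relation.Binary.PropositionalEquality hiding ([_])

  module Sets {r : ℕ} (Fd : PrimeField r) where
    open PrimeField Fd
    open FieldTheory Fd

    translate-multiple : ∀ {X d} → (∀ x → x ∊ X → x ⊕ d ∊ X) → ∀ k {x} → x ∊ X → x ⊕ nat k ⊗ d ∊ X
    translate-multiple {X} {d} cl zero {x} h = subst (_∊ X)
      (trans (solve 2 (λ x d → x := x :+ :0 :* d) refl x d) (cong (λ t → x ⊕ t ⊗ d) (sym nat-0))) h
    translate-multiple {X} {d} cl (suc k) {x} h = subst (_∊ X)
      (trans (solve 3 (λ x d m → x :+ m :* d :+ d := x :+ (:1 :+ m) :* d) refl x d (nat k))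
        (cong (λ t → x ⊕ t ⊗ d) (trans (cong (_⊕ nat k) (sym nat-1)) (sym (nat-+ 1 k))))) (cl _ (translate-multiple cl k h))

    divide : ∀ d y → d ≢ 𝟘 → ∃[ k ] nat k ⊗ d ≡ y
    divide d y nd with i , e ← inverse d nd = toℕ (y ⊗ i) , (begin
      nat (toℕ (y ⊗ i)) ⊗ d ≡⟨ cong (_⊗ d) (nat-toℕ _) ⟩
      y ⊗ i ⊗ d ≡⟨ ⊗-assoc y i d ⟩
      y ⊗ (i ⊗ d) ≡⟨ cong (y ⊗_) e ⟩
      y ⊗ 𝟙 ≡⟨ ⊗-identityʳ y ⟩
      y ∎)
      where open ≡-Reasoning

    -- Every difference y - x is a multiple of the invertible `d`.
    translate-closed : ∀ {X d x} → d ≢ 𝟘 → (∀ x → x ∊ X → x ⊕ d ∊ X) → x ∊ X → ∀ y → y ∊ X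
    translate-closed {X} {d} {x} nd cl h y with k , e ← divide d (y ⊝ x) nd =
      subst (_∊ X) (trans (cong (x ⊕_) e) (solve 2 (λ x y → x :+ (y :- x) := y) refl x y)) (translate-multiple cl k h)

    module Translate (d : Fin r) = Bijection (_⊕ d) (_⊝ d)
      (λ x → solve 2 (λ x d → (x :- d) :+ d := x) refl x d) (λ x → solve 2 (λ x d → (x :+ d) :- d := x) refl x d)

    private
      summand? : ∀ (A B : Sub r) y → Dec (∃[ a ] a ∊ A × (y ⊝ a) ∊ B)
      summand? A B y = any? (λ a → (a ∊? A) ×-dec ((y ⊝ a) ∊? B))

    _⊞_ : Sub r → Sub r → Sub r
    A ⊞ B = sep (summand? A B)

    ⊞⁺ : ∀ {A B a b} → a ∊ A → b ∊ B → a ⊕ b ∊ A ⊞ B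
    ⊞⁺ {A} {B} {a} {b} h k = sep⁺ (summand? A B) (a , h , subst (_∊ B) (solve 2 (λ a b → b := (a :+ b) :- a) refl a b) k)

    ⊞⁻ : ∀ {A B y} → y ∊ A ⊞ B → ∃[ a ] ∃[ b ] a ∊ A × b ∊ B × y ≡ a ⊕ b
    ⊞⁻ {A} {B} {y} h = let a , p , q = sep⁻ (summand? A B) h in
      a , y ⊝ a , p , q , solve 2 (λ y a → y := a :+ (y :- a)) refl y a

    private
      x⊕𝟘 : ∀ x → x ⊕ 𝟘 ≡ x
      x⊕𝟘 = ⊕-identityʳ

      -- The e-transform replaces (A , B) by (A ∪ (B + e) , B ∩ (A - e)).
      cd₀ : ∀ {A B a} → a ∊ A → 𝟘 ∊ B → Acc _<_ (count B) → r ≤ count (A ⊞ B) ⊎ count A + count B ≤ suc (count (A ⊞ B))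
      cd₀ {A} {B} {a} aA oB (acc rs) with all? (λ b → (b ∊? B) →-dec (b ≟ 𝟘))
      ... | yes tr = inj₂ (begin
          count A + count B  ≤⟨ +-mono-≤ (count-mono {X = A} {A ⊞ B} (λ x h → subst (_∊ A ⊞ B) (x⊕𝟘 x) (⊞⁺ h oB))) (count-mono {X = B} {⁅ 𝟘 ⁆} λ x h → subst (_∊ ⁅ 𝟘 ⁆) (sym (tr x h)) ∊-⁅⁆) ⟩
          count (A ⊞ B) + count {r} ⁅ 𝟘 ⁆ ≡⟨ cong (count (A ⊞ B) +_) (count-⁅⁆ 𝟘) ⟩
          count (A ⊞ B) + 1 ≡⟨ +-comm _ 1 ⟩
          suc (count (A ⊞ B)) ∎)
          where open ≤-Reasoning
      ... | no ntr with all? (λ e → (e ∊? A) →-dec all? (λ b → (b ∊? B) →-dec ((e ⊕ b) ∊? A)))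
      -- `A + B ⊆ A`, and `B` has a nonzero element: `A` is invariant under a nontrivial translation
      -- and therefore everything.
      ... | yes cl with b , h ← ¬∀⟶∃¬ r _ (λ b → (b ∊? B) →-dec (b ≟ 𝟘)) ntr with b ∊? B
      ... | no k = contradiction (λ e → contradiction e k) h
      ... | yes bB = inj₁ (≤-trans (≤-reflexive (sym (count-all r)))
            (count-mono {X = λ _ → true} {A ⊞ B} (λ y _ → subst (_∊ A ⊞ B) (x⊕𝟘 y)
              (⊞⁺ (translate-closed {A} {b} (λ e → h (λ _ → e)) (λ x k → cl x k b bB) aA y) oB))))
      cd₀ {A} {B} {a} aA oB (acc rs) | no ntr | no ncl with e , h ← ¬∀⟶∃¬ r _ (λ e → (e ∊? A) →-dec all? (λ b → (b ∊? B) →-dec ((e ⊕ b) ∊? A))) ncl with e ∊? A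
      ... | no k = contradiction (λ e → contradiction e k) h
      ... | yes eA with b , h′ ← ¬∀⟶∃¬ r _ (λ b → (b ∊? B) →-dec ((e ⊕ b) ∊? A)) (λ t → h (λ _ → t)) with b ∊? B
      ... | no k = contradiction (λ e → contradiction e k) h′
      ... | yes bB = step (cd₀ {A′} {B′} {a} (∪⁺ˡ aA) (∩⁺ oB (mem (trans (cong A (⊕-identityˡ e)) (holds eA)))) (rs small))
        where
        open Translate e
        A′ B′ : Sub r
        A′ = A ∪ image B
        B′ = B ∩ (A ∘ (_⊕ e))
        small : count B′ < count B
        small = count-mono-< {y = b} (λ x k → proj₁ (∩⁻ {X = B} k)) bB
          (λ k → h′ (λ _ → mem (trans (cong A (⊕-comm e b)) (holds (proj₂ (∩⁻ {X = B} {A ∘ (_⊕ e)} k))))))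
        sub : ∀ y → y ∊ A′ ⊞ B′ → y ∊ A ⊞ B
        sub y k with a′ , b′ , p , q , refl ← ⊞⁻ {A′} {B′} k with qB , qA ← ∩⁻ {X = B} {A ∘ (_⊕ e)} q with ∪⁻ p
        ... | inj₁ p′ = ⊞⁺ p′ qB
        ... | inj₂ p′ = subst (_∊ A ⊞ B) (solve 3 (λ a b e → (b :+ e) :+ (a :- e) := a :+ b) refl a′ b′ e)
                          (⊞⁺ {A} {B} (mem (holds qA)) (image⁻ p′))
        sizes : count A′ + count B′ ≡ count A + count B
        sizes = begin
          count A′ + count B′ ≡⟨ cong (count A′ +_) (sym (count-image B′)) ⟩
          count A′ + count (image B′) ≡⟨ cong (count A′ +_) (count-cong (λ x → comm∧ (B (x ⊝ e)) (A ((x ⊝ e) ⊕ e)) (A x) (cong A (solve 2 (λ x e → (x :- e) :+ e := x) refl x e)))) ⟩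
          count (A ∪ image B) + count (A ∩ image B) ≡⟨ count-∪∩ A (image B) ⟩
          count A + count (image B) ≡⟨ cong (count A +_) (count-image B) ⟩
          count A + count B ∎
          where
          open ≡-Reasoning
          open import Data.Bool using (_∧_)
          open import Data.Bool.Properties using (∧-comm)
          comm∧ : ∀ x y z → y ≡ z → x ∧ y ≡ z ∧ x
          comm∧ x y z refl = ∧-comm x y
        step : r ≤ count (A′ ⊞ B′) ⊎ count A′ + count B′ ≤ suc (count (A′ ⊞ B′)) → _
        step (inj₁ p) = inj₁ (≤-trans p (count-mono {X = A′ ⊞ B′} {A ⊞ B} sub))
        step (inj₂ p) = inj₂ (≤-trans (≤-reflexive (sym sizes)) (≤-trans p (s≤s (count-mono {X = A′ ⊞ B′} {A ⊞ B} sub))))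

    -- Translating `B` until it contains 0 preserves all sizes and reduces to `cd₀`.
    cauchy-davenport : ∀ {A B a b} → a ∊ A → b ∊ B → r ≤ count (A ⊞ B) ⊎ count A + count B ≤ suc (count (A ⊞ B))
    cauchy-davenport {A} {B} {a} {b} aA bB = subst (λ t → r ≤ t ⊎ count A + count B ≤ suc t) same
        (subst (λ t → r ≤ count (A ⊞ B₀) ⊎ count A + t ≤ suc (count (A ⊞ B₀))) (count-image B)
          (cd₀ {A} {B₀} aA (subst (_∊ B₀) (⊝-self b) (image⁺ bB)) (<-wellFounded _)))
      where
      open Translate (⊖ b)
      B₀ = image B
      same : count (A ⊞ B₀) ≡ count (A ⊞ B)
      same = ≤-antisym
        (≤-trans (count-mono {X = A ⊞ B₀} {image (A ⊞ B)} λ y h → sub y (⊞⁻ {A} {B₀} h)) (≤-reflexive (count-image (A ⊞ B))))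
        (≤-trans (≤-reflexive (sym (count-image (A ⊞ B)))) (count-mono {X = image (A ⊞ B)} {A ⊞ B₀} λ y h → sup y (⊞⁻ {A} {B} (image⁻ h))))
        where
        sub : ∀ y → ∃[ a ] ∃[ b ] a ∊ A × b ∊ B₀ × y ≡ a ⊕ b → y ∊ image (A ⊞ B)
        sub y (x , z , p , q , refl) = subst (_∊ image (A ⊞ B)) (solve 3 (λ x z b → (x :+ (z :- :- b)) :+ (:- b) := x :+ z) refl x z b) (image⁺ (⊞⁺ p (image⁻ q)))
        sup : ∀ y → ∃[ a ] ∃[ b′ ] a ∊ A × b′ ∊ B × y ⊝ (⊖ b) ≡ a ⊕ b′ → y ∊ A ⊞ B₀
        sup y (x , z , p , q , e) = subst (_∊ A ⊞ B₀) (trans (solve 3 (λ x z b → x :+ (z :+ :- b) := (x :+ z) :+ :- b) refl x z b)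
          (trans (cong (_⊕ ⊖ b) (sym e)) (solve 2 (λ y b → (y :- (:- b)) :+ :- b := y) refl y b))) (⊞⁺ p (image⁺ q))

    -- `A` and -`B` are too large together to be disjoint.
    sum-zero : ∀ {A B} → r < count A + count B → ∃[ a ] a ∊ A × (⊖ a) ∊ B
    sum-zero {A} {B} h with any? (λ a → (a ∊? A) ×-dec ((⊖ a) ∊? B))
    ... | yes w = w
    ... | no nw = contradiction (begin
          count A + count B ≡⟨ cong (count A +_) (sym (count-bij ⊖_ ⊖_ inv inv B)) ⟩
          count A + count (B ∘ ⊖_) ≡⟨ sym (count-∪∩ A (B ∘ ⊖_)) ⟩
          count (A ∪ (B ∘ ⊖_)) + count (A ∩ (B ∘ ⊖_)) ≡⟨ cong (count (A ∪ (B ∘ ⊖_)) +_) (count-none {X = A ∩ (B ∘ ⊖_)} λ x k → nw (x , proj₁ (∩⁻ {X = A} k) , mem (holds (proj₂ (∩⁻ {X = A} {B ∘ ⊖_} k))))) ⟩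
          count (A ∪ (B ∘ ⊖_)) + 0 ≡⟨ +-identityʳ _ ⟩
          count (A ∪ (B ∘ ⊖_)) ≤⟨ count-≤ _ ⟩
          r ∎) (<⇒≱ h)
        where
        open ≤-Reasoning
        inv : ∀ x → ⊖ ⊖ x ≡ x
        inv x = solve 1 (λ x → :- (:- x) := x) refl x

    module Affine-map (m : Fin r) (m≢𝟘 : m ≢ 𝟘) (c : Fin r) where
      m⁻¹ = proj₁ (inverse m m≢𝟘)

      m⁻¹m : m⁻¹ ⊗ m ≡ 𝟙
      m⁻¹m = proj₂ (inverse m m≢𝟘)

      aff aff⁻¹ : Fin r → Fin r
      aff v = m ⊗ v ⊕ c
      aff⁻¹ v = m⁻¹ ⊗ (v ⊝ c)

      aff-aff⁻¹ : ∀ v → aff (aff⁻¹ v) ≡ v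
      aff-aff⁻¹ v = begin
        m ⊗ (m⁻¹ ⊗ (v ⊝ c)) ⊕ c ≡⟨ solve 4 (λ m n v c → m :* (n :* (v :- c)) :+ c := (n :* m) :* (v :- c) :+ c) refl m m⁻¹ v c ⟩
        (m⁻¹ ⊗ m) ⊗ (v ⊝ c) ⊕ c ≡⟨ cong (λ t → t ⊗ (v ⊝ c) ⊕ c) m⁻¹m ⟩
        𝟙 ⊗ (v ⊝ c) ⊕ c ≡⟨ cong (_⊕ c) (⊗-identityˡ _) ⟩
        (v ⊝ c) ⊕ c ≡⟨ solve 2 (λ v c → (v :- c) :+ c := v) refl v c ⟩
        v ∎
        where open ≡-Reasoning

      aff⁻¹-aff : ∀ v → aff⁻¹ (aff v) ≡ v
      aff⁻¹-aff v = begin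
        m⁻¹ ⊗ ((m ⊗ v ⊕ c) ⊝ c) ≡⟨ solve 4 (λ m n v c → n :* ((m :* v :+ c) :- c) := (n :* m) :* v) refl m m⁻¹ v c ⟩
        (m⁻¹ ⊗ m) ⊗ v ≡⟨ cong (_⊗ v) m⁻¹m ⟩
        𝟙 ⊗ v ≡⟨ ⊗-identityˡ v ⟩
        v ∎
        where open ≡-Reasoning

      open Bijection aff aff⁻¹ aff-aff⁻¹ aff⁻¹-aff public

    -- Two affine maps whose commutator is a nontrivial translation preserve only trivial sets.
    closed-noncommuting : ∀ {X m c m′ c′ x} → m ≢ 𝟘 → m′ ≢ 𝟘 →
      m ⊗ c′ ⊕ c ≢ m′ ⊗ c ⊕ c′ →
      (∀ v → v ∊ X → m ⊗ v ⊕ c ∊ X) → (∀ v → v ∊ X → m′ ⊗ v ⊕ c′ ∊ X) → x ∊ X → ∀ y → y ∊ X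
    closed-noncommuting {X} {m} {c} {m′} {c′} nm nm′ ne cl cl′ h =
      translate-closed {X} {(m ⊗ c′ ⊕ c) ⊝ (m′ ⊗ c ⊕ c′)} (ne ∘ ⊝≡𝟘) tr h
      where
      module f = Affine-map m nm c
      module f′ = Affine-map m′ nm′ c′
      tr : ∀ x → x ∊ X → x ⊕ ((m ⊗ c′ ⊕ c) ⊝ (m′ ⊗ c ⊕ c′)) ∊ X
      tr x k = subst (_∊ X) (trans (solve 5 (λ m c m′ c′ v → m :* (m′ :* v :+ c′) :+ c := (m′ :* (m :* v :+ c) :+ c′) :+ ((m :* c′ :+ c) :- (m′ :* c :+ c′))) refl m c m′ c′ v)
          (cong (_⊕ ((m ⊗ c′ ⊕ c) ⊝ (m′ ⊗ c ⊕ c′))) ev)) (cl _ (cl′ _ (f.closed-inverse cl v (f′.closed-inverse cl′ (f.aff v) (subst (_∊ X) (sym ev) k)))))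
        where
        v = f.aff⁻¹ (f′.aff⁻¹ x)
        ev : f′.aff (f.aff v) ≡ x
        ev = trans (cong f′.aff (f.aff-aff⁻¹ _)) (f′.aff-aff⁻¹ x)

    power : Fin r → ℕ → Fin r
    power m zero = 𝟙
    power m (suc k) = m ⊗ power m k

    -- With `m` of prime order q, the map v ↦ mv + c is a rotation about its only fixed point c/(1 -
    -- m), the `centre`.
    module Rotation {q : ℕ} (q-prime : Prime q) (m : Fin r) (m≢𝟙 : m ≢ 𝟙) (m^q : power m q ≡ 𝟙) where
      m≢𝟘 : m ≢ 𝟘
      m≢𝟘 refl = go q m^q (prime⇒nonZero q-prime)
        where
        go : ∀ k → power 𝟘 k ≡ 𝟙 → NonZero k → ⊥
        go (suc k) e _ = 𝟙≢𝟘 (trans (sym e) (⊗-zeroˡ _))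

      𝟙⊝m≢𝟘 : 𝟙 ⊝ m ≢ 𝟘
      𝟙⊝m≢𝟘 e = m≢𝟙 (sym (⊝≡𝟘 e))

      module _ (c : Fin r) where
        open Affine-map m m≢𝟘 c

        abstract
          centre : Fin r
          centre = proj₁ (inverse (𝟙 ⊝ m) 𝟙⊝m≢𝟘) ⊗ c

          centre-eq : (𝟙 ⊝ m) ⊗ centre ≡ c
          centre-eq = begin
            (𝟙 ⊝ m) ⊗ (i ⊗ c) ≡⟨ sym (⊗-assoc _ _ _) ⟩
            (𝟙 ⊝ m) ⊗ i ⊗ c ≡⟨ cong (_⊗ c) (⊗-comm _ _) ⟩
            i ⊗ (𝟙 ⊝ m) ⊗ c ≡⟨ cong (_⊗ c) (proj₂ (inverse (𝟙 ⊝ m) 𝟙⊝m≢𝟘)) ⟩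
            𝟙 ⊗ c ≡⟨ ⊗-identityˡ c ⟩
            c ∎
            where
            open ≡-Reasoning
            i : Fin r
            i = proj₁ (inverse (𝟙 ⊝ m) 𝟙⊝m≢𝟘)

          aff-centred : ∀ v → aff v ≡ centre ⊕ m ⊗ (v ⊝ centre)
          aff-centred v = trans (cong (m ⊗ v ⊕_) (sym centre-eq))
            (solve 3 (λ m v φ → m :* v :+ (:1 :- m) :* φ := φ :+ m :* (v :- φ)) refl m v centre)

          iter-aff : ∀ k v → iter k aff v ≡ centre ⊕ power m k ⊗ (v ⊝ centre)
          iter-aff zero v = trans (solve 2 (λ v φ → v := φ :+ (v :- φ)) refl v centre) (cong (centre ⊕_) (sym (⊗-identityˡ _)))
          iter-aff (suc k) v = trans (aff-centred _) (trans (cong (λ t → centre ⊕ m ⊗ (t ⊝ centre)) (iter-aff k v))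
            (solve 4 (λ m φ p v → φ :+ m :* ((φ :+ p :* (v :- φ)) :- φ) := φ :+ m :* p :* (v :- φ)) refl m centre (power m k) v))

          periodic : ∀ v → iter q aff v ≡ v
          periodic v = trans (iter-aff q v) (trans (cong (λ t → centre ⊕ t ⊗ (v ⊝ centre)) m^q) (trans (cong (centre ⊕_) (⊗-identityˡ _))
            (solve 2 (λ v φ → φ :+ (v :- φ) := v) refl v centre)))

          fixed : ∀ v → aff v ≡ v → v ≡ centre
          fixed v e = ⊝≡𝟘 (⊗≡𝟘 {𝟙 ⊝ m} (begin
            (𝟙 ⊝ m) ⊗ (v ⊝ centre) ≡⟨ solve 4 (λ i m v φ → (i :- m) :* (v :- φ) := (i :* v :- m :* v) :- (i :- m) :* φ) refl 𝟙 m v centre ⟩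
            (𝟙 ⊗ v ⊝ m ⊗ v) ⊝ (𝟙 ⊝ m) ⊗ centre ≡⟨ cong₂ (λ s t → (s ⊝ m ⊗ v) ⊝ t) (⊗-identityˡ v) centre-eq ⟩
            (v ⊝ m ⊗ v) ⊝ c ≡⟨ solve 3 (λ v w c → (v :- w) :- c := v :- (w :+ c)) refl v (m ⊗ v) c ⟩
            v ⊝ aff v ≡⟨ cong (v ⊝_) e ⟩
            v ⊝ v ≡⟨ ⊝-self v ⟩
            𝟘 ∎) 𝟙⊝m≢𝟘)
            where open ≡-Reasoning

          fixed⁺ : aff centre ≡ centre
          fixed⁺ = trans (aff-centred centre) (trans (cong (λ t → centre ⊕ m ⊗ t) (⊝-self centre)) (trans (cong (centre ⊕_) (⊗-zeroʳ m)) (⊕-identityʳ _)))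

          -- Away from the centre the rotation has free orbits of length q.
          closed-mod : ∀ X → (∀ v → v ∊ X → aff v ∊ X) → ∃[ k ] count (remove centre X) ≡ k * q
          closed-mod X cl = quotient d , _∣_.equality d
            where
            moves : ∀ v → v ∊ remove centre X → aff v ∊ remove centre X
            moves v h = let a , b = remove⁻ {X = X} h in
              remove⁺ (cl v a) λ e → b (trans (sym (aff⁻¹-aff v)) (trans (cong aff⁻¹ (trans e (sym fixed⁺))) (aff⁻¹-aff centre)))
            d : q ∣ count (remove centre X)
            d = free-orbits q-prime aff periodic (remove centre X) moves (λ v h e → proj₂ (remove⁻ {X = X} h) (fixed v e))

          -- An invariant set is a union of orbits of length `q`, possibly with the centre; without
          -- an orbit at most the centre is left.
          closed-size : ∀ X → (∀ v → v ∊ X → aff v ∊ X) → count X ≤ 1 ⊎ q ≤ count X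
          closed-size X cl = by-quotient (closed-mod X cl) (centre ∊? X)
            where
            by-quotient : ∃[ k ] count (remove centre X) ≡ k * q → Dec (centre ∊ X) → count X ≤ 1 ⊎ q ≤ count X
            by-quotient (suc k , e) _ = inj₂ (≤-trans (m≤m+n q (k * q)) (≤-trans (≤-reflexive (sym e)) (count-mono {X = remove centre X} {X} (λ v h → proj₁ (remove⁻ h)))))
            by-quotient (zero , e) (yes h) = inj₁ (≤-reflexive (trans (count-remove h) (cong suc e)))
            by-quotient (zero , e) (no h) = inj₁ (≤-trans (count-mono {X = X} {remove centre X} (λ v k → remove⁺ k λ e → h (subst (_∊ X) e k))) (≤-trans (≤-reflexive e) z≤n))

          closed-∁ : ∀ X → (∀ v → v ∊ X → aff v ∊ X) → ∀ v → v ∊ ∁ X → aff v ∊ ∁ X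
          closed-∁ X cl v h = ∁⁺ {X = X} λ k → ∁⁻ {X = X} h (closed-inverse cl v k)

      abstract
        -- The whole field is invariant under v ↦ mv: count its orbits.
        r≡1+kq : ∃[ k ] r ≡ suc (k * q)
        r≡1+kq = let k , e = closed-mod 𝟘 (λ _ → true) (λ _ _ → mem refl) in k ,
          trans (trans (sym (count-all r)) (count-remove {x = centre 𝟘} {λ _ → true} (mem refl))) (cong suc e)

    module AP (m : Fin r) (m≢𝟘 : m ≢ 𝟘) (m≢𝟙 : m ≢ 𝟙) (𝟙⊕m≢𝟘 : 𝟙 ⊕ m ≢ 𝟘) where
      private
        -- Walking from `x` in steps of `d` arrives at 0, and the last place before it is -d.
        reach-end : ∀ {X d} → (∀ x → x ∊ X → x ≢ 𝟘 → x ⊕ d ∊ X) →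
          ∀ k x → x ∊ X → x ≢ 𝟘 → x ⊕ nat k ⊗ d ≡ 𝟘 → ⊖ d ∊ X
        reach-end {X} {d} cl zero x h nx e = contradiction (trans (trans (sym (⊕-identityʳ x)) (cong (x ⊕_) (trans (sym (⊗-zeroˡ d)) (cong (_⊗ d) (sym nat-0))))) e) nx
        reach-end {X} {d} cl (suc k) x h nx e with x ⊕ d ≟ 𝟘
        ... | yes z = subst (_∊ X) (trans (solve 2 (λ x d → x := (x :+ d) :- d) refl x d) (trans (cong (_⊝ d) z) (⊕-identityˡ _))) h
        ... | no nz = reach-end cl k (x ⊕ d) (cl x h nx) nz (trans (trans (solve 3 (λ x d t → x :+ d :+ t := x :+ (d :+ t)) refl x d (nat k ⊗ d))
               (cong (x ⊕_) (trans (cong (_⊕ nat k ⊗ d) (trans (sym (⊗-identityˡ d)) (cong (_⊗ d) (sym nat-1)))) (trans (sym (⊗-distribʳ d (nat 1) (nat k))) (cong (_⊗ d) (sym (nat-+ 1 k))))))) e)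

        -- The chain -d, -d + md, md stays in `X`, because both steps start at nonzero elements, the
        -- second one by m ≠ 1.
        zero-end : ∀ {X d x} → d ≢ 𝟘 → (∀ x → x ∊ X → x ≢ 𝟘 → x ⊕ d ∊ X) → (∀ x → x ∊ X → x ≢ 𝟘 → x ⊕ m ⊗ d ∊ X) →
          X ∌ (m ⊗ d) → x ∊ X → x ≢ 𝟘 → ⊥
        zero-end {X} {d} {x} nd cl clm nmd h nx with k , e ← divide d (⊖ x) nd =
          nmd (subst (_∊ X) (solve 2 (λ d w → (:- d :+ w) :+ d := w) refl d (m ⊗ d))
            (cl _ (clm (⊖ d) -d (λ z → nd (trans (solve 1 (λ d → d := :- (:- d)) refl d) (trans (cong ⊖_ z) (trans (sym (⊕-identityˡ _)) (⊖-inverseʳ 𝟘)))))) λ z → m≢𝟙 (⊗-cancelˡ d nd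
               (trans (⊗-comm d m) (trans (⊝≡𝟘 (trans (⊕-comm (m ⊗ d) (⊖ d)) z)) (sym (⊗-identityʳ d)))))))
          where
          -d = reach-end cl k x h nx (trans (cong (x ⊕_) e) (⊖-inverseʳ x))

      -- A set X = mX has at least two elements whose d-translate leaves X: a single one b would satisfy
      -- b = 0 or b = -d (compare the ways of adding d + md), and both ends of an interval through 0 are excluded.
      two-exits : ∀ {X d} → d ≢ 𝟘 → (∀ x → x ∊ X → m ⊗ x ∊ X) → (∀ x → m ⊗ x ∊ X → x ∊ X) →
        2 ≤ count X → 2 ≤ count (∁ X) → suc (suc (count X)) ≤ count (X ∪ Translate.image d X)
      two-exits {X} {d} nd cl cl⁻ 2≤ 2≤′ with suc (suc (count X)) ≤? count (X ∪ Translate.image d X)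
      ... | yes p = p
      ... | no np = ⊥-elim absurd
        where
        open Translate d
        U = X ∪ image X
        -- The failed inequality allows at most one element of X + d outside `X`, hence at most one
        -- exit.
        uniq : ∀ {x y} → x ∊ X → X ∌ (x ⊕ d) → y ∊ X → X ∌ (y ⊕ d) → x ≡ y
        uniq {x} {y} hx ex hy ey = ⊕-cancelʳ d (count≤1 {X = U ∩ ∁ X} le (∩⁺ (∪⁺ʳ (image⁺ hx)) (∁⁺ {X = X} ex)) (∩⁺ (∪⁺ʳ (image⁺ hy)) (∁⁺ {X = X} ey)))
          where
          open ≤-Reasoning
          le : count (U ∩ ∁ X) ≤ 1
          le = +-cancelˡ-≤ (count X) _ _ (begin
            count X + count (U ∩ ∁ X) ≡⟨ sym (count-∪∩ X (U ∩ ∁ X)) ⟩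
            count (X ∪ (U ∩ ∁ X)) + count (X ∩ (U ∩ ∁ X)) ≡⟨ cong (count (X ∪ (U ∩ ∁ X)) +_) (count-none {X = X ∩ (U ∩ ∁ X)} λ v h → let a , b = ∩⁻ {X = X} h in ∁⁻ {X = X} (proj₂ (∩⁻ {X = U} b)) a) ⟩
            count (X ∪ (U ∩ ∁ X)) + 0 ≡⟨ +-identityʳ _ ⟩
            count (X ∪ (U ∩ ∁ X)) ≤⟨ count-mono {X = X ∪ (U ∩ ∁ X)} {U} (λ v h → case∪ v (∪⁻ {X = X} h)) ⟩
            count U ≤⟨ ≤-pred (≰⇒> np) ⟩
            suc (count X) ≡⟨ +-comm 1 _ ⟩
            count X + 1 ∎)
            where
            case∪ : ∀ v → v ∊ X ⊎ v ∊ U ∩ ∁ X → v ∊ U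
            case∪ v (inj₁ h) = ∪⁺ˡ h
            case∪ v (inj₂ h) = proj₁ (∩⁻ {X = U} h)
        module M = Affine-map m m≢𝟘 𝟘
        half : ∀ x → ∃[ y ] x ≡ m ⊗ y
        half x = M.aff⁻¹ x , trans (sym (M.aff-aff⁻¹ x)) (⊕-identityʳ _)
        -- Scaling by `m` preserves `X` and turns exits under d into exits under md.
        uniqm : ∀ {x y} → x ∊ X → X ∌ (x ⊕ m ⊗ d) → y ∊ X → X ∌ (y ⊕ d) → x ≡ m ⊗ y
        uniqm {x} {y} hx ex hy ey with z , refl ← half x = cong (m ⊗_) (uniq (cl⁻ z hx) (λ k → ex (subst (_∊ X) (⊗-distribˡ m z d) (cl _ k))) hy ey)
        find : ∃[ b ] b ∊ X × X ∌ (b ⊕ d)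
        find with grows-or-closed X
        ... | inj₁ c = contradiction (translate-closed nd c (proj₂ (count-witness X (≤-trans (s≤s z≤n) 2≤)))
                         (proj₁ (count-witness (∁ X) (≤-trans (s≤s z≤n) 2≤′)))) (∁⁻ {X = X} (proj₂ (count-witness (∁ X) (≤-trans (s≤s z≤n) 2≤′))))
        ... | inj₂ _ with any? (λ b → (b ∊? X) ×-dec ((b ⊕ d) ∊? ∁ X))
        ... | yes (b , h , k) = b , h , ∁⁻ {X = X} k
        ... | no nb = contradiction (translate-closed nd (λ x h → dec x h) (proj₂ (count-witness X (≤-trans (s≤s z≤n) 2≤)))
                         (proj₁ (count-witness (∁ X) (≤-trans (s≤s z≤n) 2≤′)))) (∁⁻ {X = X} (proj₂ (count-witness (∁ X) (≤-trans (s≤s z≤n) 2≤′))))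
          where
          dec : ∀ x → x ∊ X → x ⊕ d ∊ X
          dec x h with (x ⊕ d) ∊? X
          ... | yes k = k
          ... | no k = contradiction (x , h , ∁⁺ {X = X} k) nb
        m-fix : ∀ {x} → m ⊗ x ≡ x → x ≡ 𝟘
        m-fix {x} e = ⊗≡𝟘 {m ⊝ 𝟙} (trans (⊗-distribʳ x m (⊖ 𝟙)) (trans (cong₂ _⊕_ e (trans (solve 2 (λ i x → (:- i) :* x := :- (i :* x)) refl 𝟙 x) (cong ⊖_ (⊗-identityˡ x)))) (⊝-self x))) (m≢𝟙 ∘ ⊝≡𝟘)
        d⊕md≢𝟘 : d ⊕ m ⊗ d ≢ 𝟘
        d⊕md≢𝟘 e = 𝟙⊕m≢𝟘 (⊗≡𝟘 {d} (trans (⊗-distribˡ d 𝟙 m) (trans (cong₂ _⊕_ (⊗-identityʳ d) (⊗-comm d m)) e)) nd)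
        escape : ∃[ x ] x ∊ X × X ∌ (x ⊕ (d ⊕ m ⊗ d))
        escape with any? (λ b → (b ∊? X) ×-dec ((b ⊕ (d ⊕ m ⊗ d)) ∊? ∁ X))
        ... | yes (b , h , k) = b , h , ∁⁻ {X = X} k
        ... | no nb = contradiction (translate-closed d⊕md≢𝟘 dec (proj₂ (count-witness X (≤-trans (s≤s z≤n) 2≤)))
                         (proj₁ (count-witness (∁ X) (≤-trans (s≤s z≤n) 2≤′)))) (∁⁻ {X = X} (proj₂ (count-witness (∁ X) (≤-trans (s≤s z≤n) 2≤′))))
          where
          dec : ∀ x → x ∊ X → x ⊕ (d ⊕ m ⊗ d) ∊ X
          dec x h with (x ⊕ (d ⊕ m ⊗ d)) ∊? X
          ... | yes k = k
          ... | no k = contradiction (x , h , ∁⁺ {X = X} k) nb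
        md≢𝟘 : m ⊗ d ≢ 𝟘
        md≢𝟘 e = nd (⊗≡𝟘 e m≢𝟘)
        other : ∀ (Y : Sub r) → 2 ≤ count Y → ∃[ x ] x ∊ Y × x ≢ 𝟘
        other Y h with any? (λ x → (x ∊? remove 𝟘 Y))
        ... | yes (x , k) = x , remove⁻ k
        ... | no n with 𝟘 ∊? Y
        ... | yes z = contradiction (≤-trans h (≤-reflexive (trans (count-remove z) (cong suc (count-none {X = remove 𝟘 Y} (λ x k → n (x , k))))))) λ { (s≤s ()) }
        ... | no z with x , k ← count-witness Y (≤-trans (s≤s z≤n) h) = x , k , λ { refl → z k }
        ⊝⊕ : ∀ x e → (x ⊕ ⊖ e) ⊕ e ≡ x
        ⊝⊕ x e = solve 2 (λ x e → (x :+ :- e) :+ e := x) refl x e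
        module Exit (b : Fin r) (bX : b ∊ X) (b∌ : X ∌ (b ⊕ d)) where
          inX : ∀ {x} → x ∊ X → x ≢ b → x ⊕ d ∊ X
          inX {x} h n with (x ⊕ d) ∊? X
          ... | yes k = k
          ... | no k = contradiction (uniq h k bX b∌) n
          inXm : ∀ {x} → x ∊ X → x ≢ m ⊗ b → x ⊕ m ⊗ d ∊ X
          inXm {x} h n with (x ⊕ m ⊗ d) ∊? X
          ... | yes k = k
          ... | no k = contradiction (uniqm h k bX b∌) n
          mb∌ : X ∌ (m ⊗ b ⊕ m ⊗ d)
          mb∌ k = b∌ (cl⁻ _ (subst (_∊ X) (sym (⊗-distribˡ m b d)) k))
          -- Both routes from `y` to y + d + md fail, each at `b` for the step d or at `m ⊗ b` for
          -- the step md. Comparing the places leaves mb = b or m(b + d) = b + d.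
          cases : ∀ y → y ∊ X → X ∌ (y ⊕ (d ⊕ m ⊗ d)) → b ≡ 𝟘 ⊎ b ⊕ d ≡ 𝟘
          cases y h k with y ≟ b | y ≟ m ⊗ b
          ... | yes e₁ | yes e₂ = inj₁ (m-fix (trans (sym e₂) e₁))
          ... | yes refl | no n₂ with (b ⊕ m ⊗ d) ≟ b
          ... | yes e = contradiction (trans (solve 2 (λ b w → w := (b :+ w) :- b) refl b (m ⊗ d)) (trans (cong (_⊝ b) e) (⊝-self b))) md≢𝟘
          ... | no n = contradiction (subst (_∊ X) (solve 3 (λ b d w → b :+ w :+ d := b :+ (d :+ w)) refl b d (m ⊗ d)) (inX (inXm h n₂) n)) k
          cases y h k | no n₁ | yes refl with (m ⊗ b ⊕ d) ≟ m ⊗ b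
          ... | yes e = contradiction (trans (solve 2 (λ b w → w := (b :+ w) :- b) refl (m ⊗ b) d) (trans (cong (_⊝ (m ⊗ b)) e) (⊝-self _))) nd
          ... | no n = contradiction (subst (_∊ X) (solve 3 (λ b d w → b :+ d :+ w := b :+ (d :+ w)) refl (m ⊗ b) d (m ⊗ d)) (inXm (inX h n₁) n)) k
          cases y h k | no n₁ | no n₂ with (y ⊕ m ⊗ d) ≟ b | (y ⊕ d) ≟ m ⊗ b
          ... | no n | _ = contradiction (subst (_∊ X) (solve 3 (λ b d w → b :+ w :+ d := b :+ (d :+ w)) refl y d (m ⊗ d)) (inX (inXm h n₂) n)) k
          ... | yes _ | no n = contradiction (subst (_∊ X) (solve 3 (λ b d w → b :+ d :+ w := b :+ (d :+ w)) refl y d (m ⊗ d)) (inXm (inX h n₁) n)) k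
          ... | yes e₁ | yes e₂ = inj₂ (m-fix (begin
              m ⊗ (b ⊕ d) ≡⟨ ⊗-distribˡ m b d ⟩
              m ⊗ b ⊕ m ⊗ d ≡⟨ cong (_⊕ m ⊗ d) (sym e₂) ⟩
              y ⊕ d ⊕ m ⊗ d ≡⟨ solve 3 (λ y d w → y :+ d :+ w := y :+ w :+ d) refl y d (m ⊗ d) ⟩
              y ⊕ m ⊗ d ⊕ d ≡⟨ cong (_⊕ d) e₁ ⟩
              b ⊕ d ∎))
            where open ≡-Reasoning
          conclude : b ≡ 𝟘 ⊎ b ⊕ d ≡ 𝟘 → ⊥
          conclude (inj₁ b≡𝟘) = let x , hx , nx = other X 2≤ in
            zero-end {X} {d} nd (λ x h n → inX h (λ e → n (trans e b≡𝟘))) (λ x h n → inXm h (λ e → n (trans e (trans (cong (m ⊗_) b≡𝟘) (⊗-zeroʳ m)))))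
              (λ k → mb∌ (subst (_∊ X) (trans (sym (⊕-identityˡ _)) (cong (_⊕ m ⊗ d) (trans (sym (⊗-zeroʳ m)) (cong (m ⊗_) (sym b≡𝟘))))) k)) hx nx
          -- For b = -d the complement takes the role of `X`, with -d in place of d.
          conclude (inj₂ b⊕d≡𝟘) = let x , hx , nx = other (∁ X) 2≤′ in
            zero-end {∁ X} {⊖ d} (λ e → nd (trans (solve 1 (λ d → d := :- (:- d)) refl d) (trans (cong ⊖_ e) (trans (sym (⊕-identityˡ _)) (⊖-inverseʳ 𝟘)))))
              (λ x h n → ∁⁺ {X = X} λ k → ∁⁻ {X = X} h (subst (_∊ X) (⊝⊕ x d) (inX k (λ e → n (trans (sym (⊝⊕ x d)) (trans (cong (_⊕ d) e) b⊕d≡𝟘))))))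
              (λ x h n → ∁⁺ {X = X} λ k → ∁⁻ {X = X} h (subst (_∊ X) (m⊝⊕ x) (inXm k (λ e → n (trans (sym (m⊝⊕ x)) (trans (cong (_⊕ m ⊗ d) e) (trans (sym (⊗-distribˡ m b d)) (trans (cong (m ⊗_) b⊕d≡𝟘) (⊗-zeroʳ m)))))))))
              (λ k → ∁⁻ {X = X} k (subst (_∊ X) (cong (m ⊗_) (trans (solve 2 (λ b d → b := (b :+ d) :+ :- d) refl b d) (trans (cong (_⊕ ⊖ d) b⊕d≡𝟘) (⊕-identityˡ _)))) (cl b bX))) hx nx
            where
            m⊝⊕ : ∀ x → (x ⊕ m ⊗ (⊖ d)) ⊕ m ⊗ d ≡ x
            m⊝⊕ x = solve 3 (λ x m d → (x :+ m :* (:- d)) :+ m :* d := x) refl x m d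
        absurd : ⊥
        absurd = let b , bX , b∌ = find ; y , h , k = escape in Exit.conclude b bX b∌ (Exit.cases b bX b∌ y h k)

-- Lists up to permutation: repeated prefixes, filters, and pairings.

module Lists where

  open import Data.Nat using (ℕ; zero; suc; _+_; _*_; _∸_; _≤_; _<_; z≤n; s≤s)
  open import Data.Nat.Properties
  open import Data.Fin using (Fin; toℕ)
  open import Data.Fin.Properties using (pigeonhole; toℕ<n)
  open import Data.List using (List; []; _∷_; _++_; length; take; drop; filter)
  open import Data.List.Properties using (++-assoc; length-++; length-take; length-drop; take++drop≡id; filter-++; filter-all; filter-none)
  open import Data.List.Relation.Unary.All using (All; []; _∷_)
  import Data.List.Relation.Unary.All as All
  import Data.List.Relation.Unary.All.Properties as Allₚ
  open import Data.List.Membership.Propositional using (_∈_; find)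
  open import Data.List.Membership.Propositional.Properties using (∈-∃++)
  open import Data.List.Relation.Binary.Permutation.Propositional hiding (trans)
  open import Data.List.Relation.Binary.Permutation.Propositional.Properties hiding (++-assoc)
  open import Data.Product using (∃-syntax; _×_; _,_)
  open import Data.Sum using (_⊎_; inj₁; inj₂)
  open import Relation.Nullary using (¬_; Dec; yes; no; contradiction)
  open import Relation.Nullary.Decidable using (¬?)
  open import Relation.Unary using (Pred; Decidable)
  open import Relation.Binary.PropositionalEquality using (_≡_; _≢_; refl; sym; trans; cong)

  module _ {A : Set} where
    ∈⇒↭ : ∀ {x : A} {xs} → x ∈ xs → ∃[ ys ] xs ↭ x ∷ ys
    ∈⇒↭ {x} h with as , bs , refl ← ∈-∃++ h = as ++ bs , shift x as bs

    separate : ∀ {ℓ} {P : Pred A ℓ} → Decidable P → ∀ xs → ∃[ as ] ∃[ bs ] xs ↭ as ++ bs × All P as × All (λ x → ¬ P x) bs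
    separate P? [] = [] , [] , ↭-refl , [] , []
    separate P? (x ∷ xs) with P? x | separate P? xs
    ... | yes p | as , bs , e , pa , pb = x ∷ as , bs , prep x e , p ∷ pa , pb
    ... | no p | as , bs , e , pa , pb = as , x ∷ bs , ↭-trans (prep x e) (↭-sym (shift x as bs)) , pa , p ∷ pb

    transfer : ∀ {x : A} {xs ys} zs → xs ↭ x ∷ ys → xs ++ zs ↭ ys ++ x ∷ zs
    transfer {x} {xs} {ys} zs e = ↭-trans (++⁺ʳ zs e) (↭-sym (shift x ys zs))

    ↭-++-length : ∀ {xs as bs : List A} → xs ↭ as ++ bs → length xs ≡ length as + length bs
    ↭-++-length {xs} {as} {bs} e rewrite ↭-length e = length-++ as

    nonempty-length : ∀ {xs : List A} → xs ≢ [] → 1 ≤ length xs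
    nonempty-length {[]} n = contradiction refl n
    nonempty-length {x ∷ xs} _ = s≤s z≤n

    length-nonempty : ∀ {xs : List A} → 1 ≤ length xs → xs ≢ []
    length-nonempty () refl

    split-at : ∀ n (xs : List A) → n ≤ length xs → ∃[ as ] ∃[ bs ] xs ≡ as ++ bs × length as ≡ n
    split-at n xs h = take n xs , drop n xs , sym (take++drop≡id n xs) , trans (length-take n xs) (m≤n⇒m⊓n≡m h)

    -- Pigeonhole on the first n + 1 prefixes.
    repeated-prefix : ∀ {n} (f : List A → Fin n) xs → n ≤ length xs →
      ∃[ as ] ∃[ bs ] ∃[ cs ] xs ≡ as ++ bs ++ cs × bs ≢ [] × length (as ++ bs) ≤ n × f as ≡ f (as ++ bs)
    repeated-prefix {n} f xs h with i , j , i<j , e ← pigeonhole (n<1+n n) (λ i → f (take (toℕ i) xs)) =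
      as , bs , cs , eq , ne , len , trans e (cong f whole)
      where
      as = take (toℕ i) xs
      bs = take (toℕ j ∸ toℕ i) (drop (toℕ i) xs)
      cs = drop (toℕ j ∸ toℕ i) (drop (toℕ i) xs)
      j≤n : toℕ j ≤ n
      j≤n = ≤-pred (toℕ<n j)
      eq : xs ≡ as ++ bs ++ cs
      eq = trans (sym (take++drop≡id (toℕ i) xs)) (cong (as ++_) (sym (take++drop≡id (toℕ j ∸ toℕ i) _)))
      take-take : ∀ a b (ys : List A) → take (a + b) ys ≡ take a ys ++ take b (drop a ys)
      take-take zero b ys = refl
      take-take (suc a) zero [] = refl
      take-take (suc a) (suc b) [] = refl
      take-take (suc a) b (y ∷ ys) = cong (y ∷_) (take-take a b ys)
      whole : take (toℕ j) xs ≡ as ++ bs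
      whole = trans (cong (λ k → take k xs) (sym (m+[n∸m]≡n (<⇒≤ i<j)))) (take-take (toℕ i) (toℕ j ∸ toℕ i) xs)
      len : length (as ++ bs) ≤ n
      len = ≤-trans (≤-reflexive (trans (cong length (sym whole)) (length-take (toℕ j) xs))) (≤-trans (m⊓n≤m _ _) j≤n)
      ne : bs ≢ []
      ne z = contradiction (trans (sym (trans (length-take (toℕ j ∸ toℕ i) (drop (toℕ i) xs)) (m≤n⇒m⊓n≡m
          (≤-trans (∸-monoˡ-≤ (toℕ i) (≤-trans j≤n h)) (≤-reflexive (sym (length-drop (toℕ i) xs))))))) (cong length z))
        (λ k → <⇒≢ (m<n⇒0<n∸m i<j) (sym k))

    module _ {ℓ} {P : Pred A ℓ} (P? : Decidable P) where
      # : List A → ℕ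
      # xs = length (filter P? xs)

      #-↭ : ∀ {xs ys} → xs ↭ ys → # xs ≡ # ys
      #-↭ p = ↭-length (filter-↭ P? p)

      #-++ : ∀ xs ys → # (xs ++ ys) ≡ # xs + # ys
      #-++ xs ys = trans (cong length (filter-++ P? xs ys)) (length-++ (filter P? xs))

      #-all : ∀ {xs} → All P xs → # xs ≡ length xs
      #-all a = cong length (filter-all P? a)

      #-none : ∀ {xs} → All (λ x → ¬ P x) xs → # xs ≡ 0
      #-none a = cong length (filter-none P? a)

      #-≤ : ∀ xs → # xs ≤ length xs
      #-≤ [] = z≤n
      #-≤ (x ∷ xs) with P? x
      ... | yes _ = s≤s (#-≤ xs)
      ... | no _ = m≤n⇒m≤1+n (#-≤ xs)

      #-part : ∀ {xs as bs} → xs ↭ as ++ bs → All P as → length as ≤ # xs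
      #-part {xs} {as} {bs} p a = ≤-trans (≤-reflexive (sym (#-all a))) (≤-trans (m≤m+n _ _) (≤-reflexive (sym (trans (#-↭ p) (#-++ as bs)))))

      #-outside : ∀ {xs as bs} → xs ↭ as ++ bs → All (λ x → ¬ P x) as → # xs ≤ length bs
      #-outside {xs} {as} {bs} p a = ≤-trans (≤-reflexive (trans (#-↭ p) (trans (#-++ as bs) (cong (_+ # bs) (#-none a))))) (#-≤ bs)

      #-select : ∀ xs → ∃[ as ] ∃[ bs ] xs ↭ as ++ bs × All P as × All (λ x → ¬ P x) bs × length as ≡ # xs
      #-select xs with as , bs , p , pa , pb ← separate P? xs =
        as , bs , p , pa , pb , trans (sym (#-all pa)) (trans (sym (+-identityʳ _)) (trans (cong (# as +_) (sym (#-none pb))) (sym (trans (#-↭ p) (#-++ as bs)))))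

      -- Cut the list into chunks of length q.
      window : ∀ q k xs → k * q ≤ length xs →
        (∃[ as ] ∃[ bs ] ∃[ cs ] xs ≡ as ++ bs ++ cs × length bs ≡ q × All P bs) ⊎ k ≤ length (filter (λ x → ¬? (P? x)) xs)
      window q zero xs h = inj₂ z≤n
      window q (suc k) xs h with as , bs , refl , len ← split-at q xs (≤-trans (m≤m+n q (k * q)) h) with All.all? P? as
      ... | yes a = inj₁ ([] , as , bs , refl , len , a)
      ... | no na with window q k bs (+-cancelˡ-≤ q _ _ (≤-trans h (≤-reflexive (trans (length-++ as) (cong (_+ length bs) len)))))
      ... | inj₁ (us , vs , ws , refl , l , a) = inj₁ (as ++ us , vs , ws , sym (++-assoc as us _) , l , a)
      ... | inj₂ s with x , m , px ← find (Allₚ.¬All⇒Any¬ P? as na) with ys , p ← ∈⇒↭ m =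
        inj₂ (≤-trans (+-mono-≤ (≤-trans one (≤-reflexive (sym (↭-length (filter-↭ (λ x → ¬? (P? x)) p))))) s) (≤-reflexive (sym (trans (cong length (filter-++ _ as bs)) (length-++ (filter _ as))))))
        where
        one : 1 ≤ length (filter (λ x → ¬? (P? x)) (x ∷ ys))
        one with P? x
        ... | yes p = contradiction p px
        ... | no _ = s≤s z≤n

  flatten : ∀ {A : Set} → List (A × A) → List A
  flatten [] = []
  flatten ((a , b) ∷ ps) = a ∷ b ∷ flatten ps

  length-flatten : ∀ {A : Set} (ps : List (A × A)) → length (flatten ps) ≡ length ps + length ps
  length-flatten [] = refl
  length-flatten (p ∷ ps) = cong suc (trans (cong suc (length-flatten ps)) (sym (+-suc _ _)))

  -- Transitivity is asked for only through `Ok` elements: commuting is transitive through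
  -- nonidentity elements, but not through the identity.
  module Pairing {A : Set} {R : A → A → Set} (R? : ∀ x y → Dec (R x y)) {Ok : A → Set}
    (R-refl : ∀ x → R x x) (R-sym : ∀ {x y} → R x y → R y x) (R-trans : ∀ {x y z} → Ok y → R x y → R y z → R x z) where

    Apart : A × A → Set
    Apart (a , b) = ¬ R a b

    private
      -- Either some pair avoids the class of `x`, or every pair contributes a member to it and only
      -- one element per pair stays aside.
      scan : ∀ x → Ok x → ∀ ps → All Apart ps → (∃[ a ] ∃[ b ] ∃[ qs ] ps ↭ (a , b) ∷ qs × ¬ R x a × ¬ R x b) ⊎
        (∃[ as ] ∃[ bs ] flatten ps ↭ as ++ bs × All (R x) as × length bs ≡ length ps)
      scan x ok [] [] = inj₂ ([] , [] , ↭-refl , [] , refl)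
      scan x ok ((a , b) ∷ ps) (n ∷ ns) with scan x ok ps ns
      ... | inj₁ (a′ , b′ , qs , p , u , v) = inj₁ (a′ , b′ , (a , b) ∷ qs , ↭-trans (prep _ p) (swap _ _ ↭-refl) , u , v)
      ... | inj₂ (as , bs , p , al , l) with R? x a | R? x b
      ... | no u | no v = inj₁ (a , b , ps , ↭-refl , u , v)
      ... | yes u | _ = inj₂ (a ∷ as , b ∷ bs , prep a (↭-trans (prep b p) (↭-sym (shift b as bs))) , u ∷ al , cong suc l)
      ... | no _ | yes v = inj₂ (b ∷ as , a ∷ bs , ↭-trans (swap a b p) (prep b (↭-sym (shift a as bs))) , v ∷ al , cong suc l)

      flatten-↭ : ∀ {ps qs : List (A × A)} → ps ↭ qs → flatten ps ↭ flatten qs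
      flatten-↭ refl = ↭-refl
      flatten-↭ (prep (a , b) p) = prep a (prep b (flatten-↭ p))
      flatten-↭ (swap (a , b) (c , d) p) = ↭-trans (↭-sym (shifts (c ∷ d ∷ []) (a ∷ b ∷ []))) (prep c (prep d (prep a (prep b (flatten-↭ p)))))
      flatten-↭ (_↭_.trans p q) = ↭-trans (flatten-↭ p) (flatten-↭ q)

    -- When the leftover lies in one class, a pair avoiding that class can be split into two pairs.
    pairs : ∀ k L → All Ok L → k + k ≤ length L →
      (∃[ ps ] ∃[ rest ] L ↭ flatten ps ++ rest × length ps ≡ k × All Apart ps) ⊎
      (∃[ x ] ∃[ as ] ∃[ bs ] L ↭ as ++ bs × Ok x × All (R x) as × length bs < k)
    pairs zero L ok h = inj₁ ([] , L , ↭-refl , refl , [])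
    pairs (suc k) L ok h with pairs k L ok (≤-trans (+-mono-≤ (n≤1+n k) (n≤1+n k)) h)
    ... | inj₂ (x , as , bs , p , o , a , l) = inj₂ (x , as , bs , p , o , a , m≤n⇒m≤1+n l)
    ... | inj₁ (ps , rest , p , l , ap) = go rest refl
      where
      len : 2 ≤ length rest
      len = +-cancelˡ-≤ (length ps + length ps) _ _ (≤-trans (≤-reflexive (trans (cong (λ t → t + t + 2) l) (trans (+-comm (k + k) 2) (cong suc (sym (+-suc k k)))))) (≤-trans h (≤-reflexive (trans (↭-++-length {as = flatten ps} p) (cong (_+ length rest) (length-flatten ps))))))
      okr : All Ok rest
      okr = Allₚ.++⁻ʳ (flatten ps) (All-resp-↭ p ok)
      Goal = (∃[ ps ] ∃[ rest ] L ↭ flatten ps ++ rest × length ps ≡ suc k × All Apart ps) ⊎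
             (∃[ x ] ∃[ as ] ∃[ bs ] L ↭ as ++ bs × Ok x × All (R x) as × length bs < suc k)
      go : ∀ rs → rest ≡ rs → Goal
      go [] refl = contradiction len λ ()
      go (x ∷ []) refl = contradiction len λ { (s≤s ()) }
      go (x ∷ y ∷ rs) refl with All.all? (R? x) (y ∷ rs)
      ... | no na with h , m , nr ← find (Allₚ.¬All⇒Any¬ (R? x) (y ∷ rs) na) with ys , e ← ∈⇒↭ m =
        inj₁ ((x , h) ∷ ps , ys , ↭-trans p (↭-trans (++⁺ˡ (flatten ps) (prep x e)) (↭-trans (shift x (flatten ps) (h ∷ ys)) (prep x (shift h (flatten ps) ys)))) , cong suc l , nr ∷ ap)
      ... | yes al with scan x (All.head okr) ps ap
      ... | inj₂ (as , bs , e , ra , lb) = inj₂ (x , (x ∷ y ∷ rs) ++ as , bs ,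
              ↭-trans p (↭-trans (++-comm (flatten ps) (x ∷ y ∷ rs)) (↭-trans (++⁺ˡ (x ∷ y ∷ rs) e) (↭-reflexive (sym (++-assoc (x ∷ y ∷ rs) as bs))))) ,
              All.head okr , Allₚ.++⁺ (R-refl x ∷ al) ra , s≤s (≤-reflexive (trans lb l)))
      ... | inj₁ (a , b , qs , e , u , v) = inj₁ ((a , x) ∷ (b , y) ∷ qs , rs , perm , trans (cong suc (sym (↭-length e))) (cong suc l) , (λ z → u (R-sym z)) ∷ (λ z → v (R-trans (All.head (All.tail okr)) (All.head al) (R-sym z))) ∷ All.tail (All-resp-↭ e ap))
        where
        perm : L ↭ a ∷ x ∷ b ∷ y ∷ flatten qs ++ rs
        perm = ↭-trans p (↭-trans (++⁺ʳ (x ∷ y ∷ rs) (flatten-↭ e)) (prep a (↭-trans (prep b (↭-trans (shift x (flatten qs) (y ∷ rs)) (prep x (shift y (flatten qs) rs)))) (swap b x ↭-refl))))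

-- The affine group ℤ/r ⋊ ℤ/q and the values of the orderings of a list.

module Affine where

  open Counting
  open ZMod
  open FieldSets
  open Lists
  open import Data.Nat using (ℕ; zero; suc; _+_; _*_; _≤_; _<_; z≤n; s≤s; _≤?_)
  open import Data.Nat.Properties hiding (_≟_)
  open import Data.Nat.Divisibility using (∣-refl; ∣⇒≤)
  open import Data.Bool using (true)
  open import Data.Fin using (Fin; toℕ; _≟_)
  open import Data.List using (List; []; _∷_; _++_; [_])
  open import Data.List.Relation.Unary.All using ([]; _∷_)
  import Data.List.Relation.Unary.All as All
  open import Data.List.Relation.Binary.Permutation.Propositional renaming (trans to ptrans)
  open import Data.List.Relation.Binary.Permutation.Propositional.Properties
  open import Data.Product using (∃-syntax; _×_; _,_; proj₁; proj₂)
  open import Data.Sum using (_⊎_; inj₁; inj₂)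
  open import Relation.Nullary using (¬_; Dec; yes; no; contradiction)
  open import Relation.Binary.PropositionalEquality hiding ([_])

  record Semidirect (r q : ℕ) : Set where
    field
      Fr : PrimeField r
      Fq : PrimeField q
    open PrimeField Fr public
    module Q = PrimeField Fq
    field
      χ : Fin q → Fin r
      χ-𝟘 : χ Q.𝟘 ≡ 𝟙
      χ-⊕ : ∀ i j → χ (i Q.⊕ j) ≡ χ i ⊗ χ j
      χ-faithful : ∀ i → χ i ≡ 𝟙 → i ≡ Q.𝟘
      3≤q : 3 ≤ q
      2q<r : 2 * q < r

  module Elements {r q : ℕ} (SD : Semidirect r q) where
    open Semidirect SD
    open FieldTheory Fr
    open Sets Fr
    module QT = FieldTheory Fq
    module QS = Sets Fq

    0<r : 0 < r
    0<r = ≤-trans (s≤s z≤n) 2q<r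

    q<r : q < r
    q<r = ≤-<-trans (m≤m+n q (q + 0)) 2q<r

    χ≢𝟘 : ∀ i → χ i ≢ 𝟘
    χ≢𝟘 i e = 𝟙≢𝟘 (trans (sym χ-𝟘) (trans (cong χ (sym (QT.⊝-self i))) (trans (χ-⊕ i (Q.⊖ i)) (trans (cong (_⊗ χ (Q.⊖ i)) e) (⊗-zeroˡ _)))))

    χ-power : ∀ i k → power (χ i) k ≡ χ (Q.nat k Q.⊗ i)
    χ-power i zero = sym (trans (cong χ (trans (cong (Q._⊗ i) Q.nat-0) (QT.⊗-zeroˡ i))) χ-𝟘)
    χ-power i (suc k) = trans (cong (χ i ⊗_) (χ-power i k)) (trans (sym (χ-⊕ i _)) (cong χ (sym
      (trans (cong (Q._⊗ i) (trans (Q.nat-+ 1 k) (cong (Q._⊕ Q.nat k) Q.nat-1))) (QT.solve 2 (λ i n → (QT.:1 QT.:+ n) QT.:* i QT.:= i QT.:+ n QT.:* i) refl i (Q.nat k))))))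

    χ^q : ∀ i → power (χ i) q ≡ 𝟙
    χ^q i = trans (χ-power i q) (trans (cong χ (trans (cong (Q._⊗ i) (Q.nat≡𝟘⁺ q ∣-refl)) (QT.⊗-zeroˡ i))) χ-𝟘)

    module Rot (i : Fin q) (i≢𝟘 : i ≢ Q.𝟘) = Rotation Q.r-prime (χ i) (λ e → i≢𝟘 (χ-faithful i e)) (χ^q i)

    ω : Fin r
    ω = χ Q.𝟙

    ω≢𝟙 : ω ≢ 𝟙
    ω≢𝟙 e = QT.𝟙≢𝟘 (χ-faithful _ e)

    -- ω = -1 would give ω² = 1 and hence 2 = 0 in ℤ/q, although q ≥ 3.
    𝟙⊕ω≢𝟘 : 𝟙 ⊕ ω ≢ 𝟘
    𝟙⊕ω≢𝟘 e = contradiction (∣⇒≤ (Q.nat≡𝟘⁻ 2 (trans (Q.nat-+ 1 1) (trans (cong₂ Q._⊕_ Q.nat-1 Q.nat-1) (χ-faithful _ (trans (χ-⊕ _ _) sq)))))) (<⇒≱ 3≤q)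
      where
      ω≡ : ω ≡ ⊖ 𝟙
      ω≡ = ⊕-cancelˡ 𝟙 (trans e (sym (⊝-self 𝟙)))
      sq : ω ⊗ ω ≡ 𝟙
      sq = trans (cong₂ _⊗_ ω≡ ω≡) (solve 0 ((:- :1) :* (:- :1) := :1) refl)

    -- (u , i) stands for the map w ↦ u + χ(i)w under composition; `val` and `level` are the two
    -- coordinates of the product of a list.
    Elt : Set
    Elt = Fin r × Fin q

    lev : Elt → Fin q
    lev = proj₂

    pos : Elt → Fin r
    pos = proj₁

    one : Elt
    one = 𝟘 , Q.𝟘

    level : List Elt → Fin q
    level [] = Q.𝟘
    level (g ∷ L) = lev g Q.⊕ level L

    val : List Elt → Fin r
    val [] = 𝟘
    val (g ∷ L) = pos g ⊕ χ (lev g) ⊗ val L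

    level-++ : ∀ A B → level (A ++ B) ≡ level A Q.⊕ level B
    level-++ [] B = sym (QT.⊕-identityˡ _)
    level-++ (g ∷ A) B = trans (cong (lev g Q.⊕_) (level-++ A B)) (sym (QT.⊕-assoc _ _ _))

    val-++ : ∀ A B → val (A ++ B) ≡ val A ⊕ χ (level A) ⊗ val B
    val-++ [] B = trans (sym (⊗-identityˡ _)) (trans (cong (_⊗ val B) (sym χ-𝟘)) (sym (⊕-identityˡ _)))
    val-++ (g ∷ A) B = trans (cong (λ t → pos g ⊕ χ (lev g) ⊗ t) (val-++ A B))
      (trans (solve 5 (λ u x a l b → u :+ x :* (a :+ l :* b) := (u :+ x :* a) :+ (x :* l) :* b) refl (pos g) (χ (lev g)) (val A) (χ (level A)) (val B))
        (cong (λ t → pos g ⊕ χ (lev g) ⊗ val A ⊕ t ⊗ val B) (sym (χ-⊕ _ _))))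

    level-↭ : ∀ {A B} → A ↭ B → level A ≡ level B
    level-↭ refl = refl
    level-↭ (prep x p) = cong (lev x Q.⊕_) (level-↭ p)
    level-↭ (swap x y p) = trans (cong (λ t → lev x Q.⊕ (lev y Q.⊕ t)) (level-↭ p))
      (QT.solve 3 (λ a b c → a QT.:+ (b QT.:+ c) QT.:= b QT.:+ (a QT.:+ c)) refl (lev x) (lev y) _)
    level-↭ (ptrans p p′) = trans (level-↭ p) (level-↭ p′)

    Reach : List Elt → Fin r → Set
    Reach L v = ∃[ T ] L ↭ T × val T ≡ v

    -- `X` collects attained values, not necessarily all of them. The level is common to all
    -- orderings.
    Cert : List Elt → Sub r → Set
    Cert L X = ∀ v → v ∊ X → Reach L v

    Full : List Elt → Set
    Full L = ∀ v → Reach L v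

    reach-↭ : ∀ {L L′ v} → L ↭ L′ → Reach L v → Reach L′ v
    reach-↭ p (T , e , w) = T , ↭-trans (↭-sym p) e , w

    cert-↭ : ∀ {L L′ X} → L ↭ L′ → Cert L X → Cert L′ X
    cert-↭ p c v h = reach-↭ p (c v h)

    full-↭ : ∀ {L L′} → L ↭ L′ → Full L → Full L′
    full-↭ p c v = reach-↭ p (c v)

    reach-∷ : ∀ {D v} g → Reach D v → Reach (g ∷ D) (pos g ⊕ χ (lev g) ⊗ v)
    reach-∷ g (T , e , refl) = g ∷ T , prep g e , refl

    reach-∷ʳ : ∀ {D v} g → Reach D v → Reach (g ∷ D) (v ⊕ χ (level D) ⊗ pos g)
    reach-∷ʳ {D} g (T , e , refl) = T ++ [ g ] , ↭-trans (prep g e) (↭-sym (↭-trans (shift g T []) (prep g (++-identityʳ T)))) ,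
      trans (val-++ T [ g ]) (cong₂ (λ l w → val T ⊕ χ l ⊗ w) (sym (level-↭ e)) (trans (cong (pos g ⊕_) (⊗-zeroʳ _)) (⊕-identityʳ _)))

    full-∷ : ∀ {D} g → Full D → Full (g ∷ D)
    full-∷ {D} g f v = subst (Reach (g ∷ D)) (solve 2 (λ v t → (v :- t) :+ t := v) refl v (χ (level D) ⊗ pos g)) (reach-∷ʳ g (f _))

    full-++ : ∀ {D} E → Full D → Full (E ++ D)
    full-++ [] f = f
    full-++ (g ∷ E) f = full-∷ g (full-++ E f)

    full-cert : ∀ {D X} → Cert D X → r ≤ count X → Full D
    full-cert c h v = c v (count-full h v)

    module Moved (g : Elt) (M : Fin r) = Affine-map (χ (lev g)) (χ≢𝟘 _) (pos g ⊝ M ⊗ pos g)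

    Closed : Elt → Fin r → Sub r → Set
    Closed g M X = ∀ v → v ∊ X → Moved.aff g M v ∊ X

    Grown : List Elt → Sub r → Elt → Set
    Grown D X g = ∃[ X′ ] Cert (g ∷ D) X′ × count X < count X′

    -- Putting g first or last turns v into u + mv or v + Mu; up to a translation by Mu
    -- the new values are X together with its image under v ↦ mv + (1 - M)u.
    grow : ∀ {D X} g → Cert D X → Closed g (χ (level D)) X ⊎ Grown D X g
    grow {D} {X} g c = go (Mv.grows-or-closed X)
      where
      M = χ (level D)
      module Mv = Moved g M
      module Tr = Translate (M ⊗ pos g)
      U = X ∪ Mv.image X
      cert : ∀ v → (v ⊝ M ⊗ pos g) ∊ X ⊎ (v ⊝ M ⊗ pos g) ∊ Mv.image X → Reach (g ∷ D) v
      cert v (inj₁ h) = subst (Reach (g ∷ D)) (solve 2 (λ v t → (v :- t) :+ t := v) refl v (M ⊗ pos g)) (reach-∷ʳ g (c _ h))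
      cert v (inj₂ h) = subst (Reach (g ∷ D)) (trans (solve 4 (λ u m w t → u :+ m :* w := (m :* w :+ (u :- t)) :+ t) refl (pos g) (χ (lev g)) _ (M ⊗ pos g))
        (trans (cong (_⊕ M ⊗ pos g) (Mv.aff-aff⁻¹ _)) (solve 2 (λ v t → (v :- t) :+ t := v) refl v (M ⊗ pos g)))) (reach-∷ g (c _ (Mv.image⁻ h)))
      go : (∀ v → v ∊ X → Mv.aff v ∊ X) ⊎ count X < count U → Closed g M X ⊎ Grown D X g
      go (inj₁ cl) = inj₁ cl
      go (inj₂ lt) = inj₂ (Tr.image U , (λ v h → cert v (∪⁻ (Tr.image⁻ {X = U} h))) , subst (count X <_) (sym (Tr.count-image U)) lt)

    keep : ∀ {D X} g → Cert D X → ∃[ X′ ] Cert (g ∷ D) X′ × count X′ ≡ count X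
    keep {D} {X} g c = Tr.image X , (λ v h → subst (Reach (g ∷ D)) (solve 2 (λ v t → (v :- t) :+ t := v) refl v (χ (level D) ⊗ pos g)) (reach-∷ʳ g (c _ (Tr.image⁻ h)))) , Tr.count-image X
      where module Tr = Translate (χ (level D) ⊗ pos g)

    keep-++ : ∀ {D X} E → Cert D X → ∃[ X′ ] Cert (E ++ D) X′ × count X′ ≡ count X
    keep-++ {X = X} [] c = X , c , refl
    keep-++ (g ∷ E) c = let X₁ , c₁ , e₁ = keep-++ E c ; X₂ , c₂ , e₂ = keep g c₁ in X₂ , c₂ , trans e₂ e₁

    -- Compares the first coordinates of gh and hg; the second coordinates always agree.
    Comm : Elt → Elt → Set
    Comm g h = pos g ⊕ χ (lev g) ⊗ pos h ≡ pos h ⊕ χ (lev h) ⊗ pos g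

    comm? : ∀ g h → Dec (Comm g h)
    comm? g h = _ ≟ _

    comm-sym : ∀ {g h} → Comm g h → Comm h g
    comm-sym = sym

    comm-refl : ∀ {g} → Comm g g
    comm-refl = refl

    Outer Inner NonId : Elt → Set
    Outer g = lev g ≢ Q.𝟘
    Inner g = lev g ≡ Q.𝟘
    NonId g = g ≢ one

    inner? : ∀ g → Dec (Inner g)
    inner? g = lev g ≟ Q.𝟘

    χ-inner : ∀ {g} → Inner g → χ (lev g) ≡ 𝟙
    χ-inner e = trans (cong χ e) χ-𝟘

    inner-pos : ∀ {g} → Inner g → NonId g → pos g ≢ 𝟘
    inner-pos i n e = n (cong₂ _,_ e i)

    outer-nonid : ∀ {g} → Outer g → NonId g
    outer-nonid o refl = o refl

    inner-comm : ∀ {g h} → Inner g → Inner h → Comm g h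
    inner-comm {g} {h} i j rewrite χ-inner {g} i | χ-inner {h} j = solve 2 (λ x y → x :+ :1 :* y := y :+ :1 :* x) refl (pos g) (pos h)

    private
      -- For an outer element u/(1 - χ) is its fixed point, so for two outer elements this says that
      -- the fixed points coincide.
      comm⇒ : ∀ {g h} → Comm g h → (𝟙 ⊝ χ (lev h)) ⊗ pos g ≡ (𝟙 ⊝ χ (lev g)) ⊗ pos h
      comm⇒ {g} {h} e = begin
        (𝟙 ⊝ m′) ⊗ u ≡⟨ solve 4 (λ m m′ u v → (:1 :- m′) :* u := ((u :+ m :* v) :- (v :+ m′ :* u)) :+ (:1 :- m) :* v) refl m m′ u v ⟩
        ((u ⊕ m ⊗ v) ⊝ (v ⊕ m′ ⊗ u)) ⊕ (𝟙 ⊝ m) ⊗ v ≡⟨ cong (λ t → (t ⊝ (v ⊕ m′ ⊗ u)) ⊕ (𝟙 ⊝ m) ⊗ v) e ⟩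
        ((v ⊕ m′ ⊗ u) ⊝ (v ⊕ m′ ⊗ u)) ⊕ (𝟙 ⊝ m) ⊗ v ≡⟨ solve 2 (λ t w → (t :- t) :+ w := w) refl (v ⊕ m′ ⊗ u) _ ⟩
        (𝟙 ⊝ m) ⊗ v ∎
        where
        open ≡-Reasoning
        u = pos g
        v = pos h
        m = χ (lev g)
        m′ = χ (lev h)

      comm⇐ : ∀ {g h} → (𝟙 ⊝ χ (lev h)) ⊗ pos g ≡ (𝟙 ⊝ χ (lev g)) ⊗ pos h → Comm g h
      comm⇐ {g} {h} e = begin
        u ⊕ m ⊗ v ≡⟨ solve 4 (λ m m′ u v → u :+ m :* v := (:1 :- m′) :* u :+ (m′ :* u :+ m :* v)) refl m m′ u v ⟩
        (𝟙 ⊝ m′) ⊗ u ⊕ (m′ ⊗ u ⊕ m ⊗ v) ≡⟨ cong (_⊕ (m′ ⊗ u ⊕ m ⊗ v)) e ⟩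
        (𝟙 ⊝ m) ⊗ v ⊕ (m′ ⊗ u ⊕ m ⊗ v) ≡⟨ solve 4 (λ m m′ u v → (:1 :- m) :* v :+ (m′ :* u :+ m :* v) := v :+ m′ :* u) refl m m′ u v ⟩
        v ⊕ m′ ⊗ u ∎
        where
        open ≡-Reasoning
        u = pos g
        v = pos h
        m = χ (lev g)
        m′ = χ (lev h)

    𝟙⊝χ≢𝟘 : ∀ i → i ≢ Q.𝟘 → 𝟙 ⊝ χ i ≢ 𝟘
    𝟙⊝χ≢𝟘 i n e = n (χ-faithful i (sym (⊝≡𝟘 e)))

    comm-inner : ∀ {g h} → NonId h → Inner h → Comm g h → Inner g
    comm-inner {g} {h} nh ih c with inner? g
    ... | yes i = i
    ... | no o = contradiction (⊗≡𝟘 {𝟙 ⊝ χ (lev g)} (trans (sym (comm⇒ {g} {h} c)) (trans (cong (λ t → (𝟙 ⊝ t) ⊗ pos g) (χ-inner {h} ih)) (trans (cong (_⊗ pos g) (⊝-self 𝟙)) (⊗-zeroˡ _)))) (𝟙⊝χ≢𝟘 _ o)) (inner-pos ih nh)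

    comm-outer : ∀ {g h} → NonId g → Outer h → Comm g h → Outer g
    comm-outer {g} {h} ng oh c ig = oh (comm-inner {h} {g} ng ig (comm-sym {g} {h} c))

    -- An inner `h` makes all three inner. Through an outer `h` the linear forms of the two
    -- relations are chained and 1 - χ(lev h) is cancelled.
    comm-trans : ∀ {g h k} → NonId h → Comm g h → Comm h k → Comm g k
    comm-trans {g} {h} {k} nh c d with inner? h
    ... | yes i = inner-comm {g} {k} (comm-inner {g} {h} nh i c) (comm-inner {k} {h} nh i (comm-sym {h} {k} d))
    ... | no o = comm⇐ {g} {k} (⊗-cancelˡ (𝟙 ⊝ m′) (𝟙⊝χ≢𝟘 _ o) (begin
          (𝟙 ⊝ m′) ⊗ ((𝟙 ⊝ m″) ⊗ u) ≡⟨ sw _ _ _ ⟩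
          (𝟙 ⊝ m″) ⊗ ((𝟙 ⊝ m′) ⊗ u) ≡⟨ cong ((𝟙 ⊝ m″) ⊗_) (comm⇒ {g} {h} c) ⟩
          (𝟙 ⊝ m″) ⊗ ((𝟙 ⊝ m) ⊗ v) ≡⟨ sw _ _ _ ⟩
          (𝟙 ⊝ m) ⊗ ((𝟙 ⊝ m″) ⊗ v) ≡⟨ cong ((𝟙 ⊝ m) ⊗_) (comm⇒ {h} {k} d) ⟩
          (𝟙 ⊝ m) ⊗ ((𝟙 ⊝ m′) ⊗ w) ≡⟨ sw _ _ _ ⟩
          (𝟙 ⊝ m′) ⊗ ((𝟙 ⊝ m) ⊗ w) ∎))
      where
      open ≡-Reasoning
      u = pos g
      v = pos h
      w = pos k
      m = χ (lev g)
      m′ = χ (lev h)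
      m″ = χ (lev k)
      sw : ∀ a b c → a ⊗ (b ⊗ c) ≡ b ⊗ (a ⊗ c)
      sw a b c = solve 3 (λ a b c → a :* (b :* c) := b :* (a :* c)) refl a b c

    -- A set invariant under both maps of `grow` is invariant under their commutator, the
    -- translation by 1 - M times the difference of the values of gh and hg. The factor 1 - M is
    -- nonzero because `D` has nonzero level.
    grow-pair : ∀ {D X x g h} → Cert D X → x ∊ X → level D ≢ Q.𝟘 → ¬ Comm g h → count X < r → Grown D X g ⊎ Grown D X h
    grow-pair {D} {X} {x} {g} {h} c xX nl nc lt = go (grow g c) (grow h c)
      where
      nf = count-nonfull {X = X} lt
      M = χ (level D)
      ne : χ (lev g) ⊗ (pos h ⊝ M ⊗ pos h) ⊕ (pos g ⊝ M ⊗ pos g) ≢ χ (lev h) ⊗ (pos g ⊝ M ⊗ pos g) ⊕ (pos h ⊝ M ⊗ pos h)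
      ne e = nc (⊗-cancelˡ (𝟙 ⊝ M) (𝟙⊝χ≢𝟘 _ nl) (trans (fact _ _ _) (trans e (sym (fact _ _ _)))))
        where
        fact : ∀ u m v → (𝟙 ⊝ M) ⊗ (u ⊕ m ⊗ v) ≡ m ⊗ (v ⊝ M ⊗ v) ⊕ (u ⊝ M ⊗ u)
        fact u m v = solve 4 (λ M u m v → (:1 :- M) :* (u :+ m :* v) := m :* (v :- M :* v) :+ (u :- M :* u)) refl M u m v
      go : Closed g M X ⊎ Grown D X g → Closed h M X ⊎ Grown D X h → Grown D X g ⊎ Grown D X h
      go (inj₂ p) _ = inj₁ p
      go (inj₁ _) (inj₂ p) = inj₂ p
      go (inj₁ cg) (inj₁ ch) = contradiction (closed-noncommuting {X} (χ≢𝟘 _) (χ≢𝟘 _) ne cg ch xX (proj₁ nf)) (proj₂ nf)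

    -- For inner `g` the map of `grow` is translation by (1 - M)u, which preserves no proper
    -- nonempty set.
    grow-inner : ∀ {D X x g} → Cert D X → x ∊ X → level D ≢ Q.𝟘 → Inner g → NonId g → count X < r → Grown D X g
    grow-inner {D} {X} {x} {g} c xX nl ig ng lt = go (grow g c)
      where
      nf = count-nonfull {X = X} lt
      M = χ (level D)
      nz : pos g ⊝ M ⊗ pos g ≢ 𝟘
      nz e = inner-pos ig ng (⊗≡𝟘 {𝟙 ⊝ M} (trans (solve 2 (λ M u → (:1 :- M) :* u := u :- M :* u) refl M (pos g)) e) (𝟙⊝χ≢𝟘 _ nl))
      go : Closed g M X ⊎ Grown D X g → Grown D X g
      go (inj₂ p) = p
      go (inj₁ cl) = contradiction (translate-closed {X} {pos g ⊝ M ⊗ pos g} nz (λ v h → subst (λ t → (t ⊕ (pos g ⊝ M ⊗ pos g)) ∊ X) (trans (cong (_⊗ v) (χ-inner {g} ig)) (⊗-identityˡ v)) (cl v h)) xX (proj₁ nf)) (proj₂ nf)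

    -- No growth means that `X`, and with it the complement, is invariant under a rotation.
    grow-outer : ∀ {D X g} → Cert D X → Outer g → Grown D X g ⊎
      ((count X ≤ 1 ⊎ q ≤ count X) × (count (∁ X) ≤ 1 ⊎ q ≤ count (∁ X)))
    grow-outer {D} {X} {g} c og = go (grow g c)
      where
      go : Closed g (χ (level D)) X ⊎ Grown D X g → Grown D X g ⊎ ((count X ≤ 1 ⊎ q ≤ count X) × (count (∁ X) ≤ 1 ⊎ q ≤ count (∁ X)))
      go (inj₂ p) = inj₁ p
      go (inj₁ cl) = inj₂ (Rot.closed-size (lev g) og _ X cl , Rot.closed-size (lev g) og _ (∁ X) (Rot.closed-∁ (lev g) og _ X cl))

    ωClosed : Sub r → Set
    ωClosed X = ∀ v → v ∊ X → ω ⊗ v ∊ X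

    χ-closed : ∀ {X} → ωClosed X → ∀ i v → v ∊ X → χ i ⊗ v ∊ X
    χ-closed {X} cl i v h = subst (λ t → χ t ⊗ v ∊ X) (trans (QT.⊗-identityʳ _) (Q.nat-toℕ i)) (go (toℕ i))
      where
      go : ∀ k → χ (Q.nat k Q.⊗ Q.𝟙) ⊗ v ∊ X
      go zero = subst (_∊ X) (trans (sym (⊗-identityˡ v)) (cong (_⊗ v) (χ-power Q.𝟙 0))) h
      go (suc k) = subst (_∊ X) (trans (sym (⊗-assoc _ _ v)) (cong (_⊗ v) (trans (cong (ω ⊗_) (sym (χ-power Q.𝟙 k))) (χ-power Q.𝟙 (suc k))))) (cl _ (go k))

    -- `q` is prime, so the powers of a nontrivial χ(i) include ω.
    ω-closed-from : ∀ {X} i → i ≢ Q.𝟘 → (∀ v → v ∊ X → χ i ⊗ v ∊ X) → ωClosed X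
    ω-closed-from {X} i ni cl v h = let k , e = QS.divide i Q.𝟙 ni in subst (λ t → χ t ⊗ v ∊ X) e (go k)
      where
      go : ∀ k → χ (Q.nat k Q.⊗ i) ⊗ v ∊ X
      go zero = subst (_∊ X) (trans (sym (⊗-identityˡ v)) (cong (_⊗ v) (χ-power i 0))) h
      go (suc k) = subst (_∊ X) (trans (sym (⊗-assoc _ _ v)) (cong (_⊗ v) (trans (cong (χ i ⊗_) (sym (χ-power i k))) (χ-power i (suc k))))) (cl _ (go k))

    -- At level zero M = 1, and the translation part (1 - M)u vanishes: all outer elements then
    -- rotate about the same point 0. This makes level zero the delicate case.
    grow-outer₀ : ∀ {D X g} → Cert D X → Outer g → level D ≡ Q.𝟘 → ωClosed X ⊎ Grown D X g
    grow-outer₀ {D} {X} {g} c og e = go (grow g c)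
      where
      go : Closed g (χ (level D)) X ⊎ Grown D X g → ωClosed X ⊎ Grown D X g
      go (inj₂ p) = inj₂ p
      go (inj₁ cl) = inj₁ (ω-closed-from (lev g) og λ v h → subst (_∊ X) (trans (cong (χ (lev g) ⊗ v ⊕_)
          (trans (cong (λ t → pos g ⊝ t ⊗ pos g) (trans (cong χ e) χ-𝟘)) (solve 1 (λ u → u :- :1 :* u := :0) refl (pos g)))) (⊕-identityʳ _)) (cl v h))

    module Ω = Rot Q.𝟙 QT.𝟙≢𝟘

    ω⊕𝟘 : ∀ {X} → ωClosed X → ∀ v → v ∊ X → ω ⊗ v ⊕ 𝟘 ∊ X
    ω⊕𝟘 {X} cl v h = subst (_∊ X) (sym (⊕-identityʳ _)) (cl v h)

    ω-complement : ∀ {X} → ωClosed X → count (∁ X) ≤ 1 ⊎ q ≤ count (∁ X)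
    ω-complement {X} cl = Ω.closed-size 𝟘 (∁ X) (Ω.closed-∁ 𝟘 X (ω⊕𝟘 cl))

    -- The products g h T and h g T differ by a fixed translation.
    add-pair : ∀ {D X x g h} → Cert D X → ωClosed X → x ∊ X → ¬ Comm g h → 2 ≤ count X →
      ∃[ X′ ] Cert (g ∷ h ∷ D) X′ × (r ≤ count X′ ⊎ 2 + count X ≤ count X′)
    add-pair {D} {X} {x} {g} {h} c cl xX nc 2≤ = Ta.image V , cert′ , subst (λ t → r ≤ t ⊎ 2 + count X ≤ t) (sym (Ta.count-image V)) size
      where
      a = pos g ⊕ χ (lev g) ⊗ pos h
      b = pos h ⊕ χ (lev h) ⊗ pos g
      m = χ (lev g) ⊗ χ (lev h)
      i = lev g Q.⊕ lev h
      module Ta = Translate a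
      module Td = Translate (b ⊝ a)
      V = X ∪ Td.image X
      inv : ∀ v → v ∊ X → χ (Q.⊖ i) ⊗ v ∊ X × m ⊗ (χ (Q.⊖ i) ⊗ v) ≡ v
      inv v k = χ-closed cl (Q.⊖ i) v k , trans (sym (⊗-assoc m _ v)) (trans (cong (_⊗ v) (trans (cong (_⊗ χ (Q.⊖ i)) (sym (χ-⊕ _ _))) (trans (sym (χ-⊕ i (Q.⊖ i))) (trans (cong χ (QT.⊝-self i)) χ-𝟘)))) (⊗-identityˡ v))
      at-a : ∀ w → w ∊ X → Reach (g ∷ h ∷ D) (a ⊕ w)
      at-a w k = let k′ , e = inv w k in subst (Reach (g ∷ h ∷ D))
        (trans (solve 5 (λ u p v s z → u :+ p :* (v :+ s :* z) := (u :+ p :* v) :+ (p :* s) :* z) refl (pos g) (χ (lev g)) (pos h) (χ (lev h)) (χ (Q.⊖ i) ⊗ w)) (cong (a ⊕_) e))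
        (reach-∷ g (reach-∷ h (c _ k′)))
      at-b : ∀ w → w ∊ X → Reach (g ∷ h ∷ D) (b ⊕ w)
      at-b w k = let k′ , e = inv w k in subst (Reach (g ∷ h ∷ D))
        (trans (solve 5 (λ u p v s z → v :+ s :* (u :+ p :* z) := (v :+ s :* u) :+ (p :* s) :* z) refl (pos g) (χ (lev g)) (pos h) (χ (lev h)) (χ (Q.⊖ i) ⊗ w)) (cong (b ⊕_) e))
        (reach-↭ (swap h g ↭-refl) (reach-∷ h (reach-∷ g (c _ k′))))
      cert : ∀ v → (v ⊝ a) ∊ X ⊎ (v ⊝ a) ∊ Td.image X → Reach (g ∷ h ∷ D) v
      cert v (inj₁ k) = subst (Reach (g ∷ h ∷ D)) (solve 2 (λ v a → a :+ (v :- a) := v) refl v a) (at-a _ k)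
      cert v (inj₂ k) = subst (Reach (g ∷ h ∷ D)) (solve 3 (λ v a b → b :+ ((v :- a) :- (b :- a)) := v) refl v a b) (at-b _ (Td.image⁻ {X = X} k))
      cert′ : Cert (g ∷ h ∷ D) (Ta.image V)
      cert′ v k = cert v (∪⁻ (Ta.image⁻ {X = V} k))
      d≢𝟘 : b ⊝ a ≢ 𝟘
      d≢𝟘 e = nc (sym (⊝≡𝟘 e))
      size : r ≤ count V ⊎ 2 + count X ≤ count V
      -- With two or more elements missing `two-exits` yields two new values; with at most one
      -- missing a single new value fills everything.
      size with 2 ≤? count (∁ X)
      ... | yes p = inj₂ (AP.two-exits ω Ω.m≢𝟘 ω≢𝟙 𝟙⊕ω≢𝟘 d≢𝟘 cl (λ v k → Ω⁻ v k) 2≤ p)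
        where
        Ω⁻ : ∀ v → ω ⊗ v ∊ X → v ∊ X
        Ω⁻ v k = Affine-map.closed-inverse ω Ω.m≢𝟘 𝟘 {X} (ω⊕𝟘 cl) v (subst (_∊ X) (sym (⊕-identityʳ _)) k)
      ... | no np = inj₁ (go (Td.grows-or-closed X))
        where
        r≤1+ : r ≤ suc (count X)
        r≤1+ = ≤-trans (≤-reflexive (sym (count-∁ X))) (≤-trans (+-monoʳ-≤ (count X) (≤-pred (≰⇒> np))) (≤-reflexive (+-comm _ 1)))
        go : (∀ v → v ∊ X → v ⊕ (b ⊝ a) ∊ X) ⊎ count X < count V → r ≤ count V
        go (inj₂ p) = ≤-trans r≤1+ p
        go (inj₁ tc) = ≤-trans (≤-reflexive (sym (count-all r))) (count-mono {X = λ _ → true} {V} λ y _ → ∪⁺ˡ (translate-closed {X} d≢𝟘 tc xX y))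

-- Filling a coset of ℤ/r by inserting the elements of a mixed list.

module Spread where

  open Counting
  open ZMod
  open FieldSets
  open Lists
  open Affine
  open import Data.Nat using (ℕ; zero; suc; _+_; _≤_; _<_; z≤n; s≤s; _≤?_)
  open import Data.Nat.Properties hiding (_≟_)
  open import Data.Fin using (_≟_)
  import Data.Fin.Properties as Finₚ
  open import Data.List.Properties using (length-++)
  open import Data.List using (List; []; _∷_; _++_; length; [_])
  open import Data.List.Relation.Unary.All using (All; []; _∷_)
  import Data.List.Relation.Unary.All as All
  import Data.List.Relation.Unary.All.Properties as Allₚ
  open import Data.List.Relation.Unary.AllPairs using ([]; _∷_)
  open import Data.List.Membership.Propositional using (find)
  open import Data.List.Relation.Binary.Permutation.Propositional hiding (trans)
  open import Data.List.Relation.Binary.Permutation.Propositional.Properties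
  open import Data.Product using (∃-syntax; _×_; _,_; proj₁; proj₂)
  open import Data.Sum using (_⊎_; inj₁; inj₂)
  open import Function using (_∘_)
  open import Relation.Nullary using (¬_; Dec; yes; no; contradiction)
  open import Relation.Nullary.Decidable using (_→-dec_)
  open import Relation.Binary.PropositionalEquality hiding ([_])

  module Spreading {r q : ℕ} (SD : Semidirect r q) where
    open Semidirect SD
    open FieldTheory Fr
    open Sets Fr
    open Elements SD

    -- For nonidentity elements this says that the list is not contained in one centraliser.
    Mixed : List Elt → Set
    Mixed L = ∃[ g ] ∃[ h ] ∃[ L′ ] L ↭ g ∷ h ∷ L′ × ¬ Comm g h

    mixed? : ∀ x L → All (Comm x) L ⊎ Mixed (x ∷ L)
    mixed? x L with All.all? (comm? x) L
    ... | yes a = inj₁ a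
    ... | no na with h , m , nc ← find (Allₚ.¬All⇒Any¬ (comm? x) L na) with L′ , e ← ∈⇒↭ m = inj₂ (x , h , L′ , prep x e , nc)

    -- Fewer than `q` terms in every point stabiliser; `A` ranges over the parts of the list inside
    -- the stabiliser fixed by `g`.
    Bounded : List Elt → Set
    Bounded L = ∀ g → Outer g → ∀ A B → L ↭ A ++ B → All (Comm g) A → length A < q

    bounded-∷ : ∀ {L x L′} → L ↭ x ∷ L′ → Bounded L → Bounded L′
    bounded-∷ {L} {x} {L′} p b g og A B e = b g og A (x ∷ B) (↭-trans p (↭-trans (prep x e) (↭-sym (shift x A B))))

    start : ∀ g → ∃[ X ] Cert [ g ] X × count X ≡ 1
    start g = ⁅ pos g ⁆ , (λ v h → [ g ] , ↭-refl , trans (trans (cong (pos g ⊕_) (⊗-zeroʳ _)) (⊕-identityʳ _)) (sym (⁅⁆⁻ h))) , count-⁅⁆ _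

    Certified : List Elt → ℕ → Set
    Certified L n = ∃[ X ] Cert L X × n ≤ count X

    start-pair : ∀ {g h} → ¬ Comm g h → Certified (g ∷ h ∷ []) 2
    start-pair {g} {h} nc = ⁅ a ⁆ ∪ ⁅ b ⁆ , (λ v k → cert v (∪⁻ {X = ⁅ a ⁆} {⁅ b ⁆} k)) , count-unique {xs = a ∷ b ∷ []} ((nc ∷ []) ∷ [] ∷ []) (∪⁺ˡ {X = ⁅ a ⁆} {⁅ b ⁆} ∊-⁅⁆ ∷ ∪⁺ʳ {X = ⁅ a ⁆} {⁅ b ⁆} ∊-⁅⁆ ∷ [])
      where
      a = pos g ⊕ χ (lev g) ⊗ pos h
      b = pos h ⊕ χ (lev h) ⊗ pos g
      two : ∀ x y → val (x ∷ y ∷ []) ≡ pos x ⊕ χ (lev x) ⊗ pos y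
      two x y = solve 4 (λ u m v n → u :+ m :* (v :+ n :* :0) := u :+ m :* v) refl (pos x) (χ (lev x)) (pos y) (χ (lev y))
      cert : ∀ v → v ∊ ⁅ a ⁆ ⊎ v ∊ ⁅ b ⁆ → Reach (g ∷ h ∷ []) v
      cert v (inj₁ k) = _ , ↭-refl , trans (two g h) (sym (⁅⁆⁻ k))
      cert v (inj₂ k) = _ , swap g h ↭-refl , trans (two h g) (sym (⁅⁆⁻ k))

    level-inner : ∀ g D → Inner g → level (g ∷ D) ≡ level D
    level-inner g D i = trans (cong (Q._⊕ level D) i) (QT.⊕-identityˡ _)

    level-inners : ∀ {E} D → All Inner E → level (E ++ D) ≡ level D
    level-inners D [] = refl
    level-inners {g ∷ E} D (i ∷ is) = trans (level-inner g (E ++ D) i) (level-inners D is)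

    -- Inner elements do not change the level, so once it is nonzero each of them adds a value until
    -- everything is reached.
    add-inners : ∀ {D X E} → Cert D X → 1 ≤ count X → level D ≢ Q.𝟘 → All Inner E → All NonId E →
      ∃[ X′ ] Cert (E ++ D) X′ × (r ≤ count X′ ⊎ count X + length E ≤ count X′)
    add-inners {D} {X} {[]} c 1≤ nl [] [] = X , c , inj₂ (≤-reflexive (+-identityʳ _))
    add-inners {D} {X} {g ∷ E} c 1≤ nl (i ∷ is) (n ∷ ns) = go (add-inners c 1≤ nl is ns)
      where
      go : ∃[ X′ ] Cert (E ++ D) X′ × (r ≤ count X′ ⊎ count X + length E ≤ count X′) →
           ∃[ X′ ] Cert (g ∷ E ++ D) X′ × (r ≤ count X′ ⊎ count X + length (g ∷ E) ≤ count X′)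
      go (X₁ , c₁ , inj₁ f) = let X₂ , c₂ , e = keep {E ++ D} {X₁} g c₁ in X₂ , c₂ , inj₁ (≤-trans f (≤-reflexive (sym e)))
      go (X₁ , c₁ , inj₂ s) = go′ (r ≤? count X₁)
        where
        go′ : Dec (r ≤ count X₁) → ∃[ X′ ] Cert (g ∷ E ++ D) X′ × (r ≤ count X′ ⊎ count X + length (g ∷ E) ≤ count X′)
        go′ (yes f) = let X₂ , c₂ , e = keep {E ++ D} {X₁} g c₁ in X₂ , c₂ , inj₁ (≤-trans f (≤-reflexive (sym e)))
        go′ (no nf) = let X₂ , c₂ , lt = grow-inner {E ++ D} {X₁} c₁ (proj₂ (count-witness X₁ (≤-trans 1≤ (≤-trans (m≤m+n _ _) s)))) (λ z → nl (trans (sym (level-inners D is)) z)) i n (≰⇒> nf)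
                      in X₂ , c₂ , inj₂ (≤-trans (≤-reflexive (+-suc _ _)) (≤-trans (s≤s s) lt))

    finish-inners : ∀ {D X E} → Cert D X → 1 ≤ count X → level D ≢ Q.𝟘 → All Inner E → All NonId E → r ≤ count X + length E → Full (E ++ D)
    finish-inners {D} {X} {E} c 1≤ nl is ns h = go (add-inners c 1≤ nl is ns)
      where
      go : ∃[ X′ ] Cert (E ++ D) X′ × (r ≤ count X′ ⊎ count X + length E ≤ count X′) → Full (E ++ D)
      go (X′ , c′ , inj₁ f) = full-cert c′ f
      go (X′ , c′ , inj₂ s) = full-cert c′ (≤-trans h s)

    -- A rotation-invariant set with at least two elements has at least `q`, so below `q` every
    -- outer element adds a value.
    add-outers : ∀ {D X E n} → Cert D X → 2 ≤ count X → n ≤ count X → All Outer E →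
      ∃[ X′ ] Cert (E ++ D) X′ × (q ≤ count X′ ⊎ n + length E ≤ count X′) × 2 ≤ count X′
    add-outers {D} {X} {[]} c 2≤ s [] = X , c , inj₂ (≤-trans (≤-reflexive (+-identityʳ _)) s) , 2≤
    add-outers {D} {X} {g ∷ E} {n} c 2≤ s (o ∷ os) = go (add-outers c 2≤ s os)
      where
      go : ∃[ X′ ] Cert (E ++ D) X′ × (q ≤ count X′ ⊎ n + length E ≤ count X′) × 2 ≤ count X′ →
           ∃[ X′ ] Cert (g ∷ E ++ D) X′ × (q ≤ count X′ ⊎ n + length (g ∷ E) ≤ count X′) × 2 ≤ count X′
      go (X₁ , c₁ , inj₁ f , b) = let X₂ , c₂ , e = keep {E ++ D} {X₁} g c₁ in X₂ , c₂ , inj₁ (≤-trans f (≤-reflexive (sym e))) , ≤-trans b (≤-reflexive (sym e))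
      go (X₁ , c₁ , inj₂ s₁ , b) = go′ (grow-outer {E ++ D} {X₁} c₁ o)
        where
        go′ : Grown (E ++ D) X₁ g ⊎ ((count X₁ ≤ 1 ⊎ q ≤ count X₁) × (count (∁ X₁) ≤ 1 ⊎ q ≤ count (∁ X₁))) →
           ∃[ X′ ] Cert (g ∷ E ++ D) X′ × (q ≤ count X′ ⊎ n + length (g ∷ E) ≤ count X′) × 2 ≤ count X′
        go′ (inj₁ (X₂ , c₂ , lt)) = X₂ , c₂ , inj₂ (≤-trans (≤-reflexive (+-suc _ _)) (≤-trans (s≤s s₁) lt)) , ≤-trans b (<⇒≤ lt)
        go′ (inj₂ (inj₁ le , _)) = contradiction (≤-trans b le) λ { (s≤s ()) }
        go′ (inj₂ (inj₂ f , _)) = let X₂ , c₂ , e = keep {E ++ D} {X₁} g c₁ in X₂ , c₂ , inj₁ (≤-trans f (≤-reflexive (sym e))) , ≤-trans b (≤-reflexive (sym e))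

    -- One outer element first, then the inner ones, then the remaining outer ones.
    small-mixed : ∀ {L} → All NonId L → Mixed L → length L ≤ q → Certified L (length L)
    small-mixed {L} nid (g , h , L′ , e , nc) le = go (separate inner? L)
      where
      done : ∀ {M n} → L ↭ M → n ≡ length L → ∃[ X′ ] Cert M X′ × (q ≤ count X′ ⊎ n ≤ count X′) × 2 ≤ count X′ → Certified L (length L)
      done p refl (X , c , inj₁ f , _) = X , cert-↭ (↭-sym p) c , ≤-trans le f
      done p refl (X , c , inj₂ f , _) = X , cert-↭ (↭-sym p) c , f
      go : ∃[ I ] ∃[ O ] L ↭ I ++ O × All Inner I × All Outer O → Certified L (length L)
      go (I , [] , p , is , []) = contradiction (inner-comm (All.head is′) (All.head (All.tail is′))) nc
        where is′ = All-resp-↭ e (All-resp-↭ (↭-sym p) (Allₚ.++⁺ is []))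
      go ([] , O , p , [] , os) = let X , c , s = start-pair nc in
        done (↭-trans e (++-comm (g ∷ h ∷ []) L′)) (trans (+-comm 2 _) (trans (+-comm _ 2) (sym (↭-length e))))
          (add-outers {E = L′} {2} c s s (All.tail (All.tail (All-resp-↭ e (All-resp-↭ (↭-sym p) os)))))
      go (i ∷ I , o ∷ O , p , ii ∷ is , oo ∷ os) = second (add-inners {E = i ∷ I} c (≤-reflexive (sym s)) (λ z → oo (trans (sym (QT.⊕-identityʳ _)) z)) (ii ∷ is) nI)
        where
        X = proj₁ (start o)
        c = proj₁ (proj₂ (start o))
        s = proj₂ (proj₂ (start o))
        nI = Allₚ.++⁻ˡ (i ∷ I) (All-resp-↭ p nid)
        perm : L ↭ O ++ ((i ∷ I) ++ [ o ])
        perm = ↭-trans p (↭-trans (++-comm (i ∷ I) (o ∷ O)) (↭-trans (↭-sym (shift o O (i ∷ I))) (++⁺ˡ O (++-comm [ o ] (i ∷ I)))))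
        second : ∃[ X′ ] Cert ((i ∷ I) ++ [ o ]) X′ × (r ≤ count X′ ⊎ count X + length (i ∷ I) ≤ count X′) → Certified L (length L)
        second (X₁ , c₁ , inj₁ f) = let X₂ , c₂ , e₂ = keep-++ O c₁ in X₂ , cert-↭ (↭-sym perm) c₂ , ≤-trans le (≤-trans (<⇒≤ q<r) (≤-trans f (≤-reflexive (sym e₂))))
        second (X₁ , c₁ , inj₂ f) = done perm (trans (cong₂ _+_ (cong (_+ length (i ∷ I)) s) refl) (sym (trans (↭-length p) len)))
            (add-outers {E = O} {count X + length (i ∷ I)} c₁ (≤-trans (subst (λ t → 2 ≤ t + length (i ∷ I)) (sym s) (s≤s (s≤s z≤n))) f) f os)
          where
          len : length ((i ∷ I) ++ o ∷ O) ≡ 1 + length (i ∷ I) + length O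
          len = trans (length-++ (i ∷ I)) (+-suc (length (i ∷ I)) (length O))

    pick : ∀ {E g E′ D} → E ↭ g ∷ E′ → Full (E′ ++ g ∷ D) → Full (E ++ D)
    pick {D = D} p f = full-↭ (↭-sym (transfer D p)) f

    pick₂ : ∀ {E g h E′ D} → E ↭ g ∷ h ∷ E′ → Full (E′ ++ g ∷ h ∷ D) → Full (E ++ D)
    pick₂ {E} {g} {h} {E′} {D} p f = pick {E} {g} {h ∷ E′} p (pick {h ∷ E′} {h} {E′} ↭-refl (full-↭ (++⁺ˡ E′ (swap g h ↭-refl)) f))

    private
      -- One step of the induction: `D` is placed with values `X`, and `E` waits. Values keep pace
      -- with placed elements, so a total above r suffices. `inv` excludes a single value at level
      -- zero, to which `add-pair` does not apply.
      module Step (D E : List Elt) (X : Sub r) (c : Cert D X) (D≤X : length D ≤ count X) (1≤D : 1 ≤ length D)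
        (inv : 2 ≤ count X ⊎ level D ≢ Q.𝟘) (r<DE : r < length D + length E) (nid : All NonId E) (bd : Bounded E)
        (rec : ∀ g E′ (X′ : Sub r) → E ↭ g ∷ E′ → Cert (g ∷ D) X′ → count X < count X′ → Mixed E′ → Full (E′ ++ g ∷ D))
        (rec₂ : ∀ g h E′ (X′ : Sub r) → E ↭ g ∷ h ∷ E′ → Cert (g ∷ h ∷ D) X′ → 2 + count X ≤ count X′ → Mixed E′ → Full (E′ ++ g ∷ h ∷ D))
        (nf : count X < r) where

        1≤X : 1 ≤ count X
        1≤X = ≤-trans 1≤D D≤X

        xX : ∃[ x ] x ∊ X
        xX = count-witness X 1≤X

        r<XE : r < count X + length E
        r<XE = ≤-trans r<DE (+-monoˡ-≤ _ D≤X)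

        fill : ∀ {g E′} (X′ : Sub r) → E ↭ g ∷ E′ → Cert (g ∷ D) X′ → r ≤ count X′ → Full (E ++ D)
        fill {g} {E′} X′ p c′ h = pick {E} p (full-++ E′ (full-cert c′ h))

        ∁<E : count (∁ X) < length E
        ∁<E = +-cancelˡ-< (count X) _ _ (subst (_< count X + length E) (sym (count-∁ X)) r<XE)

        -- With two elements left the next growth is the last one needed.
        last-two : ∀ {g h E′} → E ↭ g ∷ h ∷ E′ → E′ ≡ [] → Grown D X g → Full (E ++ D)
        last-two p refl (X′ , c′ , lt) = fill X′ p c′
          (≤-trans (≤-pred (subst (r <_) (trans (cong (count X +_) (↭-length p)) (+-comm (count X) 2)) r<XE)) lt)

        -- Placing `g` is harmless if the remainder stays mixed. Otherwise all of `E′` commutes with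
        -- `h`, and `alt` has to find another move.
        grown-outside : ∀ g h E′ → E ↭ g ∷ h ∷ E′ → ¬ Comm g h → Grown D X g →
          (∀ e E″ → E′ ≡ e ∷ E″ → All (Comm h) E′ → Full (E ++ D)) → Full (E ++ D)
        grown-outside g h E′ p nc gr@(X′ , c′ , lt) alt with mixed? h E′
        ... | inj₂ mx = pick {E} p (rec g (h ∷ E′) X′ p c′ lt mx)
        ... | inj₁ cm with E′
        ... | [] = last-two p refl gr
        ... | e ∷ E″ = alt e E″ refl cm

        swap-in : ∀ {g h e E″} → E ↭ g ∷ h ∷ e ∷ E″ → E ↭ e ∷ g ∷ h ∷ E″
        swap-in {g} {h} {e} {E″} p = ↭-trans p (↭-trans (prep g (swap h e ↭-refl)) (swap g e ↭-refl))

        -- If placing `g` would leave only elements commuting with `h`, an `e` from `E′` is placed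
        -- instead and the pair g, h stays behind. If even `e` adds nothing, `X` is
        -- rotation-invariant; `Bounded` leaves fewer than `q` missing values, hence at most one,
        -- and `g` supplies it.
        other-level : level D ≢ Q.𝟘 → ∀ g h E′ → E ↭ g ∷ h ∷ E′ → ¬ Comm g h → Grown D X g → Full (E ++ D)
        other-level nl g h E′ p nc gr@(X′ , c′ , lt) = grown-outside g h E′ p nc gr alt
          where
          nid′ = All-resp-↭ p nid
          alt : ∀ e E″ → E′ ≡ e ∷ E″ → All (Comm h) E′ → Full (E ++ D)
          alt e E″ refl cm = by (inner? h)
            where
            mx : Mixed (g ∷ h ∷ E″)
            mx = g , h , E″ , ↭-refl , nc
            nh = All.head (All.tail nid′)
            ne = All.head (All.tail (All.tail nid′))
            use : Grown D X e → Full (E ++ D)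
            use (X″ , c″ , lt″) = pick {E} (swap-in p) (rec e (g ∷ h ∷ E″) X″ (swap-in p) c″ lt″ mx)
            by : Dec (Inner h) → Full (E ++ D)
            by (yes ih) = use (grow-inner c (proj₂ xX) nl (comm-inner {e} {h} nh ih (comm-sym {h} {e} (All.head cm))) ne nf)
            by (no oh) = by′ (grow-outer c (comm-outer {e} {h} ne oh (comm-sym {h} {e} (All.head cm))))
              where
              ∁<q : count (∁ X) < q
              ∁<q = ≤-<-trans (≤-pred (subst (count (∁ X) <_) (↭-length p) ∁<E))
                (bd h oh (h ∷ e ∷ E″) [ g ] (↭-trans p (++-comm [ g ] (h ∷ e ∷ E″))) (comm-refl {h} ∷ cm))
              by′ : Grown D X e ⊎ ((count X ≤ 1 ⊎ q ≤ count X) × (count (∁ X) ≤ 1 ⊎ q ≤ count (∁ X))) → Full (E ++ D)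
              by′ (inj₁ ge) = use ge
              by′ (inj₂ (_ , inj₂ f)) = contradiction f (<⇒≱ ∁<q)
              by′ (inj₂ (_ , inj₁ s)) = fill X′ p c′ (≤-trans (≤-reflexive (sym (count-∁ X))) (≤-trans (+-monoʳ-≤ (count X) s) (≤-trans (≤-reflexive (+-comm _ 1)) lt)))

        -- Every outer element adds a value, as `X` is not ω-invariant. If the remainder after `g`
        -- commutes with an inner `h`, it is all inner; the level is then nonzero and the inner
        -- elements finish. If `h` is outer, so is `e`, which is placed instead of `g`.
        zero-level : level D ≡ Q.𝟘 → ∀ g h E′ → E ↭ g ∷ h ∷ E′ → ¬ Comm g h → Outer g → ¬ ωClosed X → Full (E ++ D)
        zero-level zl g h E′ p nc og ncl = grown-outside g h E′ p nc gr alt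
          where
          nid′ = All-resp-↭ p nid
          grows : ∀ {e} → Outer e → Grown D X e
          grows {e} oe = unclosed (grow-outer₀ c oe zl)
            where
            unclosed : ωClosed X ⊎ Grown D X e → Grown D X e
            unclosed (inj₁ cl) = contradiction cl ncl
            unclosed (inj₂ w) = w
          gr = grows og
          alt : ∀ e E″ → E′ ≡ e ∷ E″ → All (Comm h) E′ → Full (E ++ D)
          alt e E″ refl cm = by (inner? h)
            where
            nh = All.head (All.tail nid′)
            ne = All.head (All.tail (All.tail nid′))
            by : Dec (Inner h) → Full (E ++ D)
            by (yes ih) = let X′ , c′ , lt = gr in pick {E} p (finish-inners c′ (≤-trans 1≤X (<⇒≤ lt)) (λ z → og (trans (sym (trans (cong (lev g Q.⊕_) zl) (QT.⊕-identityʳ _))) z))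
                (ih ∷ All.map (λ {x} k → comm-inner {x} {h} nh ih (comm-sym {h} {x} k)) cm) (All.tail nid′)
                (≤-trans (≤-pred (≤-trans r<XE (≤-trans (≤-reflexive (cong (count X +_) (↭-length p))) (≤-reflexive (+-suc _ _))))) (+-monoˡ-≤ _ (<⇒≤ lt))))
            by (no oh) = let X″ , c″ , lt″ = grows (comm-outer {e} {h} ne oh (comm-sym {h} {e} (All.head cm))) in
              pick {E} (swap-in p) (rec e (g ∷ h ∷ E″) X″ (swap-in p) c″ lt″ (g , h , E″ , ↭-refl , nc))

        pair : ∀ {g h E′} → E ↭ g ∷ h ∷ E′ → ¬ Comm g h → ωClosed X → 2 ≤ count X →
          (∀ (X′ : Sub r) → Cert (g ∷ h ∷ D) X′ → 2 + count X ≤ count X′ → Full (E′ ++ g ∷ h ∷ D)) → Full (E ++ D)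
        pair {g} {h} {E′} p nc cl 2≤ k = pick₂ {E} p (go (add-pair c cl (proj₂ xX) nc 2≤))
          where
          go : ∃[ X′ ] Cert (g ∷ h ∷ D) X′ × (r ≤ count X′ ⊎ 2 + count X ≤ count X′) → Full (E′ ++ g ∷ h ∷ D)
          go (X′ , c′ , inj₁ f) = full-++ E′ (full-cert c′ f)
          go (X′ , c′ , inj₂ s) = k X′ c′ s

        -- `g`, `e` and `E″` are at least `q` elements commuting with `e`, so `Bounded` makes `e`
        -- inner. Then `g` is inner and `h` outer; after this pair the level is nonzero and only
        -- inner elements remain.
        rest-inner : ∀ g h e E″ → E ↭ g ∷ h ∷ e ∷ E″ → ¬ Comm g h → ωClosed X → 2 ≤ count X → level D ≡ Q.𝟘 →
          All (Comm e) E″ → Comm g e → q ≤ suc (suc (length E″)) → Full (E ++ D)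
        rest-inner g h e E″ p nc cl 2≤ zl cm cge q≤ = by (inner? e)
          where
          nid′ = All-resp-↭ p nid
          ne = All.head (All.tail (All.tail nid′))
          by : Dec (Inner e) → Full (E ++ D)
          by (no oe) = contradiction q≤ (<⇒≱ (bd e oe (g ∷ e ∷ E″) [ h ] (↭-trans p (prep g (++-comm [ h ] (e ∷ E″)))) (comm-sym {g} {e} cge ∷ comm-refl {e} ∷ cm)))
          by (yes ie) = pair p nc cl 2≤ λ X′ c′ s → finish-inners c′ (≤-trans (s≤s z≤n) s) lv
               (ie ∷ All.map (λ {x} k → comm-inner {x} {e} ne ie (comm-sym {e} {x} k)) cm) (All.tail (All.tail nid′))
               (≤-trans (<⇒≤ r<XE) (≤-trans (≤-reflexive (trans (cong (count X +_) (↭-length p)) (trans (+-suc _ _) (cong suc (+-suc _ _))))) (+-monoˡ-≤ _ s)))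
            where
            ig : Inner g
            ig = comm-inner {g} {e} ne ie cge
            oh : Outer h
            oh ih = nc (inner-comm {g} {h} ig ih)
            lv : level (g ∷ h ∷ D) ≢ Q.𝟘
            lv z = oh (trans (sym (trans (cong (lev h Q.⊕_) zl) (QT.⊕-identityʳ _))) (trans (sym (level-inner g (h ∷ D) ig)) z))

        -- One outer element may add nothing to an ω-invariant set, so a noncommuting pair is placed
        -- at once for two new values. The pair is chosen to leave a mixed or an all inner
        -- remainder, unless at most one value was missing.
        closed-level : level D ≡ Q.𝟘 → ∀ g h E′ → E ↭ g ∷ h ∷ E′ → ¬ Comm g h → ωClosed X → 2 ≤ count X → Full (E ++ D)
        closed-level zl g h E′ p nc cl 2≤ = by (ω-complement cl)
          where
          nid′ = All-resp-↭ p nid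
          by : count (∁ X) ≤ 1 ⊎ q ≤ count (∁ X) → Full (E ++ D)
          by (inj₁ s) = pair p nc cl 2≤ λ X′ c′ s′ → full-++ E′ (full-cert c′
             (≤-trans (≤-reflexive (sym (count-∁ X))) (≤-trans (+-monoʳ-≤ (count X) s) (≤-trans (≤-reflexive (+-comm _ 1)) (≤-trans (n≤1+n _) s′)))))
          by (inj₂ f) = shape E′ refl
            where
            q<E : suc q ≤ suc (suc (length E′))
            q<E = ≤-trans (s≤s f) (≤-trans ∁<E (≤-reflexive (↭-length p)))
            shape : ∀ L → E′ ≡ L → Full (E ++ D)
            shape [] refl = contradiction (≤-trans 3≤q (≤-pred q<E)) λ { (s≤s ()) }
            shape (e ∷ []) refl = contradiction (≤-trans 3≤q (≤-pred q<E)) λ { (s≤s (s≤s ())) }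
            shape (e ∷ e′ ∷ E″) refl with mixed? e (e′ ∷ E″)
            ... | inj₂ mx = pair p nc cl 2≤ λ X′ c′ s → rec₂ g h _ X′ p c′ s mx
            ... | inj₁ cm with comm? g e | comm? h e
            ... | yes cge | _ = rest-inner g h e (e′ ∷ E″) p nc cl 2≤ zl cm cge (≤-pred q<E)
            ... | no _ | yes che = rest-inner h g e (e′ ∷ E″) (↭-trans p (swap g h ↭-refl)) (nc ∘ comm-sym {h} {g}) cl 2≤ zl cm che (≤-pred q<E)
            ... | no nge | no nhe = pair p′ nge cl 2≤ λ X′ c′ s → rec₂ g e _ X′ p′ c′ s (h , e′ , E″ , ↭-refl , λ k → nhe (comm-trans {h} {e′} {e} ne′ k (comm-sym {e} {e′} (All.head cm))))
              where
              p′ : E ↭ g ∷ e ∷ h ∷ e′ ∷ E″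
              p′ = ↭-trans p (prep g (swap h e ↭-refl))
              ne′ = All.head (All.tail (All.tail (All.tail nid′)))

        step : Mixed E → Full (E ++ D)
        step (g , h , E′ , p , nc) with level D ≟ Q.𝟘
        ... | no nl = by (grow-pair c (proj₂ xX) nl nc nf)
          where
          by : Grown D X g ⊎ Grown D X h → Full (E ++ D)
          by (inj₁ gg) = other-level nl g h E′ p nc gg
          by (inj₂ gh) = other-level nl h g E′ (↭-trans p (swap g h ↭-refl)) (nc ∘ comm-sym {h} {g}) gh
        ... | yes zl with Finₚ.all? (λ v → (v ∊? X) →-dec ((ω ⊗ v) ∊? X))
        ... | yes cl = closed-level zl g h E′ p nc (λ v → cl v) (two inv)
          where
          two : 2 ≤ count X ⊎ level D ≢ Q.𝟘 → 2 ≤ count X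
          two (inj₁ h) = h
          two (inj₂ n) = contradiction zl n
        ... | no ncl with inner? g
        ... | no og = zero-level zl g h E′ p nc og (λ cl → ncl (λ v → cl v))
        ... | yes ig = zero-level zl h g E′ (↭-trans p (swap g h ↭-refl)) (nc ∘ comm-sym {h} {g}) (λ ih → nc (inner-comm {g} {h} ig ih)) (λ cl → ncl (λ v → cl v))

      spread-from : ∀ n D E (X : Sub r) → length E ≤ n → Cert D X → length D ≤ count X → 1 ≤ length D →
        2 ≤ count X ⊎ level D ≢ Q.𝟘 → r < length D + length E → All NonId E → Bounded E → Mixed E → Full (E ++ D)
      spread-from zero D E X len c s 1≤ inv lt nid bd (g , h , E′ , p , _) = contradiction (≤-trans (≤-reflexive (sym (↭-length p))) len) λ ()
      spread-from (suc n) D E X len c s 1≤ inv lt nid bd mx with r ≤? count X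
      ... | yes f = full-++ E (full-cert c f)
      ... | no nf = Step.step D E X c s 1≤ inv lt nid bd rec rec₂ (≰⇒> nf) mx
        where
        rec : ∀ g E′ (X′ : Sub r) → E ↭ g ∷ E′ → Cert (g ∷ D) X′ → count X < count X′ → Mixed E′ → Full (E′ ++ g ∷ D)
        rec g E′ X′ p c′ lt′ mx′ = spread-from n (g ∷ D) E′ X′ (≤-pred (≤-trans (≤-reflexive (sym (↭-length p))) len)) c′ (≤-trans (s≤s s) lt′) (s≤s z≤n)
          (inj₁ (≤-trans (s≤s (≤-trans 1≤ s)) lt′)) (≤-trans lt (≤-reflexive (trans (cong (length D +_) (↭-length p)) (+-suc _ _)))) (All.tail (All-resp-↭ p nid)) (bounded-∷ p bd) mx′
        rec₂ : ∀ g h E′ (X′ : Sub r) → E ↭ g ∷ h ∷ E′ → Cert (g ∷ h ∷ D) X′ → 2 + count X ≤ count X′ → Mixed E′ → Full (E′ ++ g ∷ h ∷ D)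
        rec₂ g h E′ X′ p c′ lt′ mx′ = spread-from n (g ∷ h ∷ D) E′ X′ (≤-trans (n≤1+n _) (≤-pred (≤-trans (≤-reflexive (sym (↭-length p))) len))) c′ (≤-trans (s≤s (s≤s s)) lt′) (s≤s z≤n)
          (inj₁ (≤-trans (s≤s (s≤s z≤n)) lt′)) (≤-trans lt (≤-reflexive (trans (cong (length D +_) (↭-length p)) (trans (+-suc _ _) (cong suc (+-suc _ _)))))) (All.tail (All.tail (All-resp-↭ p nid)))
          (bounded-∷ ↭-refl (bounded-∷ p bd)) mx′

    -- Insert the elements one at a time, always leaving a mixed remainder, so that each one adds a value.
    spread : ∀ {R} → All NonId R → Mixed R → Bounded R → r < length R → Full R
    spread {R} nid mx@(g , h , L , p , nc) bd lt = by (inner? g)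
      where
      from : ∀ {k E} → Outer k → R ↭ k ∷ E → Mixed E → Full R
      from {k} {E} ok pk mxE = let X , c , e = start k in
        full-↭ (↭-trans (++-comm E [ k ]) (↭-sym pk)) (spread-from (length E) [ k ] E X ≤-refl c (≤-reflexive (sym e)) ≤-refl
          (inj₂ (λ z → ok (trans (sym (QT.⊕-identityʳ _)) z))) (≤-trans lt (≤-reflexive (↭-length pk))) (All.tail (All-resp-↭ pk nid)) (bounded-∷ pk bd) mxE)
      outer-first : ∀ g h L → R ↭ g ∷ h ∷ L → ¬ Comm g h → Outer g → Full R
      outer-first g h L p nc og with mixed? h L
      ... | inj₂ mxh = from og p mxh
      ... | inj₁ cm with inner? h
      ... | yes ih = let X , c , e = start g in full-↭ (↭-trans (++-comm (h ∷ L) [ g ]) (↭-sym p))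
             (finish-inners {E = h ∷ L} c (≤-reflexive (sym e)) (λ z → og (trans (sym (QT.⊕-identityʳ _)) z))
               (ih ∷ All.map (λ {x} k → comm-inner {x} {h} nh ih (comm-sym {h} {x} k)) cm) (All.tail nid′)
               (subst (λ t → r ≤ t + length (h ∷ L)) (sym e) (≤-trans (<⇒≤ lt) (≤-reflexive (↭-length p)))))
        where
        nid′ = All-resp-↭ p nid
        nh = All.head (All.tail nid′)
      ... | no oh with L
      ... | [] = contradiction (≤-trans (s≤s q<r) (≤-trans lt (≤-reflexive (↭-length p)))) (<⇒≱ (s≤s (s≤s (≤-trans (s≤s z≤n) 3≤q))))
      ... | e ∷ L′ = from (comm-outer {e} {h} (All.head (All.tail (All.tail (All-resp-↭ p nid)))) oh (comm-sym {h} {e} (All.head cm)))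
             (↭-trans p (↭-trans (prep g (swap h e ↭-refl)) (swap g e ↭-refl))) (g , h , L′ , ↭-refl , nc)
      by : Dec (Inner g) → Full R
      by (no og) = outer-first g h L p nc og
      by (yes ig) = outer-first h g L (↭-trans p (swap g h ↭-refl)) (nc ∘ comm-sym {h} {g}) (λ ih → nc (inner-comm {g} {h} ig ih))

-- Product-one parts among few elements, and mixed groups of q elements.

module Blocks where

  open Counting
  open ZMod
  open FieldSets
  open Lists
  open Affine
  open Spread
  open import Data.Nat using (ℕ; zero; suc; _+_; _*_; _∸_; _≤_; _<_; z≤n; s≤s; _≤?_)
  open import Data.Nat.Properties hiding (_≟_)
  open import Data.Bool using (true)
  open import Data.Fin using (Fin)
  open import Data.List using (List; []; _∷_; _++_; length; [_])
  open import Data.List.Properties using (length-++; ++-conicalˡ) renaming (++-assoc to ≡-assoc)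
  open import Data.List.Relation.Unary.All using (All; []; _∷_)
  import Data.List.Relation.Unary.All as All
  import Data.List.Relation.Unary.All.Properties as Allₚ
  open import Data.List.Relation.Binary.Permutation.Propositional hiding (trans)
  open import Data.List.Relation.Binary.Permutation.Propositional.Properties
  open import Data.Product using (∃-syntax; _×_; _,_; proj₂)
  open import Data.Sum using (_⊎_; inj₁; inj₂)
  open import Relation.Nullary using (¬_; Dec; yes; no; contradiction)
  open import Relation.Binary.PropositionalEquality hiding ([_])

  -- Choosing one element from each of k pairs gives at least k + 1 values, if evaluation is
  -- v ↦ σ v + off x for each prepended x, with off separating the two elements of each pair.
  module Choice {n : ℕ} (Fd : PrimeField n) {A : Set} (eval : List A → Fin n) (off : A → Fin n) (Good : A → Set)
    (σ σ⁻¹ : Fin n → Fin n) (σσ⁻¹ : ∀ x → σ (σ⁻¹ x) ≡ x) (σ⁻¹σ : ∀ x → σ⁻¹ (σ x) ≡ x)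
    (eval-∷ : ∀ x L → Good x → eval (x ∷ L) ≡ PrimeField._⊕_ Fd (σ (eval L)) (off x)) where
    open PrimeField Fd
    open FieldTheory Fd
    open Sets Fd
    module Σᵇ = Bijection σ σ⁻¹ σσ⁻¹ σ⁻¹σ

    Selects : List (A × A) → Fin n → Set
    Selects ps v = ∃[ L ] ∃[ U ] flatten ps ↭ L ++ U × length L ≡ length ps × eval L ≡ v

    choose : ∀ ps → All (λ { (a , b) → Good a × Good b × off a ≢ off b }) ps →
      ∃[ Y ] (∀ v → v ∊ Y → Selects ps v) × 1 ≤ count Y × (n ≤ count Y ⊎ suc (length ps) ≤ count Y)
    choose [] [] = ⁅ eval [] ⁆ , (λ v h → [] , [] , ↭-refl , refl , sym (⁅⁆⁻ h)) , ≤-reflexive (sym (count-⁅⁆ _)) , inj₂ (≤-reflexive (sym (count-⁅⁆ _)))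
    choose ((a , b) ∷ ps) ((ga , gb , ne) ∷ gs) = step (choose ps gs)
      where
      d : Fin n
      d = off b ⊝ off a
      module Ta = Translate (off a)
      module Td = Translate d
      step : ∃[ Y ] (∀ v → v ∊ Y → Selects ps v) × 1 ≤ count Y × (n ≤ count Y ⊎ suc (length ps) ≤ count Y) →
             ∃[ Y ] (∀ v → v ∊ Y → Selects ((a , b) ∷ ps) v) × 1 ≤ count Y × (n ≤ count Y ⊎ suc (suc (length ps)) ≤ count Y)
      step (Y , sel , 1≤ , size) = Ta.image V , (λ v h → cert v (∪⁻ {X = Z} {Td.image Z} (Ta.image⁻ {X = V} h))) ,
          ≤-trans 1≤ Y≤V , sizes (Td.grows-or-closed Z)
        where
        Z V : Sub n
        Z = Σᵇ.image Y
        V = Z ∪ Td.image Z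
        Y≤V : count Y ≤ count (Ta.image V)
        Y≤V = ≤-trans (≤-reflexive (sym (Σᵇ.count-image Y))) (≤-trans (count-mono {X = Z} {V} (λ _ → ∪⁺ˡ)) (≤-reflexive (sym (Ta.count-image V))))
        use : ∀ x y → Good x → flatten ((a , b) ∷ ps) ↭ x ∷ y ∷ flatten ps → ∀ w → w ∊ Z → Selects ((a , b) ∷ ps) (w ⊕ off x)
        use x y gx p w h with L , U , e , l , refl′ ← sel (σ⁻¹ w) (Σᵇ.image⁻ h) =
          x ∷ L , y ∷ U , ↭-trans p (prep x (↭-trans (prep y e) (↭-sym (shift y L U)))) , cong suc l ,
          trans (eval-∷ x L gx) (cong (_⊕ off x) (trans (cong σ refl′) (σσ⁻¹ w)))
        cert : ∀ v → (v ⊝ off a) ∊ Z ⊎ (v ⊝ off a) ∊ Td.image Z → Selects ((a , b) ∷ ps) v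
        cert v (inj₁ h) = subst (Selects ((a , b) ∷ ps)) (solve 2 (λ v a → (v :- a) :+ a := v) refl v (off a)) (use a b ga ↭-refl _ h)
        cert v (inj₂ h) = subst (Selects ((a , b) ∷ ps)) (solve 3 (λ v a b → ((v :- a) :- (b :- a)) :+ b := v) refl v (off a) (off b)) (use b a gb (swap a b ↭-refl) _ (Td.image⁻ {X = Z} h))
        sizes : (∀ x → x ∊ Z → x ⊕ d ∊ Z) ⊎ count Z < count V → n ≤ count (Ta.image V) ⊎ suc (suc (length ps)) ≤ count (Ta.image V)
        sizes (inj₁ cl) = inj₁ (≤-trans (≤-reflexive (sym (count-all n))) (≤-trans (count-mono {X = λ _ → true} {V}
            (λ y _ → ∪⁺ˡ (translate-closed (λ e → ne (sym (⊝≡𝟘 e))) cl (proj₂ (count-witness Z (≤-trans 1≤ (≤-reflexive (sym (Σᵇ.count-image Y)))))) y))) (≤-reflexive (sym (Ta.count-image V)))))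
        sizes (inj₂ lt) = by size
          where
          Y<V : count Y < count (Ta.image V)
          Y<V = ≤-trans (s≤s (≤-reflexive (sym (Σᵇ.count-image Y)))) (≤-trans lt (≤-reflexive (sym (Ta.count-image V))))
          by : n ≤ count Y ⊎ suc (length ps) ≤ count Y → n ≤ count (Ta.image V) ⊎ suc (suc (length ps)) ≤ count (Ta.image V)
          by (inj₁ f) = inj₁ (≤-trans f (<⇒≤ Y<V))
          by (inj₂ s) = inj₂ (≤-trans (s≤s s) Y<V)

  module ZeroSums {r q : ℕ} (SD : Semidirect r q) where
    open Semidirect SD
    open FieldTheory Fr
    open Sets Fr
    open Elements SD
    open Spreading SD

    IsOne : List Elt → Set
    IsOne L = level L ≡ Q.𝟘 × Reach L 𝟘

    -- A nonempty sublist which in some order multiplies to the translation by `v`.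
    ZeroLevelPart : List Elt → Fin r → Set
    ZeroLevelPart L v = ∃[ T ] ∃[ R ] L ↭ T ++ R × T ≢ [] × level T ≡ Q.𝟘 × Reach T v

    Found : List Elt → Set
    Found L = ZeroLevelPart L 𝟘

    Parts : List Elt → Sub r → Set
    Parts L P = ∀ v → v ∊ P → ZeroLevelPart L v

    part-++ˡ : ∀ {L v} M → ZeroLevelPart L v → ZeroLevelPart (L ++ M) v
    part-++ˡ M (T , R , p , rest) = T , R ++ M , ↭-trans (++⁺ʳ M p) (↭-reflexive (≡-assoc T R M)) , rest

    part-↭ : ∀ {L M v} → L ↭ M → ZeroLevelPart L v → ZeroLevelPart M v
    part-↭ p (T , R , e , rest) = T , R , ↭-trans (↭-sym p) e , rest

    part-++ʳ : ∀ {L v} M → ZeroLevelPart L v → ZeroLevelPart (M ++ L) v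
    part-++ʳ {L} M z = part-↭ (++-comm L M) (part-++ˡ M z)

    reach-++ : ∀ {K L a b} → level K ≡ Q.𝟘 → Reach K a → Reach L b → Reach (K ++ L) (a ⊕ b)
    reach-++ {K} {L} e (S , p , refl) (T , p′ , refl) = S ++ T , ++⁺ p p′ , trans (val-++ S T)
      (cong (val S ⊕_) (trans (cong (_⊗ val T) (trans (cong χ (trans (sym (level-↭ p)) e)) χ-𝟘)) (⊗-identityˡ _)))

    part-⊕ : ∀ {L M a b} → ZeroLevelPart L a → ZeroLevelPart M b → ZeroLevelPart (L ++ M) (a ⊕ b)
    part-⊕ {L} {M} (T , R , p , ne , l , rT) (T′ , R′ , p′ , ne′ , l′ , rT′) = T ++ T′ , R ++ R′ , perm , (λ z → ne (++-conicalˡ T T′ z)) ,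
        trans (level-++ T T′) (trans (cong₂ Q._⊕_ l l′) (QT.⊕-identityˡ _)) , reach-++ {T} {T′} l rT rT′
      where
      perm : L ++ M ↭ (T ++ T′) ++ R ++ R′
      perm = ↭-trans (++⁺ p p′) (↭-trans (↭-reflexive (≡-assoc T R (T′ ++ R′))) (↭-trans (++⁺ˡ T (shifts R T′)) (↭-reflexive (sym (≡-assoc T T′ (R ++ R′))))))

    0∪ : Sub r → Sub r
    0∪ P = ⁅ 𝟘 ⁆ ∪ P

    count-0∪ : ∀ {P} → P ∌ 𝟘 → count (0∪ P) ≡ suc (count P)
    count-0∪ {P} n = trans (sym (+-identityʳ _)) (trans (cong (count (0∪ P) +_) (sym (count-none {X = ⁅ 𝟘 ⁆ ∩ P} λ x h → let a , b = ∩⁻ {X = ⁅ 𝟘 ⁆} {P} h in n (subst (_∊ P) (⁅⁆⁻ a) b))))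
      (trans (count-∪∩ ⁅ 𝟘 ⁆ P) (cong (_+ count P) (count-⁅⁆ 𝟘))))

    -- With 0 adjoined for the empty part, the sumset of the two sets of values lies in that of the
    -- union, and Cauchy-Davenport loses nothing. If |P| + |B| ≥ r, then `0∪ P` meets -`B` and the
    -- identity is found.
    add-parts : ∀ {L M P B n k} → Parts L P → Parts M B → n ≤ count P → k ≤ count B →
      Found (L ++ M) ⊎ ∃[ P′ ] Parts (L ++ M) P′ × n + k ≤ count P′
    add-parts {L} {M} {P} {B} {n} {k} cp cb n≤ k≤ = by (𝟘 ∊? P′)
      where
      P′ : Sub r
      P′ = P ∪ B ∪ (P ⊞ B)
      parts : Parts (L ++ M) P′
      parts v h = go (∪⁻ {X = P} {B ∪ (P ⊞ B)} h)
        where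
        go₃ : ∃[ a ] ∃[ b ] a ∊ P × b ∊ B × v ≡ a ⊕ b → ZeroLevelPart (L ++ M) v
        go₃ (a , b , ha , hb , refl) = part-⊕ (cp a ha) (cb b hb)
        go₂ : v ∊ B ⊎ v ∊ P ⊞ B → ZeroLevelPart (L ++ M) v
        go₂ (inj₁ hb) = part-++ʳ L (cb v hb)
        go₂ (inj₂ hs) = go₃ (⊞⁻ {P} {B} hs)
        go : v ∊ P ⊎ v ∊ B ∪ (P ⊞ B) → ZeroLevelPart (L ++ M) v
        go (inj₁ hp) = part-++ˡ M (cp v hp)
        go (inj₂ hb) = go₂ (∪⁻ {X = B} {P ⊞ B} hb)
      by : Dec (𝟘 ∊ P′) → Found (L ++ M) ⊎ ∃[ P′ ] Parts (L ++ M) P′ × n + k ≤ count P′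
      by (yes z) = inj₁ (parts 𝟘 z)
      by (no nz) = by₂ (r ≤? count P + count B)
        where
        nP : P ∌ 𝟘
        nP h = nz (∪⁺ˡ h)
        nB : B ∌ 𝟘
        nB h = nz (∪⁺ʳ {X = P} (∪⁺ˡ h))
        sub : ∀ y → y ∊ 0∪ P ⊞ 0∪ B → y ∊ 0∪ P′
        sub y h = go (⊞⁻ {0∪ P} {0∪ B} h)
          where
          cases : ∀ a b → a ∊ ⁅ 𝟘 ⁆ ⊎ a ∊ P → b ∊ ⁅ 𝟘 ⁆ ⊎ b ∊ B → a ⊕ b ∊ 0∪ P′
          cases a b (inj₁ z) (inj₁ z′) = ∪⁺ˡ (subst (_∊ ⁅ 𝟘 ⁆) (sym (trans (cong₂ _⊕_ (⁅⁆⁻ z) (⁅⁆⁻ z′)) (⊕-identityˡ 𝟘))) ∊-⁅⁆)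
          cases a b (inj₁ z) (inj₂ hb) = ∪⁺ʳ {X = ⁅ 𝟘 ⁆} (∪⁺ʳ {X = P} (∪⁺ˡ (subst (_∊ B) (sym (trans (cong (_⊕ b) (⁅⁆⁻ z)) (⊕-identityˡ b))) hb)))
          cases a b (inj₂ ha) (inj₁ z) = ∪⁺ʳ {X = ⁅ 𝟘 ⁆} (∪⁺ˡ (subst (_∊ P) (sym (trans (cong (a ⊕_) (⁅⁆⁻ z)) (⊕-identityʳ a))) ha))
          cases a b (inj₂ ha) (inj₂ hb) = ∪⁺ʳ {X = ⁅ 𝟘 ⁆} (∪⁺ʳ {X = P} (∪⁺ʳ {X = B} (⊞⁺ ha hb)))
          go : ∃[ a ] ∃[ b ] a ∊ 0∪ P × b ∊ 0∪ B × y ≡ a ⊕ b → y ∊ 0∪ P′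
          go (a , b , ha , hb , refl) = cases a b (∪⁻ {X = ⁅ 𝟘 ⁆} {P} ha) (∪⁻ {X = ⁅ 𝟘 ⁆} {B} hb)
        up : count (0∪ P ⊞ 0∪ B) ≤ suc (count P′)
        up = ≤-trans (count-mono {X = 0∪ P ⊞ 0∪ B} {0∪ P′} sub) (≤-reflexive (count-0∪ nz))
        by₂ : Dec (r ≤ count P + count B) → Found (L ++ M) ⊎ ∃[ P′ ] Parts (L ++ M) P′ × n + k ≤ count P′
        by₂ (yes f) = inj₁ (meet (sum-zero {0∪ P} {B} (≤-trans (s≤s f) (≤-reflexive (cong (_+ count B) (sym (count-0∪ nP)))))))
          where
          meet₂ : ∀ a → a ∊ ⁅ 𝟘 ⁆ ⊎ a ∊ P → (⊖ a) ∊ B → Found (L ++ M)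
          meet₂ a (inj₁ z) hb = part-++ʳ L (cb 𝟘 (subst (_∊ B) (trans (cong ⊖_ (⁅⁆⁻ z)) (trans (sym (⊕-identityˡ _)) (⊖-inverseʳ 𝟘))) hb))
          meet₂ a (inj₂ ha) hb = subst (ZeroLevelPart (L ++ M)) (⊖-inverseʳ a) (part-⊕ (cp a ha) (cb _ hb))
          meet : ∃[ a ] a ∊ 0∪ P × (⊖ a) ∊ B → Found (L ++ M)
          meet (a , ha , hb) = meet₂ a (∪⁻ {X = ⁅ 𝟘 ⁆} {P} ha) hb
        by₂ (no nf) = inj₂ (P′ , parts , ≤-trans (+-mono-≤ n≤ k≤) (≤-pred (size (cauchy-davenport {0∪ P} {0∪ B} {𝟘} {𝟘} (∪⁺ˡ ∊-⁅⁆) (∪⁺ˡ ∊-⁅⁆)))))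
          where
          size : r ≤ count (0∪ P ⊞ 0∪ B) ⊎ count (0∪ P) + count (0∪ B) ≤ suc (count (0∪ P ⊞ 0∪ B)) → suc (count P + count B) ≤ suc (count P′)
          size (inj₁ f) = ≤-trans (≰⇒> nf) (≤-trans f up)
          size (inj₂ s) = ≤-trans (≤-pred (≤-trans (≤-reflexive (sym (trans (cong₂ _+_ (count-0∪ nP) (count-0∪ nB)) (cong suc (+-suc _ _))))) s)) up

    -- The analogue of the fact that a zero-sum free sequence has at least as many subset sums as
    -- terms.
    Plenty : List Elt → Set
    Plenty L = Found L ⊎ ∃[ P ] Parts L P × length L ≤ count P

    plenty-++ : ∀ {L M} → Plenty L → Plenty M → Plenty (L ++ M)
    plenty-++ {L} {M} (inj₁ f) _ = inj₁ (part-++ˡ M f)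
    plenty-++ {L} {M} (inj₂ _) (inj₁ f) = inj₁ (part-++ʳ L f)
    plenty-++ {L} {M} (inj₂ (P , cp , sp)) (inj₂ (B , cb , sb)) = go (add-parts cp cb sp sb)
      where
      go : Found (L ++ M) ⊎ ∃[ P′ ] Parts (L ++ M) P′ × length L + length M ≤ count P′ → Plenty (L ++ M)
      go (inj₁ f) = inj₁ f
      go (inj₂ (P′ , c , s)) = inj₂ (P′ , c , ≤-trans (≤-reflexive (length-++ L)) s)

    plenty-[] : Plenty []
    plenty-[] = inj₂ (∁ (λ _ → true) , (λ { v (mem ()) }) , z≤n)

    plenty-↭ : ∀ {L M} → L ↭ M → Plenty L → Plenty M
    plenty-↭ p (inj₁ f) = inj₁ (part-↭ p f)
    plenty-↭ p (inj₂ (P , c , s)) = inj₂ (P , (λ v h → part-↭ p (c v h)) , ≤-trans (≤-reflexive (sym (↭-length p))) s)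

    level-all-inner : ∀ {L} → All Inner L → level L ≡ Q.𝟘
    level-all-inner [] = refl
    level-all-inner {g ∷ L} (i ∷ is) = trans (level-inner g L i) (level-all-inner is)

    plenty-inner : ∀ {L} → All Inner L → Plenty L
    plenty-inner [] = plenty-[]
    plenty-inner {g ∷ L} (i ∷ is) = plenty-++ {[ g ]} {L} (inj₂ (⁅ pos g ⁆ , single , ≤-reflexive (sym (count-⁅⁆ _)))) (plenty-inner is)
      where
      single : Parts [ g ] ⁅ pos g ⁆
      single v h = [ g ] , [] , ↭-refl , (λ ()) , level-all-inner {[ g ]} (i ∷ []) , [ g ] , ↭-refl , trans (trans (cong (pos g ⊕_) (⊗-zeroʳ _)) (⊕-identityʳ _)) (sym (⁅⁆⁻ h))

    -- A product commuting with an outer element is determined by its level.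
    val-commuting : ∀ {g L} → All (Comm g) L → (𝟙 ⊝ χ (lev g)) ⊗ val L ≡ (𝟙 ⊝ χ (level L)) ⊗ pos g
    val-commuting {g} [] = trans (⊗-zeroʳ _) (sym (trans (cong (λ t → (𝟙 ⊝ t) ⊗ pos g) χ-𝟘) (trans (cong (_⊗ pos g) (⊝-self 𝟙)) (⊗-zeroˡ _))))
    val-commuting {g} {h ∷ L} (c ∷ cs) = begin
      (𝟙 ⊝ m) ⊗ (v ⊕ m′ ⊗ w) ≡⟨ solve 4 (λ m v m′ w → (:1 :- m) :* (v :+ m′ :* w) := (:1 :- m) :* v :+ m′ :* ((:1 :- m) :* w)) refl m v m′ w ⟩
      (𝟙 ⊝ m) ⊗ v ⊕ m′ ⊗ ((𝟙 ⊝ m) ⊗ w) ≡⟨ cong₂ (λ s t → s ⊕ m′ ⊗ t) (sym flip) (val-commuting cs) ⟩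
      (𝟙 ⊝ m′) ⊗ u ⊕ m′ ⊗ ((𝟙 ⊝ l) ⊗ u) ≡⟨ solve 3 (λ m′ l u → (:1 :- m′) :* u :+ m′ :* ((:1 :- l) :* u) := (:1 :- m′ :* l) :* u) refl m′ l u ⟩
      (𝟙 ⊝ m′ ⊗ l) ⊗ u ≡⟨ cong (λ t → (𝟙 ⊝ t) ⊗ u) (sym (χ-⊕ _ _)) ⟩
      (𝟙 ⊝ χ (level (h ∷ L))) ⊗ u ∎
      where
      open ≡-Reasoning
      u = pos g
      v = pos h
      w = val L
      m = χ (lev g)
      m′ = χ (lev h)
      l = χ (level L)
      flip : (𝟙 ⊝ m′) ⊗ u ≡ (𝟙 ⊝ m) ⊗ v
      flip = begin
        (𝟙 ⊝ m′) ⊗ u ≡⟨ solve 4 (λ m m′ u v → (:1 :- m′) :* u := ((u :+ m :* v) :- (v :+ m′ :* u)) :+ (:1 :- m) :* v) refl m m′ u v ⟩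
        ((u ⊕ m ⊗ v) ⊝ (v ⊕ m′ ⊗ u)) ⊕ (𝟙 ⊝ m) ⊗ v ≡⟨ cong (λ t → (t ⊝ (v ⊕ m′ ⊗ u)) ⊕ (𝟙 ⊝ m) ⊗ v) c ⟩
        ((v ⊕ m′ ⊗ u) ⊝ (v ⊕ m′ ⊗ u)) ⊕ (𝟙 ⊝ m) ⊗ v ≡⟨ solve 2 (λ t w → (t :- t) :+ w := w) refl (v ⊕ m′ ⊗ u) _ ⟩
        (𝟙 ⊝ m) ⊗ v ∎

    val-outer : ∀ {g L} → Outer g → All (Comm g) L → level L ≡ Q.𝟘 → val L ≡ 𝟘
    val-outer {g} {L} og cs e = ⊗≡𝟘 {𝟙 ⊝ χ (lev g)} (trans (val-commuting cs) (trans (cong (λ t → (𝟙 ⊝ t) ⊗ pos g) (trans (cong χ e) χ-𝟘)) (trans (cong (_⊗ pos g) (⊝-self 𝟙)) (⊗-zeroˡ _)))) (𝟙⊝χ≢𝟘 _ og)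

    -- A mixed block attains enough values as a whole, commuting inner elements through their subset
    -- sums, and commuting outer elements at level zero multiply to the identity.
    plenty-block : ∀ {L} → All NonId L → level L ≡ Q.𝟘 → length L ≤ q → Plenty L
    plenty-block {[]} _ _ _ = plenty-[]
    plenty-block {x ∷ L} nid e len = by (mixed? x L)
      where
      whole : ∀ {v} → Reach (x ∷ L) v → ZeroLevelPart (x ∷ L) v
      whole h = x ∷ L , [] , ↭-sym (++-identityʳ _) , (λ ()) , e , h
      by : All (Comm x) L ⊎ Mixed (x ∷ L) → Plenty (x ∷ L)
      by (inj₂ mx) = let X , c , s = small-mixed nid mx len in inj₂ (X , (λ v h → whole (c v h)) , s)
      by (inj₁ cm) = by₂ (inner? x)
        where
        by₂ : Dec (Inner x) → Plenty (x ∷ L)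
        by₂ (yes i) = plenty-inner (i ∷ All.map (λ {y} k → comm-inner {y} {x} (All.head nid) i (comm-sym {x} {y} k)) cm)
        by₂ (no o) = inj₁ (whole (x ∷ L , ↭-refl , val-outer {x} o (comm-refl {x} ∷ cm) e))

    level-cancelˡ : ∀ A B → level (A ++ B) ≡ level A → level B ≡ Q.𝟘
    level-cancelˡ A B e = QT.⊕-cancelˡ (level A) (trans (sym (level-++ A B)) (trans e (sym (QT.⊕-identityʳ _))))

    zero-block : ∀ L → q ≤ length L → ∃[ A ] ∃[ B ] ∃[ C ] L ≡ A ++ B ++ C × B ≢ [] × length B ≤ q × level B ≡ Q.𝟘
    zero-block L h with A , B , C , e , ne , len , f ← repeated-prefix level L h =
      A , B , C , e , ne , ≤-trans (m≤n+m _ _) (≤-trans (≤-reflexive (sym (length-++ A))) len) , level-cancelˡ A B (sym f)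

    -- Prefixes of `q` elements repeat a level, so blocks of level zero and length at most `q` can
    -- be split off one by one.
    plenty : ∀ {L} → All NonId L → level L ≡ Q.𝟘 → Plenty L
    plenty {L} nid e = go (length L) L ≤-refl nid e
      where
      go : ∀ n L → length L ≤ n → All NonId L → level L ≡ Q.𝟘 → Plenty L
      go n L len nid e with length L ≤? q
      go n L len nid e | yes s = plenty-block nid e s
      go zero L len nid e | no ns = contradiction (≤-trans len z≤n) ns
      go (suc n) L len nid e | no ns with A , B , C , refl , ne , lB , zB ← zero-block L (<⇒≤ (≰⇒> ns)) =
        plenty-↭ (↭-sym p) (plenty-++ {B} {A ++ C} (plenty-block (Allₚ.++⁻ˡ B nid′) zB lB)
          (go n (A ++ C) (≤-pred (≤-trans (≤-trans (+-monoˡ-≤ (length (A ++ C)) (nonempty-length ne)) (≤-reflexive (sym (↭-++-length {as = B} p)))) len)) (Allₚ.++⁻ʳ B nid′)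
            (level-cancelˡ B (A ++ C) (trans (sym (level-↭ p)) (trans e (sym zB))))))
        where
        p : A ++ B ++ C ↭ B ++ A ++ C
        p = shifts A B
        nid′ : All NonId (B ++ A ++ C)
        nid′ = All-resp-↭ p nid

    plenty-found : ∀ {L} → Plenty L → r ≤ length L → Found L
    plenty-found (inj₁ f) _ = f
    plenty-found (inj₂ (P , c , s)) h = c 𝟘 (count-full (≤-trans h s) 𝟘)

    -- Orderings with `K` before `L` have the values a + χ(level K)b, to which Cauchy-Davenport
    -- applies. Sizes are counted minus one because that is what adds up.
    cert-++ : ∀ {K L X Y n k} → Cert K X → Cert L Y → suc n ≤ count X → suc k ≤ count Y →
      ∃[ Z ] Cert (K ++ L) Z × (r ≤ count Z ⊎ suc (n + k) ≤ count Z)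
    cert-++ {K} {L} {X} {Y} {n} {k} cx cy sx sy = X ⊞ S.image Y , cert , size (cauchy-davenport {X} {S.image Y} (proj₂ (count-witness X (≤-trans (s≤s z≤n) sx)))
          (proj₂ (count-witness (S.image Y) (≤-trans (s≤s z≤n) (≤-trans sy (≤-reflexive (sym (S.count-image Y))))))))
      where
      module S = Affine-map (χ (level K)) (χ≢𝟘 _) 𝟘
      cert : Cert (K ++ L) (X ⊞ S.image Y)
      cert v h = go (⊞⁻ {X} {S.image Y} h)
        where
        join : ∀ a b → Reach K a → Reach L (S.aff⁻¹ b) → Reach (K ++ L) (a ⊕ b)
        join a b (T , p , refl) (T′ , p′ , e) = T ++ T′ , ++⁺ p p′ , trans (val-++ T T′) (cong (val T ⊕_)
          (trans (cong₂ (λ l w → χ l ⊗ w) (sym (level-↭ p)) e) (trans (sym (⊕-identityʳ _)) (S.aff-aff⁻¹ b))))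
        go : ∃[ a ] ∃[ b ] a ∊ X × b ∊ S.image Y × v ≡ a ⊕ b → Reach (K ++ L) v
        go (a , b , ha , hb , refl) = join a b (cx a ha) (cy _ (S.image⁻ hb))
      size : r ≤ count (X ⊞ S.image Y) ⊎ count X + count (S.image Y) ≤ suc (count (X ⊞ S.image Y)) → r ≤ count (X ⊞ S.image Y) ⊎ suc (n + k) ≤ count (X ⊞ S.image Y)
      size (inj₁ f) = inj₁ f
      size (inj₂ s) = inj₂ (≤-pred (≤-trans (≤-reflexive (sym (cong suc (+-suc n k)))) (≤-trans (+-mono-≤ sx (≤-trans sy (≤-reflexive (sym (S.count-image Y))))) s)))

    NoncommutingPair : Elt × Elt → Set
    NoncommutingPair (a , b) = ¬ Comm a b

    -- Each pair is completed to a mixed group of q elements, which contributes q - 1 new values.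
    groups : ∀ ps rest → All NonId (flatten ps ++ rest) → All NoncommutingPair ps → length ps * (q ∸ 2) ≤ length rest →
      ∃[ L ] ∃[ U ] flatten ps ++ rest ↭ L ++ U × ∃[ X ] Cert L X × (r ≤ count X ⊎ suc (length ps * (q ∸ 1)) ≤ count X)
    groups [] rest nid [] h = [] , rest , ↭-refl , ⁅ 𝟘 ⁆ , (λ v k → [] , ↭-refl , sym (⁅⁆⁻ k)) , inj₂ (≤-reflexive (sym (count-⁅⁆ _)))
    groups ((a , b) ∷ ps) rest nid (nc ∷ ncs) h with A , B , refl , lA ← split-at (q ∸ 2) rest (≤-trans (m≤m+n _ _) h) =
      go (groups ps B (Allₚ.++⁻ʳ grp nid′) ncs (+-cancelˡ-≤ (q ∸ 2) _ _ (≤-trans h (≤-reflexive (trans (length-++ A) (cong (_+ length B) lA))))))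
      where
      grp = a ∷ b ∷ A
      perm : a ∷ b ∷ flatten ps ++ A ++ B ↭ grp ++ flatten ps ++ B
      perm = prep a (prep b (shifts (flatten ps) A))
      nid′ : All NonId (grp ++ flatten ps ++ B)
      nid′ = All-resp-↭ perm nid
      2≤q : 2 ≤ q
      2≤q = ≤-trans (n≤1+n 2) 3≤q
      lgrp : length grp ≡ q
      lgrp = trans (cong (2 +_) lA) (m+[n∸m]≡n 2≤q)
      Goal = ∃[ L ] ∃[ U ] a ∷ b ∷ flatten ps ++ A ++ B ↭ L ++ U × ∃[ X ] Cert L X × (r ≤ count X ⊎ suc (suc (length ps) * (q ∸ 1)) ≤ count X)
      go : ∃[ L ] ∃[ U ] flatten ps ++ B ↭ L ++ U × ∃[ X ] Cert L X × (r ≤ count X ⊎ suc (length ps * (q ∸ 1)) ≤ count X) → Goal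
      go (L , U , p , X , c , inj₁ f) = let X′ , c′ , e = keep-++ grp c in
        grp ++ L , U , ↭-trans perm (↭-trans (++⁺ˡ grp p) (↭-reflexive (sym (≡-assoc grp L U)))) , X′ , c′ , inj₁ (≤-trans f (≤-reflexive (sym e)))
      go (L , U , p , X , c , inj₂ s) = let Y , cy , sy = small-mixed (Allₚ.++⁻ˡ grp nid′) (a , b , A , ↭-refl , nc) (≤-reflexive lgrp)
                                            Z , cz , sz = cert-++ cy c (≤-trans (≤-reflexive (trans (m+[n∸m]≡n (≤-trans (n≤1+n 1) 2≤q)) (sym lgrp))) sy) s in
        grp ++ L , U , ↭-trans perm (↭-trans (++⁺ˡ grp p) (↭-reflexive (sym (≡-assoc grp L U)))) , Z , cz , sz

    -- Each of the groups takes two elements from a pair and q - 2 from `rest`, so room for q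
    -- elements per pair is enough.
    full-groups : ∀ {R ps rest} → All NonId R → R ↭ flatten ps ++ rest → All NoncommutingPair ps →
      r ≤ suc (length ps * (q ∸ 1)) → length ps * q ≤ length R → Full R
    full-groups {R} {ps} {rest} nid p nc big len = go (groups ps rest (All-resp-↭ p nid) nc room)
      where
      k = length ps
      open ≤-Reasoning
      room : k * (q ∸ 2) ≤ length rest
      room = +-cancelˡ-≤ (k + k) _ _ (begin
        k + k + k * (q ∸ 2) ≡⟨ cong (_+ k * (q ∸ 2)) (trans (cong (k +_) (sym (+-identityʳ k))) (*-comm 2 k)) ⟩
        k * 2 + k * (q ∸ 2) ≡⟨ sym (*-distribˡ-+ k 2 (q ∸ 2)) ⟩
        k * (2 + (q ∸ 2)) ≡⟨ cong (k *_) (m+[n∸m]≡n (≤-trans (n≤1+n 2) 3≤q)) ⟩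
        k * q ≤⟨ len ⟩
        length R ≡⟨ ↭-++-length {as = flatten ps} p ⟩
        length (flatten ps) + length rest ≡⟨ cong (_+ length rest) (length-flatten ps) ⟩
        k + k + length rest ∎)
      go : ∃[ L ] ∃[ U ] flatten ps ++ rest ↭ L ++ U × ∃[ X ] Cert L X × (r ≤ count X ⊎ suc (k * (q ∸ 1)) ≤ count X) → Full R
      go (L , U , p′ , X , c , s) = full-↭ (↭-trans (++-comm U L) (↭-trans (↭-sym p′) (↭-sym p))) (full-++ U (full-cert c (reaches s)))
        where
        reaches : r ≤ count X ⊎ suc (k * (q ∸ 1)) ≤ count X → r ≤ count X
        reaches (inj₁ f) = f
        reaches (inj₂ f) = ≤-trans big f

-- Splitting product-one lists longer than 2r over the affine group.

module PQ where

  open import Data.Nat.Divisibility using (n∣m*n)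
  open Counting
  open ZMod
  open FieldSets
  open Lists
  open Affine
  open Spread
  open Blocks
  open import Data.Nat using (ℕ; suc; pred; _+_; _*_; _∸_; _≤_; _<_; z≤n; s≤s; _≤?_; NonZero; >-nonZero; _<?_)
  open import Data.Nat.Properties hiding (_≟_)
  open import Data.Nat.Solver using (module +-*-Solver)
  open import Data.Fin using (Fin; _≟_)
  open import Data.List using (List; []; _∷_; _++_; length; [_])
  open import Data.List.Properties using (length-++; ++-conicalˡ) renaming (++-assoc to ≡-assoc; ++-identityʳ to ≡-identityʳ)
  open import Data.List.Relation.Unary.All using (All; []; _∷_)
  import Data.List.Relation.Unary.All as All
  import Data.List.Relation.Unary.All.Properties as Allₚ
  import Data.List.Relation.Unary.Any as Any
  open import Data.List.Membership.Propositional using (_∈_; find)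
  open import Data.List.Membership.Propositional.Properties using (∈-∃++)
  open import Data.List.Relation.Binary.Permutation.Propositional hiding (trans)
  open import Data.List.Relation.Binary.Permutation.Propositional.Properties
  open import Data.Product using (∃-syntax; _×_; _,_; proj₁; proj₂)
  open import Data.Product.Properties using (≡-dec)
  open import Data.Sum using (_⊎_; inj₁; inj₂)
  open import Data.Unit using (⊤; tt)
  open import Function using (id)
  open import Relation.Nullary using (Dec; yes; no; contradiction)
  open import Relation.Nullary.Decidable using (¬?; _×-dec_)
  open import Relation.Binary.PropositionalEquality hiding ([_]; J)

  private
    arith₁ : ∀ {J q G} → 2 ≤ J → 3 ≤ q → suc G ≡ J + J → J * q ≤ G * (q ∸ 1)
    arith₁ {suc (suc j)} {suc (suc (suc k))} {G} (s≤s (s≤s _)) (s≤s (s≤s (s≤s _))) e = subst (λ t → (2 + j) * (3 + k) ≤ t * (2 + k)) (sym G≡)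
        (≤-trans (m≤m+n _ (k + j + j * k)) (≤-reflexive (solve 2 (λ j k → (con 2 :+ j) :* (con 3 :+ k) :+ (k :+ j :+ j :* k) := (con 3 :+ j :+ j) :* (con 2 :+ k)) refl j k)))
      where
      open +-*-Solver
      G≡ : G ≡ 3 + j + j
      G≡ = trans (cong pred e) (solve 1 (λ j → con 1 :+ (j :+ (con 2 :+ j)) := con 3 :+ j :+ j) refl j)

    arith₂ : ∀ {J q G} → 2 ≤ J → 3 ≤ q → suc G ≡ J + J → q + G ≤ suc (J * q)
    arith₂ {suc (suc j)} {suc (suc (suc k))} {G} (s≤s (s≤s _)) (s≤s (s≤s (s≤s _))) e = subst (λ t → (3 + k) + t ≤ suc ((2 + j) * (3 + k))) (sym G≡)
        (≤-trans (m≤m+n _ (1 + k + j + j * k)) (≤-reflexive (solve 2 (λ j k → (con 3 :+ k) :+ (con 3 :+ j :+ j) :+ (con 1 :+ k :+ j :+ j :* k) := con 1 :+ (con 2 :+ j) :* (con 3 :+ k)) refl j k)))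
      where
      open +-*-Solver
      G≡ : G ≡ 3 + j + j
      G≡ = trans (cong pred e) (solve 1 (λ j → con 1 :+ (j :+ (con 2 :+ j)) := con 3 :+ j :+ j) refl j)

    arith₃ : ∀ j q → j * q + (q + q) + q ≡ (3 + j) * q
    arith₃ = solve 2 (λ j q → j :* q :+ (q :+ q) :+ q := (con 3 :+ j) :* q) refl
      where open +-*-Solver

  module Splitting {r q : ℕ} (SD : Semidirect r q) where
    open Semidirect SD
    open FieldTheory Fr
    open Sets Fr
    open Elements SD
    open Spreading SD
    open ZeroSums SD

    Splits : List Elt → Set
    Splits S = ∃[ A ] ∃[ B ] S ↭ A ++ B × A ≢ [] × B ≢ [] × IsOne A × IsOne B

    private
      J : ℕ
      J = proj₁ Ω.r≡1+kq

      r≡ : r ≡ suc (J * q)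
      r≡ = proj₂ Ω.r≡1+kq

      instance
        q≢0 : NonZero q
        q≢0 = >-nonZero (≤-trans (s≤s z≤n) 3≤q)

      2≤J : 2 ≤ J
      2≤J = *-cancelʳ-≤ 2 J q (≤-pred (subst (2 * q <_) r≡ 2q<r))

      -- The number of groups of `q` elements that survive the removal of at most `q` elements from
      -- more than 2r: 2(r - 1) = 2Jq = (G + 1)q.
      G : ℕ
      G = pred (J + J)

      suc-G : suc G ≡ J + J
      suc-G = suc-pred (J + J) {{>-nonZero (≤-trans (≤-trans (s≤s z≤n) 2≤J) (m≤m+n J J))}}

      r≤groups : r ≤ suc (G * (q ∸ 1))
      r≤groups = ≤-trans (≤-reflexive r≡) (s≤s (arith₁ 2≤J 3≤q suc-G))

      q+G≤r : q + G ≤ r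
      q+G≤r = ≤-trans (arith₂ 2≤J 3≤q suc-G) (≤-reflexive (sym r≡))

    cut : ∀ A B C → val (A ++ B ++ C) ≡ 𝟘 → level (A ++ B ++ C) ≡ Q.𝟘 → level B ≡ Q.𝟘 → val B ≡ 𝟘 → IsOne B × IsOne (A ++ C)
    cut A B C v l lB vB = (lB , B , ↭-refl , vB) , trans (sym lAC) l , A ++ C , ↭-refl , trans (sym vAC) v
      where
      lBC : level (B ++ C) ≡ level C
      lBC = trans (level-++ B C) (trans (cong (Q._⊕ level C) lB) (QT.⊕-identityˡ _))
      vBC : val (B ++ C) ≡ val C
      vBC = trans (val-++ B C) (trans (cong₂ (λ s t → s ⊕ χ t ⊗ val C) vB lB) (trans (⊕-identityˡ _) (trans (cong (_⊗ val C) χ-𝟘) (⊗-identityˡ _))))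
      lAC : level (A ++ B ++ C) ≡ level (A ++ C)
      lAC = trans (level-++ A (B ++ C)) (trans (cong (level A Q.⊕_) lBC) (sym (level-++ A C)))
      vAC : val (A ++ B ++ C) ≡ val (A ++ C)
      vAC = trans (val-++ A (B ++ C)) (trans (cong (λ t → val A ⊕ χ (level A) ⊗ t) vBC) (sym (val-++ A C)))

    splits-at : ∀ {S} A B C → IsOne S → S ↭ A ++ B ++ C → val (A ++ B ++ C) ≡ 𝟘 → level B ≡ Q.𝟘 → val B ≡ 𝟘 → B ≢ [] → length B < length S → Splits S
    splits-at {S} A B C (l , _) p v lB vB ne lt with oB , oAC ← cut A B C v (trans (sym (level-↭ p)) l) lB vB =
      B , A ++ C , p′ , ne , length-nonempty (+-cancelˡ-< (length B) _ _ (subst (length B + 0 <_) (↭-++-length {as = B} p′) (subst (_< length S) (sym (+-identityʳ _)) lt))) , oB , oAC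
      where
      p′ : S ↭ B ++ A ++ C
      p′ = ↭-trans p (shifts A B)

    -- The level of `R` vanishes with those of `S` and `T`, so a full `R` attains the identity.
    finish : ∀ {S T R} → IsOne S → S ↭ T ++ R → T ≢ [] → IsOne T → R ≢ [] → Full R → Splits S
    finish {S} {T} {R} (l , _) p neT oT neR f = T , R , p , neT , neR , oT , level-cancelˡ T R (trans (sym (level-↭ p)) (trans l (sym (proj₁ oT)))) , f 𝟘

    with-identity : ∀ {S} → IsOne S → 1 < length S → one ∈ S → Splits S
    with-identity {S} o@(l , S₀ , p , v) lt m with A , C , refl ← ∈-∃++ (∈-resp-↭ p m) =
      splits-at A [ one ] C o p v (QT.⊕-identityʳ _) (trans (⊕-identityˡ _) (⊗-zeroʳ _)) (λ ()) lt

    -- `q` consecutive elements of a point stabiliser contain a block of level zero. Its product is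
    -- the identity, so it can be cut out of the given product-one ordering.
    window-splits : ∀ {S y} A B C → IsOne S → S ↭ A ++ B ++ C → val (A ++ B ++ C) ≡ 𝟘 → Outer y → All (Comm y) B → q ≤ length B → q < length S → Splits S
    window-splits {S} {y} A B C o p v oy cm len lt with X , Y , Z , refl , ne , lY , zY ← zero-block B len =
      splits-at (A ++ X) Y (Z ++ C) o (↭-trans p (↭-reflexive eq)) (trans (cong val (sym eq)) v) zY
        (val-outer {y} oy (Allₚ.++⁻ˡ Y (Allₚ.++⁻ʳ X cm)) zY) ne (≤-<-trans lY lt)
      where
      eq : A ++ (X ++ Y ++ Z) ++ C ≡ (A ++ X) ++ Y ++ Z ++ C
      eq = trans (cong (A ++_) (trans (≡-assoc X (Y ++ Z) C) (cong (X ++_) (≡-assoc Y Z C)))) (sym (≡-assoc A X (Y ++ Z ++ C)))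

    -- Here reordering is useless; instead prefixes of the given ordering repeat, by level for an
    -- outer `x` and by value for an inner one.
    one-class : ∀ {S x} → IsOne S → NonId x → All (Comm x) S → r < length S → Splits S
    one-class {S} {x} o@(l , S₀ , p , v) nx cm lt with inner? x
    ... | no ox = window-splits {S} {x} [] S₀ [] o (↭-trans p (↭-sym (++-identityʳ S₀))) (trans (cong val (≡-identityʳ S₀)) v) ox (All-resp-↭ p cm)
                    (≤-trans (<⇒≤ (<-trans q<r lt)) (≤-reflexive (↭-length p))) (<-trans q<r lt)
    ... | yes ix with A , B , C , refl , ne , len , e ← repeated-prefix val S₀ (≤-trans (<⇒≤ lt) (≤-reflexive (↭-length p))) =
        splits-at A B C o p v (level-all-inner (Allₚ.++⁻ˡ B (Allₚ.++⁻ʳ A inn))) vB ne (≤-<-trans (≤-trans (m≤n+m _ _) (≤-trans (≤-reflexive (sym (length-++ A))) len)) lt)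
      where
      inn : All Inner (A ++ B ++ C)
      inn = All.map (λ {y} k → comm-inner {y} {x} nx ix (comm-sym {x} {y} k)) (All-resp-↭ p cm)
      vB : val B ≡ 𝟘
      vB = ⊗≡𝟘 {χ (level A)} (⊕-cancelˡ (val A) (trans (sym (val-++ A B)) (trans (sym e) (sym (⊕-identityʳ _))))) (χ≢𝟘 _)

    module Commuting = Pairing {Elt} {Comm} comm? {NonId} (λ x → comm-refl {x}) (λ {x} {y} → comm-sym {x} {y}) (λ {x} {y} {z} n → comm-trans {x} {y} {z} n)
    module OuterCommuting = Pairing {Elt} {Comm} comm? {Outer} (λ x → comm-refl {x}) (λ {x} {y} → comm-sym {x} {y}) (λ {x} {y} {z} n → comm-trans {x} {y} {z} (outer-nonid n))
    module SameLevel = Pairing {Elt} {λ x y → lev x ≡ lev y} (λ x y → lev x ≟ lev y) {NonId} (λ x → refl) sym (λ _ → trans)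

    -- The bound r leaves more than r elements, as `spread` demands.
    ShortOne : List Elt → Set
    ShortOne S = ∃[ T ] ∃[ R ] S ↭ T ++ R × T ≢ [] × IsOne T × length T ≤ r

    short-found : ∀ {S K U} → S ↭ K ++ U → length K ≤ r → Found K → ShortOne S
    short-found {S} {K} {U} p len (T , R , e , ne , l , rc) = T , R ++ U , ↭-trans p (↭-trans (++⁺ʳ U e) (↭-reflexive (≡-assoc T R U))) , ne , (l , rc) ,
      ≤-trans (m≤m+n _ _) (≤-trans (≤-reflexive (sym (↭-++-length {as = T} e))) len)

    level-const : ∀ {e L} → All (λ x → lev x ≡ e) L → level L ≡ Q.nat (length L) Q.⊗ e
    level-const {e} [] = sym (trans (cong (Q._⊗ e) Q.nat-0) (QT.⊗-zeroˡ e))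
    level-const {e} {x ∷ L} (h ∷ hs) = trans (cong₂ Q._⊕_ h (level-const hs)) (trans
      (QT.solve 2 (λ e n → e QT.:+ n QT.:* e QT.:= (QT.:1 QT.:+ n) QT.:* e) refl e (Q.nat (length L)))
      (cong (Q._⊗ e) (trans (cong (Q._⊕ Q.nat (length L)) (sym Q.nat-1)) (sym (Q.nat-+ 1 (length L))))))

    level-period : ∀ {e L k} → All (λ x → lev x ≡ e) L → length L ≡ k * q → level L ≡ Q.𝟘
    level-period {e} {L} {k} h len = trans (level-const h) (trans (cong (Q._⊗ e) (trans (cong Q.nat len) (Q.nat≡𝟘⁺ (k * q) (n∣m*n k)))) (QT.⊗-zeroˡ e))

    flatten-pairs : ∀ {P : Elt → Set} ps → All P (flatten ps) → All (λ ab → P (proj₁ ab) × P (proj₂ ab)) ps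
    flatten-pairs [] [] = []
    flatten-pairs (_ ∷ ps) (a ∷ b ∷ h) = (a , b) ∷ flatten-pairs ps h

    module LevelChoice = Choice Fq level lev (λ _ → ⊤) id id (λ _ → refl) (λ _ → refl) (λ x L _ → QT.⊕-comm (lev x) (level L))

    private
      q-1 = q ∸ 1

      suc-q-1 : suc q-1 ≡ q
      suc-q-1 = m+[n∸m]≡n (≤-trans (s≤s z≤n) 3≤q)

    module _ {S : List Elt} (nid : All NonId S) (long : r + r < length S) where
      private
        r+q≤S : r + q ≤ length S
        r+q≤S = ≤-trans (+-monoʳ-≤ r (<⇒≤ q<r)) (<⇒≤ long)

      -- Choices from q - 1 pairs of distinct levels attain every level. So some r elements have
      -- level zero, and that many contain a product-one part.
      varied-levels : ∀ {ps rest} → S ↭ flatten ps ++ rest → length ps ≡ q-1 → All SameLevel.Apart ps → ShortOne S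
      varied-levels {ps} {rest} p l ap = go₀ (split-at (r ∸ q-1) rest room)
        where
        room : r ∸ q-1 ≤ length rest
        room = ≤-trans (∸-monoˡ-≤ q-1 (m+n≤o⇒m≤o∸n r (≤-trans (+-monoʳ-≤ r (m∸n≤m q 1)) r+q≤S))) (≤-reflexive
          (trans (cong (λ t → t ∸ q-1 ∸ q-1) (trans (↭-++-length {as = flatten ps} p) (cong (_+ length rest) (trans (length-flatten ps) (cong₂ _+_ l l)))))
            (trans (∸-+-assoc (q-1 + q-1 + length rest) q-1 q-1) (m+n∸m≡n (q-1 + q-1) (length rest)))))
        q-1≤r : q-1 ≤ r
        q-1≤r = ≤-trans (m∸n≤m q 1) (<⇒≤ q<r)
        go₀ : ∃[ M ] ∃[ N ] rest ≡ M ++ N × length M ≡ r ∸ q-1 → ShortOne S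
        go₀ (M , N , refl , lM) = go (LevelChoice.choose ps (All.map (λ n → tt , tt , n) ap))
          where
          use : LevelChoice.Selects ps (Q.⊖ level M) → ShortOne S
          use (L , U , e , lL , ev) = short-found {S} {L ++ M} {U ++ N} perm (≤-reflexive len) (plenty-found (plenty nid′ zl) (≤-reflexive (sym len)))
            where
            len : length (L ++ M) ≡ r
            len = trans (length-++ L) (trans (cong₂ _+_ (trans lL l) lM) (m+[n∸m]≡n q-1≤r))
            perm : S ↭ (L ++ M) ++ U ++ N
            perm = ↭-trans p (↭-trans (++⁺ʳ (M ++ N) e) (↭-trans (↭-reflexive (≡-assoc L U (M ++ N))) (↭-trans (++⁺ˡ L (shifts U M)) (↭-reflexive (sym (≡-assoc L M (U ++ N)))))))
            nid′ : All NonId (L ++ M)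
            nid′ = Allₚ.++⁻ˡ (L ++ M) (All-resp-↭ perm nid)
            zl : level (L ++ M) ≡ Q.𝟘
            zl = trans (level-++ L M) (trans (cong (Q._⊕ level M) ev) (QT.⊖-inverseˡ (level M)))
          go : ∃[ Y ] (∀ v → v ∊ Y → LevelChoice.Selects ps v) × 1 ≤ count Y × (q ≤ count Y ⊎ suc (length ps) ≤ count Y) → ShortOne S
          go (Y , sel , _ , inj₁ f) = use (sel _ (count-full f _))
          go (Y , sel , _ , inj₂ f) = use (sel _ (count-full (≤-trans (≤-reflexive (trans (sym suc-q-1) (cong suc (sym l)))) f) _))

      -- Nearly all elements share a level e ≠ 0, so any `q` of those have level zero. Parts of (J -
      -- 1)q of them take (J - 1)q values, or one more with the empty part, unless the identity
      -- already occurs; choices from `q` pairs take q + 1 values, unless they take all. Together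
      -- this is r + 1, so a sum vanishes, using at most Jq < r elements.
      module OneLevel (e : Fin q) (e≢𝟘 : e ≢ Q.𝟘) {as bs : List Elt} (p : S ↭ as ++ bs) (lv : All (λ x → lev x ≡ e) as) (few : length bs < q-1) (bd : Bounded S) where
        private
          J′ : ℕ
          J′ = pred J

          sucJ′ : suc J′ ≡ J
          sucJ′ = suc-pred J {{>-nonZero (≤-trans (s≤s z≤n) 2≤J)}}

        many : J′ * q + (q + q) ≤ length as
        many = +-cancelʳ-≤ q _ _ (begin
          J′ * q + (q + q) + q ≡⟨ arith₃ J′ q ⟩
          (3 + J′) * q ≤⟨ *-monoˡ-≤ q (≤-trans (≤-reflexive (cong (2 +_) sucJ′)) (+-monoˡ-≤ J 2≤J)) ⟩
          (J + J) * q ≡⟨ *-distribʳ-+ q J J ⟩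
          J * q + J * q ≤⟨ +-mono-≤ (≤-trans (n≤1+n _) (≤-reflexive (sym r≡))) (≤-trans (n≤1+n _) (≤-reflexive (sym r≡))) ⟩
          r + r ≤⟨ <⇒≤ long ⟩
          length S ≡⟨ ↭-++-length {as = as} p ⟩
          length as + length bs ≤⟨ +-monoʳ-≤ (length as) (≤-trans (<⇒≤ few) (m∸n≤m q 1)) ⟩
          length as + q ∎)
          where
          open ≤-Reasoning

        module Scale = Affine-map (χ e) (χ≢𝟘 e) 𝟘
        module ValChoice = Choice Fr val pos (λ x → lev x ≡ e) Scale.aff Scale.aff⁻¹ Scale.aff-aff⁻¹ Scale.aff⁻¹-aff
          (λ x L h → trans (cong (λ t → pos x ⊕ χ t ⊗ val L) h) (trans (⊕-comm _ _) (cong (_⊕ pos x) (sym (⊕-identityʳ _)))))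

        outer-as : All Outer as
        outer-as = All.map (λ h z → e≢𝟘 (trans (sym h) z)) lv

        from-pairs : ∀ {ps rest} → as ↭ flatten ps ++ rest → length ps ≡ q → All OuterCommuting.Apart ps → ShortOne S
        from-pairs {ps} {rest} pa l ap = go (split-at (J′ * q) rest room)
          where
          lv′ : All (λ x → lev x ≡ e) (flatten ps ++ rest)
          lv′ = All-resp-↭ pa lv
          room : J′ * q ≤ length rest
          room = +-cancelˡ-≤ (q + q) _ _ (≤-trans (≤-reflexive (+-comm (q + q) _)) (≤-trans many (≤-reflexive (trans (↭-++-length {as = flatten ps} pa) (cong (_+ length rest) (trans (length-flatten ps) (cong₂ _+_ l l)))))))
          good : All (λ { (a , b) → lev a ≡ e × lev b ≡ e × pos a ≢ pos b }) ps
          good = All.zipWith (λ { {a , b} ((ha , hb) , nc) → ha , hb , λ z → nc (subst (Comm a) (cong₂ _,_ z (trans ha (sym hb))) (comm-refl {a})) }) (flatten-pairs ps (Allₚ.++⁻ˡ (flatten ps) lv′) , ap)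
          go : ∃[ M ] ∃[ N ] rest ≡ M ++ N × length M ≡ J′ * q → ShortOne S
          go (M , N , refl , lM) = by (plenty nidM zM)
            where
            lvM : All (λ x → lev x ≡ e) M
            lvM = Allₚ.++⁻ˡ M (Allₚ.++⁻ʳ (flatten ps) lv′)
            nidM : All NonId M
            nidM = All.map (λ h → outer-nonid (λ z → e≢𝟘 (trans (sym h) z))) lvM
            zM : level M ≡ Q.𝟘
            zM = level-period {k = J′} lvM lM
            M+q<r : length M + q < r
            M+q<r = ≤-reflexive (trans (cong suc (trans (cong (_+ q) lM) (trans (+-comm _ q) (cong (_* q) sucJ′)))) (sym r≡))
            perm : S ↭ M ++ (flatten ps ++ N ++ bs)
            perm = ↭-trans p (↭-trans (++⁺ʳ bs pa) (↭-trans (↭-reflexive (trans (≡-assoc (flatten ps) (M ++ N) bs) (cong (flatten ps ++_) (≡-assoc M N bs)))) (shifts (flatten ps) M)))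
            selected : ∀ {v} → ValChoice.Selects ps v → ∃[ L ] ∃[ U ] flatten ps ↭ L ++ U × length L ≡ q × level L ≡ Q.𝟘 × Reach L v
            selected (L , U , e′ , lL , ev) = L , U , e′ , trans lL l , level-period {k = 1} (Allₚ.++⁻ˡ L (All-resp-↭ e′ (Allₚ.++⁻ˡ (flatten ps) lv′))) (trans lL (trans l (sym (+-identityʳ q)))) , L , ↭-refl , ev
            q-nonempty : ∀ {L : List Elt} → length L ≡ q → L ≢ []
            q-nonempty h = length-nonempty (≤-trans (≤-trans (s≤s z≤n) 3≤q) (≤-reflexive (sym h)))
            alone : ∀ {v} → v ≡ 𝟘 → ValChoice.Selects ps v → ShortOne S
            alone refl sl with L , U , e′ , lL , zL , rL ← selected sl = L , U ++ N ++ bs ++ M ,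
              ↭-trans perm (↭-trans (++-comm M _) (↭-trans (↭-reflexive (trans (≡-assoc (flatten ps) (N ++ bs) M) (cong (flatten ps ++_) (≡-assoc N bs M)))) (↭-trans (++⁺ʳ (N ++ bs ++ M) e′) (↭-reflexive (≡-assoc L U _))))) ,
              q-nonempty lL , (zL , rL) , ≤-trans (≤-reflexive lL) (<⇒≤ q<r)
            joined : ∀ {a} → ZeroLevelPart M a → ValChoice.Selects ps (⊖ a) → ShortOne S
            joined {a} (T , R , eT , neT , lT , rT) sl with L , U , e′ , lL , zL , rL ← selected sl = T ++ L , R ++ U ++ N ++ bs ,
              ↭-trans perm (↭-trans (++⁺ eT (++⁺ʳ (N ++ bs) e′)) (↭-trans (↭-reflexive (≡-assoc T R _)) (↭-trans (++⁺ˡ T (↭-trans (↭-reflexive (cong (R ++_) (≡-assoc L U (N ++ bs)))) (shifts R L))) (↭-reflexive (sym (≡-assoc T L _)))))) ,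
              (λ z → neT (++-conicalˡ T L z)) ,
              (trans (level-++ T L) (trans (cong₂ Q._⊕_ lT zL) (QT.⊕-identityˡ _)) , subst (Reach (T ++ L)) (⊖-inverseʳ a) (reach-++ {T} {L} lT rT rL)) ,
              <⇒≤ (≤-<-trans (≤-trans (≤-reflexive (length-++ T)) (+-mono-≤ (≤-trans (m≤m+n _ _) (≤-reflexive (sym (↭-++-length {as = T} eT)))) (≤-reflexive lL))) M+q<r)
            by : Plenty M → ShortOne S
            by (inj₁ f) = short-found perm (≤-trans (m≤m+n _ q) (<⇒≤ M+q<r)) f
            by (inj₂ (P , parts , sP)) = by₂ (𝟘 ∊? P) (ValChoice.choose ps good)
              where
              by₂ : Dec (𝟘 ∊ P) → ∃[ Y ] (∀ v → v ∊ Y → ValChoice.Selects ps v) × 1 ≤ count Y × (r ≤ count Y ⊎ suc (length ps) ≤ count Y) → ShortOne S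
              by₂ (yes z) _ = short-found perm (≤-trans (m≤m+n _ q) (<⇒≤ M+q<r)) (parts 𝟘 z)
              by₂ (no _) (Y , sel , _ , inj₁ f) = alone refl (sel 𝟘 (count-full f 𝟘))
              by₂ (no nz) (Y , sel , _ , inj₂ f) = meet (sum-zero {0∪ P} {Y} size)
                where
                open ≤-Reasoning
                size : r < count (0∪ P) + count Y
                size = begin
                  suc r ≡⟨ cong suc (trans r≡ (cong suc (trans (cong (_* q) (sym sucJ′)) (+-comm q (J′ * q))))) ⟩
                  suc (suc (J′ * q + q)) ≡⟨ cong suc (sym (+-suc (J′ * q) q)) ⟩
                  suc (J′ * q) + suc q ≤⟨ +-mono-≤ (s≤s (≤-trans (≤-reflexive (sym lM)) sP)) (≤-trans (≤-reflexive (cong suc (sym l))) f) ⟩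
                  suc (count P) + count Y ≡⟨ cong (_+ count Y) (sym (count-0∪ nz)) ⟩
                  count (0∪ P) + count Y ∎
                meet₂ : ∀ a → a ∊ ⁅ 𝟘 ⁆ ⊎ a ∊ P → (⊖ a) ∊ Y → ShortOne S
                meet₂ a (inj₁ z) hy = alone (trans (cong ⊖_ (⁅⁆⁻ z)) (trans (sym (⊕-identityˡ _)) (⊖-inverseʳ 𝟘))) (sel _ hy)
                meet₂ a (inj₂ ha) hy = joined (parts a ha) (sel _ hy)
                meet : ∃[ a ] a ∊ 0∪ P × (⊖ a) ∊ Y → ShortOne S
                meet (a , ha , hy) = meet₂ a (∪⁻ {X = ⁅ 𝟘 ⁆} {P} ha) hy

        result : ShortOne S
        result with OuterCommuting.pairs q as outer-as (≤-trans (m≤n+m (q + q) (J′ * q)) many)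
        ... | inj₁ (ps , rest , pa , l , ap) = from-pairs pa l ap
        -- Without `q` noncommuting pairs all but fewer than `q` elements lie in one stabiliser,
        -- which itself holds fewer than `q`: too few in all.
        ... | inj₂ (y , cs , ds , pc , oy , cm , few′) = contradiction (≤-trans (m≤n+m (q + q) (J′ * q)) many) (<⇒≱ (begin-strict
            length as ≡⟨ ↭-++-length {as = cs} pc ⟩
            length cs + length ds <⟨ +-mono-< (bd y oy cs (ds ++ bs) (↭-trans p (↭-trans (++⁺ʳ bs pc) (↭-reflexive (≡-assoc cs ds bs)))) cm) few′ ⟩
            q + q ∎))
          where open ≤-Reasoning

      -- Unless there are q - 1 pairs of distinct levels, nearly all elements share a level, and
      -- this is not zero for lack of r inner elements.
      short-one : Bounded S → # inner? S < r → ShortOne S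
      short-one bd fewInner with SameLevel.pairs q-1 S nid (≤-trans (+-mono-≤ (m∸n≤m q 1) (m∸n≤m q 1)) (≤-trans (+-monoˡ-≤ q (<⇒≤ q<r)) r+q≤S))
      ... | inj₁ (ps , rest , p , l , ap) = varied-levels p l ap
      ... | inj₂ (x , as , bs , p , nx , lv , few) with lev x ≟ Q.𝟘
      ... | no ne = OneLevel.result (lev x) ne p (All.map sym lv) few bd
      ... | yes z = contradiction (≤-trans r≤as (#-part inner? p (All.map (λ h → trans (sym h) z) lv))) (<⇒≱ fewInner)
        where
        r≤as : r ≤ length as
        r≤as = +-cancelʳ-≤ q _ _ (≤-trans r+q≤S (≤-trans (≤-reflexive (↭-++-length {as = as} p)) (+-monoʳ-≤ (length as) (≤-trans (<⇒≤ few) (m∸n≤m q 1)))))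

      r<rest : ∀ {T R} → S ↭ T ++ R → length T ≤ r → r < length R
      r<rest {T} {R} p le = +-cancelˡ-< r _ _ (<-≤-trans long (≤-trans (≤-reflexive (↭-++-length {as = T} p)) (+-monoˡ-≤ (length R) le)))

      bounded-part : ∀ {T R} → Bounded S → S ↭ T ++ R → Bounded R
      bounded-part {T} {R} bd p g og A B e = bd g og A (B ++ T) (↭-trans p (↭-trans (++-comm T R) (↭-trans (++⁺ʳ T e) (↭-reflexive (≡-assoc A B T)))))

      -- If there are r inner elements, `T` is a zero sum of some of them and the remainder keeps an
      -- outer element, which cannot commute with all the others. With fewer, no class is large
      -- enough to contain a remainder of more than r elements.
      bounded-case : IsOne S → Mixed S → Bounded S → Splits S
      bounded-case o mx bd with #-select inner? S
      ... | I , O , p , ins , outs , lI with r ≤? length I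
      ... | no few = by (short-one bd (subst (_< r) lI (≰⇒> few)))
        where
        by : ShortOne S → Splits S
        by (T , [] , pT , neT , oT , le) = contradiction (r<rest {T} {[]} pT le) λ ()
        by (T , x ∷ R , pT , neT , oT , le) = finish o pT neT oT (λ ()) (spread nidR mxR (bounded-part {T} bd pT) lt)
          where
          lt : r < length (x ∷ R)
          lt = r<rest {T} pT le
          nidR : All NonId (x ∷ R)
          nidR = Allₚ.++⁻ʳ T (All-resp-↭ pT nid)
          mxR : Mixed (x ∷ R)
          mxR with mixed? x R
          ... | inj₂ m = m
          ... | inj₁ cm with inner? x
          ... | no ox = contradiction (bounded-part {T} bd pT x ox (x ∷ R) [] (↭-sym (++-identityʳ _)) (comm-refl {x} ∷ cm)) (<⇒≯ (<-trans q<r lt))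
          ... | yes ix = contradiction (≤-trans (<⇒≤ lt) (≤-trans (#-part inner? (↭-trans pT (++-comm T (x ∷ R))) (ix ∷ All.map (λ {y} k → comm-inner {y} {x} (All.head nidR) ix (comm-sym {x} {y} k)) cm)) (≤-reflexive (sym lI)))) few
      ... | yes many with I₁ , I₂ , refl , l₁ ← split-at r I many = by (plenty-found (plenty-inner (Allₚ.++⁻ˡ I₁ ins)) (≤-reflexive (sym l₁))) O refl
        where
        by : Found I₁ → ∀ O′ → O ≡ O′ → Splits S
        by _ [] refl = contradiction (inner-comm {proj₁ mx} {proj₁ (proj₂ mx)} (All.head allI) (All.head (All.tail allI))) (proj₂ (proj₂ (proj₂ (proj₂ mx))))
          where
          allI : All Inner (proj₁ mx ∷ proj₁ (proj₂ mx) ∷ proj₁ (proj₂ (proj₂ mx)))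
          allI = All-resp-↭ (proj₁ (proj₂ (proj₂ (proj₂ mx)))) (All-resp-↭ (↭-sym p) (Allₚ.++⁺ ins []))
        by (T , R , e , neT , zT , rT) (x ∷ O′) refl = finish o pT neT (zT , rT) (λ z → contradiction (subst (λ t → r < length t) z lt) λ ())
              (spread nidR mxR (bounded-part {T} bd pT) lt)
          where
          R′ = x ∷ O′ ++ R ++ I₂
          pT : S ↭ T ++ R′
          pT = ↭-trans p (↭-trans (++⁺ʳ (x ∷ O′) (↭-trans (++⁺ʳ I₂ e) (↭-reflexive (≡-assoc T R I₂)))) (↭-trans (↭-reflexive (≡-assoc T (R ++ I₂) (x ∷ O′))) (++⁺ˡ T (++-comm (R ++ I₂) (x ∷ O′)))))
          lt : r < length R′
          lt = r<rest {T} pT (≤-trans (m≤m+n _ _) (≤-trans (≤-reflexive (sym (↭-++-length {as = T} e))) (≤-reflexive l₁)))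
          nidR : All NonId R′
          nidR = Allₚ.++⁻ʳ T (All-resp-↭ pT nid)
          mxR : Mixed R′
          mxR with mixed? x (O′ ++ R ++ I₂)
          ... | inj₂ m = m
          ... | inj₁ cm = contradiction (bounded-part {T} bd pT x (All.head outs) R′ [] (↭-sym (++-identityʳ _)) (comm-refl {x} ∷ cm)) (<⇒≯ (<-trans q<r lt))

      class-block : ∀ {y as bs} → Outer y → S ↭ as ++ bs → All (Comm y) as → q ≤ length as →
        ∃[ T ] ∃[ R ] S ↭ T ++ R × T ≢ [] × IsOne T × length T ≤ q × All (Comm y) T
      class-block {y} {as} {bs} oy p cm len with A , B , C , refl , ne , lB , zB ← zero-block as len =
        B , A ++ C ++ bs , ↭-trans p (↭-trans (↭-reflexive (trans (≡-assoc A (B ++ C) bs) (cong (A ++_) (≡-assoc B C bs)))) (shifts A B)) , ne ,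
        (zB , B , ↭-refl , val-outer {y} oy cB zB) , lB , cB
        where
        cB : All (Comm y) B
        cB = Allₚ.++⁻ˡ B (Allₚ.++⁻ʳ A cm)

      -- The product-one ordering is cut into 2J windows of length `q`: one inside the stabiliser
      -- splits the list at once, and otherwise each window contains an outsider.
      many-outsiders : ∀ {y} → IsOne S → Outer y → Splits S ⊎ J + J ≤ # (λ x → ¬? (comm? y x)) S
      many-outsiders {y} o@(l , S₀ , p , v) oy = by (window (comm? y) q (J + J) S₀ enough)
        where
        q<S : q < length S
        q<S = <-trans q<r (≤-<-trans (m≤m+n r r) long)
        enough : (J + J) * q ≤ length S₀
        enough = begin
          (J + J) * q ≡⟨ *-distribʳ-+ q J J ⟩
          J * q + J * q ≤⟨ +-mono-≤ (≤-trans (n≤1+n _) (≤-reflexive (sym r≡))) (≤-trans (n≤1+n _) (≤-reflexive (sym r≡))) ⟩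
          r + r ≤⟨ <⇒≤ long ⟩
          length S ≡⟨ ↭-length p ⟩
          length S₀ ∎
          where open ≤-Reasoning
        by : (∃[ A ] ∃[ B ] ∃[ C ] S₀ ≡ A ++ B ++ C × length B ≡ q × All (Comm y) B) ⊎ J + J ≤ # (λ x → ¬? (comm? y x)) S₀ → Splits S ⊎ J + J ≤ # (λ x → ¬? (comm? y x)) S
        by (inj₁ (A , B , C , refl , lB , cm)) = inj₁ (window-splits {S} {y} A B C o p v oy cm (≤-reflexive (sym lB)) q<S)
        by (inj₂ h) = inj₂ (≤-trans h (≤-reflexive (sym (#-↭ (λ x → ¬? (comm? y x)) p))))

      module _ {T R : List Elt} (p : S ↭ T ++ R) (lT : length T ≤ q) where
        Gq≤R : G * q ≤ length R
        Gq≤R = +-cancelˡ-≤ q _ _ (begin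
          q + G * q ≡⟨ cong (_* q) suc-G ⟩
          (J + J) * q ≡⟨ *-distribʳ-+ q J J ⟩
          J * q + J * q ≤⟨ +-mono-≤ (≤-trans (n≤1+n _) (≤-reflexive (sym r≡))) (≤-trans (n≤1+n _) (≤-reflexive (sym r≡))) ⟩
          r + r ≤⟨ <⇒≤ long ⟩
          length S ≡⟨ ↭-++-length {as = T} p ⟩
          length T + length R ≤⟨ +-monoˡ-≤ (length R) lT ⟩
          q + length R ∎)
          where open ≤-Reasoning

        nidR : All NonId R
        nidR = Allₚ.++⁻ʳ T (All-resp-↭ p nid)

        nonemptyR : R ≢ []
        nonemptyR = length-nonempty (≤-trans (s≤s z≤n) (r<rest {T} p (≤-trans lT (<⇒≤ q<r))))

        -- `G` noncommuting pairs grow into `G` mixed groups, whose G(q - 1) ≥ r - 1 new values fill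
        -- the field.
        full-or-class : Full R ⊎ (∃[ x ] ∃[ as ] ∃[ bs ] R ↭ as ++ bs × NonId x × All (Comm x) as × length bs < G)
        full-or-class with Commuting.pairs G R nidR (≤-trans (≤-reflexive (trans (cong (G +_) (sym (+-identityʳ G))) (*-comm 2 G))) (≤-trans (*-monoʳ-≤ G (≤-trans (n≤1+n 2) 3≤q)) Gq≤R))
        ... | inj₂ w = inj₂ w
        ... | inj₁ (ps , rest , e , l , ap) = inj₁ (full-groups {R} {ps} {rest} nidR e ap (subst (λ t → r ≤ suc (t * (q ∸ 1))) (sym l) r≤groups) (subst (λ t → t * q ≤ length R) (sym l) Gq≤R))

        r≤class : ∀ {as bs} → R ↭ as ++ bs → length bs < G → r ≤ length as
        r≤class {as} {bs} e few = ≤-trans r≤groups (+-cancelʳ-≤ G _ _ (begin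
          suc (G * (q ∸ 1)) + G ≡⟨ cong suc (trans (+-comm _ G) (trans (sym (*-suc G (q ∸ 1))) (cong (G *_) suc-q-1))) ⟩
          suc (G * q) ≤⟨ s≤s Gq≤R ⟩
          suc (length R) ≡⟨ cong suc (↭-++-length {as = as} e) ⟩
          suc (length as + length bs) ≡⟨ sym (+-suc _ _) ⟩
          length as + suc (length bs) ≤⟨ +-monoʳ-≤ (length as) few ⟩
          length as + G ∎))
          where open ≤-Reasoning

      -- `T` is drawn anew from the crowded stabiliser. If the new remainder is again caught in a
      -- class up to fewer than `G` elements, the same class contradicts the 2J outsiders, while a
      -- different one leaves fewer than G + q ≤ r places for the first.
      outer-class : ∀ {T R y as bs} → IsOne S → S ↭ T ++ R → Outer y → R ↭ as ++ bs → All (Comm y) as → r ≤ length as → Splits S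
      outer-class {T} {R} {y} {as} {bs} o p oy e cm big = by (many-outsiders {y} o oy)
        where
        pas : S ↭ as ++ bs ++ T
        pas = ↭-trans p (↭-trans (++-comm T R) (↭-trans (++⁺ʳ T e) (↭-reflexive (≡-assoc as bs T))))
        by : Splits S ⊎ J + J ≤ # (λ x → ¬? (comm? y x)) S → Splits S
        by (inj₁ s) = s
        by (inj₂ out) with T′ , R′ , p′ , ne′ , o′ , l′ , c′ ← class-block {y} oy pas cm (≤-trans (<⇒≤ q<r) big) = by₂ (full-or-class {T′} p′ l′)
          where
          by₂ : Full R′ ⊎ (∃[ x ] ∃[ cs ] ∃[ ds ] R′ ↭ cs ++ ds × NonId x × All (Comm x) cs × length ds < G) → Splits S
          by₂ (inj₁ f) = finish o p′ ne′ o′ (nonemptyR {T′} p′ l′) f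
          by₂ (inj₂ (z , cs , ds , e′ , nz , cz , few)) with comm? y z
          ... | yes cyz = contradiction out (<⇒≱ (≤-<-trans
                  (#-outside (λ x → ¬? (comm? y x)) {as = T′ ++ cs} {ds} (↭-trans p′ (↭-trans (++⁺ˡ T′ e′) (↭-reflexive (sym (≡-assoc T′ cs ds)))))
                     (All.map (λ h k → k h) (Allₚ.++⁺ c′ (All.map (λ {x} h → comm-trans {y} {z} {x} nz cyz h) cz))))
                  (≤-trans few (≤-trans (n≤1+n G) (≤-reflexive suc-G)))))
          ... | no ncyz = contradiction (≤-trans big (≤-trans (#-part (comm? y) pas cm)
                  (#-outside (comm? y) {as = cs} {ds ++ T′} (↭-trans p′ (↭-trans (++-comm T′ R′) (↭-trans (++⁺ʳ T′ e′) (↭-reflexive (≡-assoc cs ds T′)))))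
                    (All.zipWith (λ { {x} (h , n) k → ncyz (comm-trans {y} {x} {z} n k (comm-sym {z} {x} h)) }) (cz , Allₚ.++⁻ˡ cs (All-resp-↭ e′ (nidR {T′} p′ l′)))))))
                (<⇒≱ (<-≤-trans (≤-<-trans (≤-reflexive (length-++ ds)) (≤-trans (+-mono-≤ few l′) (≤-reflexive (+-comm G q)))) q+G≤r))

      -- Inner elements fill everything once an outer element is placed. If `R` has no outer
      -- element, the roles change: a zero sum among r inner elements is removed, and the outer
      -- elements of `T` join the remainder.
      inner-class : ∀ {T R} → IsOne S → S ↭ T ++ R → T ≢ [] → IsOne T → length T ≤ q → All Outer T → r ≤ # inner? R → Splits S
      inner-class {T} {R} o p neT oT lT outT big with #-select inner? R
      ... | I , x ∷ O , e , ins , ox ∷ outs , lI = finish o p neT oT (nonemptyR {T} p lT)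
            (full-↭ (↭-trans (++⁺ˡ O (++-comm I [ x ])) (↭-trans (shift x O I) (↭-trans (++-comm (x ∷ O) I) (↭-sym e)))) (full-++ O (finish-inners {[ x ]} {proj₁ st} {I} (proj₁ (proj₂ st)) (≤-reflexive (sym (proj₂ (proj₂ st))))
               (λ z → ox (trans (sym (QT.⊕-identityʳ _)) z)) ins (Allₚ.++⁻ˡ I (All-resp-↭ e (nidR {T} p lT))) (≤-trans (≤-trans big (≤-reflexive (sym lI))) (m≤n+m _ _)))))
        where st = start x
      ... | I , [] , e , ins , [] , lI = by (split-at r R (≤-trans big (#-≤ inner? R))) T refl
        where
        insR : All Inner R
        insR = All-resp-↭ (↭-sym e) (Allₚ.++⁺ ins [])
        by : ∃[ A ] ∃[ B ] R ≡ A ++ B × length A ≡ r → ∀ T′ → T ≡ T′ → Splits S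
        by _ [] z = contradiction z neT
        by _ (t ∷ []) refl = contradiction (trans (sym (QT.⊕-identityʳ _)) (proj₁ oT)) (All.head outT)
        by (A , B , refl , lA) (t ∷ t′ ∷ T₂) refl with T′ , R₁ , e′ , ne′ , z′ , r′ ← plenty-found (plenty-inner (Allₚ.++⁻ˡ A insR)) (≤-reflexive (sym lA)) = by₂ (R₁ ++ B) refl
          where
          lT′ : length T′ ≤ r
          lT′ = ≤-trans (m≤m+n _ _) (≤-trans (≤-reflexive (sym (↭-++-length {as = T′} e′))) (≤-reflexive lA))
          p′ : S ↭ T′ ++ (T ++ R₁ ++ B)
          p′ = ↭-trans p (↭-trans (++⁺ˡ T (↭-trans (++⁺ʳ B e′) (↭-reflexive (≡-assoc T′ R₁ B)))) (shifts T T′))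
          inn : All Inner (R₁ ++ B)
          inn = Allₚ.++⁻ʳ T′ (subst (All Inner) (≡-assoc T′ R₁ B) (All-resp-↭ (++⁺ʳ B e′) insR))
          nidI : All NonId (R₁ ++ B)
          nidI = Allₚ.++⁻ʳ T (Allₚ.++⁻ʳ T′ (All-resp-↭ p′ nid))
          total : r < length T + length (R₁ ++ B)
          total = ≤-trans (r<rest {T′} p′ lT′) (≤-reflexive (length-++ T))
          by₂ : ∀ Z → R₁ ++ B ≡ Z → Splits S
          by₂ [] z = contradiction (≤-trans total (≤-trans (≤-reflexive (trans (cong (λ w → length T + length w) z) (+-identityʳ _))) lT)) (<⇒≱ (m≤n⇒m≤1+n q<r))
          -- `t` is held back to the end: `T` has level zero and `t` is outer, so the rest of `T`
          -- has nonzero level, as the inner elements require.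
          by₂ (i ∷ Z) z = finish o p′ ne′ (z′ , r′) (λ ()) (full-↭ permF (full-∷ t (stage₁ (add-inners {[ t′ ]} {proj₁ st} {[ i ]} (proj₁ (proj₂ st)) (≤-reflexive (sym (proj₂ (proj₂ st)))) nl₁ (All.head inn′ ∷ []) (All.head nid′ ∷ [])))))
            where
            st = start t′
            inn′ : All Inner (i ∷ Z)
            inn′ = subst (All Inner) z inn
            nid′ : All NonId (i ∷ Z)
            nid′ = subst (All NonId) z nidI
            nl₁ : level [ t′ ] ≢ Q.𝟘
            nl₁ w = All.head (All.tail outT) (trans (sym (QT.⊕-identityʳ _)) w)
            D = T₂ ++ i ∷ t′ ∷ []
            permF : t ∷ Z ++ D ↭ T ++ R₁ ++ B
            permF = prep t (↭-trans (++-comm Z D) (↭-trans (↭-reflexive (≡-assoc T₂ (i ∷ t′ ∷ []) Z)) (↭-trans (++⁺ˡ T₂ (swap i t′ ↭-refl)) (↭-trans (shift t′ T₂ (i ∷ Z)) (↭-reflexive (cong (λ w → t′ ∷ T₂ ++ w) (sym z)))))))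
            levD : level D ≢ Q.𝟘
            levD w = All.head outT (trans (sym (QT.⊕-identityʳ _)) (trans (cong (lev t Q.⊕_) (sym (trans (sym eqD) w))) (proj₁ oT)))
              where
              eqD : level D ≡ level (t′ ∷ T₂)
              eqD = trans (level-↭ (↭-trans (shift i T₂ [ t′ ]) (prep i (++-comm T₂ [ t′ ])))) (level-inner i (t′ ∷ T₂) (All.head inn′))
            stage₂ : ∃[ X ] Cert D X × (q ≤ count X ⊎ 2 + length T₂ ≤ count X) × 2 ≤ count X → Full (Z ++ D)
            stage₂ (X , c , s , 2≤) = finish-inners c (≤-trans (n≤1+n 1) 2≤) levD (All.tail inn′) (All.tail nid′) (≤-pred (≤-trans total (≤-trans (≤-reflexive (trans (cong (λ w → length T + length w) z) (+-suc (length T) (length Z)))) (s≤s (+-monoˡ-≤ (length Z) (bound s))))))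
              where
              bound : q ≤ count X ⊎ 2 + length T₂ ≤ count X → length T ≤ count X
              bound (inj₁ f) = ≤-trans lT f
              bound (inj₂ f) = f
            stage₁ : ∃[ X ] Cert (i ∷ t′ ∷ []) X × (r ≤ count X ⊎ count (proj₁ st) + 1 ≤ count X) → Full (Z ++ D)
            stage₁ (X , c , inj₁ f) = full-++ Z (full-++ T₂ (full-cert c f))
            stage₁ (X , c , inj₂ f) = stage₂ (add-outers {E = T₂} {2} c two two (All.tail (All.tail outT)))
              where
              two : 2 ≤ count X
              two = ≤-trans (≤-reflexive (cong (_+ 1) (sym (proj₂ (proj₂ st))))) f

      class-case : ∀ {g} → IsOne S → Outer g → q ≤ # (comm? g) S → Splits S
      class-case {g} o og big with A , B , p , cA , _ , lA ← #-select (comm? g) S with T , R , pT , neT , oT , lT , cT ← class-block {g} og p cA (≤-trans big (≤-reflexive (sym lA))) = by (full-or-class {T} pT lT)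
        where
        by : Full R ⊎ (∃[ x ] ∃[ as ] ∃[ bs ] R ↭ as ++ bs × NonId x × All (Comm x) as × length bs < G) → Splits S
        by (inj₁ f) = finish o pT neT oT (nonemptyR {T} pT lT) f
        by (inj₂ (y , as , bs , e , ny , cy , few)) with inner? y
        ... | no oy = outer-class {T} {R} {y} o pT oy e cy (r≤class {T} pT lT {as} {bs} e few)
        ... | yes iy = inner-class {T} {R} o pT neT oT lT (All.zipWith (λ { {x} (n , k) → comm-outer {x} {g} n og (comm-sym {g} {x} k) }) (Allₚ.++⁻ˡ T (All-resp-↭ pT nid) , cT))
               (≤-trans (r≤class {T} pT lT {as} {bs} e few) (#-part inner? e (All.map (λ {x} k → comm-inner {x} {y} ny iy (comm-sym {y} {x} k)) cy)))

      -- Only elements of the list have to be tested: a nonempty part of the class of `g` contains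
      -- some `a` of the list, with the same class.
      bounded-or-class : Bounded S ⊎ ∃[ g ] Outer g × q ≤ # (comm? g) S
      bounded-or-class with Any.any? (λ g → ¬? (inner? g) ×-dec (q ≤? # (comm? g) S)) S
      ... | yes a = let g , _ , og , h = find a in inj₂ (g , og , h)
      ... | no na = inj₁ bd
        where
        bd : Bounded S
        bd g og [] B e cm = ≤-trans (s≤s z≤n) 3≤q
        bd g og (a ∷ A) B e (ca ∷ cm) with length (a ∷ A) <? q
        ... | yes h = h
        ... | no h = contradiction (Any.map (λ { refl → oa , ≤-trans (≮⇒≥ h) (#-part (comm? a) e (comm-refl {a} ∷ All.map (λ {x} k → comm-trans {a} {g} {x} (outer-nonid og) (comm-sym {g} {a} ca) k) cm)) }) a∈) na
          where
          a∈ : a ∈ S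
          a∈ = ∈-resp-↭ (↭-sym e) (Any.here refl)
          oa : Outer a
          oa = comm-outer {a} {g} (All.lookup nid a∈) og (comm-sym {g} {a} ca)

    splits : ∀ {S} → IsOne S → r + r < length S → Splits S
    splits {S} o long with Any.any? (λ g → ≡-dec _≟_ _≟_ one g) S
    ... | yes a = with-identity o (≤-<-trans (≤-trans 0<r (m≤m+n r r)) long) a
    ... | no na = go S refl
      where
      nid : All NonId S
      nid = All.map (λ n e → n (sym e)) (Allₚ.¬Any⇒All¬ S na)
      go : ∀ S′ → S ≡ S′ → Splits S
      go [] refl = contradiction long λ ()
      go (x ∷ S′) refl with mixed? x S′
      ... | inj₁ cm = one-class {x ∷ S′} {x} o (All.head nid) (comm-refl {x} ∷ cm) (≤-<-trans (m≤m+n r r) long)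
      ... | inj₂ mx with bounded-or-class nid long
      ... | inj₁ bd = bounded-case nid long o mx bd
      ... | inj₂ (g , og , h) = class-case nid long o og h

-- Finite groups: powers, orders, and the reduction to a subgroup.

module Groups where

  open import Data.Bool.Properties using (¬-not)
  open import Defs
  open Counting
  open Lists
  open import Data.Bool using (true; false)
  open import Data.Nat using (ℕ; zero; suc; pred; _+_; _*_; _∸_; _≤_; _<_; s≤s; _≤?_; >-nonZero)
  open import Data.Nat.Properties hiding (_≟_)
  open import Data.Nat.Divisibility using (_∣_; divides; m%n≡0⇒n∣m)
  open import Data.Nat.DivMod using (_%_; _/_; m≡m%n+[m/n]*n; m%n<n)
  open import Data.Nat.Primality using (Prime)
  open import Data.Nat.Coprimality using (Coprime; coprime-Bézout)
  open import Data.Nat.GCD using (module Bézout)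
  open import Data.Fin using (Fin; toℕ; _≟_)
  open import Data.Fin.Properties using (pigeonhole; any?)
  open import Data.List using (List; []; _∷_; _++_; length; [_]; map; concat)
  open import Data.List.Properties using (map-++; length-map; length-++; concat-++; ++-conicalˡ; ∷-injectiveʳ; ∷-injectiveˡ) renaming (++-assoc to ≡-assoc; ++-identityʳ to ≡-identityʳ)
  open import Data.List.Relation.Unary.All using (All; []; _∷_)
  import Data.List.Relation.Unary.All as All
  import Data.List.Relation.Unary.All.Properties as Allₚ
  open import Data.List.Relation.Binary.Permutation.Propositional hiding (trans)
  open import Data.List.Relation.Binary.Permutation.Propositional.Properties
  open import Data.Product using (∃-syntax; _×_; _,_)
  open import Data.Sum using (_⊎_; inj₁; inj₂)
  open import Function using (_∘_)
  open import Relation.Nullary using (¬_; Dec; yes; no; contradiction)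
  open import Relation.Binary.PropositionalEquality hiding ([_])
  open import Algebra.Structures using (IsGroup)
  open import Algebra.Bundles using (Group)
  open import Level using (0ℓ)
  open import Algebra.Properties.CommutativeMonoid.Sum +-0-commutativeMonoid using (sum; ∑-distrib-+)

  module _ {A B : Set} (f : A → B) where
    map-++⁻ : ∀ xs ys zs → map f xs ≡ ys ++ zs → ∃[ as ] ∃[ bs ] xs ≡ as ++ bs × map f as ≡ ys × map f bs ≡ zs
    map-++⁻ xs [] zs e = [] , xs , refl , refl , e
    map-++⁻ (x ∷ xs) (y ∷ ys) zs e with as , bs , refl , ea , eb ← map-++⁻ xs ys zs (∷-injectiveʳ e) =
      x ∷ as , bs , refl , cong₂ _∷_ (∷-injectiveˡ e) ea , eb

    map-↭-++⁻ : ∀ {xs ys zs} → map f xs ↭ ys ++ zs → ∃[ as ] ∃[ bs ] xs ↭ as ++ bs × map f as ≡ ys × map f bs ≡ zs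
    map-↭-++⁻ {xs} {ys} {zs} p with ws , e , p′ ← ↭-map-inv f p with as , bs , refl , ea , eb ← map-++⁻ ws ys zs (sym e) = as , bs , p′ , ea , eb

  concat-↭ : ∀ {A : Set} {xs ys : List (List A)} → xs ↭ ys → concat xs ↭ concat ys
  concat-↭ refl = ↭-refl
  concat-↭ (prep x p) = ++⁺ˡ x (concat-↭ p)
  concat-↭ (swap x y p) = ↭-trans (shifts x y) (++⁺ˡ y (++⁺ˡ x (concat-↭ p)))
  concat-↭ (_↭_.trans p q) = ↭-trans (concat-↭ p) (concat-↭ q)

  concat-nonempty : ∀ {A : Set} {xs : List (List A)} → xs ≢ [] → All (_≢ []) xs → concat xs ≢ []
  concat-nonempty {xs = []} n _ = contradiction refl n
  concat-nonempty {xs = x ∷ xs} _ (h ∷ _) e = h (++-conicalˡ x (concat xs) e)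

  least : {P : ℕ → Set} → (∀ k → Dec (P k)) → ∀ n → P n → ∃[ k ] P k × (∀ j → j < k → ¬ P j)
  least P? zero p = 0 , p , λ j ()
  least {P} P? (suc n) p with P? 0
  ... | yes p₀ = 0 , p₀ , λ j ()
  ... | no n₀ with k , pk , mk ← least {P ∘ suc} (λ k → P? (suc k)) n p = suc k , pk , λ { zero _ → n₀ ; (suc j) (s≤s h) → mk j h }

  module GroupTheory (G : FiniteGroup) where
    open FiniteGroup G public renaming (_∙_ to infixl 7 _∙_; _⁻¹ to infix 9 _⁻¹)
    open IsGroup isGroup public using (assoc; identityˡ; identityʳ; inverseˡ; inverseʳ)

    group : Group 0ℓ 0ℓ
    group = record { isGroup = isGroup }
    open import Algebra.Properties.Group group public using (∙-cancelˡ; ∙-cancelʳ; ⁻¹-anti-homo-∙; ⁻¹-involutive)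

    El : Set
    El = Fin order

    infixr 8 _^_
    _^_ : El → ℕ → El
    g ^ k = pow G g k

    Π : List El → El
    Π = prod G

    cancel-inverseˡ : ∀ a b → a ⁻¹ ∙ (a ∙ b) ≡ b
    cancel-inverseˡ a b = trans (sym (assoc _ _ _)) (trans (cong (_∙ b) (inverseˡ a)) (identityˡ b))

    cancel-inverseʳ : ∀ a b → a ∙ (a ⁻¹ ∙ b) ≡ b
    cancel-inverseʳ a b = trans (sym (assoc _ _ _)) (trans (cong (_∙ b) (inverseʳ a)) (identityˡ b))

    inverse-unique : ∀ {a b} → a ∙ b ≡ ε → b ≡ a ⁻¹
    inverse-unique {a} {b} e = ∙-cancelˡ a b (a ⁻¹) (trans e (sym (inverseʳ a)))

    Commute : El → El → Set
    Commute a b = a ∙ b ≡ b ∙ a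

    ^-+ : ∀ g m k → g ^ (m + k) ≡ g ^ m ∙ g ^ k
    ^-+ g zero k = sym (identityˡ _)
    ^-+ g (suc m) k = trans (cong (g ∙_) (^-+ g m k)) (sym (assoc _ _ _))

    ε^ : ∀ k → ε ^ k ≡ ε
    ε^ zero = refl
    ε^ (suc k) = trans (identityˡ _) (ε^ k)

    ^-* : ∀ g m k → g ^ (k * m) ≡ (g ^ m) ^ k
    ^-* g m zero = refl
    ^-* g m (suc k) = trans (^-+ g m (k * m)) (cong (g ^ m ∙_) (^-* g m k))

    ^-1 : ∀ g → g ^ 1 ≡ g
    ^-1 g = identityʳ g

    commute-^ : ∀ {a b} → Commute a b → ∀ k → Commute a (b ^ k)
    commute-^ {a} c zero = trans (identityʳ a) (sym (identityˡ a))
    commute-^ {a} {b} c (suc k) = trans (sym (assoc a b _)) (trans (cong (_∙ b ^ k) c) (trans (assoc b a _) (trans (cong (b ∙_) (commute-^ c k)) (sym (assoc b _ a)))))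

    commute-^^ : ∀ {a b} → Commute a b → ∀ j k → Commute (a ^ j) (b ^ k)
    commute-^^ c j k = sym (commute-^ (sym (commute-^ c k)) j)

    commute-∙ : ∀ {a b c} → Commute a b → Commute a c → Commute a (b ∙ c)
    commute-∙ {a} {b} {c} p q = trans (sym (assoc a b c)) (trans (cong (_∙ c) p) (trans (assoc b a c) (trans (cong (b ∙_) q) (sym (assoc b c a)))))

    commute-⁻¹ : ∀ {a b} → Commute a b → Commute a (b ⁻¹)
    commute-⁻¹ {a} {b} p = ∙-cancelˡ b _ _ (trans (sym (assoc b a _)) (trans (cong (_∙ b ⁻¹) (sym p)) (trans (assoc a b _) (trans (cong (a ∙_) (inverseʳ b)) (trans (identityʳ a) (sym (cancel-inverseʳ b a)))))))

    ^-∙ : ∀ {a b} → Commute a b → ∀ k → (a ∙ b) ^ k ≡ a ^ k ∙ b ^ k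
    ^-∙ c zero = sym (identityˡ ε)
    ^-∙ {a} {b} c (suc k) = begin
      (a ∙ b) ∙ (a ∙ b) ^ k ≡⟨ cong ((a ∙ b) ∙_) (^-∙ c k) ⟩
      (a ∙ b) ∙ (a ^ k ∙ b ^ k) ≡⟨ assoc a b _ ⟩
      a ∙ (b ∙ (a ^ k ∙ b ^ k)) ≡⟨ cong (a ∙_) (sym (assoc b _ _)) ⟩
      a ∙ ((b ∙ a ^ k) ∙ b ^ k) ≡⟨ cong (λ t → a ∙ (t ∙ b ^ k)) (commute-^ (sym c) k) ⟩
      a ∙ ((a ^ k ∙ b) ∙ b ^ k) ≡⟨ cong (a ∙_) (assoc _ b _) ⟩
      a ∙ (a ^ k ∙ (b ∙ b ^ k)) ≡⟨ sym (assoc a _ _) ⟩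
      (a ∙ a ^ k) ∙ (b ∙ b ^ k) ∎
      where open ≡-Reasoning

    ^-periodic : ∀ {g m} → g ^ m ≡ ε → ∀ k → g ^ (k * m) ≡ ε
    ^-periodic {g} {m} e k = trans (^-* g m k) (trans (cong (_^ k) e) (ε^ k))

    ^-∣ : ∀ {g m k} → g ^ m ≡ ε → m ∣ k → g ^ k ≡ ε
    ^-∣ e (divides d refl) = ^-periodic e d

    ^-mod : ∀ {g m} → g ^ suc m ≡ ε → ∀ k → g ^ k ≡ g ^ (k % suc m)
    ^-mod {g} {m} e k = trans (cong (g ^_) (m≡m%n+[m/n]*n k (suc m))) (trans (^-+ g (k % suc m) _) (trans (cong (g ^ (k % suc m) ∙_) (^-periodic e (k / suc m))) (identityʳ _)))

    record Order (g : El) : Set where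
      field
        m : ℕ
        annihilates : g ^ suc m ≡ ε
        minimal : ∀ j → j < suc m → g ^ j ≡ ε → j ≡ 0

      ∣-of : ∀ k → g ^ k ≡ ε → suc m ∣ k
      ∣-of k e = m%n≡0⇒n∣m k (suc m) (minimal _ (m%n<n k (suc m)) (trans (sym (^-mod annihilates k)) e))

    abstract
      orderOf : ∀ g → Order g
      orderOf g with i , j , i<j , e ← pigeonhole (n<1+n order) (λ (i : Fin (suc order)) → g ^ toℕ i)
                with k , ek , mk ← least {λ k → g ^ suc k ≡ ε} (λ k → g ^ suc k ≟ ε) (pred (toℕ j ∸ toℕ i))
                    (trans (cong (g ^_) (suc-pred (toℕ j ∸ toℕ i) {{>-nonZero (m<n⇒0<n∸m i<j)}})) (sym (∙-cancelˡ (g ^ toℕ i) _ _ (trans (identityʳ _) (trans e (trans (cong (g ^_) (sym (m+[n∸m]≡n (<⇒≤ i<j)))) (^-+ g (toℕ i) _)))))))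
        = record { m = k ; annihilates = ek ; minimal = λ { zero _ _ → refl ; (suc j) (s≤s h) z → contradiction z (mk j h) } }

    ⁻¹-power : ∀ g → ∃[ k ] g ⁻¹ ≡ g ^ k
    ⁻¹-power g = Order.m o , sym (inverse-unique (Order.annihilates o))
      where o = orderOf g

    coprime-annihilate : ∀ {g c d} → Coprime c d → g ^ c ≡ ε → g ^ d ≡ ε → g ≡ ε
    coprime-annihilate {g} {c} {d} co ec ed with coprime-Bézout co
    ... | Bézout.+- a b e = trans (sym (trans (cong (g ∙_) (^-periodic ed b)) (identityʳ g))) (trans (cong (g ^_) e) (^-periodic ec a))
    ... | Bézout.-+ a b e = trans (sym (trans (cong (g ∙_) (^-periodic ec a)) (identityʳ g))) (trans (cong (g ^_) e) (^-periodic ed b))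

    -- Left multiplication by `g` has only free orbits, all of length `q`.
    lagrange-prime : ∀ {g q} → Prime q → g ≢ ε → g ^ q ≡ ε → q ∣ order
    lagrange-prime {g} {q} pq ne e = subst (q ∣_) (count-all order) (free-orbits pq (g ∙_) (λ x → trans (iter-∙ q x) (trans (cong (_∙ x) e) (identityˡ x))) (λ _ → true) (λ _ _ → mem refl)
        (λ x _ z → ne (∙-cancelʳ x g ε (trans z (sym (identityˡ x))))))
      where
      iter-∙ : ∀ k x → iter k (g ∙_) x ≡ g ^ k ∙ x
      iter-∙ zero x = sym (identityˡ x)
      iter-∙ (suc k) x = trans (cong (g ∙_) (iter-∙ k x)) (sym (assoc _ _ _))

    Splits : List El → Set
    Splits S = ∃[ A ] ∃[ B ] S ↭ A ++ B × NonEmpty G A × NonEmpty G B × ProductOne G A × ProductOne G B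

    Π-++ : ∀ A B → Π (A ++ B) ≡ Π A ∙ Π B
    Π-++ [] B = sym (identityˡ _)
    Π-++ (x ∷ A) B = trans (cong (x ∙_) (Π-++ A B)) (sym (assoc _ _ _))

    Π-concat : ∀ Bs → Π (concat Bs) ≡ Π (map Π Bs)
    Π-concat [] = refl
    Π-concat (B ∷ Bs) = trans (Π-++ B (concat Bs)) (cong (Π B ∙_) (Π-concat Bs))

    productOne-concat : ∀ {Bs} → ProductOne G (map Π Bs) → ProductOne G (concat Bs)
    productOne-concat {Bs} (T , p , e) with Cs , refl , p′ ← ↭-map-inv Π p = concat Cs , concat-↭ p′ , trans (Π-concat Cs) e

    splits-concat : ∀ {S Bs} → S ↭ concat Bs → All (_≢ []) Bs → Splits (map Π Bs) → Splits S
    splits-concat {S} {Bs} p ne (A , B , p′ , nA , nB , oA , oB) with As , Cs , e , refl , refl ← map-↭-++⁻ Π {Bs} {A} {B} p′ =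
      concat As , concat Cs , ↭-trans p (↭-trans (concat-↭ e) (↭-reflexive (sym (concat-++ As Cs)))) ,
      concat-nonempty (λ { refl → nA refl }) (Allₚ.++⁻ˡ As ne′) , concat-nonempty (λ { refl → nB refl }) (Allₚ.++⁻ʳ As ne′) , productOne-concat oA , productOne-concat oB
      where ne′ = All-resp-↭ e ne

    record IsSubgroup (H : Sub order) : Set where
      field
        ε∊ : ε ∊ H
        ∙∊ : ∀ {a b} → a ∊ H → b ∊ H → a ∙ b ∊ H
        ⁻¹∊ : ∀ {a} → a ∊ H → a ⁻¹ ∊ H

      ^∊ : ∀ {a} → a ∊ H → ∀ k → a ^ k ∊ H
      ^∊ h zero = ε∊
      ^∊ h (suc k) = ∙∊ h (^∊ h k)

      Π∊ : ∀ {L} → All (_∊ H) L → Π L ∊ H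
      Π∊ [] = ε∊
      Π∊ (h ∷ hs) = ∙∊ h (Π∊ hs)

    module Reduction (H : Sub order) (sg : IsSubgroup H) where
      open IsSubgroup sg

      -- The number of proper prefixes P of L with w ∈ P H.
      marks : El → List El → ℕ
      marks w [] = 0
      marks w (x ∷ L) = b2n (H w) + marks (x ⁻¹ ∙ w) L

      -- Each proper prefix P marks the |H| elements of the coset PH.
      sum-marks : ∀ L → sum (λ w → marks w L) ≡ length L * count H
      sum-marks [] = trans (sum-const order 0) (*-zeroʳ order)
      sum-marks (x ∷ L) = trans (∑-distrib-+ (λ w → b2n (H w)) (λ w → marks (x ⁻¹ ∙ w) L))
        (cong₂ _+_ (sym (count-sum H)) (trans (sum-bij (x ⁻¹ ∙_) (x ∙_) (cancel-inverseˡ x) (cancel-inverseʳ x) (λ w → marks w L)) (sum-marks L)))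

      -- `A` is the first marking prefix, `Bs` are the stretches between consecutive ones, and `Z`
      -- is what follows the last, nonempty because only proper prefixes mark.
      Cut : El → List El → Set
      Cut w L = ∃[ A ] ∃[ Bs ] ∃[ Z ] L ≡ A ++ concat Bs ++ Z × Z ≢ [] × All (_≢ []) Bs × All (λ B → Π B ∊ H) Bs × (Π A ⁻¹ ∙ w) ∊ H × marks w L ≡ suc (length Bs)

      cut : ∀ w L → marks w L ≡ 0 ⊎ Cut w L
      cut w [] = inj₁ refl
      cut w (x ∷ L) with H w in eq | cut (x ⁻¹ ∙ w) L
      ... | _ | inj₂ (A , Bs , Z , e , nZ , nB , hB , hA , m) = go (w ∊? H)
        where
        hA′ : (Π (x ∷ A) ⁻¹ ∙ w) ∊ H
        hA′ = subst (_∊ H) (trans (sym (assoc _ _ _)) (cong (_∙ w) (sym (⁻¹-anti-homo-∙ x (Π A))))) hA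
        go : Dec (w ∊ H) → b2n (_) + marks (x ⁻¹ ∙ w) L ≡ 0 ⊎ _
        go (no n) = inj₂ (x ∷ A , Bs , Z , cong (x ∷_) e , nZ , nB , hB , hA′ , trans (cong₂ _+_ (bit n) refl) m)
          where
          bit : ¬ (w ∊ H) → b2n _ ≡ 0
          bit n = trans (cong b2n (sym eq)) (cong b2n (¬-not (λ z → n (mem z))))
        go (yes h) = inj₂ ([] , (x ∷ A) ∷ Bs , Z , cong (x ∷_) (trans e (sym (≡-assoc A (concat Bs) Z))) , nZ , (λ ()) ∷ nB , hxA ∷ hB ,
            subst (_∊ H) (sym (trans (cong (_∙ w) (sym (inverse-unique (identityˡ ε)))) (identityˡ w))) h , cong₂ _+_ (trans (cong b2n (sym eq)) (cong b2n (holds h))) m)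
          where
          hxA : Π (x ∷ A) ∊ H
          hxA = subst (_∊ H) (trans (cong (w ∙_) (trans (⁻¹-anti-homo-∙ _ w) (cong (w ⁻¹ ∙_) (⁻¹-involutive _)))) (cancel-inverseʳ w _)) (∙∊ h (⁻¹∊ hA′))
      ... | true | inj₁ z = inj₂ ([] , [] , x ∷ L , refl , (λ ()) , [] , [] , subst (_∊ H) (sym (trans (cong (_∙ w) (sym (inverse-unique (identityˡ ε)))) (identityˡ w))) (mem eq) , cong suc z)
      ... | false | inj₁ z = inj₁ z

      reduce : ∀ {d} → (∀ L → All (_∊ H) L → ProductOne G L → d < length L → Splits L) →
        ∀ {S} → Π S ≡ ε → d * order < length S * count H → Splits S
      reduce {d} split {S} e big = by (any? (λ w → suc d ≤? marks w S))
        where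
        by : Dec (∃[ w ] suc d ≤ marks w S) → Splits S
        by (no n) = contradiction (≤-trans big (≤-trans (≤-reflexive (sym (sum-marks S))) (≤-trans (sum-mono {f = λ w → marks w S} {λ _ → d} (λ w → ≮⇒≥ (λ h → n (w , h)))) (≤-reflexive (trans (sum-const order d) (*-comm order d)))))) (<-irrefl refl)
        by (yes (w , h)) = go (cut w S)
          where
          go : marks w S ≡ 0 ⊎ Cut w S → Splits S
          go (inj₁ z) = contradiction (≤-trans h (≤-reflexive z)) λ ()
          go (inj₂ (A , Bs , Z , refl , nZ , nB , hB , hA , m)) = splits-concat {Bs = Cs} perm (Allₚ.++⁺ nB ((λ z → nZ (++-conicalˡ Z A z)) ∷ []))
               (split (map Π Cs) allH (map Π Cs , ↭-refl , prodC) (≤-trans h (≤-reflexive (trans m (sym lenC)))))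
            where
            X = Π (concat Bs)
            -- The last block goes round the end of the list; as the whole product is `ε`, its
            -- product is inverse to that of `Bs` and lies in `H` too.
            Cs = Bs ++ [ Z ++ A ]
            perm : A ++ concat Bs ++ Z ↭ concat Cs
            perm = ↭-trans (++-comm A _) (↭-reflexive (trans (≡-assoc (concat Bs) Z A) (trans (cong (concat Bs ++_) (sym (≡-identityʳ (Z ++ A)))) (concat-++ Bs [ Z ++ A ]))))
            closing : X ∙ Π (Z ++ A) ≡ ε
            closing = begin
              X ∙ Π (Z ++ A) ≡⟨ cong (X ∙_) (Π-++ Z A) ⟩
              X ∙ (Π Z ∙ Π A) ≡⟨ sym (assoc X _ _) ⟩
              (X ∙ Π Z) ∙ Π A ≡⟨ cong (_∙ Π A) (inverse-unique (trans (cong (Π A ∙_) (sym (Π-++ (concat Bs) Z))) (trans (sym (Π-++ A _)) e))) ⟩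
              Π A ⁻¹ ∙ Π A ≡⟨ inverseˡ _ ⟩
              ε ∎
              where open ≡-Reasoning
            hX : X ∊ H
            hX = subst (_∊ H) (sym (Π-concat Bs)) (Π∊ (Allₚ.map⁺ hB))
            allH : All (_∊ H) (map Π Cs)
            allH = Allₚ.map⁺ (Allₚ.++⁺ hB (subst (_∊ H) (sym (inverse-unique closing)) (⁻¹∊ hX) ∷ []))
            prodC : Π (map Π Cs) ≡ ε
            prodC = trans (cong Π (map-++ Π Bs _)) (trans (Π-++ (map Π Bs) _) (trans (cong₂ _∙_ (sym (Π-concat Bs)) (identityʳ _)) closing))
            lenC : length (map Π Cs) ≡ suc (length Bs)
            lenC = trans (length-map Π Cs) (trans (length-++ Bs) (+-comm _ 1))

-- The two types of subgroup; abelian groups without the first type are cyclic.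

module Classify where

  open import Defs
  open Counting
  open Groups
  open import Data.Nat using (ℕ; zero; suc; _+_; _*_; _∸_; _≤_; _<_; z≤n; s≤s; NonZero; >-nonZero⁻¹; ≢-nonZero; ≢-nonZero⁻¹)
  open import Data.Nat.Properties hiding (_≟_)
  open import Data.Nat.Divisibility
  open import Data.Nat.GCD using (gcd; gcd[m,n]∣m; gcd[m,n]∣n; gcd-greatest; gcd[m,n]≢0; module Bézout)
  open import Data.Nat.Primality using (Prime; prime⇒nonZero; prime⇒irreducible; euclidsLemma; ¬prime[1]; ¬prime[0]; prime[2])
  open import Data.Nat.Primality.Factorisation using (factorise; PrimeFactorisation)
  open import Data.Nat.Coprimality using (Coprime; coprime-Bézout)
  open import Data.Nat.ListAction using (product)
  open import Data.Fin using (toℕ; fromℕ<; _≟_)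
  open import Data.Fin.Properties using (any?; toℕ-fromℕ<)
  open import Data.List using ([]; _∷_)
  open import Data.List.Relation.Unary.All using (All; []; _∷_)
  open import Data.Nat.DivMod using (m%n<n)
  open import Data.Product using (∃-syntax; _×_; _,_)
  open import Data.Sum using (inj₁; inj₂)
  open import Function using (_∘_)
  open import Relation.Nullary using (¬_; Dec; yes; no; contradiction)
  open import Relation.Nullary.Decidable using (_×-dec_; ¬?)
  open import Relation.Binary.PropositionalEquality hiding ([_])

  prime-divisor : ∀ n → 2 ≤ n → ∃[ p ] Prime p × p ∣ n
  prime-divisor n@(suc _) 2≤n = go (PrimeFactorisation.factors f) (PrimeFactorisation.isFactorisation f) (PrimeFactorisation.factorsPrime f)
    where
    f = factorise n
    go : ∀ ps → n ≡ product ps → All Prime ps → ∃[ p ] Prime p × p ∣ n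
    go [] e _ = contradiction (≤-trans 2≤n (≤-reflexive e)) λ { (s≤s ()) }
    go (p ∷ ps) e (pp ∷ _) = p , pp , subst (p ∣_) (sym e) (m∣m*n (product ps))

  prime-coprime : ∀ {l N} → Prime l → ¬ (l ∣ N) → Coprime l N
  prime-coprime pl nd (d∣l , d∣N) with prime⇒irreducible pl d∣l
  ... | inj₁ e = e
  ... | inj₂ refl = contradiction d∣N nd

  -- `k` and `i` are `σ` and `τ` divided by their greatest common divisor.
  coprime-parts : ∀ σ τ .{{_ : NonZero τ}} → ∃[ i ] ∃[ k ] τ * k ≡ σ * i × Coprime i k
  coprime-parts σ τ with gcd[m,n]∣m σ τ in eσ | gcd[m,n]∣n σ τ in eτ
  ... | divides k e | divides i f = i , k , eq , co
    where
    g = gcd σ τ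
    eq : τ * k ≡ σ * i
    eq = begin
      τ * k ≡⟨ cong (_* k) f ⟩
      i * g * k ≡⟨ *-comm (i * g) k ⟩
      k * (i * g) ≡⟨ cong (k *_) (*-comm i g) ⟩
      k * (g * i) ≡⟨ sym (*-assoc k g i) ⟩
      k * g * i ≡⟨ cong (_* i) (sym e) ⟩
      σ * i ∎
      where open ≡-Reasoning
    instance
      g≢0 : NonZero g
      g≢0 = ≢-nonZero (gcd[m,n]≢0 σ τ (inj₂ λ z → contradiction z (≢-nonZero⁻¹ τ)))
    co : Coprime i k
    co {d} (di , dk) = ∣1⇒≡1 (*-cancelʳ-∣ g (subst (d * g ∣_) (sym (*-identityˡ g)) (gcd-greatest (subst (d * g ∣_) (sym e) (*-monoˡ-∣ g dk)) (subst (d * g ∣_) (sym f) (*-monoˡ-∣ g di)))))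

  -- The binomial coefficient n(n - 1)/2, the exponent that arises when commutators are collected.
  triangle : ℕ → ℕ
  triangle zero = 0
  triangle (suc n) = n + triangle n

  2*triangle : ∀ n → 2 * triangle (suc n) ≡ suc n * n
  2*triangle zero = refl
  2*triangle (suc n) = begin
    2 * (suc n + triangle (suc n)) ≡⟨ *-distribˡ-+ 2 (suc n) (triangle (suc n)) ⟩
    2 * suc n + 2 * triangle (suc n) ≡⟨ cong (2 * suc n +_) (2*triangle n) ⟩
    2 * suc n + suc n * n ≡⟨ cong (2 * suc n +_) (*-comm (suc n) n) ⟩
    2 * suc n + n * suc n ≡⟨ sym (*-distribʳ-+ (suc n) 2 n) ⟩
    suc (suc n) * suc n ∎
    where open ≡-Reasoning

  prime∣triangle : ∀ {r} → Prime r → r ≢ 2 → r ∣ triangle r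
  prime∣triangle {zero} pr _ = contradiction pr ¬prime[0]
  prime∣triangle {suc n} pr r≢2 with euclidsLemma 2 (triangle (suc n)) pr (subst (suc n ∣_) (sym (2*triangle n)) (m∣m*n n))
  ... | inj₂ h = h
  ... | inj₁ h with prime⇒irreducible prime[2] h
  ... | inj₁ e = contradiction (subst Prime e pr) ¬prime[1]
  ... | inj₂ e = contradiction e r≢2

  module Classification (G : FiniteGroup) where
    open GroupTheory G

    -- ⟨x , y⟩ is isomorphic to C_q × C_q.
    record Type₁ : Set where
      field
        {q} : ℕ
        {x y} : El
        q-prime : Prime q
        x≢ε : x ≢ ε
        x^q : x ^ q ≡ ε
        y^q : y ^ q ≡ ε
        commute : Commute x y
        independent : ∀ k → y ≢ x ^ k

    -- `x` acts on ⟨c⟩ as the w-th power map; the last two fields say that this action has order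
    -- exactly `q`.
    record Type₂ : Set where
      field
        {r q w} : ℕ
        {c x} : El
        r-prime : Prime r
        q-prime : Prime q
        c≢ε : c ≢ ε
        c^r : c ^ r ≡ ε
        conj : x ∙ c ≡ c ^ w ∙ x
        noncommute : ¬ Commute x c
        commute-q : Commute (x ^ q) c

    commute? : ∀ a b → Dec (Commute a b)
    commute? a b = _ ≟ _

    private
      power? : ∀ a x → Dec (∃[ i ] x ≡ a ^ toℕ {suc (Order.m (orderOf a))} i)
      power? a x = any? (λ i → x ≟ a ^ toℕ i)

    cyc : El → Sub order
    cyc a = sep (power? a)

    cyc⁺ : ∀ a k → a ^ k ∊ cyc a
    cyc⁺ a k = sep⁺ (power? a) (fromℕ< (m%n<n k _) , trans (^-mod (Order.annihilates (orderOf a)) k) (cong (a ^_) (sym (toℕ-fromℕ< (m%n<n k _)))))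

    cyc⁻ : ∀ {a x} → x ∊ cyc a → ∃[ k ] x ≡ a ^ k
    cyc⁻ {a} h = let i , e = sep⁻ (power? a) h in toℕ i , e

    cyc-self : ∀ a → a ∊ cyc a
    cyc-self a = subst (_∊ cyc a) (^-1 a) (cyc⁺ a 1)

    cyc-subgroup : ∀ a → IsSubgroup (cyc a)
    cyc-subgroup a = record
      { ε∊ = cyc⁺ a 0
      ; ∙∊ = λ h k → let i , e = cyc⁻ h ; j , f = cyc⁻ k in subst (_∊ cyc a) (trans (^-+ a i j) (sym (cong₂ _∙_ e f))) (cyc⁺ a (i + j))
      ; ⁻¹∊ = λ {x} h → let i , e = cyc⁻ h ; k , f = ⁻¹-power x in subst (_∊ cyc a) (trans (^-* a i k) (trans (cong (_^ k) (sym e)) (sym f))) (cyc⁺ a (k * i)) }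

    cyc-⊆ : ∀ {a K} → IsSubgroup K → a ∊ K → ∀ x → x ∊ cyc a → x ∊ K
    cyc-⊆ {a} {K} sg h x m = let k , e = cyc⁻ m in subst (_∊ K) (sym e) (IsSubgroup.^∊ sg h k)

    coprime-mem : ∀ {K a c d} → IsSubgroup K → Coprime c d → a ^ c ∊ K → a ^ d ∊ K → a ∊ K
    coprime-mem {K} {a} {c} {d} sg co hc hd = go (coprime-Bézout co)
      where
      open IsSubgroup sg
      power : ∀ u m → a ^ m ∊ K → a ^ (u * m) ∊ K
      power u m h = subst (_∊ K) (sym (^-* a m u)) (^∊ h u)
      cancel : ∀ k → a ^ suc k ∊ K → a ^ k ∊ K → a ∊ K
      cancel k h l = subst (_∊ K) (trans (assoc _ _ _) (trans (cong (a ∙_) (inverseʳ _)) (identityʳ a))) (∙∊ h (⁻¹∊ l))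
      go : Bézout.Identity 1 c d → a ∊ K
      go (Bézout.+- u v e) = cancel (v * d) (subst (λ t → a ^ t ∊ K) (sym e) (power u c hc)) (power v d hd)
      go (Bézout.-+ u v e) = cancel (u * c) (subst (λ t → a ^ t ∊ K) (sym e) (power v d hd)) (power u c hc)

    ⁻¹-^ : ∀ a k → (a ⁻¹) ^ k ≡ (a ^ k) ⁻¹
    ⁻¹-^ a k = inverse-unique (trans (sym (^-∙ (commute-⁻¹ refl) k)) (trans (cong (_^ k) (inverseʳ a)) (ε^ k)))

    ^-comm : ∀ g m k → (g ^ m) ^ k ≡ (g ^ k) ^ m
    ^-comm g m k = trans (sym (^-* g m k)) (trans (cong (g ^_) (*-comm k m)) (^-* g k m))

    -- The root is b^v a^{-u}.
    common-root : ∀ {a b k l u v} → Commute a b → a ^ k ≡ b ^ l → 1 + u * l ≡ v * k → ∃[ i ] ∃[ j ] let d = b ^ i ∙ (a ^ j) ⁻¹ in d ^ l ≡ a × d ^ k ≡ b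
    common-root {a} {b} {k} {l} {u} {v} c e f = v , u , rootˡ , rootᵏ
      where
      d = b ^ v ∙ (a ^ u) ⁻¹
      dist : ∀ n → d ^ n ≡ (b ^ v) ^ n ∙ ((a ^ u) ^ n) ⁻¹
      dist n = trans (^-∙ (commute-⁻¹ (commute-^^ (sym c) v u)) n) (cong ((b ^ v) ^ n ∙_) (⁻¹-^ (a ^ u) n))
      divideʳ : ∀ {p s t} → p ≡ t ∙ s → p ∙ s ⁻¹ ≡ t
      divideʳ {p} {s} {t} refl = trans (assoc t s _) (trans (cong (t ∙_) (inverseʳ s)) (identityʳ t))
      open ≡-Reasoning
      rootˡ : d ^ l ≡ a
      rootˡ = trans (dist l) (divideʳ (begin
        (b ^ v) ^ l ≡⟨ ^-comm b v l ⟩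
        (b ^ l) ^ v ≡⟨ cong (_^ v) (sym e) ⟩
        (a ^ k) ^ v ≡⟨ sym (^-* a k v) ⟩
        a ^ (v * k) ≡⟨ cong (a ^_) (sym f) ⟩
        a ∙ a ^ (u * l) ≡⟨ cong (a ∙_) (trans (cong (a ^_) (*-comm u l)) (^-* a u l)) ⟩
        a ∙ (a ^ u) ^ l ∎))
      rootᵏ : d ^ k ≡ b
      rootᵏ = trans (dist k) (divideʳ (begin
        (b ^ v) ^ k ≡⟨ sym (^-* b v k) ⟩
        b ^ (k * v) ≡⟨ cong (b ^_) (trans (*-comm k v) (sym f)) ⟩
        b ∙ b ^ (u * l) ≡⟨ cong (b ∙_) (^-* b l u) ⟩
        b ∙ (b ^ l) ^ u ≡⟨ cong (λ t → b ∙ t ^ u) (sym e) ⟩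
        b ∙ (a ^ k) ^ u ≡⟨ cong (b ∙_) (^-comm a k u) ⟩
        b ∙ (a ^ u) ^ k ∎))

    Cyclic : Sub order → Set
    Cyclic H = ∃[ a ] a ∊ H × (∀ x → x ∊ H → x ∊ cyc a)

    -- The least positive exponent satisfying `P` exceeds 1, so it is tl with `l` prime, and
    -- minimality excludes `t`.
    least-positive : ∀ {P : ℕ → Set} → (∀ k → Dec (P k)) → ∀ {n} → P (suc n) → ¬ P 1 → ∃[ l ] ∃[ t ] Prime l × P (t * l) × ¬ P t
    least-positive {P} P? {n} p np₁ = go (least {P ∘ suc} (λ k → P? (suc k)) n p)
      where
      go : ∃[ k ] P (suc k) × (∀ j → j < k → ¬ P (suc j)) → ∃[ l ] ∃[ t ] Prime l × P (t * l) × ¬ P t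
      go (zero , pk , _) = contradiction pk np₁
      go (suc k , pk , mk) = factor (prime-divisor (2 + k) (s≤s (s≤s z≤n)))
        where
        factor : ∃[ l ] Prime l × l ∣ 2 + k → ∃[ l ] ∃[ t ] Prime l × P (t * l) × ¬ P t
        factor (l , pl , divides zero ())
        factor (l , pl , divides (suc t) e) = l , suc t , pl , subst P e pk , mk t (≤-pred (≤-trans lt (≤-reflexive (sym e))))
          where
          instance
            l≢0 : NonZero l
            l≢0 = prime⇒nonZero pl
          lt : suc t < suc t * l
          lt = m<m*n (suc t) l (≤∧≢⇒< (>-nonZero⁻¹ l) (λ z → ¬prime[1] (subst Prime (sym z) pl)))

    module Abelian (H : Sub order) (sg : IsSubgroup H) (ab : ∀ {a b} → a ∊ H → b ∊ H → Commute a b) (no₁ : ¬ Type₁) where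
      open IsSubgroup sg

      -- A power b′ of `b` outside ⟨a⟩ has b′^l = a^k with `l` prime. If `l` does not divide `k`,
      -- then `a` and b′ have a common root. If k = jl, then z = b′ ∙ (a ^ j) ⁻¹ satisfies z^l =
      -- `ε`; if `l` divides the order of `a` this gives `Type₁`, and otherwise ⟨az⟩ contains both
      -- `a` and `z`.
      enlarge : ∀ {a b} → a ∊ H → b ∊ H → cyc a ∌ b → ∃[ d ] d ∊ H × count (cyc a) < count (cyc d)
      enlarge {a} {b} ha hb nb = go (least-positive (λ k → (b ^ k) ∊? cyc a) {Order.m (orderOf b)}
          (subst (_∊ cyc a) (sym (Order.annihilates (orderOf b))) (IsSubgroup.ε∊ (cyc-subgroup a))) (λ h → nb (subst (_∊ cyc a) (^-1 b) h)))
        where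
        bigger : ∀ {d b′} → d ∊ H → a ∊ cyc d → b′ ∊ cyc d → cyc a ∌ b′ → ∃[ d ] d ∊ H × count (cyc a) < count (cyc d)
        bigger {d} {b′} hd had hbd nb′ = d , hd , count-mono-< {y = b′} (cyc-⊆ (cyc-subgroup d) had) hbd nb′
        go : ∃[ l ] ∃[ t ] Prime l × (b ^ (t * l)) ∊ cyc a × ¬ (b ^ t ∊ cyc a) → ∃[ d ] d ∊ H × count (cyc a) < count (cyc d)
        go (l , t , pl , h , nbt) = go₂ (cyc⁻ h)
          where
          b′ = b ^ t
          hb′ : b′ ∊ H
          hb′ = ^∊ hb t
          c : Commute a b′
          c = ab ha hb′
          go₂ : ∃[ k ] b ^ (t * l) ≡ a ^ k → ∃[ d ] d ∊ H × count (cyc a) < count (cyc d)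
          go₂ (k , e) = by (l ∣? k)
            where
            ak : a ^ k ≡ b′ ^ l
            ak = trans (sym e) (trans (cong (b ^_) (*-comm t l)) (^-* b t l))
            by : Dec (l ∣ k) → ∃[ d ] d ∊ H × count (cyc a) < count (cyc d)
            by (no nk) = root (coprime-Bézout (prime-coprime pl nk))
              where
              done : ∀ d → d ∊ H → d ^ l ≡ a → d ^ k ≡ b′ → ∃[ d ] d ∊ H × count (cyc a) < count (cyc d)
              done d hd el ek = bigger hd (subst (_∊ cyc d) el (cyc⁺ d l)) (subst (_∊ cyc d) ek (cyc⁺ d k)) nbt
              root : Bézout.Identity 1 l k → ∃[ d ] d ∊ H × count (cyc a) < count (cyc d)
              root (Bézout.-+ u v f) = let i , j , el , ek = common-root {a} {b′} {k} {l} {u} {v} c ak f in done _ (∙∊ (^∊ hb′ i) (⁻¹∊ (^∊ ha j))) el ek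
              root (Bézout.+- u v f) = let i , j , ek , el = common-root {b′} {a} {l} {k} {v} {u} (sym c) (sym ak) f in done _ (∙∊ (^∊ ha i) (⁻¹∊ (^∊ hb′ j))) el ek
            by (yes (divides j kj)) = by₂ (l ∣? N)
              where
              N = suc (Order.m (orderOf a))
              z = b′ ∙ (a ^ j) ⁻¹
              hz : z ∊ H
              hz = ∙∊ hb′ (⁻¹∊ (^∊ ha j))
              b′≡ : z ∙ a ^ j ≡ b′
              b′≡ = trans (assoc _ _ _) (trans (cong (b′ ∙_) (inverseˡ _)) (identityʳ _))
              zl : z ^ l ≡ ε
              zl = trans (^-∙ (ab hb′ (⁻¹∊ (^∊ ha j))) l) (trans (cong₂ _∙_ (trans (sym ak) (trans (cong (a ^_) (trans kj (*-comm j l))) (^-* a j l))) (⁻¹-^ (a ^ j) l)) (inverseʳ _))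
              by₂ : Dec (l ∣ N) → ∃[ d ] d ∊ H × count (cyc a) < count (cyc d)
              by₂ (yes (divides zero ()))
              by₂ (yes (divides (suc N′) Nl)) = contradiction (record
                  { q-prime = pl ; x≢ε = λ x≡ → contradiction (Order.minimal (orderOf a) (suc N′) (≤-trans (m<m*n (suc N′) l 1<l) (≤-reflexive (sym Nl))) x≡) (λ ())
                  ; x^q = trans (sym (trans (cong (a ^_) Nl) (trans (cong (a ^_) (*-comm (suc N′) l)) (^-* a (suc N′) l)))) (Order.annihilates (orderOf a))
                  ; y^q = zl ; commute = ab (^∊ ha (suc N′)) hz
                  ; independent = λ i zi → nbt (subst (_∊ cyc a) b′≡ (IsSubgroup.∙∊ (cyc-subgroup a) (subst (_∊ cyc a) (trans (^-* a (suc N′) i) (sym zi)) (cyc⁺ a (i * suc N′))) (cyc⁺ a j))) }) no₁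
                where
                1<l : 1 < l
                1<l = ≤∧≢⇒< (>-nonZero⁻¹ l {{prime⇒nonZero pl}}) (λ z → ¬prime[1] (subst Prime (sym z) pl))
              by₂ (no nN) = bigger (∙∊ ha hz) a∊ (subst (_∊ cyc d) b′≡ (IsSubgroup.∙∊ sgd z∊ (IsSubgroup.^∊ sgd a∊ j))) nbt
                where
                d = a ∙ z
                sgd = cyc-subgroup d
                a∊ : a ∊ cyc d
                a∊ = coprime-mem sgd (prime-coprime pl nN) (subst (_∊ cyc d) (trans (^-∙ (ab ha hz) l) (trans (cong (a ^ l ∙_) zl) (identityʳ _))) (cyc⁺ d l))
                       (subst (_∊ cyc d) (sym (Order.annihilates (orderOf a))) (IsSubgroup.ε∊ sgd))
                z∊ : z ∊ cyc d
                z∊ = subst (_∊ cyc d) (cancel-inverseˡ a z) (IsSubgroup.∙∊ sgd (IsSubgroup.⁻¹∊ sgd a∊) (cyc-self d))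

      cyclic : Cyclic H
      cyclic = go ε ε∊ order (m∸n≤m order (count (cyc ε)))
        where
        go : ∀ a → a ∊ H → ∀ n → order ∸ count (cyc a) ≤ n → Cyclic H
        go a ha n le with any? (λ b → (b ∊? H) ×-dec ((¬? (b ∊? cyc a))))
        ... | no nb = a , ha , λ x hx → stable x hx (x ∊? cyc a)
          where
          stable : ∀ x → x ∊ H → Dec (x ∊ cyc a) → x ∊ cyc a
          stable x hx (yes h) = h
          stable x hx (no h) = contradiction (x , hx , h) nb
        ... | yes (b , hb , nb) = next n le (enlarge ha hb nb)
          where
          next : ∀ n → order ∸ count (cyc a) ≤ n → ∃[ d ] d ∊ H × count (cyc a) < count (cyc d) → Cyclic H
          next zero le (d , hd , lt) = contradiction (≤-trans lt (count-≤ (cyc d))) (≤⇒≯ (m∸n≡0⇒m≤n (n≤0⇒n≡0 le)))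
          next (suc n) le (d , hd , lt) = go d hd n (≤-pred (≤-trans (∸-monoʳ-< lt (count-≤ (cyc d))) le))

-- Nonabelian groups of odd order with only cyclic proper subgroups.

module Centralisers where

  open import Defs
  open Counting
  open Groups
  open Classify
  open import Data.Bool using (true; false)
  open import Data.Bool.Properties using (¬-not; ⇔→≡)
  open import Data.Nat using (ℕ; zero; suc; _+_; _*_; _≤_; _<_; _≤?_; NonZero; >-nonZero; >-nonZero⁻¹)
  open import Data.Nat.Properties hiding (_≟_)
  open import Data.Nat.Divisibility
  open import Data.Nat.Primality using (Prime; prime⇒nonZero; ¬prime[1])
  open import Data.Nat.Coprimality using (Coprime)
  open import Data.Nat.Induction using (<-wellFounded)
  open import Induction.WellFounded using (Acc; acc)
  open import Data.Fin.Properties using (any?; all?)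
  open import Data.Product using (∃-syntax; _×_; _,_; proj₁; proj₂)
  open import Data.Sum using (_⊎_; inj₁; inj₂)
  open import Data.Empty using (⊥; ⊥-elim)
  open import Function using (_∘_; mk⇔)
  open import Relation.Nullary using (¬_; Dec; yes; no; contradiction)
  open import Relation.Nullary.Decidable using (_×-dec_; _→-dec_; ¬?)
  open import Relation.Binary.PropositionalEquality hiding ([_])
  open import Algebra.Properties.CommutativeMonoid.Sum +-0-commutativeMonoid using (sum; sum-cong-≗; ∑-comm)

  private
    iff : ∀ {x y} → (x ≡ true → y ≡ true) → (y ≡ true → x ≡ true) → x ≡ y
    iff f g = ⇔→≡ (mk⇔ f g)

  module NonAbelianCase (G : FiniteGroup) where
    open GroupTheory G
    open Classification G

    conj : El → El → El
    conj t u = t ∙ u ∙ t ⁻¹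

    conj-∙ : ∀ s t u → conj (s ∙ t) u ≡ conj s (conj t u)
    conj-∙ s t u = begin
      s ∙ t ∙ u ∙ (s ∙ t) ⁻¹ ≡⟨ cong (s ∙ t ∙ u ∙_) (⁻¹-anti-homo-∙ s t) ⟩
      s ∙ t ∙ u ∙ (t ⁻¹ ∙ s ⁻¹) ≡⟨ sym (assoc _ _ _) ⟩
      s ∙ t ∙ u ∙ t ⁻¹ ∙ s ⁻¹ ≡⟨ cong (_∙ s ⁻¹) (trans (cong (_∙ t ⁻¹) (assoc s t u)) (assoc s (t ∙ u) (t ⁻¹))) ⟩
      s ∙ (t ∙ u ∙ t ⁻¹) ∙ s ⁻¹ ∎
      where open ≡-Reasoning

    conj-ε : ∀ u → conj ε u ≡ u
    conj-ε u = trans (cong₂ _∙_ (identityˡ u) (sym (inverse-unique (identityˡ ε)))) (identityʳ u)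

    conj-inverseˡ : ∀ t u → conj (t ⁻¹) (conj t u) ≡ u
    conj-inverseˡ t u = trans (sym (conj-∙ _ _ u)) (trans (cong (λ s → conj s u) (inverseˡ t)) (conj-ε u))

    conj-inverseʳ : ∀ t u → conj t (conj (t ⁻¹) u) ≡ u
    conj-inverseʳ t u = trans (sym (conj-∙ _ _ u)) (trans (cong (λ s → conj s u) (inverseʳ t)) (conj-ε u))

    conj-homo : ∀ t u v → conj t (u ∙ v) ≡ conj t u ∙ conj t v
    conj-homo t u v = sym (begin
      t ∙ u ∙ t ⁻¹ ∙ (t ∙ v ∙ t ⁻¹) ≡⟨ assoc (t ∙ u) _ _ ⟩
      t ∙ u ∙ (t ⁻¹ ∙ (t ∙ v ∙ t ⁻¹)) ≡⟨ cong (t ∙ u ∙_) (trans (cong (t ⁻¹ ∙_) (assoc t v _)) (cancel-inverseˡ t _)) ⟩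
      t ∙ u ∙ (v ∙ t ⁻¹) ≡⟨ sym (assoc _ v _) ⟩
      t ∙ u ∙ v ∙ t ⁻¹ ≡⟨ cong (_∙ t ⁻¹) (assoc t u v) ⟩
      t ∙ (u ∙ v) ∙ t ⁻¹ ∎)
      where open ≡-Reasoning

    conj-commute : ∀ t {u v} → Commute u v → Commute (conj t u) (conj t v)
    conj-commute t {u} {v} c = trans (sym (conj-homo t u v)) (trans (cong (conj t) c) (conj-homo t v u))

    conj-^ : ∀ t u k → conj t (u ^ k) ≡ conj t u ^ k
    conj-^ t u zero = trans (cong (_∙ t ⁻¹) (identityʳ t)) (inverseʳ t)
    conj-^ t u (suc k) = trans (conj-homo t u (u ^ k)) (cong (conj t u ∙_) (conj-^ t u k))

    commute⇒conj : ∀ {t u} → Commute t u → conj t u ≡ u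
    commute⇒conj {t} {u} c = trans (cong (_∙ t ⁻¹) c) (trans (assoc u t _) (trans (cong (u ∙_) (inverseʳ t)) (identityʳ u)))

    conj⇒ : ∀ {t u v} → conj t u ≡ v → t ∙ u ≡ v ∙ t
    conj⇒ {t} {u} refl = sym (trans (assoc _ _ t) (trans (cong (t ∙ u ∙_) (inverseˡ t)) (identityʳ _)))

    -- The commutator `ζ` is central in ⟨X , Y⟩, so powers of products are collected as in a group
    -- of class two.
    module ClassTwo {X Y ζ : El} (YX : Y ∙ X ≡ X ∙ Y ∙ ζ) (ζX : Commute ζ X) (ζY : Commute ζ Y) where
      swap-power : ∀ n → Y ∙ X ^ n ≡ X ^ n ∙ Y ∙ ζ ^ n
      swap-power zero = sym (trans (identityʳ _) (trans (identityˡ Y) (sym (identityʳ Y))))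
      swap-power (suc n) = begin
        Y ∙ (X ∙ X ^ n) ≡⟨ sym (assoc _ _ _) ⟩
        Y ∙ X ∙ X ^ n ≡⟨ cong (_∙ X ^ n) YX ⟩
        X ∙ Y ∙ ζ ∙ X ^ n ≡⟨ trans (assoc (X ∙ Y) ζ _) (cong (X ∙ Y ∙_) (commute-^ ζX n)) ⟩
        X ∙ Y ∙ (X ^ n ∙ ζ) ≡⟨ trans (sym (assoc _ _ ζ)) (cong (_∙ ζ) (trans (assoc X Y _) (cong (X ∙_) (swap-power n)))) ⟩
        X ∙ (X ^ n ∙ Y ∙ ζ ^ n) ∙ ζ ≡⟨ trans (cong (_∙ ζ) (sym (assoc X _ _))) (trans (assoc _ _ ζ) (cong (X ∙ (X ^ n ∙ Y) ∙_) (sym (commute-^ refl n)))) ⟩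
        X ∙ (X ^ n ∙ Y) ∙ (ζ ∙ ζ ^ n) ≡⟨ cong (_∙ (ζ ∙ ζ ^ n)) (sym (assoc X _ Y)) ⟩
        X ∙ X ^ n ∙ Y ∙ (ζ ∙ ζ ^ n) ∎
        where open ≡-Reasoning

      collect : ∀ n → (X ∙ Y) ^ n ≡ X ^ n ∙ Y ^ n ∙ ζ ^ triangle n
      collect zero = sym (trans (identityʳ _) (identityˡ ε))
      collect (suc n) = begin
        X ∙ Y ∙ (X ∙ Y) ^ n ≡⟨ cong (X ∙ Y ∙_) (collect n) ⟩
        X ∙ Y ∙ (X ^ n ∙ Y ^ n ∙ T) ≡⟨ trans (sym (assoc _ _ T)) (cong (_∙ T) (trans (sym (assoc (X ∙ Y) _ _)) (cong (_∙ Y ^ n) (trans (assoc X Y _) (cong (X ∙_) (swap-power n)))))) ⟩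
        X ∙ (X ^ n ∙ Y ∙ ζ ^ n) ∙ Y ^ n ∙ T ≡⟨ cong (λ t → t ∙ Y ^ n ∙ T) (trans (sym (assoc X _ _)) (cong (_∙ ζ ^ n) (sym (assoc X _ Y)))) ⟩
        X ∙ X ^ n ∙ Y ∙ ζ ^ n ∙ Y ^ n ∙ T ≡⟨ cong (_∙ T) (trans (assoc (X ∙ X ^ n ∙ Y) _ _) (trans (cong (X ∙ X ^ n ∙ Y ∙_) (commute-^^ ζY n n)) (sym (assoc _ _ _)))) ⟩
        X ∙ X ^ n ∙ Y ∙ Y ^ n ∙ ζ ^ n ∙ T ≡⟨ trans (assoc _ (ζ ^ n) T) (cong₂ _∙_ (assoc (X ∙ X ^ n) Y _) (sym (^-+ ζ n (triangle n)))) ⟩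
        X ∙ X ^ n ∙ (Y ∙ Y ^ n) ∙ ζ ^ (n + triangle n) ∎
        where
        open ≡-Reasoning
        T = ζ ^ triangle n

    module CentralCommutator {t b z : El} {r : ℕ} (pr : Prime r) (z≢ε : z ≢ ε) (z^r : z ^ r ≡ ε)
      (cz : Commute t z) (bz : Commute b z) (conj-b : conj t b ≡ b ∙ z) where

      β : El
      β = b ⁻¹

      zβ : Commute z β
      zβ = commute-⁻¹ (sym bz)

      βt : β ∙ t ≡ t ∙ β ∙ z
      βt = ∙-cancelˡ b _ _ (trans (cancel-inverseʳ b t) (sym (begin
        b ∙ (t ∙ β ∙ z) ≡⟨ cong (b ∙_) (trans (assoc t β z) (cong (t ∙_) (sym zβ))) ⟩
        b ∙ (t ∙ (z ∙ β)) ≡⟨ cong (b ∙_) (trans (sym (assoc t z β)) (cong (_∙ β) cz)) ⟩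
        b ∙ (z ∙ t ∙ β) ≡⟨ trans (cong (b ∙_) (assoc z t β)) (sym (assoc b z _)) ⟩
        b ∙ z ∙ (t ∙ β) ≡⟨ trans (sym (assoc (b ∙ z) t β)) (cong (λ y → y ∙ t ∙ β) (sym conj-b)) ⟩
        conj t b ∙ t ∙ β ≡⟨ cong (_∙ β) (sym (conj⇒ refl)) ⟩
        t ∙ b ∙ β ≡⟨ trans (assoc t b β) (trans (cong (t ∙_) (inverseʳ b)) (identityʳ t)) ⟩
        t ∎)))
        where open ≡-Reasoning

      module C₁ = ClassTwo {t} {β} {z} βt (sym cz) zβ

      βti : ∀ i k → β ^ k ∙ t ^ i ≡ t ^ i ∙ β ^ k ∙ z ^ (k * i)
      βti i zero = trans (identityˡ _) (sym (trans (identityʳ _) (identityʳ _)))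
      βti i (suc k) = begin
        β ∙ β ^ k ∙ t ^ i ≡⟨ trans (assoc β _ _) (cong (β ∙_) (βti i k)) ⟩
        β ∙ (t ^ i ∙ β ^ k ∙ z ^ (k * i)) ≡⟨ trans (sym (assoc β _ _)) (cong (_∙ z ^ (k * i)) (trans (sym (assoc β _ _)) (cong (_∙ β ^ k) (C₁.swap-power i)))) ⟩
        t ^ i ∙ β ∙ z ^ i ∙ β ^ k ∙ z ^ (k * i) ≡⟨ cong (_∙ z ^ (k * i)) (trans (assoc _ (z ^ i) _) (trans (cong (t ^ i ∙ β ∙_) (commute-^^ zβ i k)) (sym (assoc _ _ _)))) ⟩
        t ^ i ∙ β ∙ β ^ k ∙ z ^ i ∙ z ^ (k * i) ≡⟨ trans (assoc _ (z ^ i) _) (cong₂ _∙_ (assoc (t ^ i) β _) (sym (^-+ z i (k * i)))) ⟩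
        t ^ i ∙ (β ∙ β ^ k) ∙ z ^ (i + k * i) ∎
        where open ≡-Reasoning

      t^r-b : Commute (t ^ r) b
      t^r-b = subst (Commute (t ^ r)) (⁻¹-involutive b) (commute-⁻¹ (sym (trans (C₁.swap-power r) (trans (cong (t ^ r ∙ β ∙_) z^r) (identityʳ _)))))

      -- u = t^i β^k is chosen with iσ = kτ, so that the powers of `a` in u^r cancel. The collected
      -- exponent of `z` is a multiple of r(r - 1)/2, hence of `r`, because `r` is odd.
      type₁ : r ≢ 2 → ∀ {a σ} τ .{{_ : NonZero τ}} → t ^ r ≡ a ^ σ → b ^ r ≡ a ^ τ → Type₁
      type₁ r≢2 {a} {σ} τ tσ bτ = build (coprime-parts σ τ)
        where
        build : ∃[ i ] ∃[ k ] τ * k ≡ σ * i × Coprime i k → Type₁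
        build (i , k , eq , co) = record { q-prime = pr ; x≢ε = z≢ε ; x^q = z^r ; y^q = u^r
                  ; commute = commute-∙ (commute-^ (sym cz) i) (commute-^ zβ k) ; independent = indep }
          where
          u = t ^ i ∙ β ^ k
          module C₂ = ClassTwo {t ^ i} {β ^ k} {z ^ (k * i)} (βti i k) (commute-^^ (sym cz) (k * i) i) (commute-^^ zβ (k * i) k)
          u^r : u ^ r ≡ ε
          u^r = begin
            u ^ r ≡⟨ C₂.collect r ⟩
            (t ^ i) ^ r ∙ (β ^ k) ^ r ∙ (z ^ (k * i)) ^ triangle r ≡⟨ cong₂ _∙_ (cong₂ _∙_ ti βk) zt ⟩
            a ^ (i * σ) ∙ (a ^ (i * σ)) ⁻¹ ∙ ε ≡⟨ trans (identityʳ _) (inverseʳ _) ⟩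
            ε ∎
            where
            open ≡-Reasoning
            ti : (t ^ i) ^ r ≡ a ^ (i * σ)
            ti = trans (^-comm t i r) (trans (cong (_^ i) tσ) (sym (^-* a σ i)))
            βk : (β ^ k) ^ r ≡ (a ^ (i * σ)) ⁻¹
            βk = trans (^-comm β k r) (trans (cong (_^ k) (⁻¹-^ b r)) (trans (⁻¹-^ (b ^ r) k) (cong _⁻¹ (trans (cong (_^ k) bτ) (trans (sym (^-* a τ k)) (cong (a ^_) (trans (*-comm k τ) (trans eq (*-comm σ i)))))))))
            zt : (z ^ (k * i)) ^ triangle r ≡ ε
            zt = trans (sym (^-* z (k * i) (triangle r))) (^-∣ z^r (∣m⇒∣m*n (k * i) (prime∣triangle pr r≢2)))
          r∣ : ∀ n → z ^ n ≡ ε → r ∣ n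
          r∣ n zn with r ∣? n
          ... | yes d = d
          ... | no nd = contradiction (coprime-annihilate (prime-coprime pr nd) z^r zn) z≢ε
          -- A power of `z` commutes with `t` and `β`. Their commutator `z` has order `r`, which
          -- forces `r` to divide both of the coprime exponents i and k.
          indep : ∀ j → u ≢ z ^ j
          indep j uj = ¬prime[1] (subst Prime (co (r∣i , r∣k)) pr)
            where
            uβ : Commute u β
            uβ = subst (λ y → Commute y β) (sym uj) (sym (commute-^ (sym zβ) j))
            ut : Commute u t
            ut = subst (λ y → Commute y t) (sym uj) (sym (commute-^ cz j))
            cti : Commute β (t ^ i)
            cti = subst (Commute β) (trans (assoc _ _ _) (trans (cong (t ^ i ∙_) (inverseʳ _)) (identityʳ _))) (commute-∙ (sym uβ) (commute-⁻¹ (commute-^ refl k)))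
            r∣i : r ∣ i
            r∣i = r∣ i (∙-cancelˡ (t ^ i ∙ β) _ _ (trans (sym (C₁.swap-power i)) (trans cti (sym (identityʳ _)))))
            cβk : Commute t (β ^ k)
            cβk = subst (Commute t) (cancel-inverseˡ (t ^ i) _) (commute-∙ (commute-⁻¹ (commute-^ refl i)) (sym ut))
            r∣k : r ∣ k
            r∣k = r∣ k (∙-cancelˡ (t ∙ β ^ k) _ _ (trans (sym (subst₂ (λ p n → β ^ k ∙ p ≡ p ∙ β ^ k ∙ z ^ n) (^-1 t) (*-identityʳ k) (βti 1 k))) (trans (sym cβk) (sym (identityʳ _)))))

    module NonAbelian (no₁ : ¬ Type₁) (no₂ : ¬ Type₂) (odd : ¬ (2 ∣ order)) (H : Sub order) (sg : IsSubgroup H)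
      (IH : ∀ K → IsSubgroup K → (∀ x → x ∊ K → x ∊ H) → count K < count H → Cyclic K) where
      open IsSubgroup sg

      conj∊ : ∀ {t u} → t ∊ H → u ∊ H → conj t u ∊ H
      conj∊ ht hu = ∙∊ (∙∊ ht hu) (⁻¹∊ ht)

      private
        central? : ∀ x → Dec (x ∊ H × (∀ h → h ∊ H → Commute x h))
        central? x = (x ∊? H) ×-dec all? (λ h → (h ∊? H) →-dec commute? x h)

        centralises? : ∀ x h → Dec (h ∊ H × Commute h x)
        centralises? x h = (h ∊? H) ×-dec commute? h x

      Z : Sub order
      Z = sep central?

      cent : El → Sub order
      cent x = sep (centralises? x)

      cent⁺ : ∀ {x h} → h ∊ H → Commute h x → h ∊ cent x
      cent⁺ {x} a b = sep⁺ (centralises? x) (a , b)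

      cent⁻ : ∀ {x h} → h ∊ cent x → h ∊ H × Commute h x
      cent⁻ {x} = sep⁻ (centralises? x)

      ε∊Z : ε ∊ Z
      ε∊Z = sep⁺ central? (ε∊ , λ h _ → trans (identityˡ h) (sym (identityʳ h)))

      Z⁻ : ∀ {z} → z ∊ Z → z ∊ H × (∀ h → h ∊ H → Commute z h)
      Z⁻ = sep⁻ central?

      Z⁺ : ∀ {z} → z ∊ H → (∀ h → h ∊ H → Commute z h) → z ∊ Z
      Z⁺ a b = sep⁺ central? (a , b)

      noncentral : ∀ {x h} → h ∊ H → ¬ Commute x h → Z ∌ x
      noncentral hh nc z = nc (proj₂ (Z⁻ z) _ hh)

      witness : ∀ {x} → x ∊ H → Z ∌ x → ∃[ h ] h ∊ H × ¬ Commute x h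
      witness {x} hx nz with any? (λ h → (h ∊? H) ×-dec ¬? (commute? x h))
      ... | yes w = w
      ... | no n = contradiction (Z⁺ hx λ h hh → stable h hh (commute? x h)) nz
        where
        stable : ∀ h → h ∊ H → Dec (Commute x h) → Commute x h
        stable h hh (yes c) = c
        stable h hh (no c) = contradiction (h , hh , c) n

      cent-subgroup : ∀ x → IsSubgroup (cent x)
      cent-subgroup x = record
        { ε∊ = cent⁺ ε∊ (trans (identityˡ x) (sym (identityʳ x)))
        ; ∙∊ = λ p q → let a , b = cent⁻ p ; c , d = cent⁻ q in cent⁺ (∙∊ a c) (sym (commute-∙ (sym b) (sym d)))
        ; ⁻¹∊ = λ p → let a , b = cent⁻ p in cent⁺ (⁻¹∊ a) (sym (commute-⁻¹ (sym b))) }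

      cent-small : ∀ {x} → x ∊ H → Z ∌ x → count (cent x) < count H
      cent-small {x} hx nz = let h , hh , nc = witness hx nz in count-mono-< {y = h} (λ _ p → proj₁ (cent⁻ p)) hh (λ p → nc (sym (proj₂ (cent⁻ p))))

      cent-cyclic : ∀ {x} → x ∊ H → Z ∌ x → Cyclic (cent x)
      cent-cyclic {x} hx nz = IH (cent x) (cent-subgroup x) (λ _ p → proj₁ (cent⁻ p)) (cent-small hx nz)

      cent-abelian : ∀ {x a b} → x ∊ H → Z ∌ x → a ∊ cent x → b ∊ cent x → Commute a b
      cent-abelian {x} {a} {b} hx nz ha hb = let g , _ , gen = cent-cyclic hx nz ; i , e = cyc⁻ (gen a ha) ; j , f = cyc⁻ (gen b hb) in
        subst₂ Commute (sym e) (sym f) (commute-^^ {g} {g} refl i j)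

      -- Centralisers of noncentral elements are cyclic, so abelian; those sharing a noncentral
      -- element coincide.
      cent-⊆ : ∀ {x a h} → x ∊ H → a ∊ cent x → Z ∌ a → h ∊ cent a → h ∊ cent x
      cent-⊆ {x} hx ha na hh = let aH , ax = cent⁻ ha in cent⁺ (proj₁ (cent⁻ hh)) (cent-abelian aH na hh (cent⁺ hx (sym ax)))

      cent-⊇ : ∀ {x a h} → x ∊ H → Z ∌ x → a ∊ cent x → h ∊ cent x → h ∊ cent a
      cent-⊇ hx nx ha hh = cent⁺ (proj₁ (cent⁻ hh)) (cent-abelian hx nx hh ha)

      conj-noncentral : ∀ {t u} → t ∊ H → u ∊ H → Z ∌ u → Z ∌ conj t u
      conj-noncentral {t} {u} ht hu nu z = nu (subst (_∊ Z) (trans (sym (commute⇒conj (sym (proj₂ (Z⁻ z) _ (⁻¹∊ ht))))) (conj-inverseˡ t u)) z)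

      NZ : Sub order
      NZ = H ∩ ∁ Z

      count-H : count H ≡ count Z + count NZ
      count-H = begin
        count H ≡⟨ count-cong eq ⟩
        count (Z ∪ NZ) ≡⟨ sym (+-identityʳ _) ⟩
        count (Z ∪ NZ) + 0 ≡⟨ cong (count (Z ∪ NZ) +_) (sym (count-none {X = Z ∩ NZ} λ x p → let a , b = ∩⁻ {X = Z} {NZ} p in ∁⁻ {X = Z} (proj₂ (∩⁻ {X = H} b)) a)) ⟩
        count (Z ∪ NZ) + count (Z ∩ NZ) ≡⟨ count-∪∩ Z NZ ⟩
        count Z + count NZ ∎
        where
        open ≡-Reasoning
        eq : ∀ x → H x ≡ (Z ∪ NZ) x
        eq x = iff (λ e → holds (split e (x ∊? Z))) (λ e → holds (join (∪⁻ {X = Z} {NZ} (mem e))))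
          where
          split : H x ≡ true → Dec (x ∊ Z) → x ∊ Z ∪ NZ
          split e (yes z) = ∪⁺ˡ z
          split e (no z) = ∪⁺ʳ {X = Z} (∩⁺ {X = H} (mem e) (∁⁺ {X = Z} z))
          join : x ∊ Z ⊎ x ∊ NZ → x ∊ H
          join (inj₁ z) = proj₁ (Z⁻ z)
          join (inj₂ z) = proj₁ (∩⁻ {X = H} z)

      -- If every centraliser is self-normalising, the conjugates of one centraliser cover at least half of H.
      module SelfNormalising (sn : ∀ {x t} → x ∊ H → Z ∌ x → t ∊ H → Commute (conj t x) x → Commute t x) where
        module Cover (x : El) (hx : x ∊ H) (nx : Z ∌ x) where
          W : Sub order
          W = cent x ∩ ∁ Z

          W⁻ : ∀ {a} → a ∊ W → a ∊ cent x × Z ∌ a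
          W⁻ h = let p , q = ∩⁻ {X = cent x} h in p , ∁⁻ {X = Z} q

          W⁺ : ∀ {a} → a ∊ cent x → Z ∌ a → a ∊ W
          W⁺ p q = ∩⁺ p (∁⁺ {X = Z} q)

          into : El → Sub order
          into u = H ∩ (λ h → W (conj h u))

          B : Sub order
          B = sep (λ u → 1 ≤? count (into u))

          B⁺ : ∀ {u h} → h ∊ H → conj h u ∊ W → u ∊ B
          B⁺ {u} {h} hh hw = sep⁺ (λ u → 1 ≤? count (into u)) (count-pos {x = h} (∩⁺ hh (mem (holds hw))))

          B⁻ : ∀ {u} → u ∊ B → ∃[ h ] h ∊ H × conj h u ∊ W
          B⁻ {u} hu = let h , p = count-witness (into u) (sep⁻ (λ u → 1 ≤? count (into u)) hu) ; a , b = ∩⁻ {X = H} p in h , a , mem (holds b)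

          B⊆NZ : ∀ u → u ∊ B → u ∊ NZ
          B⊆NZ u hu = let h , hh , hw = B⁻ hu ; c , nz = W⁻ hw ; cH = proj₁ (cent⁻ c) in
            subst (_∊ NZ) (conj-inverseˡ h u) (∩⁺ {X = H} (conj∊ (⁻¹∊ hh) cH) (∁⁺ {X = Z} (conj-noncentral (⁻¹∊ hh) cH nz)))

          -- If `h₀` conjugates `u` into `W`, then `h` does so exactly when h h₀⁻¹ lies in the
          -- centraliser: by self-normalisation, an element that conjugates a noncentral member of
          -- the centraliser into it belongs to it.
          into-size : ∀ u → count (into u) ≡ b2n (B u) * count (cent x)
          into-size u = go (u ∊? B)
            where
            go : Dec (u ∊ B) → count (into u) ≡ b2n (B u) * count (cent x)
            go (no n) = trans (n<1⇒n≡0 (≰⇒> (λ h → n (sep⁺ (λ u → 1 ≤? count (into u)) h)))) (cong (λ b → b2n b * count (cent x)) (sym (¬-not (λ e → n (mem e)))))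
            go (yes hu) = trans size (trans (sym (+-identityʳ _)) (cong (λ b → b2n b * count (cent x)) (sym (holds hu))))
              where
              h₀ = proj₁ (B⁻ hu)
              h₀∊ = proj₁ (proj₂ (B⁻ hu))
              a = conj h₀ u
              aC = proj₁ (W⁻ (proj₂ (proj₂ (B⁻ hu))))
              aZ = proj₂ (W⁻ (proj₂ (proj₂ (B⁻ hu))))
              aH = proj₁ (cent⁻ aC)
              via : ∀ h → conj h u ≡ conj (h ∙ h₀ ⁻¹) a
              via h = trans (cong (conj h) (sym (conj-inverseˡ h₀ u))) (sym (conj-∙ h (h₀ ⁻¹) a))
              to : ∀ h → h ∊ into u → h ∙ h₀ ⁻¹ ∊ cent x
              to h p = let hh , hw = ∩⁻ {X = H} p ; k∊ = ∙∊ hh (⁻¹∊ h₀∊)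
                           kC = subst (_∊ cent x) (via h) (proj₁ (W⁻ (mem (holds hw)))) in
                cent-⊆ hx aC aZ (cent⁺ k∊ (sn aH aZ k∊ (proj₂ (cent⁻ (cent-⊇ hx nx aC kC)))))
              from : ∀ h → h ∙ h₀ ⁻¹ ∊ cent x → h ∊ into u
              from h p = ∩⁺ {X = H} (subst (_∊ H) (trans (assoc h _ h₀) (trans (cong (h ∙_) (inverseˡ h₀)) (identityʳ h))) (∙∊ (proj₁ (cent⁻ p)) h₀∊))
                (mem (holds (subst (_∊ W) (sym (trans (via h) (commute⇒conj (proj₂ (cent⁻ (cent-⊇ hx nx aC p)))))) (W⁺ aC aZ))))
              size : count (into u) ≡ count (cent x)
              size = trans (count-cong {X = into u} {λ h → cent x (h ∙ h₀ ⁻¹)} (λ h → iff (λ e → holds (to h (mem e))) (λ e → holds (from h (mem e)))))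
                (count-bij (_∙ h₀ ⁻¹) (_∙ h₀) (λ h → trans (assoc h h₀ _) (trans (cong (h ∙_) (inverseʳ h₀)) (identityʳ h))) (λ h → trans (assoc h _ h₀) (trans (cong (h ∙_) (inverseˡ h₀)) (identityʳ h))) (cent x))

          double-count : count B * count (cent x) ≡ count H * count W
          double-count = begin
            count B * count (cent x) ≡⟨ cong (_* count (cent x)) (count-sum B) ⟩
            sum (λ u → b2n (B u)) * count (cent x) ≡⟨ sym (sum-*ʳ (λ u → b2n (B u)) (count (cent x))) ⟩
            sum (λ u → b2n (B u) * count (cent x)) ≡⟨ sum-cong-≗ (λ u → trans (sym (into-size u)) (count-sum (into u))) ⟩
            sum (λ u → sum (λ h → b2n (into u h))) ≡⟨ ∑-comm (λ u h → b2n (into u h)) ⟩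
            sum (λ h → sum (λ u → b2n (into u h))) ≡⟨ sum-cong-≗ column ⟩
            sum (λ h → b2n (H h) * count W) ≡⟨ sum-*ʳ (λ h → b2n (H h)) (count W) ⟩
            sum (λ h → b2n (H h)) * count W ≡⟨ cong (_* count W) (sym (count-sum H)) ⟩
            count H * count W ∎
            where
            open ≡-Reasoning
            column : ∀ h → sum (λ u → b2n (into u h)) ≡ b2n (H h) * count W
            column h with H h
            ... | true = trans (trans (sum-bij (conj h) (conj (h ⁻¹)) (conj-inverseʳ h) (conj-inverseˡ h) (b2n ∘ W)) (sym (count-sum W))) (sym (+-identityʳ _))
            ... | false = trans (sum-const order 0) (*-zeroʳ order)

          count-cent : count (cent x) ≡ count Z + count W
          count-cent = begin
            count (cent x) ≡⟨ count-cong eq ⟩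
            count (Z ∪ W) ≡⟨ sym (+-identityʳ _) ⟩
            count (Z ∪ W) + 0 ≡⟨ cong (count (Z ∪ W) +_) (sym (count-none {X = Z ∩ W} λ y p → let a , b = ∩⁻ {X = Z} {W} p in proj₂ (W⁻ b) a)) ⟩
            count (Z ∪ W) + count (Z ∩ W) ≡⟨ count-∪∩ Z W ⟩
            count Z + count W ∎
            where
            open ≡-Reasoning
            eq : ∀ y → cent x y ≡ (Z ∪ W) y
            eq y = iff (λ e → holds (split (mem e) (y ∊? Z))) (λ e → holds (join (∪⁻ {X = Z} {W} (mem e))))
              where
              split : y ∊ cent x → Dec (y ∊ Z) → y ∊ Z ∪ W
              split e (yes z) = ∪⁺ˡ z
              split e (no z) = ∪⁺ʳ {X = Z} (W⁺ e z)
              join : y ∊ Z ⊎ y ∊ W → y ∊ cent x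
              join (inj₁ z) = cent⁺ (proj₁ (Z⁻ z)) (proj₂ (Z⁻ z) x hx)
              join (inj₂ z) = proj₁ (W⁻ z)

          -- The coset xZ lies in `W`.
          Z≤W : count Z ≤ count W
          Z≤W = ≤-trans (≤-reflexive (sym (count-bij (x ⁻¹ ∙_) (x ∙_) (cancel-inverseˡ x) (cancel-inverseʳ x) Z))) (count-mono {X = λ h → Z (x ⁻¹ ∙ h)} {W} λ h p → sub h (mem (holds p)))
            where
            sub : ∀ h → (x ⁻¹ ∙ h) ∊ Z → h ∊ W
            sub h z = subst (_∊ W) (cancel-inverseʳ x h) (W⁺ (cent⁺ (∙∊ hx zH) (sym (commute-∙ refl (sym (zc x hx))))) λ xz → nx (Z⁺ hx λ k hk →
                sym (subst (Commute k) (trans (assoc x _ _) (trans (cong (x ∙_) (inverseʳ _)) (identityʳ x))) (commute-∙ (sym (proj₂ (Z⁻ xz) k hk)) (commute-⁻¹ (sym (zc k hk)))))))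
              where
              zH = proj₁ (Z⁻ z)
              zc = proj₂ (Z⁻ z)

          half : count H ≤ count B + count B
          half = *-cancelʳ-≤ (count H) (count B + count B) (count (cent x)) {{>-nonZero (count-pos (cent⁺ hx refl))}} (begin
            count H * count (cent x) ≡⟨ cong (count H *_) count-cent ⟩
            count H * (count Z + count W) ≤⟨ *-monoʳ-≤ (count H) (+-monoˡ-≤ (count W) Z≤W) ⟩
            count H * (count W + count W) ≡⟨ *-distribˡ-+ (count H) (count W) (count W) ⟩
            count H * count W + count H * count W ≡⟨ sym (cong₂ _+_ double-count double-count) ⟩
            count B * count (cent x) + count B * count (cent x) ≡⟨ sym (*-distribʳ-+ (count (cent x)) (count B) (count B)) ⟩
            (count B + count B) * count (cent x) ∎)
            where open ≤-Reasoning

          -- From |B||C(x)| = |H||W| and |C(x)| = |Z| + |W| it follows that |B| = |H| -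
          -- |H||Z|/|C(x)|, which is less than |H| - |Z|.
          uncovered : ∃[ u ] u ∊ NZ × B ∌ u
          uncovered with any? (λ u → (u ∊? NZ) ×-dec ¬? (u ∊? B))
          ... | yes w = w
          ... | no n = contradiction (*-cancelʳ-≤ (count H) (count (cent x)) (count Z) {{>-nonZero (count-pos ε∊Z)}} (+-cancelʳ-≤ (count H * count W) _ _ (begin
              count H * count Z + count H * count W ≡⟨ sym (*-distribˡ-+ (count H) (count Z) (count W)) ⟩
              count H * (count Z + count W) ≡⟨ cong (count H *_) (sym count-cent) ⟩
              count H * count (cent x) ≤⟨ *-monoˡ-≤ (count (cent x)) (≤-trans (≤-reflexive count-H) (+-monoʳ-≤ (count Z) (count-mono {X = NZ} {B} λ u hu → stable u hu (u ∊? B)))) ⟩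
              (count Z + count B) * count (cent x) ≡⟨ *-distribʳ-+ (count (cent x)) (count Z) (count B) ⟩
              count Z * count (cent x) + count B * count (cent x) ≡⟨ cong₂ _+_ (*-comm (count Z) _) double-count ⟩
              count (cent x) * count Z + count H * count W ∎))) (<⇒≱ (cent-small hx nx))
            where
            open ≤-Reasoning
            stable : ∀ u → u ∊ NZ → Dec (u ∊ B) → u ∊ B
            stable u hu (yes h) = h
            stable u hu (no h) = contradiction (u , hu , h) n

        -- An uncovered `u` yields a second family of conjugates, disjoint from the first. Each has
        -- at least |H|/2 elements, yet both avoid the centre.
        impossible : ∀ {x} → x ∊ H → Z ∌ x → ⊥
        impossible {x} hx nx = go (Cover.uncovered x hx nx)
          where
          module X = Cover x hx nx
          go : ∃[ u ] u ∊ NZ × X.B ∌ u → ⊥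
          go (u , hu , nu) = <⇒≱ (+-mono-< NZ<H NZ<H) (begin
              count H + count H ≤⟨ +-mono-≤ X.half U.half ⟩
              count X.B + count X.B + (count U.B + count U.B) ≡⟨ interchange (count X.B) (count X.B) (count U.B) (count U.B) ⟩
              count X.B + count U.B + (count X.B + count U.B) ≤⟨ +-mono-≤ both both ⟩
              count NZ + count NZ ∎)
            where
            open ≤-Reasoning
            open import Algebra.Properties.CommutativeSemigroup +-commutativeSemigroup using (interchange)
            uH = proj₁ (∩⁻ {X = H} hu)
            uZ : Z ∌ u
            uZ = ∁⁻ {X = Z} (proj₂ (∩⁻ {X = H} hu))
            module U = Cover u uH uZ
            NZ<H : count NZ < count H
            NZ<H = ≤-trans (+-monoˡ-≤ (count NZ) (count-pos ε∊Z)) (≤-reflexive (sym count-H))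
            disjoint : ∀ w → ¬ (w ∊ X.B ∩ U.B)
            disjoint w p = meet (X.B⁻ (proj₁ (∩⁻ {X = X.B} {U.B} p))) (U.B⁻ (proj₂ (∩⁻ {X = X.B} {U.B} p)))
              where
              meet : ∃[ h ] h ∊ H × conj h w ∊ X.W → ∃[ k ] k ∊ H × conj k w ∊ U.W → ⊥
              meet (h , hh , hw) (k , hk , kw) = nu (X.B⁺ {u} {h ∙ k ⁻¹} s∊ (X.W⁺ (cent-⊆ hx aC aZ (cent⁺ (conj∊ s∊ uH) comm)) (conj-noncentral s∊ uH uZ)))
                where
                s∊ = ∙∊ hh (⁻¹∊ hk)
                aC = proj₁ (X.W⁻ hw)
                aZ = proj₂ (X.W⁻ hw)
                comm : Commute (conj (h ∙ k ⁻¹) u) (conj h w)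
                comm = subst (λ t → Commute t (conj h w)) (sym (conj-∙ h (k ⁻¹) u)) (conj-commute h (subst (Commute (conj (k ⁻¹) u)) (conj-inverseˡ k w) (conj-commute (k ⁻¹) (sym (proj₂ (cent⁻ (proj₁ (U.W⁻ kw))))))))
            both : count X.B + count U.B ≤ count NZ
            both = begin
              count X.B + count U.B ≡⟨ sym (count-∪∩ X.B U.B) ⟩
              count (X.B ∪ U.B) + count (X.B ∩ U.B) ≡⟨ cong (count (X.B ∪ U.B) +_) (count-none {X = X.B ∩ U.B} disjoint) ⟩
              count (X.B ∪ U.B) + 0 ≡⟨ +-identityʳ _ ⟩
              count (X.B ∪ U.B) ≤⟨ count-mono {X = X.B ∪ U.B} {NZ} (λ w p → case w (∪⁻ {X = X.B} {U.B} p)) ⟩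
              count NZ ∎
              where
              case : ∀ w → w ∊ X.B ⊎ w ∊ U.B → w ∊ NZ
              case w (inj₁ h) = X.B⊆NZ w h
              case w (inj₂ h) = U.B⊆NZ w h

      -- `t` normalises the cyclic group C(x) = ⟨a⟩ without centralising it. Some power b of `a`
      -- does not commute with `t` while b^r does, `r` prime, so the commutator z of `t` and b has
      -- order `r`. If `t` commutes with z, `CentralCommutator` produces `Type₁`; otherwise a power
      -- of `t` acts on ⟨z⟩ with prime order, which is `Type₂`.
      module Normalised {x t : El} (hx : x ∊ H) (nx : Z ∌ x) (ht : t ∊ H) (norm : Commute (conj t x) x) (nc : ¬ Commute t x) where
        abstract
          a : El
          a = proj₁ (cent-cyclic hx nx)

          aC : a ∊ cent x
          aC = proj₁ (proj₂ (cent-cyclic hx nx))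

          gen : ∀ {h} → h ∊ cent x → ∃[ k ] h ≡ a ^ k
          gen h = cyc⁻ (proj₂ (proj₂ (cent-cyclic hx nx)) _ h)

          stays : ∀ {h} → h ∊ cent x → conj t h ∊ cent x
          stays h = let hH , hc = cent⁻ h in cent-⊆ hx (cent⁺ (conj∊ ht hx) norm) (conj-noncentral ht hx nx) (cent⁺ (conj∊ ht hH) (conj-commute t hc))

          s : ℕ
          s = proj₁ (gen (stays aC))

          acts : ∀ {h} → h ∊ cent x → conj t h ≡ h ^ s
          acts {h} hC = let k , e = gen hC in
            trans (cong (conj t) e) (trans (conj-^ t a k) (trans (cong (_^ k) (proj₂ (gen (stays aC)))) (trans (^-comm a s k) (cong (_^ s) (sym e)))))

          nca : ¬ Commute t a
          nca c = let k , e = gen (cent⁺ hx refl) in nc (subst (Commute t) (sym e) (commute-^ c k))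

        result : ⊥
        result = go (least-positive (λ k → commute? t (a ^ k)) {Order.m (orderOf a)}
            (subst (Commute t) (sym (Order.annihilates (orderOf a))) (trans (identityʳ t) (sym (identityˡ t)))) (λ c → nca (subst (Commute t) (^-1 a) c)))
          where
          go : ∃[ r ] ∃[ e ] Prime r × Commute t (a ^ (e * r)) × ¬ Commute t (a ^ e) → ⊥
          go (r , e , pr , cr , ncb) = by (commute? t z)
            where
            b = a ^ e
            bC : b ∊ cent x
            bC = IsSubgroup.^∊ (cent-subgroup x) aC e
            b^r : b ^ r ≡ a ^ (e * r)
            b^r = trans (sym (^-* a e r)) (cong (a ^_) (*-comm r e))
            z = b ⁻¹ ∙ conj t b
            zC : z ∊ cent x
            zC = IsSubgroup.∙∊ (cent-subgroup x) (IsSubgroup.⁻¹∊ (cent-subgroup x) bC) (stays bC)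
            conj-b : conj t b ≡ b ∙ z
            conj-b = sym (cancel-inverseʳ b _)
            bz : Commute b z
            bz = cent-abelian hx nx bC zC
            z≢ε : z ≢ ε
            z≢ε eq = ncb (conj⇒ (trans conj-b (trans (cong (b ∙_) eq) (identityʳ b))))
            z^r : z ^ r ≡ ε
            z^r = ∙-cancelˡ (b ^ r) _ _ (trans (sym (^-∙ bz r)) (trans (cong (_^ r) (sym conj-b)) (trans (sym (conj-^ t b r)) (trans (commute⇒conj (subst (Commute t) (sym b^r) cr)) (sym (identityʳ _))))))
            r∣order : r ∣ order
            r∣order = lagrange-prime pr z≢ε z^r
            by : Dec (Commute t z) → ⊥
            by (no ncz) = go₂ (least-positive (λ k → commute? (t ^ k) z) {Order.m (orderOf t)}
                (subst (λ y → Commute y z) (sym (Order.annihilates (orderOf t))) (trans (identityˡ z) (sym (identityʳ z)))) (λ c → ncz (subst (λ y → Commute y z) (^-1 t) c)))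
              where
              power-conj : ∀ f → ∃[ w ] conj (t ^ f) z ≡ z ^ w
              power-conj zero = 1 , trans (conj-ε z) (sym (^-1 z))
              power-conj (suc f) with w , eq ← power-conj f = w * s , trans (conj-∙ t (t ^ f) z) (trans (cong (conj t) eq) (trans (conj-^ t z w) (trans (cong (_^ w) (acts zC)) (sym (^-* z s w)))))
              go₂ : ∃[ q ] ∃[ f ] Prime q × Commute (t ^ (f * q)) z × ¬ Commute (t ^ f) z → ⊥
              go₂ (q , f , pq , cq , ncf) = no₂ (record { w = proj₁ (power-conj f) ; r-prime = pr ; q-prime = pq ; c≢ε = z≢ε ; c^r = z^r ; conj = conj⇒ (proj₂ (power-conj f)) ; noncommute = ncf
                  ; commute-q = subst (λ y → Commute y z) (trans (cong (t ^_) (*-comm f q)) (^-* t f q)) cq })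
            by (yes cz) = no₁ (C.type₁ r≢2 {a} {proj₁ (gen trC)} (e * r) {{>-nonZero er>0}} (proj₂ (gen trC)) b^r)
              where
              module C = CentralCommutator {t} {b} {z} pr z≢ε z^r cz bz conj-b
              er>0 : 0 < e * r
              er>0 = *-mono-≤ e>0 (>-nonZero⁻¹ r {{prime⇒nonZero pr}})
                where
                e>0 : 1 ≤ e
                e>0 = n≢0⇒n>0 λ z → ncb (subst (λ k → Commute t (a ^ k)) (sym z) (trans (identityʳ t) (sym (identityˡ t))))
              r≢2 : r ≢ 2
              r≢2 z = odd (subst (_∣ order) z r∣order)
              trC : t ^ r ∊ cent x
              trC = cent-⊆ hx bC (noncentral ht (ncb ∘ sym)) (cent⁺ (^∊ ht r) C.t^r-b)

      contradictory : ∀ {x y} → x ∊ H → y ∊ H → ¬ Commute x y → ⊥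
      contradictory {x} {y} hx hy nc with any? (λ x → any? (λ t → ((x ∊? H) ×-dec ¬? (x ∊? Z)) ×-dec ((t ∊? H) ×-dec (commute? (conj t x) x ×-dec ¬? (commute? t x)))))
      ... | yes (x , t , (hx , nx) , ht , norm , nct) = Normalised.result hx nx ht norm nct
      ... | no n = SelfNormalising.impossible sn hx (noncentral hy nc)
        where
        sn : ∀ {x t} → x ∊ H → Z ∌ x → t ∊ H → Commute (conj t x) x → Commute t x
        sn {x} {t} hx nx ht norm with commute? t x
        ... | yes c = c
        ... | no c = contradiction (x , t , (hx , nx) , ht , norm , c) n

    classify : ¬ Type₁ → ¬ Type₂ → ¬ (2 ∣ order) → ∀ H → IsSubgroup H → Cyclic H
    classify no₁ no₂ odd H sg = go H sg (<-wellFounded (count H))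
      where
      go : ∀ H → IsSubgroup H → Acc _<_ (count H) → Cyclic H
      go H sg (acc rs) with any? (λ a → any? (λ b → ((a ∊? H) ×-dec (b ∊? H)) ×-dec ¬? (commute? a b)))
      ... | yes (a , b , (ha , hb) , nc) = ⊥-elim (NonAbelian.contradictory no₁ no₂ odd H sg (λ K sk _ lt → go K sk (rs lt)) ha hb nc)
      ... | no n = Abelian.cyclic H sg ab no₁
        where
        ab : ∀ {a b} → a ∊ H → b ∊ H → Commute a b
        ab {a} {b} ha hb with commute? a b
        ... | yes c = c
        ... | no c = contradiction (a , b , (ha , hb) , c) n

    noncyclic-types : ¬ IsCyclic G → ¬ (2 ∣ order) → ¬ Type₁ → ¬ Type₂ → ⊥
    noncyclic-types nc odd no₁ no₂ with a , _ , gen ← classify no₁ no₂ odd (λ _ → true) (record { ε∊ = mem refl ; ∙∊ = λ _ _ → mem refl ; ⁻¹∊ = λ _ → mem refl }) =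
      nc (a , λ x → cyc⁻ (gen x (mem refl)))

-- Zero sums in C_q × C_q and the bound for the first type.

module Olson where

  open import Defs
  open Counting
  open ZMod
  open FieldSets
  open Lists
  open Groups
  open Classify
  open import Data.Nat using (ℕ; zero; suc; pred; _+_; _*_; _∸_; _≤_; _<_; s≤s; NonZero)
  open import Data.Nat.Properties hiding (_≟_)
  open import Data.Nat.Divisibility using (_∣_; ∣⇒≤)
  open import Data.Nat.Primality using (prime⇒nonZero)
  open import Data.Fin using (Fin; toℕ; fromℕ<; _≟_; remQuot; combine)
  open import Data.Fin.Properties using (any?; toℕ<n; toℕ-fromℕ<; combine-remQuot)
  open import Data.List using (List; []; _∷_; _++_; length; [_]; map; tabulate)
  open import Data.List.Properties using (length-tabulate; length-map; map-++) renaming (++-assoc to ≡-assoc)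
  open import Data.List.Relation.Unary.All using (All; []; _∷_)
  import Data.List.Relation.Unary.All as All
  import Data.List.Relation.Unary.All.Properties as Allₚ
  open import Data.List.Relation.Unary.Any using (here; there)
  open import Data.List.Membership.Propositional using (_∈_)
  open import Data.List.Membership.Propositional.Properties using (∈-tabulate⁺)
  open import Data.List.Relation.Binary.Permutation.Propositional hiding (trans)
  open import Data.List.Relation.Binary.Permutation.Propositional.Properties
  open import Data.Product using (∃-syntax; _×_; _,_; proj₁; proj₂)
  open import Data.Product.Properties using (≡-dec)
  open import Data.Sum using (_⊎_; inj₁; inj₂)
  open import Relation.Nullary using (¬_; Dec; yes; no; contradiction)
  open import Relation.Binary.PropositionalEquality hiding ([_])

  module ZeroSum {q : ℕ} (Fq : PrimeField q) where
    open PrimeField Fq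
    open FieldTheory Fq

    V : Set
    V = Fin q × Fin q

    infixl 6 _⊹_
    _⊹_ : V → V → V
    (a , b) ⊹ (c , d) = a ⊕ c , b ⊕ d

    0v : V
    0v = 𝟘 , 𝟘

    ⊹-comm : ∀ s t → s ⊹ t ≡ t ⊹ s
    ⊹-comm (a , b) (c , d) = cong₂ _,_ (⊕-comm a c) (⊕-comm b d)

    ⊹-assoc : ∀ s t u → s ⊹ t ⊹ u ≡ s ⊹ (t ⊹ u)
    ⊹-assoc (a , b) (c , d) (e , f) = cong₂ _,_ (⊕-assoc a c e) (⊕-assoc b d f)

    ⊹-identityʳ : ∀ s → s ⊹ 0v ≡ s
    ⊹-identityʳ (a , b) = cong₂ _,_ (⊕-identityʳ a) (⊕-identityʳ b)

    ⊹-identityˡ : ∀ s → 0v ⊹ s ≡ s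
    ⊹-identityˡ s = trans (⊹-comm 0v s) (⊹-identityʳ s)

    ⊹-swap : ∀ s t u → s ⊹ t ⊹ u ≡ s ⊹ u ⊹ t
    ⊹-swap s t u = trans (⊹-assoc s t u) (trans (cong (s ⊹_) (⊹-comm t u)) (sym (⊹-assoc s u t)))

    ∑ : List V → V
    ∑ [] = 0v
    ∑ (p ∷ ps) = p ⊹ ∑ ps

    ∑-++ : ∀ A B → ∑ (A ++ B) ≡ ∑ A ⊹ ∑ B
    ∑-++ [] B = sym (⊹-identityˡ _)
    ∑-++ (p ∷ A) B = trans (cong (p ⊹_) (∑-++ A B)) (sym (⊹-assoc p _ _))

    ∑-↭ : ∀ {A B} → A ↭ B → ∑ A ≡ ∑ B
    ∑-↭ refl = refl
    ∑-↭ (prep p e) = cong (p ⊹_) (∑-↭ e)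
    ∑-↭ (swap p p′ e) = trans (cong (λ t → p ⊹ (p′ ⊹ t)) (∑-↭ e)) (rotate p p′ _)
      where
      rotate : ∀ s t u → s ⊹ (t ⊹ u) ≡ t ⊹ (s ⊹ u)
      rotate s t u = trans (sym (⊹-assoc s t u)) (trans (cong (_⊹ u) (⊹-comm s t)) (⊹-assoc t s u))
    ∑-↭ (_↭_.trans e f) = trans (∑-↭ e) (∑-↭ f)

    Δ : V → (V → Fin q) → V → Fin q
    Δ p f s = f s ⊝ f (s ⊹ p)

    -- Deg k f: all k-fold differences of f vanish, i.e. f has degree less than k.
    Deg : ℕ → (V → Fin q) → Set
    Deg zero f = ∀ s → f s ≡ 𝟘
    Deg (suc k) f = ∀ p → Deg k (Δ p f)

    deg-ext : ∀ k {f g} → (∀ s → f s ≡ g s) → Deg k f → Deg k g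
    deg-ext zero e d s = trans (sym (e s)) (d s)
    deg-ext (suc k) e d p = deg-ext k (λ s → cong₂ _⊝_ (e s) (e (s ⊹ p))) (d p)

    deg-zero : ∀ k {f} → (∀ s → f s ≡ 𝟘) → Deg k f
    deg-zero zero z = z
    deg-zero (suc k) z p = deg-zero k (λ s → trans (cong₂ _⊝_ (z s) (z (s ⊹ p))) (⊝-self 𝟘))

    deg-⊕ : ∀ k {f g} → Deg k f → Deg k g → Deg k (λ s → f s ⊕ g s)
    deg-⊕ zero d e s = trans (cong₂ _⊕_ (d s) (e s)) (⊕-identityˡ 𝟘)
    deg-⊕ (suc k) {f} {g} d e p = deg-ext k (λ s → solve 4 (λ a b c d → (a :- b) :+ (c :- d) := (a :+ c) :- (b :+ d)) refl (f s) (f (s ⊹ p)) (g s) (g (s ⊹ p))) (deg-⊕ k (d p) (e p))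

    deg-shift : ∀ k {f} t → Deg k f → Deg k (λ s → f (s ⊹ t))
    deg-shift zero t d s = d (s ⊹ t)
    deg-shift (suc k) {f} t d p = deg-ext k (λ s → cong (λ w → f (s ⊹ t) ⊝ f w) (⊹-swap s t p)) (deg-shift k t (d p))

    -- The Leibniz rule Δ(fg) = Δf g + f(s + p) Δg lets degrees add; the index of `Deg` is one more
    -- than the degree bound.
    deg-⊗ : ∀ i j {f g} → Deg (suc i) f → Deg (suc j) g → Deg (suc (i + j)) (λ s → f s ⊗ g s)
    deg-⊗ i j {f} {g} df dg p = deg-ext (i + j) leibniz (deg-⊕ (i + j) (first i df) (second j dg))
      where
      leibniz : ∀ s → Δ p f s ⊗ g s ⊕ f (s ⊹ p) ⊗ Δ p g s ≡ Δ p (λ s → f s ⊗ g s) s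
      leibniz s = solve 4 (λ a b c d → (a :- b) :* c :+ b :* (c :- d) := a :* c :- b :* d) refl (f s) (f (s ⊹ p)) (g s) (g (s ⊹ p))
      first : ∀ i → Deg (suc i) f → Deg (i + j) (λ s → Δ p f s ⊗ g s)
      first zero d = deg-zero j (λ s → trans (cong (_⊗ g s) (d p s)) (⊗-zeroˡ _))
      first (suc i) d = deg-⊗ i j (d p) dg
      second : ∀ j → Deg (suc j) g → Deg (i + j) (λ s → f (s ⊹ p) ⊗ Δ p g s)
      second zero d = deg-zero (i + 0) (λ s → trans (cong (f (s ⊹ p) ⊗_) (d p s)) (⊗-zeroʳ _))
      second (suc j) d = subst (λ k → Deg k (λ s → f (s ⊹ p) ⊗ Δ p g s)) (sym (+-suc i j)) (deg-⊗ i j (deg-shift (suc i) p df) (d p))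

    module Factors (π : V → Fin q) (π-⊹ : ∀ s t → π (s ⊹ t) ≡ π s ⊕ π t) where
      deg-linear : ∀ c → Deg 2 (λ s → c ⊝ π s)
      deg-linear c p p′ s = trans (cong₂ (λ a b → ((c ⊝ π s) ⊝ (c ⊝ a)) ⊝ ((c ⊝ π (s ⊹ p′)) ⊝ (c ⊝ b))) (π-⊹ s p) (π-⊹ (s ⊹ p′) p))
        (solve 4 (λ c s t p → ((c :- s) :- (c :- (s :+ p))) :- ((c :- t) :- (c :- (t :+ p))) := :0) refl c (π s) (π (s ⊹ p′)) (π p))

      factors : List (Fin q) → V → Fin q
      factors [] s = 𝟙
      factors (c ∷ cs) s = (c ⊝ π s) ⊗ factors cs s

      deg-factors : ∀ cs → Deg (suc (length cs)) (factors cs)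
      deg-factors [] p s = ⊝-self 𝟙
      deg-factors (c ∷ cs) = deg-⊗ 1 (length cs) (deg-linear c) (deg-factors cs)

      factors-vanish : ∀ {c cs s} → c ∈ cs → π s ≡ c → factors cs s ≡ 𝟘
      factors-vanish {c} {_ ∷ cs} {s} (here refl) e = trans (cong (_⊗ factors cs s) (trans (cong (c ⊝_) e) (⊝-self c))) (⊗-zeroˡ _)
      factors-vanish {cs = c′ ∷ cs} {s} (there m) e = trans (cong ((c′ ⊝ π s) ⊗_) (factors-vanish m e)) (⊗-zeroʳ _)

      factors-origin : ∀ {cs s} → All (_≢ 𝟘) cs → π s ≡ 𝟘 → factors cs s ≢ 𝟘
      factors-origin [] e = 𝟙≢𝟘
      factors-origin {c ∷ cs} {s} (n ∷ ns) e z = factors-origin ns e (⊗≡𝟘 {c ⊝ π s} z (λ w → n (trans (⊝≡𝟘 w) e)))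

    private
      instance
        q≢0 : NonZero q
        q≢0 = prime⇒nonZero r-prime

    nonzero : List (Fin q)
    nonzero = tabulate {n = pred q} (λ i → nat (suc (toℕ i)))

    nonzero-all : All (_≢ 𝟘) nonzero
    nonzero-all = Allₚ.tabulate⁺ λ i z → contradiction (∣⇒≤ (nat≡𝟘⁻ _ z)) (<⇒≱ (≤-trans (s≤s (toℕ<n i)) (≤-reflexive (suc-pred q))))

    nonzero-complete : ∀ x → x ≢ 𝟘 → x ∈ nonzero
    nonzero-complete x nx with toℕ x in eq
    ... | zero = contradiction (trans (sym (nat-toℕ x)) (trans (cong nat eq) nat-0)) nx
    ... | suc k = subst (_∈ nonzero) (trans (cong (λ t → nat (suc t)) (toℕ-fromℕ< lt)) (trans (cong nat (sym eq)) (nat-toℕ x))) (∈-tabulate⁺ (fromℕ< lt))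
      where
      lt : k < pred q
      lt = ≤-pred (≤-trans (≤-reflexive (cong suc (sym eq))) (≤-trans (toℕ<n x) (≤-reflexive (sym (suc-pred q)))))

    module F₁ = Factors proj₁ (λ _ _ → refl)
    module F₂ = Factors proj₂ (λ _ _ → refl)

    -- Supported at the origin, of degree 2(q - 1).
    spike : V → Fin q
    spike s = F₁.factors nonzero s ⊗ F₂.factors nonzero s

    spike-deg : Deg (suc (pred q + pred q)) spike
    spike-deg = subst (λ k → Deg (suc (k + k)) spike) (length-tabulate {n = pred q} _) (deg-⊗ (length nonzero) (length nonzero) (F₁.deg-factors nonzero) (F₂.deg-factors nonzero))

    spike-0 : spike 0v ≢ 𝟘
    spike-0 e = F₂.factors-origin {s = 0v} nonzero-all refl (⊗≡𝟘 e (F₁.factors-origin {s = 0v} nonzero-all refl))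

    spike-else : ∀ s → s ≢ 0v → spike s ≡ 𝟘
    spike-else (a , b) ne with a ≟ 𝟘 | b ≟ 𝟘
    ... | no na | _ = trans (cong (_⊗ F₂.factors nonzero (a , b)) (F₁.factors-vanish (nonzero-complete a na) refl)) (⊗-zeroˡ _)
    ... | yes _ | no nb = trans (cong (F₁.factors nonzero (a , b) ⊗_) (F₂.factors-vanish (nonzero-complete b nb) refl)) (⊗-zeroʳ _)
    ... | yes refl | yes refl = contradiction refl ne

    -- The sum of (-1)^|T| f(s + ∑ T) over all sublists T of the list.
    alt : (V → Fin q) → List V → V → Fin q
    alt f [] s = f s
    alt f (p ∷ ps) s = alt f ps s ⊝ alt f ps (s ⊹ p)

    alt-Δ : ∀ p f ps s → alt (Δ p f) ps s ≡ alt f ps s ⊝ alt f ps (s ⊹ p)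
    alt-Δ p f [] s = refl
    alt-Δ p f (p′ ∷ ps) s = trans (cong₂ _⊝_ (alt-Δ p f ps s) (trans (alt-Δ p f ps (s ⊹ p′)) (cong (λ w → alt f ps (s ⊹ p′) ⊝ alt f ps w) (⊹-swap s p′ p))))
      (solve 4 (λ a b c d → (a :- b) :- (c :- d) := (a :- c) :- (b :- d)) refl (alt f ps s) (alt f ps (s ⊹ p)) (alt f ps (s ⊹ p′)) (alt f ps (s ⊹ p ⊹ p′)))

    alt-deg : ∀ f ps s → Deg (length ps) f → alt f ps s ≡ 𝟘
    alt-deg f [] s d = d s
    alt-deg f (p ∷ ps) s d = trans (sym (alt-Δ p f ps s)) (alt-deg (Δ p f) ps s (d p))

    ZeroSumFrom : V → List V → Set
    ZeroSumFrom s ps = ∃[ T ] ∃[ R ] ps ↭ T ++ R × T ≢ [] × s ⊹ ∑ T ≡ 0v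

    -- Without zero-sum sublists only the empty sublist contributes to the alternating sum.
    alt-spike : ∀ ps s → ZeroSumFrom s ps ⊎ alt spike ps s ≡ spike s
    alt-spike [] s = inj₂ refl
    alt-spike (p ∷ ps) s = go (alt-spike ps s) (≡-dec _≟_ _≟_ (s ⊹ p) 0v) (alt-spike ps (s ⊹ p))
      where
      go : ZeroSumFrom s ps ⊎ alt spike ps s ≡ spike s → Dec (s ⊹ p ≡ 0v) → ZeroSumFrom (s ⊹ p) ps ⊎ alt spike ps (s ⊹ p) ≡ spike (s ⊹ p) →
        ZeroSumFrom s (p ∷ ps) ⊎ alt spike (p ∷ ps) s ≡ spike s
      go (inj₁ (T , R , e , ne , z)) _ _ = inj₁ (T , p ∷ R , ↭-trans (prep p e) (↭-sym (shift p T R)) , ne , z)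
      go (inj₂ _) (yes z) _ = inj₁ ([ p ] , ps , ↭-refl , (λ ()) , trans (cong (s ⊹_) (⊹-identityʳ p)) z)
      go (inj₂ _) (no _) (inj₁ (T , R , e , ne , z)) = inj₁ (p ∷ T , R , prep p e , (λ ()) , trans (sym (⊹-assoc s p _)) z)
      go (inj₂ e) (no n) (inj₂ f) = inj₂ (trans (cong₂ _⊝_ e (trans f (spike-else _ n))) (solve 1 (λ a → a :- :0 := a) refl (spike s)))

    -- On 2(q - 1) + 1 elements the alternating sum of `spike` vanishes for reasons of degree,
    -- whereas without zero sums it would be the nonzero value at the origin.
    zero-sum : ∀ ps → pred q + pred q < length ps → ∃[ T ] ∃[ R ] ps ↭ T ++ R × T ≢ [] × ∑ T ≡ 0v
    zero-sum ps lt with A , B , refl , l ← split-at (suc (pred q + pred q)) ps lt = go (alt-spike A 0v)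
      where
      go : ZeroSumFrom 0v A ⊎ alt spike A 0v ≡ spike 0v → ∃[ T ] ∃[ R ] A ++ B ↭ T ++ R × T ≢ [] × ∑ T ≡ 0v
      go (inj₁ (T , R , e , ne , z)) = T , R ++ B , ↭-trans (++⁺ʳ B e) (↭-reflexive (≡-assoc T R B)) , ne , trans (sym (⊹-identityˡ _)) z
      go (inj₂ e) = contradiction (trans (sym e) (alt-deg spike A 0v (subst (λ k → Deg k spike) (sym l) spike-deg))) spike-0

  -- Since g^q is the identity, exponents of `g` may be taken in ℤ/q.
  module ResiduePowers (G : FiniteGroup) {q : ℕ} (Fq : PrimeField q) {g : Fin (FiniteGroup.order G)} (g^q : pow G g q ≡ FiniteGroup.ε G) where
    open GroupTheory G
    open PrimeField Fq
    open FieldTheory Fq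

    nat-cong : ∀ m k → nat m ≡ nat k → g ^ m ≡ g ^ k
    nat-cong m k e = go (≤-total m k)
      where
      step : ∀ a b → nat a ≡ nat b → a ≤ b → g ^ b ≡ g ^ a
      step a b e le = trans (cong (g ^_) (sym (m+[n∸m]≡n le))) (trans (^-+ g a _) (trans (cong (g ^ a ∙_) (^-∣ g^q (nat≡𝟘⁻ (b ∸ a)
        (⊕-cancelˡ (nat a) (trans (sym (nat-+ a (b ∸ a))) (trans (cong nat (m+[n∸m]≡n le)) (trans (sym e) (sym (⊕-identityʳ _))))))))) (identityʳ _)))
      go : m ≤ k ⊎ k ≤ m → g ^ m ≡ g ^ k
      go (inj₁ le) = sym (step m k e le)
      go (inj₂ le) = step k m (sym e) le

    g^ : Fin q → El
    g^ a = g ^ toℕ a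

    g^-nat : ∀ m → g^ (nat m) ≡ g ^ m
    g^-nat m = nat-cong _ _ (nat-toℕ (nat m))

    g^-⊕ : ∀ a b → g^ (a ⊕ b) ≡ g^ a ∙ g^ b
    g^-⊕ a b = trans (nat-cong _ (toℕ a + toℕ b) (trans (nat-toℕ _) (trans (sym (cong₂ _⊕_ (nat-toℕ a) (nat-toℕ b))) (sym (nat-+ _ _))))) (^-+ g (toℕ a) (toℕ b))

    g^-⊗ : ∀ a b → g^ (a ⊗ b) ≡ g^ a ^ toℕ b
    g^-⊗ a b = trans (nat-cong _ (toℕ b * toℕ a) (trans (nat-toℕ _) (trans (⊗-comm a b) (trans (sym (cong₂ _⊗_ (nat-toℕ b) (nat-toℕ a))) (sym (nat-* _ _)))))) (^-* g (toℕ a) (toℕ b))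

    g^-𝟘 : g^ 𝟘 ≡ ε
    g^-𝟘 = trans (cong g^ (sym nat-0)) (g^-nat 0)

    g^-𝟙 : g^ 𝟙 ≡ g
    g^-𝟙 = trans (cong g^ (sym nat-1)) (trans (g^-nat 1) (^-1 g))

    g^-generates : ∀ a → a ≢ 𝟘 → ∃[ k ] g^ a ^ k ≡ g
    g^-generates a na = let i , e = inverse a na in toℕ i , trans (sym (g^-⊗ a i)) (trans (cong g^ (trans (⊗-comm a i) e)) g^-𝟙)

    g^-faithful : g ≢ ε → ∀ a → g^ a ≡ ε → a ≡ 𝟘
    g^-faithful ne a e with a ≟ 𝟘
    ... | yes z = z
    ... | no na = let k , f = g^-generates a na in contradiction (trans (sym f) (trans (cong (_^ k) e) (ε^ k))) ne

  module TypeOneBound (G : FiniteGroup) where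
    open GroupTheory G
    open Classification G

    module _ (t : Type₁) where
      open Type₁ t
      private
        Fq : PrimeField q
        Fq = ℤmod q q-prime
        instance
          q≢0 : NonZero q
          q≢0 = prime⇒nonZero q-prime
      open PrimeField Fq using (_⊕_; ⊖_; 𝟘)
      open FieldTheory Fq using (⊖-inverseˡ; ⊕-cancelʳ)
      open ZeroSum Fq
      module X = ResiduePowers G Fq {x} x^q
      module Y = ResiduePowers G Fq {y} y^q

      φ : V → El
      φ (a , b) = X.g^ a ∙ Y.g^ b

      φ-⊹ : ∀ s u → φ (s ⊹ u) ≡ φ s ∙ φ u
      φ-⊹ (a , b) (c , d) = begin
        X.g^ (a ⊕ c) ∙ Y.g^ (b ⊕ d) ≡⟨ cong₂ _∙_ (X.g^-⊕ a c) (Y.g^-⊕ b d) ⟩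
        X.g^ a ∙ X.g^ c ∙ (Y.g^ b ∙ Y.g^ d) ≡⟨ trans (assoc (X.g^ a) _ _) (cong (X.g^ a ∙_) (trans (sym (assoc _ _ _)) (cong (_∙ Y.g^ d) (commute-^^ commute (toℕ c) (toℕ b))))) ⟩
        X.g^ a ∙ (Y.g^ b ∙ X.g^ c ∙ Y.g^ d) ≡⟨ trans (cong (X.g^ a ∙_) (assoc _ _ _)) (sym (assoc _ _ _)) ⟩
        X.g^ a ∙ Y.g^ b ∙ (X.g^ c ∙ Y.g^ d) ∎
        where open ≡-Reasoning

      φ-0 : φ 0v ≡ ε
      φ-0 = trans (cong₂ _∙_ X.g^-𝟘 Y.g^-𝟘) (identityˡ ε)

      φ-kernel : ∀ s → φ s ≡ ε → s ≡ 0v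
      φ-kernel (a , b) e with b ≟ 𝟘
      ... | yes refl = cong (_, 𝟘) (X.g^-faithful x≢ε a (trans (sym (trans (cong (X.g^ a ∙_) Y.g^-𝟘) (identityʳ _))) e))
      ... | no nb = let k , f = Y.g^-generates b nb ; i , g = ⁻¹-power (X.g^ a) in contradiction
            (trans (sym f) (trans (cong (_^ k) (trans (inverse-unique e) (trans g (sym (^-* x (toℕ a) i))))) (sym (^-* x (i * toℕ a) k)))) (independent (k * (i * toℕ a)))

      neg : V → V
      neg (a , b) = ⊖ a , ⊖ b

      φ-neg : ∀ s → φ (neg s) ≡ φ s ⁻¹
      φ-neg s = inverse-unique (trans (sym (φ-⊹ s (neg s))) (trans (cong φ (trans (⊹-comm s (neg s)) (cong₂ _,_ (⊖-inverseˡ _) (⊖-inverseˡ _)))) φ-0))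

      φ-injective : ∀ {s u} → φ s ≡ φ u → s ≡ u
      φ-injective {s} {u} e = trans (sym (⊹-identityʳ s)) (trans (cong (s ⊹_) (sym (cong₂ _,_ (⊖-inverseˡ _) (⊖-inverseˡ _)))) (trans (sym (⊹-assoc s (neg u) u)) (trans (cong (_⊹ u) z) (⊹-identityˡ u))))
        where
        z : s ⊹ neg u ≡ 0v
        z = φ-kernel _ (trans (φ-⊹ s (neg u)) (trans (cong₂ _∙_ e (φ-neg u)) (inverseʳ _)))

      private
        hit? : ∀ g → Dec (∃[ a ] ∃[ b ] g ≡ φ (a , b))
        hit? g = any? (λ a → any? (λ b → g ≟ φ (a , b)))

      H : Sub order
      H = sep hit?

      H⁺ : ∀ s → φ s ∊ H
      H⁺ (a , b) = sep⁺ hit? (a , b , refl)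

      H⁻ : ∀ {g} → g ∊ H → ∃[ s ] g ≡ φ s
      H⁻ h = let a , b , e = sep⁻ hit? h in (a , b) , e

      H-subgroup : IsSubgroup H
      H-subgroup = record
        { ε∊ = subst (_∊ H) φ-0 (H⁺ 0v)
        ; ∙∊ = λ h k → let s , e = H⁻ h ; u , f = H⁻ k in subst (_∊ H) (trans (φ-⊹ s u) (sym (cong₂ _∙_ e f))) (H⁺ (s ⊹ u))
        ; ⁻¹∊ = λ h → let s , e = H⁻ h in subst (_∊ H) (trans (φ-neg s) (cong _⁻¹ (sym e))) (H⁺ (neg s)) }

      H-size : q * q ≤ count H
      H-size = count-inj (λ i → φ (remQuot q i)) (λ {i} {j} e → trans (sym (combine-remQuot {q} q i)) (trans (cong (λ s → combine (proj₁ s) (proj₂ s)) (φ-injective e)) (combine-remQuot {q} q j))) (λ i → H⁺ (remQuot q i))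

      φ-∑ : ∀ ps → Π (map φ ps) ≡ φ (∑ ps)
      φ-∑ [] = sym φ-0
      φ-∑ (p ∷ ps) = trans (cong (φ p ∙_) (φ-∑ ps)) (sym (φ-⊹ p _))

      lift : ∀ {L} → All (_∊ H) L → ∃[ ps ] L ≡ map φ ps
      lift [] = [] , refl
      lift (h ∷ hs) = let s , e = H⁻ h ; ps , f = lift hs in s ∷ ps , cong₂ _∷_ e f

      splits-over : ∀ L → All (_∊ H) L → ProductOne G L → q + q < length L → Splits L
      splits-over L hL (T₀ , p , e) lt with ps , refl ← lift hL = go ps refl p
        where
        go : ∀ ps′ → ps ≡ ps′ → map φ ps′ ↭ T₀ → Splits (map φ ps)
        go [] refl _ = contradiction lt λ ()
        -- `p₀` is set aside so that the zero-sum part is a proper one.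
        go (p₀ ∷ ps′) refl p with zero-sum ps′ (≤-trans (+-mono-≤ (≤-reflexive (suc-pred q)) pred[n]≤n) (≤-pred (≤-trans lt (≤-reflexive (length-map φ (p₀ ∷ ps′))))))
                           | ↭-map-inv φ p
        ... | T , R , e′ , ne , z | ps₀ , refl , p′ =
          map φ T , map φ (p₀ ∷ R) , ↭-trans (map⁺ φ perm) (↭-reflexive (map-++ φ T (p₀ ∷ R))) , nonempty ne , (λ ()) ,
          (map φ T , ↭-refl , trans (φ-∑ T) (trans (cong φ z) φ-0)) , (map φ (p₀ ∷ R) , ↭-refl , trans (φ-∑ (p₀ ∷ R)) (trans (cong φ zR) φ-0))
          where
          perm : p₀ ∷ ps′ ↭ T ++ p₀ ∷ R
          perm = ↭-trans (prep p₀ e′) (↭-sym (shift p₀ T R))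
          nonempty : ∀ {T} → T ≢ [] → map φ T ≢ []
          nonempty {[]} n _ = n refl
          zR : ∑ (p₀ ∷ R) ≡ 0v
          zR = trans (sym (⊹-identityˡ _)) (trans (cong (_⊹ ∑ (p₀ ∷ R)) (sym z)) (trans (sym (∑-++ T (p₀ ∷ R))) (trans (sym (∑-↭ perm)) (trans (∑-↭ p′) (φ-kernel _ (trans (sym (φ-∑ ps₀)) e))))))

      type-one-bound : ∀ {S} → Π S ≡ ε → ¬ Splits S → q * length S ≤ 2 * order
      type-one-bound {S} e ns = ≮⇒≥ λ lt → ns (Reduction.reduce H H-subgroup splits-over e (begin-strict
        (q + q) * order ≡⟨ cong (_* order) (trans (cong (q +_) (sym (+-identityʳ q))) (*-comm 2 q)) ⟩
        q * 2 * order ≡⟨ *-assoc q 2 order ⟩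
        q * (2 * order) <⟨ *-monoʳ-< q lt ⟩
        q * (q * length S) ≡⟨ trans (sym (*-assoc q q _)) (*-comm (q * q) _) ⟩
        length S * (q * q) ≤⟨ *-monoʳ-≤ (length S) H-size ⟩
        length S * count H ∎))
        where open ≤-Reasoning

      prime∣order : q ∣ order
      prime∣order = lagrange-prime q-prime x≢ε x^q

-- The bound for the second type: lifting splits from the affine group to ⟨c , x⟩.

module TypeTwo where

  open import Defs
  open Counting
  open ZMod
  open FieldSets
  open Lists
  open Affine
  open Blocks
  open PQ
  open Groups
  open Classify
  open Olson
  open import Data.Nat using (ℕ; zero; suc; _+_; _*_; _∸_; _≤_; _<_; z≤n; s≤s; _≤?_; NonZero; >-nonZero⁻¹; ≢-nonZero; ≢-nonZero⁻¹)
  open import Data.Nat.Properties hiding (_≟_)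
  open import Data.Nat.Divisibility using (_∣_; ∣⇒≤; divides; divides-refl; ∣m+n∣m⇒∣n; ∣-trans; _∣0; n∣m*n; *-monoˡ-∣; ∣m∣n⇒∣m+n; ∣-refl)
  open import Data.Nat.DivMod using (_/_; _%_; m%n<n; m*n/n≡m; m≡m%n+[m/n]*n)
  open import Data.Nat.Primality using (Prime; prime⇒nonZero; ¬prime[0]; ¬prime[1])
  open import Data.Nat.Coprimality using (prime⇒coprime)
  open import Data.Fin using (Fin; toℕ; fromℕ<; _≟_; remQuot; combine)
  open import Data.Fin.Properties using (any?; toℕ<n; toℕ-fromℕ<; toℕ-injective; combine-remQuot)
  open import Data.List using (List; []; _∷_; _++_; length; [_]; map; concat)
  open import Data.List.Properties using (length-map; length-++; map-++; concat-++) renaming (++-identityʳ to ≡-identityʳ)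
  open import Data.List.Relation.Unary.All using (All; []; _∷_)
  import Data.List.Relation.Unary.All as All
  import Data.List.Relation.Unary.All.Properties as Allₚ
  open import Data.List.Relation.Binary.Permutation.Propositional hiding (trans)
  open import Data.List.Relation.Binary.Permutation.Propositional.Properties
  open import Data.Product using (∃-syntax; _×_; _,_; proj₁; proj₂)
  open import Data.Sum using (_⊎_; inj₁; inj₂)
  open import Relation.Nullary using (¬_; Dec; yes; no; contradiction)
  open import Relation.Binary.PropositionalEquality hiding ([_])

  private
    even-or-odd : ∀ n → 2 ∣ n ⊎ 2 ∣ suc n
    even-or-odd zero = inj₁ (2 ∣0)
    even-or-odd (suc n) with even-or-odd n
    ... | inj₁ h = inj₂ (∣m∣n⇒∣m+n {2} ∣-refl h)
    ... | inj₂ h = inj₁ h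

    odd-prime : ∀ {q} → Prime q → ¬ (2 ∣ q) → 3 ≤ q
    odd-prime {0} pq _ = contradiction pq ¬prime[0]
    odd-prime {1} pq _ = contradiction pq ¬prime[1]
    odd-prime {2} _ n = contradiction ∣-refl n
    odd-prime {suc (suc (suc q))} _ _ = s≤s (s≤s (s≤s z≤n))

    same-residue : ∀ a b ζ .{{_ : NonZero ζ}} → a % ζ ≡ (a + b) % ζ → ζ ∣ b
    same-residue a b ζ e = ∣m+n∣m⇒∣n (divides ((a + b) / ζ) (+-cancelˡ-≡ (a % ζ) _ _ (begin
      a % ζ + (a / ζ * ζ + b) ≡⟨ sym (+-assoc (a % ζ) _ b) ⟩
      a % ζ + a / ζ * ζ + b ≡⟨ cong (_+ b) (sym (m≡m%n+[m/n]*n a ζ)) ⟩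
      a + b ≡⟨ m≡m%n+[m/n]*n (a + b) ζ ⟩
      (a + b) % ζ + (a + b) / ζ * ζ ≡⟨ cong (_+ (a + b) / ζ * ζ) (sym e) ⟩
      a % ζ + (a + b) / ζ * ζ ∎))) (n∣m*n (a / ζ))
      where open ≡-Reasoning

    same-residue-/ : ∀ a b q ζ .{{_ : NonZero q}} .{{_ : NonZero ζ}} → q ∣ a → q ∣ b → a / q % ζ ≡ (a + b) / q % ζ → ζ * q ∣ b
    same-residue-/ .(a * q) .(b * q) q ζ (divides-refl a) (divides-refl b) e = *-monoˡ-∣ q (same-residue a b ζ (begin
      a % ζ ≡⟨ cong (_% ζ) (sym (m*n/n≡m a q)) ⟩
      a * q / q % ζ ≡⟨ e ⟩
      (a * q + b * q) / q % ζ ≡⟨ cong (λ t → t / q % ζ) (sym (*-distribʳ-+ q a b)) ⟩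
      (a + b) * q / q % ζ ≡⟨ cong (_% ζ) (m*n/n≡m (a + b) q) ⟩
      (a + b) % ζ ∎))
      where open ≡-Reasoning

  module TypeTwoBound (G : FiniteGroup) (odd : ¬ (2 ∣ FiniteGroup.order G)) where
    open GroupTheory G
    open Classification G

    module _ (t : Type₂) where
      open Type₂ t
      private
        Fr : PrimeField r
        Fr = ℤmod r r-prime
        Fq : PrimeField q
        Fq = ℤmod q q-prime
        instance
          q≢0 : NonZero q
          q≢0 = prime⇒nonZero q-prime
          r≢0 : NonZero r
          r≢0 = prime⇒nonZero r-prime
      open PrimeField Fr using (_⊕_; _⊗_; ⊖_; _⊝_; 𝟘; 𝟙; nat; nat-1; nat-toℕ; nat-*)
      module Q = PrimeField Fq
      module QT = FieldTheory Fq
      open FieldTheory Fr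
      open Sets Fr using (power; module Rotation)
      module C = ResiduePowers G Fr {c} c^r

      ŵ : Fin r
      ŵ = nat w

      c^-injective : ∀ {a b} → C.g^ a ≡ C.g^ b → a ≡ b
      c^-injective {a} {b} e = ⊝≡𝟘 (C.g^-faithful c≢ε _ (∙-cancelʳ (C.g^ b) _ _ (trans (sym (C.g^-⊕ (a ⊝ b) b)) (trans (cong C.g^ (solve 2 (λ a b → (a :- b) :+ b := a) refl a b)) (trans e (sym (identityˡ _)))))))

      x-c : ∀ v → x ∙ C.g^ v ≡ C.g^ (ŵ ⊗ v) ∙ x
      x-c v = trans (go (toℕ v)) (cong (_∙ x) (trans (sym (C.g^-nat (w * toℕ v))) (cong C.g^ (trans (nat-* w _) (cong (ŵ ⊗_) (nat-toℕ v))))))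
        where
        go : ∀ k → x ∙ c ^ k ≡ c ^ (w * k) ∙ x
        go zero = trans (identityʳ x) (sym (trans (cong (λ k → c ^ k ∙ x) (*-zeroʳ w)) (identityˡ x)))
        go (suc k) = begin
          x ∙ (c ∙ c ^ k) ≡⟨ sym (assoc _ _ _) ⟩
          x ∙ c ∙ c ^ k ≡⟨ cong (_∙ c ^ k) conj ⟩
          c ^ w ∙ x ∙ c ^ k ≡⟨ trans (assoc _ _ _) (cong (c ^ w ∙_) (go k)) ⟩
          c ^ w ∙ (c ^ (w * k) ∙ x) ≡⟨ trans (sym (assoc _ _ _)) (cong (_∙ x) (trans (sym (^-+ c w (w * k))) (cong (c ^_) (sym (*-suc w k))))) ⟩
          c ^ (w * suc k) ∙ x ∎
          where open ≡-Reasoning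

      x^-c : ∀ i v → x ^ i ∙ C.g^ v ≡ C.g^ (power ŵ i ⊗ v) ∙ x ^ i
      x^-c zero v = trans (identityˡ _) (sym (trans (identityʳ _) (cong C.g^ (⊗-identityˡ v))))
      x^-c (suc i) v = begin
        x ∙ x ^ i ∙ C.g^ v ≡⟨ trans (assoc x _ _) (cong (x ∙_) (x^-c i v)) ⟩
        x ∙ (C.g^ (power ŵ i ⊗ v) ∙ x ^ i) ≡⟨ trans (sym (assoc x _ _)) (cong (_∙ x ^ i) (x-c _)) ⟩
        C.g^ (ŵ ⊗ (power ŵ i ⊗ v)) ∙ x ∙ x ^ i ≡⟨ trans (assoc _ x _) (cong (λ u → C.g^ u ∙ x ^ suc i) (sym (⊗-assoc ŵ _ v))) ⟩
        C.g^ (ŵ ⊗ power ŵ i ⊗ v) ∙ (x ∙ x ^ i) ∎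
        where open ≡-Reasoning

      ŵ≢𝟙 : ŵ ≢ 𝟙
      ŵ≢𝟙 e = noncommute (trans conj (cong (_∙ x) (trans (sym (C.g^-nat w)) (trans (cong C.g^ e) C.g^-𝟙))))

      power-commute : ∀ i → Commute (x ^ i) c → power ŵ i ≡ 𝟙
      power-commute i e = c^-injective (∙-cancelʳ (x ^ i) _ _ (trans (cong (λ u → C.g^ u ∙ x ^ i) (sym (⊗-identityʳ _))) (trans (sym (x^-c i 𝟙)) (trans (cong (x ^ i ∙_) C.g^-𝟙) (trans e (cong (_∙ x ^ i) (sym C.g^-𝟙)))))))

      ŵ^q : power ŵ q ≡ 𝟙
      ŵ^q = power-commute q commute-q

      power-+ : ∀ i j → power ŵ (i + j) ≡ power ŵ i ⊗ power ŵ j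
      power-+ zero j = sym (⊗-identityˡ _)
      power-+ (suc i) j = trans (cong (ŵ ⊗_) (power-+ i j)) (sym (⊗-assoc ŵ _ _))

      power-periodic : ∀ k → power ŵ (k * q) ≡ 𝟙
      power-periodic zero = refl
      power-periodic (suc k) = trans (power-+ q (k * q)) (trans (cong₂ _⊗_ ŵ^q (power-periodic k)) (⊗-identityˡ 𝟙))

      power-cong : ∀ i j → Q.nat i ≡ Q.nat j → power ŵ i ≡ power ŵ j
      power-cong i j e = go (≤-total i j)
        where
        step : ∀ a b → Q.nat a ≡ Q.nat b → a ≤ b → power ŵ b ≡ power ŵ a
        step a b e le = trans (cong (power ŵ) (sym (m+[n∸m]≡n le))) (trans (power-+ a (b ∸ a)) (trans (cong (power ŵ a ⊗_) (period (Q.nat≡𝟘⁻ (b ∸ a)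
            (QT.⊕-cancelˡ (Q.nat a) (trans (sym (Q.nat-+ a (b ∸ a))) (trans (cong Q.nat (m+[n∸m]≡n le)) (trans (sym e) (sym (QT.⊕-identityʳ _))))))))) (⊗-identityʳ _)))
          where
          period : ∀ {d} → q ∣ d → power ŵ d ≡ 𝟙
          period (divides-refl k) = power-periodic k
        go : i ≤ j ⊎ j ≤ i → power ŵ i ≡ power ŵ j
        go (inj₁ le) = sym (step i j e le)
        go (inj₂ le) = step j i (sym e) le

      -- x^i acts on ⟨c⟩ as multiplication of exponents by ŵ^i, which depends on i modulo `q` only.
      χ : Fin q → Fin r
      χ i = power ŵ (toℕ i)

      χ-nat : ∀ i → χ (Q.nat i) ≡ power ŵ i
      χ-nat i = power-cong _ _ (Q.nat-toℕ (Q.nat i))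

      χ-⊕ : ∀ i j → χ (i Q.⊕ j) ≡ χ i ⊗ χ j
      χ-⊕ i j = trans (power-cong _ (toℕ i + toℕ j) (trans (Q.nat-toℕ _) (trans (sym (cong₂ Q._⊕_ (Q.nat-toℕ i) (Q.nat-toℕ j))) (sym (Q.nat-+ _ _))))) (power-+ (toℕ i) (toℕ j))

      χ-faithful : ∀ i → χ i ≡ 𝟙 → i ≡ Q.𝟘
      χ-faithful i e with toℕ i in eq
      ... | zero = trans (sym (Q.nat-toℕ i)) (trans (cong Q.nat eq) Q.nat-0)
      ... | suc k = contradiction (trans (sym (⊗-identityʳ ŵ)) (iter-coprime (ŵ ⊗_) (prime⇒coprime {n = suc k} q-prime (subst (_< q) eq (toℕ<n i))) (trans (as-iter q) ŵ^q) (trans (as-iter (suc k)) e))) ŵ≢𝟙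
        where
        as-iter : ∀ k → iter k (ŵ ⊗_) 𝟙 ≡ power ŵ k
        as-iter zero = refl
        as-iter (suc k) = cong (ŵ ⊗_) (as-iter k)

      private
        m : ℕ
        m = suc (Order.m (orderOf x))

        x^m : x ^ m ≡ ε
        x^m = Order.annihilates (orderOf x)

        q∣m : q ∣ m
        q∣m = Q.nat≡𝟘⁻ m (χ-faithful (Q.nat m) (trans (χ-nat m) (power-commute m (subst (λ y → Commute y c) (sym x^m) (trans (identityˡ c) (sym (identityʳ c)))))))

        abstract
          -- The order of x^q, whose powers are what is divided out in passing to the affine group.
          ζ : ℕ
          ζ = _∣_.quotient q∣m

          m≡ζq : m ≡ ζ * q
          m≡ζq = _∣_.equality q∣m

        instance
          ζ≢0 : NonZero ζ
          ζ≢0 = ≢-nonZero λ z → contradiction (trans m≡ζq (cong (_* q) z)) λ ()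

      prime∣order : q ∣ order
      prime∣order = lagrange-prime {x ^ ζ} q-prime nontrivial (trans (sym (^-* x ζ q)) (trans (cong (x ^_) (trans (*-comm q ζ) (sym m≡ζq))) x^m))
        where
        1<q : 1 < q
        1<q = ≤∧≢⇒< (>-nonZero⁻¹ q) (λ z → ¬prime[1] (subst Prime (sym z) q-prime))
        nontrivial : x ^ ζ ≢ ε
        nontrivial z = contradiction (Order.minimal (orderOf x) ζ (≤-trans (m<m*n ζ q 1<q) (≤-reflexive (sym m≡ζq))) z) (≢-nonZero⁻¹ ζ)

      q-odd : ¬ (2 ∣ q)
      q-odd h = odd (∣-trans h prime∣order)

      r-odd : ¬ (2 ∣ r)
      r-odd h = odd (∣-trans h (lagrange-prime r-prime c≢ε c^r))

      -- r = 1 + kq. A prime `r` excludes k = 0, and k = 1 would make one of q and q + 1 = r even.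
      2q<r : 2 * q < r
      2q<r = go (Rotation.r≡1+kq q-prime ŵ ŵ≢𝟙 ŵ^q)
        where
        go : ∃[ k ] r ≡ suc (k * q) → 2 * q < r
        go (zero , e) = contradiction (subst Prime e r-prime) ¬prime[1]
        go (suc zero , e) = parity (even-or-odd q)
          where
          parity : 2 ∣ q ⊎ 2 ∣ suc q → 2 * q < r
          parity (inj₁ h) = contradiction h q-odd
          parity (inj₂ h) = contradiction (subst (2 ∣_) (trans (cong suc (sym (+-identityʳ q))) (sym e)) h) r-odd
        go (suc (suc k) , e) = ≤-trans (s≤s (*-monoˡ-≤ q {2} {suc (suc k)} (s≤s (s≤s z≤n)))) (≤-reflexive (sym e))

      SD : Semidirect r q
      SD = record { Fr = Fr ; Fq = Fq ; χ = χ ; χ-𝟘 = trans (cong χ (sym Q.nat-0)) (χ-nat 0) ; χ-⊕ = χ-⊕ ; χ-faithful = χ-faithful ; 3≤q = odd-prime q-prime q-odd ; 2q<r = 2q<r }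

      open Elements SD using (Elt; val; level; Reach; level-↭)
      open ZeroSums SD using (IsOne)
      module PQ′ = Splitting SD

      -- The exponent of `x` stays in ℕ because it is read modulo `q` in the affine group and modulo
      -- the order of `x` in `G`.
      P : Set
      P = Fin r × ℕ

      φ : P → El
      φ (u , i) = C.g^ u ∙ x ^ i

      elt : P → Elt
      elt (u , i) = u , Q.nat i

      total : List P → ℕ
      total [] = 0
      total ((_ , i) ∷ ps) = i + total ps

      total-++ : ∀ A B → total (A ++ B) ≡ total A + total B
      total-++ [] B = refl
      total-++ ((_ , i) ∷ A) B = trans (cong (i +_) (total-++ A B)) (sym (+-assoc i _ _))

      total-↭ : ∀ {A B} → A ↭ B → total A ≡ total B
      total-↭ refl = refl
      total-↭ (prep (_ , i) e) = cong (i +_) (total-↭ e)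
      total-↭ (swap (_ , i) (_ , j) e) = trans (cong (λ k → i + (j + k)) (total-↭ e)) (exchange i j _)
        where
        exchange : ∀ i j k → i + (j + k) ≡ j + (i + k)
        exchange i j k = trans (sym (+-assoc i j k)) (trans (cong (_+ k) (+-comm i j)) (+-assoc j i k))
      total-↭ (_↭_.trans e f) = trans (total-↭ e) (total-↭ f)

      level-total : ∀ ps → level (map elt ps) ≡ Q.nat (total ps)
      level-total [] = sym Q.nat-0
      level-total ((_ , i) ∷ ps) = trans (cong (Q.nat i Q.⊕_) (level-total ps)) (sym (Q.nat-+ i _))

      φ-mul : ∀ u i v j → φ (u , i) ∙ φ (v , j) ≡ φ (u ⊕ power ŵ i ⊗ v , i + j)
      φ-mul u i v j = begin
        C.g^ u ∙ x ^ i ∙ (C.g^ v ∙ x ^ j) ≡⟨ trans (assoc _ _ _) (cong (C.g^ u ∙_) (trans (sym (assoc _ _ _)) (cong (_∙ x ^ j) (x^-c i v)))) ⟩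
        C.g^ u ∙ (C.g^ (power ŵ i ⊗ v) ∙ x ^ i ∙ x ^ j) ≡⟨ trans (cong (C.g^ u ∙_) (assoc _ _ _)) (sym (assoc _ _ _)) ⟩
        C.g^ u ∙ C.g^ (power ŵ i ⊗ v) ∙ (x ^ i ∙ x ^ j) ≡⟨ sym (cong₂ _∙_ (C.g^-⊕ u _) (^-+ x i j)) ⟩
        C.g^ (u ⊕ power ŵ i ⊗ v) ∙ x ^ (i + j) ∎
        where open ≡-Reasoning

      φ-Π : ∀ ps → Π (map φ ps) ≡ φ (val (map elt ps) , total ps)
      φ-Π [] = sym (trans (identityʳ _) C.g^-𝟘)
      φ-Π ((u , i) ∷ ps) = trans (cong (φ (u , i) ∙_) (φ-Π ps)) (trans (φ-mul u i _ _) (cong (λ t → φ (u ⊕ t ⊗ val (map elt ps) , i + total ps)) (sym (χ-nat i))))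

      φ-kernel : ∀ u i → φ (u , i) ≡ ε → u ≡ 𝟘 × m ∣ i
      φ-kernel u i e with u ≟ 𝟘
      ... | yes refl = refl , Order.∣-of (orderOf x) i (trans (sym (trans (cong (_∙ x ^ i) C.g^-𝟘) (identityˡ _))) e)
      ... | no nu = let k , f = C.g^-generates u nu in contradiction (subst (Commute x) f (commute-^ {x} {C.g^ u} cu k)) noncommute
        where
        cu : Commute x (C.g^ u)
        cu = subst (Commute x) (trans (cong _⁻¹ (inverse-unique e)) (⁻¹-involutive _)) (commute-⁻¹ (commute-^ refl i))

      private
        hit? : ∀ g → Dec (∃[ u ] ∃[ i ] g ≡ φ (u , toℕ {m} i))
        hit? g = any? (λ u → any? (λ i → g ≟ φ (u , toℕ {m} i)))

      H : Sub order
      H = sep hit?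

      H⁺ : ∀ u i → φ (u , i) ∊ H
      H⁺ u i = sep⁺ hit? (u , fromℕ< (m%n<n i m) , cong (C.g^ u ∙_) (trans (^-mod x^m i) (cong (x ^_) (sym (toℕ-fromℕ< (m%n<n i m))))))

      H⁻ : ∀ {g} → g ∊ H → ∃[ p ] g ≡ φ p
      H⁻ h = let u , i , e = sep⁻ hit? h in (u , toℕ i) , e

      H-∙ : ∀ {a b} → a ∊ H → b ∊ H → a ∙ b ∊ H
      H-∙ h k = let (u , i) , e = H⁻ h ; (v , j) , f = H⁻ k in subst (_∊ H) (trans (sym (φ-mul u i v j)) (sym (cong₂ _∙_ e f))) (H⁺ (u ⊕ power ŵ i ⊗ v) (i + j))

      H-ε : ε ∊ H
      H-ε = subst (_∊ H) (trans (identityʳ _) C.g^-𝟘) (H⁺ 𝟘 0)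

      H-subgroup : IsSubgroup H
      H-subgroup = record
        { ε∊ = H-ε ; ∙∊ = H-∙
        ; ⁻¹∊ = λ {a} h → let k , e = ⁻¹-power a in subst (_∊ H) (sym e) (powers h k) }
        where
        powers : ∀ {a} → a ∊ H → ∀ k → a ^ k ∊ H
        powers h zero = H-ε
        powers h (suc k) = H-∙ h (powers h k)

      φ-injective : ∀ u (i : Fin m) v (j : Fin m) → φ (u , toℕ i) ≡ φ (v , toℕ j) → (u , i) ≡ (v , j)
      φ-injective u i v j e = go (≤-total (toℕ i) (toℕ j))
        where
        step : ∀ u (i : Fin m) v (j : Fin m) → φ (u , toℕ i) ≡ φ (v , toℕ j) → toℕ i ≤ toℕ j → (u , i) ≡ (v , j)
        step u i v j e le = cong₂ _,_ (sym (⊝≡𝟘 (trans (⊕-comm v _) (proj₁ ker)))) (toℕ-injective (≤-antisym le (m∸n≡0⇒m≤n (zero-diff _ (proj₂ ker) (≤-<-trans (m∸n≤m (toℕ j) (toℕ i)) (toℕ<n j))))))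
          where
          d = toℕ j ∸ toℕ i
          zero-diff : ∀ d → m ∣ d → d < m → d ≡ 0
          zero-diff zero _ _ = refl
          zero-diff (suc d) h lt = contradiction (∣⇒≤ h) (<⇒≱ lt)
          ker : ⊖ u ⊕ v ≡ 𝟘 × m ∣ d
          ker = φ-kernel (⊖ u ⊕ v) d (∙-cancelˡ (C.g^ u) _ _ (∙-cancelʳ (x ^ toℕ i) _ _ (begin
            C.g^ u ∙ (C.g^ (⊖ u ⊕ v) ∙ x ^ d) ∙ x ^ toℕ i ≡⟨ cong (_∙ x ^ toℕ i) (trans (sym (assoc _ _ _)) (cong (_∙ x ^ d) (trans (sym (C.g^-⊕ u _)) (cong C.g^ (solve 2 (λ u v → u :+ (:- u :+ v) := v) refl u v))))) ⟩
            C.g^ v ∙ x ^ d ∙ x ^ toℕ i ≡⟨ trans (assoc _ _ _) (cong (C.g^ v ∙_) (trans (sym (^-+ x d (toℕ i))) (cong (x ^_) (m∸n+n≡m le)))) ⟩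
            φ (v , toℕ j) ≡⟨ sym e ⟩
            C.g^ u ∙ x ^ toℕ i ≡⟨ cong (_∙ x ^ toℕ i) (sym (identityʳ _)) ⟩
            C.g^ u ∙ ε ∙ x ^ toℕ i ∎)))
            where open ≡-Reasoning
        go : toℕ i ≤ toℕ j ⊎ toℕ j ≤ toℕ i → (u , i) ≡ (v , j)
        go (inj₁ le) = step u i v j e le
        go (inj₂ le) = sym (step v j u i (sym e) le)

      H-size : r * m ≤ count H
      H-size = count-inj (λ k → φ (proj₁ (remQuot {r} m k) , toℕ (proj₂ (remQuot {r} m k))))
        (λ {i} {j} e → trans (sym (combine-remQuot {r} m i)) (trans (cong (λ s → combine (proj₁ s) (proj₂ s)) (φ-injective (proj₁ (remQuot {r} m i)) (proj₂ (remQuot {r} m i)) (proj₁ (remQuot {r} m j)) (proj₂ (remQuot {r} m j)) e)) (combine-remQuot {r} m j)))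
        (λ k → H⁺ (proj₁ (remQuot {r} m k)) (toℕ (proj₂ (remQuot {r} m k))))

      lift : ∀ {L} → All (_∊ H) L → ∃[ ps ] L ≡ map φ ps
      lift [] = [] , refl
      lift (h ∷ hs) = let s , e = H⁻ h ; ps , f = lift hs in s ∷ ps , cong₂ _∷_ e f

      Piece : List P → Set
      Piece B = B ≢ [] × IsOne (map elt B)

      -- Split off product-one parts modulo the centre until all have length at most 2r.
      pieces : ∀ n ps → length ps ≤ n → IsOne (map elt ps) → ∃[ Bs ] ps ↭ concat Bs × All Piece Bs × length ps ≤ length Bs * (r + r)
      pieces n [] le o = [] , ↭-refl , [] , z≤n
      pieces n ps@(_ ∷ _) le o with length ps ≤? r + r
      pieces n ps@(_ ∷ _) le o | yes short = [ ps ] , ↭-reflexive (sym (≡-identityʳ ps)) , ((λ ()) , o) ∷ [] , ≤-trans short (≤-reflexive (sym (+-identityʳ _)))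
      pieces (suc n) ps@(_ ∷ _) le o | no long = go (PQ′.splits o (≤-trans (≰⇒> long) (≤-reflexive (sym (length-map elt ps)))))
        where
        go : PQ′.Splits (map elt ps) → ∃[ Bs ] ps ↭ concat Bs × All Piece Bs × length ps ≤ length Bs * (r + r)
        go (A , B , p , nA , nB , oA , oB) = go₂ (map-↭-++⁻ elt {ps} {A} {B} p)
          where
          go₂ : ∃[ as ] ∃[ bs ] ps ↭ as ++ bs × map elt as ≡ A × map elt bs ≡ B → ∃[ Bs ] ps ↭ concat Bs × All Piece Bs × length ps ≤ length Bs * (r + r)
          go₂ (as , bs , e , refl , refl) = join (pieces n as shortA oA) (pieces n bs shortB oB)
            where
            len : length ps ≡ length as + length bs
            len = ↭-++-length {as = as} e
            pos : ∀ {cs : List P} → map elt cs ≢ [] → 1 ≤ length cs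
            pos {[]} n = contradiction refl n
            pos {_ ∷ _} _ = s≤s z≤n
            shortA : length as ≤ n
            shortA = ≤-pred (≤-trans (≤-trans (≤-reflexive (+-comm 1 (length as))) (+-monoʳ-≤ (length as) (pos nB))) (≤-trans (≤-reflexive (sym len)) le))
            shortB : length bs ≤ n
            shortB = ≤-pred (≤-trans (+-monoˡ-≤ (length bs) (pos nA)) (≤-trans (≤-reflexive (sym len)) le))
            join : ∃[ Bs ] as ↭ concat Bs × All Piece Bs × length as ≤ length Bs * (r + r) → ∃[ Cs ] bs ↭ concat Cs × All Piece Cs × length bs ≤ length Cs * (r + r) →
              ∃[ Bs ] ps ↭ concat Bs × All Piece Bs × length ps ≤ length Bs * (r + r)
            join (Bs , e₁ , h₁ , l₁) (Cs , e₂ , h₂ , l₂) = Bs ++ Cs , ↭-trans e (↭-trans (++⁺ e₁ e₂) (↭-reflexive (concat-++ Bs Cs))) , Allₚ.++⁺ h₁ h₂ ,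
              ≤-trans (≤-reflexive len) (≤-trans (+-mono-≤ l₁ l₂) (≤-reflexive (trans (sym (*-distribʳ-+ (r + r) (length Bs) (length Cs))) (cong (_* (r + r)) (sym (length-++ Bs))))))

      q∣total : ∀ {Bs} → All Piece Bs → q ∣ total (concat Bs)
      q∣total [] = q ∣0
      q∣total {B ∷ Bs} ((_ , l , _) ∷ hs) = subst (q ∣_) (sym (total-++ B (concat Bs))) (∣m∣n⇒∣m+n (Q.nat≡𝟘⁻ _ (trans (sym (level-total B)) l)) (q∣total hs))

      -- In its product-one order a piece has no `c`-part left and multiplies to a power of `x`.
      arrange : ∀ {Bs} → All Piece Bs → ∃[ D ] concat Bs ↭ D × Π (map φ D) ≡ x ^ total (concat Bs)
      arrange [] = [] , ↭-refl , refl
      arrange {B ∷ Bs} ((_ , _ , T , p , v) ∷ hs) with D , e , f ← arrange hs with B′ , refl , p′ ← ↭-map-inv elt p =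
        B′ ++ D , ++⁺ p′ e , (begin
          Π (map φ (B′ ++ D)) ≡⟨ trans (cong Π (map-++ φ B′ D)) (Π-++ (map φ B′) (map φ D)) ⟩
          Π (map φ B′) ∙ Π (map φ D) ≡⟨ cong₂ _∙_ (trans (φ-Π B′) (trans (cong₂ (λ a b → φ (a , b)) v (sym (total-↭ p′))) (trans (cong (_∙ x ^ total B) C.g^-𝟘) (identityˡ _)))) f ⟩
          x ^ total B ∙ x ^ total (concat Bs) ≡⟨ sym (^-+ x (total B) _) ⟩
          x ^ (total B + total (concat Bs)) ≡⟨ cong (x ^_) (sym (total-++ B (concat Bs))) ⟩
          x ^ total (concat (B ∷ Bs)) ∎)
        where open ≡-Reasoning

      productOne-pieces : ∀ {Bs} → All Piece Bs → m ∣ total (concat Bs) → ProductOne G (map φ (concat Bs))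
      productOne-pieces h d = let D , e , f = arrange h in map φ D , map⁺ φ e , trans f (^-∣ x^m d)

      -- More than 2rζ elements make more than `ζ` pieces, whose products are powers of x^q, an
      -- element of order `ζ`. Two prefixes of the list of pieces agree, and the pieces between them
      -- multiply to the identity.
      splits-lifted : ∀ ps ps₀ → ps ↭ ps₀ → Π (map φ ps₀) ≡ ε → ζ * (r + r) < length ps → Splits (map φ ps)
      splits-lifted ps ps₀ p′ e lt = go (pieces (length ps) ps ≤-refl isOne)
        where
        ker : val (map elt ps₀) ≡ 𝟘 × m ∣ total ps₀
        ker = φ-kernel _ _ (trans (sym (φ-Π ps₀)) e)
        m∣total : m ∣ total ps
        m∣total = subst (m ∣_) (sym (total-↭ p′)) (proj₂ ker)
        isOne : IsOne (map elt ps)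
        isOne = trans (level-total ps) (Q.nat≡𝟘⁺ _ (∣-trans q∣m m∣total)) , map elt ps₀ , map⁺ elt p′ , proj₁ ker
        residue : List (List P) → Fin ζ
        residue Bs = fromℕ< (m%n<n (total (concat Bs) / q) ζ)
        go : ∃[ Bs ] ps ↭ concat Bs × All Piece Bs × length ps ≤ length Bs * (r + r) → Splits (map φ ps)
        go (Bs , eB , hB , lB) = go₂ (repeated-prefix residue Bs (<⇒≤ many))
          where
          many : ζ < length Bs
          many = *-cancelʳ-< (r + r) ζ (length Bs) (<-≤-trans lt lB)
          go₂ : ∃[ As ] ∃[ Ds ] ∃[ Es ] Bs ≡ As ++ Ds ++ Es × Ds ≢ [] × length (As ++ Ds) ≤ ζ × residue As ≡ residue (As ++ Ds) → Splits (map φ ps)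
          go₂ (As , Ds , Es , refl , nD , len , same) = map φ (concat Ds) , map φ (concat (As ++ Es)) , ↭-trans (map⁺ φ perm) (↭-reflexive (map-++ φ (concat Ds) _)) ,
              nonempty (concat-nonempty nD (All.map proj₁ hD)) , nonempty (concat-nonempty nAE (All.map proj₁ hAE)) , productOne-pieces hD m∣D , productOne-pieces hAE m∣AE
            where
            hA : All Piece As
            hA = Allₚ.++⁻ˡ As hB
            hD : All Piece Ds
            hD = Allₚ.++⁻ˡ Ds (Allₚ.++⁻ʳ As hB)
            hAE : All Piece (As ++ Es)
            hAE = Allₚ.++⁺ hA (Allₚ.++⁻ʳ Ds (Allₚ.++⁻ʳ As hB))
            perm : ps ↭ concat Ds ++ concat (As ++ Es)
            perm = ↭-trans eB (↭-trans (concat-↭ (shifts As Ds)) (↭-reflexive (sym (concat-++ Ds (As ++ Es)))))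
            nonempty : ∀ {T : List P} → T ≢ [] → map φ T ≢ []
            nonempty {[]} n _ = n refl
            nAE : As ++ Es ≢ []
            nAE z = contradiction (≤-trans many (≤-trans (≤-reflexive (trans (↭-++-length {as = Ds} (shifts As Ds)) (trans (cong (λ t → length Ds + length t) z) (+-identityʳ _)))) (≤-trans (m≤n+m (length Ds) (length As)) (≤-trans (≤-reflexive (sym (length-++ As))) len)))) (<-irrefl refl)
            m∣D : m ∣ total (concat Ds)
            m∣D = subst (_∣ total (concat Ds)) (sym m≡ζq) (same-residue-/ (total (concat As)) (total (concat Ds)) q ζ (q∣total hA) (q∣total hD) (trans (sym (toℕ-fromℕ< (m%n<n _ ζ)))
              (trans (cong toℕ same) (trans (toℕ-fromℕ< (m%n<n _ ζ)) (cong (λ t → t / q % ζ) (trans (cong total (sym (concat-++ As Ds))) (total-++ (concat As) (concat Ds))))))))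
            m∣AE : m ∣ total (concat (As ++ Es))
            m∣AE = ∣m+n∣m⇒∣n (subst (m ∣_) (trans (total-↭ perm) (total-++ (concat Ds) (concat (As ++ Es)))) m∣total) m∣D

      splits-over : ∀ L → All (_∊ H) L → ProductOne G L → ζ * (r + r) < length L → Splits L
      splits-over L hL (T₀ , p , e) lt = go (lift hL)
        where
        go : ∃[ ps ] L ≡ map φ ps → Splits L
        go (ps , refl) = let ps₀ , f , p′ = ↭-map-inv φ p in splits-lifted ps ps₀ p′ (trans (cong Π (sym f)) e) (<-≤-trans lt (≤-reflexive (length-map φ ps)))

      type-two-bound : ∀ {S} → Π S ≡ ε → ¬ Splits S → q * length S ≤ 2 * order
      type-two-bound {S} e ns = ≮⇒≥ λ lt → ns (Reduction.reduce H H-subgroup splits-over e (begin-strict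
        ζ * (r + r) * order ≡⟨ cong (_* order) (trans (cong (ζ *_) (trans (cong (r +_) (sym (+-identityʳ r))) (*-comm 2 r))) (sym (*-assoc ζ r 2))) ⟩
        ζ * r * 2 * order ≡⟨ *-assoc (ζ * r) 2 order ⟩
        ζ * r * (2 * order) <⟨ *-monoʳ-< (ζ * r) {{m*n≢0 ζ r}} lt ⟩
        ζ * r * (q * length S) ≡⟨ trans (sym (*-assoc (ζ * r) q _)) (*-comm (ζ * r * q) _) ⟩
        length S * (ζ * r * q) ≡⟨ cong (length S *_) (trans (cong (_* q) (*-comm ζ r)) (trans (*-assoc r ζ q) (cong (r *_) (sym m≡ζq)))) ⟩
        length S * (r * m) ≤⟨ *-monoʳ-≤ (length S) H-size ⟩
        length S * count H ∎))
        where open ≤-Reasoning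

-- Assembling the bound.

module Main where

  open import Defs
  open Counting
  open Lists
  open Groups
  open Classify
  open Centralisers
  open Olson
  open TypeTwo
  open import Data.Nat using (_+_; _*_; _≤_; _<_; _≤?_)
  open import Data.Nat.Properties hiding (_≟_)
  open import Data.Nat.Divisibility using (_∣_; _∣?_)
  open import Data.Nat.Primality using (Prime; prime[2])
  open import Data.List using ([]; _++_; length)
  open import Data.List.Properties using (length-++)
  open import Data.List.Relation.Binary.Permutation.Propositional hiding (trans)
  open import Data.List.Relation.Binary.Permutation.Propositional.Properties
  open import Data.Product using (_,_)
  open import Relation.Nullary using (¬_; yes; no; contradiction)
  open import Relation.Nullary.Decidable using (decidable-stable)
  open import Relation.Binary.PropositionalEquality hiding ([_])

  module Bounds (G : FiniteGroup) where
    open GroupTheory G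
    open Classification G
    open NonAbelianCase G

    -- More than |G| elements have two equal prefix products, and the stretch between them splits
    -- off.
    length-bound : ∀ {S} → Π S ≡ ε → ¬ Splits S → length S ≤ order
    length-bound {S} e ns = ≮⇒≥ λ lt → ns (split lt)
      where
      split : order < length S → Splits S
      split lt with A , B , C , refl , nB , len , f ← repeated-prefix Π S (<⇒≤ lt) =
        B , A ++ C , shifts A B , nB , nAC , (B , ↭-refl , ΠB) , (A ++ C , ↭-refl , trans (Π-++ A C) (trans (cong (Π A ∙_) (sym ΠBC)) (trans (sym (Π-++ A (B ++ C))) e)))
        where
        ΠB : Π B ≡ ε
        ΠB = ∙-cancelˡ (Π A) _ _ (trans (sym (Π-++ A B)) (trans (sym f) (sym (identityʳ _))))
        ΠBC : Π (B ++ C) ≡ Π C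
        ΠBC = trans (Π-++ B C) (trans (cong (_∙ Π C) ΠB) (identityˡ _))
        nAC : A ++ C ≢ []
        nAC z = contradiction (≤-trans lt (≤-trans (≤-reflexive (trans (↭-++-length {as = B} (shifts A B)) (trans (cong (λ t → length B + length t) z) (+-identityʳ _)))) (≤-trans (m≤n+m (length B) (length A)) (≤-trans (≤-reflexive (sym (length-++ A))) len)))) (<-irrefl refl)

    bound : ¬ IsCyclic G → ∀ p → Prime p → (∀ q → Prime q → q ∣ order → p ≤ q) → ∀ {S} → Π S ≡ ε → ¬ Splits S → p * length S ≤ 2 * order
    bound nc p pp least-p {S} e ns with 2 ∣? order
    ... | yes even = *-mono-≤ (least-p 2 prime[2] even) (length-bound e ns)
    -- The classification only refutes the absence of both types; as the inequality is decidable,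
    -- deriving it from either type is enough.
    ... | no odd = decidable-stable (p * length S ≤? 2 * order) λ fails → noncyclic-types nc odd
        (λ t → fails (≤-trans (*-monoˡ-≤ (length S) (least-p _ (Type₁.q-prime t) (TypeOneBound.prime∣order G t))) (TypeOneBound.type-one-bound G t e ns)))
        (λ t → fails (≤-trans (*-monoˡ-≤ (length S) (least-p _ (Type₂.q-prime t) (TypeTwoBound.prime∣order G odd t))) (TypeTwoBound.type-two-bound G odd t e ns)))

    minimal-bound : ¬ IsCyclic G → ∀ p → Prime p → (∀ q → Prime q → q ∣ order → p ≤ q) → ∀ S → MinimalProductOne G S → p * length S ≤ 2 * order
    minimal-bound nc p pp least-p S (_ , (T , S↭T , e) , ns) = subst (λ n → p * n ≤ 2 * order) (sym (↭-length S↭T))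
      (bound nc p pp least-p e λ { (A , B , T↭ , rest) → ns (A , B , ↭-trans S↭T T↭ , rest) })

open import Defs
open import Data.Nat using (ℕ; _*_; _≤_)
open import Data.Nat.Divisibility using (_∣_)
open import Data.Nat.Primality using (Prime)
open import Data.List using (length)
open import Relation.Nullary using (¬_)

theorem7p1 : (G : FiniteGroup) → ¬ IsCyclic G →
    (p : ℕ) → Prime p → p ∣ ∣ G ∣ᴳ →
    (∀ (q : ℕ) → Prime q → q ∣ ∣ G ∣ᴳ → p ≤ q) →
    ∀ (S : Sequence G) → MinimalProductOne G S →
    p * length S ≤ 2 * ∣ G ∣ᴳ
theorem7p1 G noncyclic p p-prime p∣order p-least = Bounds.minimal-bound G noncyclic p p-prime p-least
  where open Main
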